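{- Let $\alpha=(\alpha_1,\dots,\alpha_r)$ and $\beta=(\beta_1,\dots,\beta_s)$ be tuples of parameters in $\mathbb{Q}\setminus\mathbb{Z}_{\leq 0}$ such that $F_{\alpha,\beta}$ is $N$-integral. Then there exists $C\in\mathbb{N}$ such that $$ C_{\alpha,\beta}=C\,\frac{\prod_{i=1}^r d(\alpha_i)}{\prod_{j=1}^s d(\beta_j)}\prod_{p\in\mathcal{P}_{\alpha,\beta}} p^{ -\left\lfloor\frac{\lambda_p(\alpha,\beta)}{p-1}\right\rfloor}. $$ Furthermore, if $r=s$ and all elements of $\alpha$ and $\beta$ lie in $(0,1]$, then $C=1$.
   Context: For tuples $\alpha=(\alpha_1,\dots,\alpha_r)$, $\beta=(\beta_1,\dots,\beta_s)$ of parameters in $\mathbb{Q}\setminus\mathbb{Z}_{\leq 0}$, the generalized hypergeometric series is $F_{\alpha,\beta}(z)=\sum_{n\geq 0}\frac{(\alpha_1)_n\cdots(\alpha_r)_n}{(\beta_1)_n\cdots(\beta_s)_n}z^n$, where $(x)_n=x(x+1)\cdots(x+n-1)$ for $n\ge1$ and $(x)_0=1$. A power series $f(z)\in\mathbb{C}[[z]]$ is $N$-integral if there is $c\in\mathbb{Q}$ with $f(cz)\in\mathbb{Z}[[z]]$. If $F_{\alpha,\beta}$ is $N$-integral, the set of all $c\in\mathbb{Q}$ with $F_{\alpha,\beta}(cz)\in\mathbb{Z}[[z]]$ is $C_{\alpha,\beta}\mathbb{Z}$ for some $C_{\alpha,\beta}\in\mathbb{Q}\setminus\{0\}$. For a rational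 $a$, $d(a)$ denotes its exact denominator. $d_{\alpha,\beta}$ is the least common multiple of the exact denominators of the elements of $\alpha$ and $\beta$. For a prime $p$, $\lambda_p(\alpha,\beta)=\#\{1\le i\le r:\alpha_i\in\mathbb{Z}_p\}-\#\{1\le j\le s:\beta_j\in\mathbb{Z}_p\}$, where $\mathbb{Z}_p$ is the ring of $p$-adic integers. $\mathcal{P}_{\alpha,\beta}$ is the set of primes $p$ such that $p$ divides $d_{\alpha,\beta}$ or $p\le r-s+1$. -}

module Defs where

open import Data.Nat as ℕ using (ℕ; zero; suc)
open import Data.Nat.Divisibility using (_∣?_)
open import Data.Nat.Primality using (prime?)
open import Data.Nat.LCM using (lcm)
import Data.Nat.ListAction
open import Data.Integer as ℤ using (ℤ; +_; -[1+_])
open import Data.Rational using (ℚ; _/_; _*_; _+_; -_; 0ℚ; 1ℚ; ↧ₙ_)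
open import Data.Rational.Properties using (_≟_)
open import Data.List using (List; []; _∷_; map; foldr; filter; length; upTo; _++_)
open import Data.Product using (∃; _×_)
open import Relation.Nullary using (yes; no; ¬?)
open import Relation.Nullary.Decidable using (_⊎-dec_; _×-dec_)
open import Relation.Binary.PropositionalEquality using (_≡_; _≢_)

-- total division on ℚ (x / 0 := 0); only ever used with nonzero divisors
divQ : ℚ → ℚ → ℚ
divQ p q with q ≟ 0ℚ
... | yes _ = 0ℚ
... | no q≢0 = Data.Rational._÷_ p q {{Data.Rational.≢-nonZero q≢0}}

_^ℚ_ : ℚ → ℕ → ℚ
x ^ℚ zero = 1ℚ
x ^ℚ suc n = x * (x ^ℚ n)

ℤtoℚ : ℤ → ℚ
ℤtoℚ k = k / 1

ℕtoℚ : ℕ → ℚ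
ℕtoℚ n = (+ n) / 1

IsInteger : ℚ → Set
IsInteger q = ∃ λ (k : ℤ) → q ≡ ℤtoℚ k

NotNonPosInt : ℚ → Set
NotNonPosInt q = (n : ℕ) → q ≢ - ℕtoℚ n

poch : ℚ → ℕ → ℚ
poch x zero = 1ℚ
poch x (suc n) = poch x n * (x + ℕtoℚ n)

prodℚ : List ℚ → ℚ
prodℚ = foldr _*_ 1ℚ

hypCoeff : List ℚ → List ℚ → ℕ → ℚ
hypCoeff α β n = divQ (prodℚ (map (λ a → poch a n) α)) (prodℚ (map (λ b → poch b n) β))

-- F_{α,β}(c z) ∈ ℤ[[z]]
IntegralAt : List ℚ → List ℚ → ℚ → Set
IntegralAt α β c = (n : ℕ) → IsInteger ((c ^ℚ n) * hypCoeff α β n)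

NIntegral : List ℚ → List ℚ → Set
NIntegral α β = ∃ λ (c : ℚ) → c ≢ 0ℚ × IntegralAt α β c

d : ℚ → ℕ
d a = ↧ₙ a

dAB : List ℚ → List ℚ → ℕ
dAB α β = foldr lcm 1 (map d (α ++ β))

-- λ_p(α,β);  a ∈ ℤ_p  iff  p ∤ d(a)
countInZp : ℕ → List ℚ → ℕ
countInZp p xs = length (filter (λ a → ¬? (p ∣? d a)) xs)

lambdaP : ℕ → List ℚ → List ℚ → ℤ
lambdaP p α β = (+ countInZp p α) ℤ.- (+ countInZp p β)

floorDiv : ℤ → ℕ → ℤ
floorDiv x zero = + 0
floorDiv x (suc m) = x ℤ./ℕ suc m

powℤ : ℕ → ℤ → ℚ
powℤ p (+ n) = ℕtoℚ (p ℕ.^ n)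
powℤ p -[1+ n ] = divQ 1ℚ (ℕtoℚ (p ℕ.^ suc n))

-- 𝒫_{α,β} : primes p with p ∣ d_{α,β} or p ≤ r - s + 1  (i.e. p + s ≤ r + 1).
-- All such primes are < d_{α,β} + r + 2, so we enumerate that range.
primeSet : List ℚ → List ℚ → List ℕ
primeSet α β =
  filter (λ p → prime? p ×-dec ((p ∣? dAB α β) ⊎-dec (p ℕ.+ length β ℕ.≤? suc (length α))))
         (upTo (dAB α β ℕ.+ length α ℕ.+ 2))

primeFactor : List ℚ → List ℚ → ℚ
primeFactor α β =
  prodℚ (map (λ p → powℤ p (ℤ.- floorDiv (lambdaP p α β) (p ℕ.∸ 1))) (primeSet α β))

formulaFactor : List ℚ → List ℚ → ℚ
formulaFactor α β =
  divQ (ℕtoℚ (Data.Nat.ListAction.product (map d α))) (ℕtoℚ (Data.Nat.ListAction.product (map d β)))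
  * primeFactor α β

InUnitInterval : ℚ → Set
InUnitInterval a = 0ℚ Data.Rational.< a × a Data.Rational.≤ 1ℚ

{-# OPTIONS --safe #-}
-- Let S(a, n) be the sum of the p-adic valuations of the numerators of a, a + 1, …, a + n - 1. The n-th
-- coefficient has valuation W(n) = Σ S(αᵢ, n) - Σ S(βⱼ, n), up to n times the contribution of the denominators.
-- For n = pᵏ, W(n) is λ n / (p - 1) + O(k), so integrality at all these n
-- forces the exponent of p in C_{α,β}: this is the formula up to a positive integer C.
--
-- For C = 1 it suffices that (p - 1) W(n) ≥ λ n for all n. For a = A/d ∈ (0,1], the number of i < n with
-- m | A + i d is the number of j ≤ dn/m with jm ≡ A mod d, so it depends only on m mod d and on ⌊dn/m⌋.
-- Reading off integrality at large primes q ≡ m, for which only m = q counts, shows that the α-count dominates the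
-- β-count for every m coprime to d_{α,β} = Δ. If p ∤ Δ, this is applied to m = pˡ for all l; if p | Δ,
-- with D the part of Δ prime to p, it is applied to all m = pˡ + Dk that are coprime to p, and summed over k.
--
-- The existence of the primes q is Dirichlet's theorem, in the weak form that not all large primes avoid the class a.
-- It is proved with rational numbers only. If pₓ(t) = (1/log x) Σ Λ(n)/n over n ≤ x, n ≡ t, then a Selberg-type
-- identity gives p_y + pₓ * p_y ≈ 2/φ for y much larger than x. If the class a has no large primes, then comparing
-- three scales shows that pₓ is nearly 0 or 2/φ, the latter on the nontrivial coset of a subgroup of index 2.
-- For the real character χ of that coset, Σ Λ(n)χ(n)/n is of order - log x, whereas L(1,χ) Σ Λ(n)χ(n)/n is bounded,
-- contradicting L(1,χ) > 0.

module Submission where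

import Data.Integer as ℤ
import Data.Integer.DivMod as ℤDM
import Data.Integer.Divisibility.Signed as ℤ∣
import Data.Integer.GCD as ℤgcd
import Data.Integer.Properties as ℤₚ
import Data.Integer.Tactic.RingSolver as ℤS
import Data.List.Relation.Unary.All.Properties as AllP
import Data.List.Relation.Unary.Unique.Propositional.Properties as UniqueP
import Data.Nat.Coprimality as C
import Data.Nat.Divisibility as ∣ₚ
import Data.Nat.DivMod as DM
import Data.Nat.Properties as ℕₚ
import Data.Nat.Tactic.RingSolver as ℕS
import Data.Rational.Properties as ℚₚ
import Data.Rational.Unnormalised as ℚᵘ
import Data.Rational.Unnormalised.Properties as ℚᵘₚ
import Tactic.RingSolver as RS
open import Data.Empty using (⊥; ⊥-elim)
open import Data.Integer using (ℤ)
open import Data.List using (List; []; _∷_; map; foldr; length; upTo; _++_)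
open import Data.List.Membership.Propositional using (_∈_)
open import Data.List.Membership.Propositional.Properties using (∈-filter⁺; ∈-filter⁻; ∈-upTo⁺; ∈-++⁺ˡ; ∈-++⁺ʳ)
open import Data.List.Relation.Unary.All as All using (All; []; _∷_)
open import Data.List.Relation.Unary.Any using (here; there)
open import Data.List.Relation.Unary.Unique.Propositional using (Unique; []; _∷_)
open import Data.Nat as ℕ using (ℕ; zero; suc; z≤n; s≤s)
open import Data.Nat.Divisibility using (_∣_; _∣?_; divides)
open import Data.Nat.GCD using (gcd; module Bézout)
open import Data.Nat.LCM using (lcm; m∣lcm[m,n]; n∣lcm[m,n]; gcd*lcm)
open import Data.Nat.ListAction using (product)
open import Data.Nat.Primality using (Prime; prime?; euclidsLemma; prime⇒irreducible; prime⇒nonZero; prime⇒nonTrivial; prime[2])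
open import Data.Nat.Primality.Factorisation using (PrimeFactorisation; factorise)
open import Data.Product using (_×_; _,_; proj₁; proj₂; ∃)
open import Data.Rational using (ℚ; mkℚ; ½; _+_; _*_; _-_; -_; _≤_; _<_; 0ℚ; 1ℚ; ∣_∣; _/_; ↥_; ↧_; ↧ₙ_; nonNegative; positive; *≤*)
open import Data.Rational.Properties using (≤-refl; ≤-reflexive; ≤-trans; <⇒≤; +-mono-≤; +-identityˡ; +-identityʳ; +-comm; +-assoc; *-comm; *-assoc; *-identityˡ; *-identityʳ; *-zeroˡ; *-zeroʳ; *-distribˡ-+; *-distribʳ-+)
open import Data.Sum using (_⊎_; inj₁; inj₂)
open import Defs
open import Function using (_∘_)
open import Function.Bundles using (_⇔_; Equivalence)
open import Relation.Binary.PropositionalEquality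
open import Relation.Nullary using (Dec; yes; no; ¬_; ¬?)
open import Relation.Nullary.Decidable using (dec⇒maybe; from-yes; decidable-stable; _×-dec_; _⊎-dec_)
open import Tactic.RingSolver.Core.AlmostCommutativeRing using (AlmostCommutativeRing; fromCommutativeRing)

-- The obstacle at a prime p dividing Δ is that pˡ is not prime to Δ, so that domination says
-- nothing about m = pˡ. The substitutes pˡ + Dk agree with pˡ mod D and, for p not dividing k, are
-- prime to Δ. Let pᶠ be the exact power of p in Δ. Summed over k, a p-integral parameter
-- contributes φ(pᶠ) S(a, n), while every other parameter contributes the same amount n pᶠ⁻¹,
-- because its sum over l telescopes. As φ(pᶠ) = (p - 1) pᶠ⁻¹ and r = s, these constants differ
-- between α and β by exactly the term λ n. Dirichlet's theorem serves to prove an inequality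
-- between rationals, which is decidable; a doubly negated existence statement is therefore enough.
-- Limits are replaced by one cutoff Y for all arithmetic functions and one mesh M for the
-- logarithm. In 2/φ, the 2 is the total mass 1 + 1 of p_y and pₓ * p_y. The upper bound 2/φ for a
-- single density comes from pairing it with a smaller scale, so the three scales to be compared
-- need a fourth one below them.

-- Ordered-field arithmetic in ℚ.

ℚring : AlmostCommutativeRing _ _
ℚring = fromCommutativeRing ℚₚ.+-*-commutativeRing (λ x → dec⇒maybe (0ℚ ℚₚ.≟ x))

0≤1 : 0ℚ ≤ 1ℚ
0≤1 = *≤* (ℤ.+≤+ z≤n)

≤-by : ∀ {a b s} → 0ℚ ≤ s → b ≡ a + s → a ≤ b
≤-by {a} {b} {s} h refl = subst (_≤ a + s) (+-identityʳ a) (+-mono-≤ (≤-refl {a}) h)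

≤-+ : ∀ a {s} → 0ℚ ≤ s → a ≤ a + s
≤-+ a h = ≤-by h refl

+ˡ : ∀ c {a b} → a ≤ b → c + a ≤ c + b
+ˡ c h = +-mono-≤ (≤-refl {c}) h

+ʳ : ∀ c {a b} → a ≤ b → a + c ≤ b + c
+ʳ c h = +-mono-≤ h (≤-refl {c})

diff≥0 : ∀ {a b} → a ≤ b → 0ℚ ≤ b - a
diff≥0 {a} {b} h = subst (_≤ b - a) (ℚₚ.+-inverseʳ a) (+-mono-≤ h (≤-refl { - a}))

+-≥0 : ∀ {a b} → 0ℚ ≤ a → 0ℚ ≤ b → 0ℚ ≤ a + b
+-≥0 = +-mono-≤

*-≥0 : ∀ {a b} → 0ℚ ≤ a → 0ℚ ≤ b → 0ℚ ≤ a * b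
*-≥0 {a} {b} ha hb = subst (_≤ a * b) (*-zeroʳ a) (ℚₚ.*-monoˡ-≤-nonNeg a {{nonNegative ha}} hb)

*-monoˡ : ∀ {a b c} → 0ℚ ≤ c → a ≤ b → c * a ≤ c * b
*-monoˡ {c = c} hc h = ℚₚ.*-monoˡ-≤-nonNeg c {{nonNegative hc}} h

*-monoʳ : ∀ {a b c} → 0ℚ ≤ c → a ≤ b → a * c ≤ b * c
*-monoʳ {c = c} hc h = ℚₚ.*-monoʳ-≤-nonNeg c {{nonNegative hc}} h

*-mono : ∀ {a b c e} → 0ℚ ≤ a → 0ℚ ≤ c → a ≤ b → c ≤ e → a * c ≤ b * e
*-mono ha hc h k = ≤-trans (*-monoˡ ha k) (*-monoʳ (≤-trans hc k) h)

*-cancelˡ : ∀ {a b c} → 0ℚ < c → c * a ≤ c * b → a ≤ b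
*-cancelˡ {c = c} hc = ℚₚ.*-cancelˡ-≤-pos c {{positive hc}}

∣∣-intro : ∀ {x b} → - b ≤ x → x ≤ b → ∣ x ∣ ≤ b
∣∣-intro {x} {b} h k with ℚₚ.∣p∣≡p∨∣p∣≡-p x
... | inj₁ e = subst (_≤ b) (sym e) k
... | inj₂ e = subst (_≤ b) (sym e) (subst (- x ≤_) (neg-neg b) (ℚₚ.neg-antimono-≤ h))
  where
  neg-neg : ∀ a → - (- a) ≡ a
  neg-neg = RS.solve-∀ ℚring

≤∣∣ : ∀ x → x ≤ ∣ x ∣
≤∣∣ x with ℚₚ.≤-total 0ℚ x
... | inj₁ h = ≤-reflexive (sym (ℚₚ.0≤p⇒∣p∣≡p h))
... | inj₂ h = ≤-trans h (ℚₚ.0≤∣p∣ x)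

-∣∣≤ : ∀ x → - x ≤ ∣ x ∣
-∣∣≤ x = subst (- x ≤_) (ℚₚ.∣-p∣≡∣p∣ x) (≤∣∣ (- x))

∣∣≤⇒ : ∀ {x b} → ∣ x ∣ ≤ b → x ≤ b × - x ≤ b
∣∣≤⇒ {x} h = ≤-trans (≤∣∣ x) h , ≤-trans (-∣∣≤ x) h

∣+∣≤ : ∀ {x y a b} → ∣ x ∣ ≤ a → ∣ y ∣ ≤ b → ∣ x + y ∣ ≤ a + b
∣+∣≤ {x} {y} h k = ≤-trans (ℚₚ.∣p+q∣≤∣p∣+∣q∣ x y) (+-mono-≤ h k)

∣*∣≤ : ∀ {x y a b} → ∣ x ∣ ≤ a → ∣ y ∣ ≤ b → ∣ x * y ∣ ≤ a * b
∣*∣≤ {x} {y} h k = ≤-trans (≤-reflexive (ℚₚ.∣p*q∣≡∣p∣*∣q∣ x y)) (*-mono (ℚₚ.0≤∣p∣ x) (ℚₚ.0≤∣p∣ y) h k)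

-- ℕtoℚ, defined by recursion so that it does not unfold to a normalised fraction on open terms.
ι : ℕ → ℚ
ι zero = 0ℚ
ι (suc n) = 1ℚ + ι n

ℕtoℚ≡mkℚ : ∀ n → ℕtoℚ n ≡ mkℚ (ℤ.+ n) 0 (C.sym (C.1-coprimeTo n))
ℕtoℚ≡mkℚ n = ℚₚ.normalize-coprime (C.sym (C.1-coprimeTo n))

ι≡ℕtoℚ : ∀ n → ι n ≡ ℕtoℚ n
ι≡ℕtoℚ zero = refl
ι≡ℕtoℚ (suc n) = trans (cong (1ℚ +_) (ι≡ℕtoℚ n)) (step n)
  where
  step : ∀ n → 1ℚ + ℕtoℚ n ≡ ℕtoℚ (suc n)
  step n rewrite ℕtoℚ≡mkℚ n = cong (_/ 1) (cong₂ ℤ._+_ {ℤ.+ 1} refl (ℤₚ.*-identityʳ (ℤ.+ n)))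

ι≡ : ∀ n → ι n ≡ mkℚ (ℤ.+ n) 0 (C.sym (C.1-coprimeTo n))
ι≡ n = trans (ι≡ℕtoℚ n) (ℕtoℚ≡mkℚ n)

ι-+ : ∀ m n → ι (m ℕ.+ n) ≡ ι m + ι n
ι-+ zero n = sym (+-identityˡ (ι n))
ι-+ (suc m) n = trans (cong (1ℚ +_) (ι-+ m n)) (sym (+-assoc 1ℚ (ι m) (ι n)))

ι-* : ∀ m n → ι (m ℕ.* n) ≡ ι m * ι n
ι-* zero n = sym (*-zeroˡ (ι n))
ι-* (suc m) n = trans (ι-+ n (m ℕ.* n)) (trans (cong (ι n +_) (ι-* m n)) (lem (ι m) (ι n)))
  where
  lem : ∀ a b → b + a * b ≡ (1ℚ + a) * b
  lem = RS.solve-∀ ℚring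

ι-suc : ∀ n → ι (suc n) ≡ 1ℚ + ι n
ι-suc n = refl

0≤ι : ∀ n → 0ℚ ≤ ι n
0≤ι zero = ≤-refl
0≤ι (suc n) = +-≥0 0≤1 (0≤ι n)

ι-mono : ∀ {m n} → m ℕ.≤ n → ι m ≤ ι n
ι-mono {m} {n} h with ℕₚ.m≤n⇒∃[o]m+o≡n h
... | o , refl = ≤-by (0≤ι o) (ι-+ m o)

1≤ι : ∀ {n} → 1 ℕ.≤ n → 1ℚ ≤ ι n
1≤ι {suc n} _ = ≤-+ 1ℚ (0≤ι n)

0<1 : 0ℚ < 1ℚ
0<1 = ℚₚ.positive⁻¹ 1ℚ

0<ι : ∀ {n} → 1 ℕ.≤ n → 0ℚ < ι n
0<ι h = ℚₚ.<-≤-trans 0<1 (1≤ι h)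

-- rec n = 1/n; rec 0 = 0 is junk.
rec : ℕ → ℚ
rec zero = 0ℚ
rec (suc n) = mkℚ (ℤ.+ 1) n (C.1-coprimeTo (suc n))

rec-ι : ∀ {n} → 1 ℕ.≤ n → rec n * ι n ≡ 1ℚ
rec-ι {suc n} _ = trans (cong (rec (suc n) *_) (ι≡ (suc n)))
  (ℚₚ.*-inverseˡ (mkℚ (ℤ.+ suc n) 0 (C.sym (C.1-coprimeTo (suc n)))))

0≤rec : ∀ n → 0ℚ ≤ rec n
0≤rec zero = ≤-refl
0≤rec (suc n) = *≤* (ℤ.+≤+ z≤n)

*-cancel-≡ : ∀ {n a b} → 1 ℕ.≤ n → a * ι n ≡ b * ι n → a ≡ b
*-cancel-≡ {n} {a} {b} h e = trans (lem a) (trans (cong (_* rec n) e) (sym (lem b)))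
  where
  lem : ∀ a → a ≡ a * ι n * rec n
  lem a = trans (sym (*-identityʳ a)) (trans (cong (a *_) (sym (trans (*-comm (ι n) (rec n)) (rec-ι h)))) (sym (*-assoc a (ι n) (rec n))))

rec-* : ∀ m n → rec (m ℕ.* n) ≡ rec m * rec n
rec-* zero n = sym (*-zeroˡ (rec n))
rec-* (suc m) zero rewrite ℕₚ.*-zeroʳ m = sym (*-zeroʳ (rec (suc m)))
rec-* (suc m) (suc n) = *-cancel-≡ {suc m ℕ.* suc n} (s≤s z≤n)
  (trans (rec-ι {suc m ℕ.* suc n} (s≤s z≤n)) (sym (trans (cong (rec (suc m) * rec (suc n) *_) (ι-* (suc m) (suc n)))
    (trans (shuffle (rec (suc m)) (rec (suc n)) (ι (suc m)) (ι (suc n)))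
      (cong₂ _*_ (rec-ι {suc m} (s≤s z≤n)) (rec-ι {suc n} (s≤s z≤n)))))))
  where
  shuffle : ∀ a b c e → a * b * (c * e) ≡ (a * c) * (b * e)
  shuffle = RS.solve-∀ ℚring

rec-anti : ∀ {m n} → 1 ℕ.≤ m → m ℕ.≤ n → rec n ≤ rec m
rec-anti {m} {n} 1≤m h = *-cancelˡ (0<ι (ℕₚ.≤-trans 1≤m h)) (≤-trans (≤-reflexive (trans (*-comm (ι n) (rec n)) (rec-ι (ℕₚ.≤-trans 1≤m h))))
  (≤-trans (≤-reflexive (sym (trans (*-comm (ι m) (rec m)) (rec-ι 1≤m)))) (*-monoʳ (0≤rec m) (ι-mono h))))

rec≤1 : ∀ n → rec n ≤ 1ℚ
rec≤1 zero = 0≤1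
rec≤1 (suc n) = rec-anti {1} {suc n} (s≤s z≤n) (s≤s z≤n)

-- Finite sums over 1, ..., y and indicator functions.

∑ : ℕ → (ℕ → ℚ) → ℚ
∑ zero f = 0ℚ
∑ (suc y) f = ∑ y f + f (suc y)

∑-cong : ∀ y {f g} → (∀ i → 1 ℕ.≤ i → i ℕ.≤ y → f i ≡ g i) → ∑ y f ≡ ∑ y g
∑-cong zero h = refl
∑-cong (suc y) h = cong₂ _+_ (∑-cong y (λ i a b → h i a (ℕₚ.m≤n⇒m≤1+n b))) (h (suc y) (s≤s z≤n) ℕₚ.≤-refl)

∑-mono : ∀ y {f g} → (∀ i → 1 ℕ.≤ i → i ℕ.≤ y → f i ≤ g i) → ∑ y f ≤ ∑ y g
∑-mono zero h = ≤-refl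
∑-mono (suc y) h = +-mono-≤ (∑-mono y (λ i a b → h i a (ℕₚ.m≤n⇒m≤1+n b))) (h (suc y) (s≤s z≤n) ℕₚ.≤-refl)

∑-≥0 : ∀ y {f} → (∀ i → 1 ℕ.≤ i → i ℕ.≤ y → 0ℚ ≤ f i) → 0ℚ ≤ ∑ y f
∑-≥0 zero h = ≤-refl
∑-≥0 (suc y) h = +-≥0 (∑-≥0 y (λ i a b → h i a (ℕₚ.m≤n⇒m≤1+n b))) (h (suc y) (s≤s z≤n) ℕₚ.≤-refl)

∑-0 : ∀ y {f} → (∀ i → 1 ℕ.≤ i → i ℕ.≤ y → f i ≡ 0ℚ) → ∑ y f ≡ 0ℚ
∑-0 zero h = refl
∑-0 (suc y) h = cong₂ _+_ (∑-0 y (λ i a b → h i a (ℕₚ.m≤n⇒m≤1+n b))) (h (suc y) (s≤s z≤n) ℕₚ.≤-refl)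

∑-+ : ∀ y f g → ∑ y (λ i → f i + g i) ≡ ∑ y f + ∑ y g
∑-+ zero f g = refl
∑-+ (suc y) f g = trans (cong (_+ (f (suc y) + g (suc y))) (∑-+ y f g)) (lem (∑ y f) (∑ y g) (f (suc y)) (g (suc y)))
  where
  lem : ∀ a b c e → a + b + (c + e) ≡ a + c + (b + e)
  lem = RS.solve-∀ ℚring

∑-*ˡ : ∀ y c f → ∑ y (λ i → c * f i) ≡ c * ∑ y f
∑-*ˡ zero c f = sym (*-zeroʳ c)
∑-*ˡ (suc y) c f = trans (cong (_+ c * f (suc y)) (∑-*ˡ y c f)) (sym (*-distribˡ-+ c (∑ y f) (f (suc y))))

∑-*ʳ : ∀ y c f → ∑ y (λ i → f i * c) ≡ ∑ y f * c
∑-*ʳ y c f = trans (∑-cong y (λ i _ _ → *-comm (f i) c)) (trans (∑-*ˡ y c f) (*-comm c (∑ y f)))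

∑-neg : ∀ y f → ∑ y (λ i → - f i) ≡ - ∑ y f
∑-neg zero f = refl
∑-neg (suc y) f = trans (cong (_+ - f (suc y)) (∑-neg y f)) (sym (ℚₚ.neg-distrib-+ (∑ y f) (f (suc y))))

∑-- : ∀ y f g → ∑ y (λ i → f i - g i) ≡ ∑ y f - ∑ y g
∑-- y f g = trans (∑-+ y f (λ i → - g i)) (cong (∑ y f +_) (∑-neg y g))

∑-const : ∀ y c → ∑ y (λ _ → c) ≡ ι y * c
∑-const zero c = sym (*-zeroˡ c)
∑-const (suc y) c = trans (cong (_+ c) (∑-const y c)) (trans (lem (ι y) c) (cong (_* c) (sym (ι-suc y))))
  where
  lem : ∀ a c → a * c + c ≡ (1ℚ + a) * c
  lem = RS.solve-∀ ℚring

∑-swap : ∀ y z (f : ℕ → ℕ → ℚ) → ∑ y (λ i → ∑ z (f i)) ≡ ∑ z (λ j → ∑ y (λ i → f i j))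
∑-swap zero z f = sym (∑-0 z (λ _ _ _ → refl))
∑-swap (suc y) z f = trans (cong (_+ ∑ z (f (suc y))) (∑-swap y z f)) (sym (∑-+ z (λ j → ∑ y (λ i → f i j)) (f (suc y))))

∑-split : ∀ s t f → ∑ (s ℕ.+ t) f ≡ ∑ s f + ∑ t (λ i → f (s ℕ.+ i))
∑-split s zero f rewrite ℕₚ.+-identityʳ s = sym (+-identityʳ (∑ s f))
∑-split s (suc t) f rewrite ℕₚ.+-suc s t = trans (cong (_+ f (suc (s ℕ.+ t))) (∑-split s t f)) (+-assoc (∑ s f) _ _)

∑-extend : ∀ {y z f} → y ℕ.≤ z → (∀ i → y ℕ.< i → i ℕ.≤ z → f i ≡ 0ℚ) → ∑ z f ≡ ∑ y f
∑-extend {y} {z} {f} y≤z h with ℕₚ.m≤n⇒∃[o]m+o≡n y≤z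
... | t , refl = trans (∑-split y t f) (trans (cong (∑ y f +_) (∑-0 t (λ i 1≤i i≤t →
      h (y ℕ.+ i) (subst (ℕ._≤ y ℕ.+ i) (ℕₚ.+-comm y 1) (ℕₚ.+-monoʳ-≤ y 1≤i)) (ℕₚ.+-monoʳ-≤ y i≤t)))) (+-identityʳ (∑ y f)))

∣∑∣≤ : ∀ y {f g} → (∀ i → 1 ℕ.≤ i → i ℕ.≤ y → ∣ f i ∣ ≤ g i) → ∣ ∑ y f ∣ ≤ ∑ y g
∣∑∣≤ zero h = ≤-refl
∣∑∣≤ (suc y) h = ∣+∣≤ (∣∑∣≤ y (λ i a b → h i a (ℕₚ.m≤n⇒m≤1+n b))) (h (suc y) (s≤s z≤n) ℕₚ.≤-refl)

∑-≤-const : ∀ y {f c} → (∀ i → 1 ℕ.≤ i → i ℕ.≤ y → f i ≤ c) → ∑ y f ≤ ι y * c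
∑-≤-const y {c = c} h = ≤-trans (∑-mono y h) (≤-reflexive (∑-const y c))

∑-mono-range : ∀ {y z f} → y ℕ.≤ z → (∀ i → y ℕ.< i → i ℕ.≤ z → 0ℚ ≤ f i) → ∑ y f ≤ ∑ z f
∑-mono-range {y} {z} {f} y≤z h with ℕₚ.m≤n⇒∃[o]m+o≡n y≤z
... | t , refl = ≤-by (∑-≥0 t (λ i 1≤i i≤t →
      h (y ℕ.+ i) (subst (ℕ._≤ y ℕ.+ i) (ℕₚ.+-comm y 1) (ℕₚ.+-monoʳ-≤ y 1≤i)) (ℕₚ.+-monoʳ-≤ y i≤t))) (∑-split y t f)

term≤∑ : ∀ y {f} → (∀ i → 1 ℕ.≤ i → i ℕ.≤ y → 0ℚ ≤ f i) → ∀ {i} → 1 ℕ.≤ i → i ℕ.≤ y → f i ≤ ∑ y f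
term≤∑ zero h {suc i} _ ()
term≤∑ (suc y) {f} h {i} 1≤i i≤y with i ℕₚ.≟ suc y
... | yes refl = subst (_≤ ∑ y f + f (suc y)) (+-identityˡ _) (+-mono-≤ (∑-≥0 y (λ i a b → h i a (ℕₚ.m≤n⇒m≤1+n b))) ≤-refl)
... | no i≢ = subst (_≤ ∑ y f + f (suc y)) (+-identityʳ _) (+-mono-≤ (term≤∑ y (λ i a b → h i a (ℕₚ.m≤n⇒m≤1+n b)) 1≤i (ℕₚ.≤-pred (ℕₚ.≤∧≢⇒< i≤y i≢))) (h (suc y) (s≤s z≤n) ℕₚ.≤-refl))

𝟙 : ∀ {A : Set} → Dec A → ℚ
𝟙 (yes _) = 1ℚ
𝟙 (no _) = 0ℚ

𝟙-yes : ∀ {A : Set} (a? : Dec A) → A → 𝟙 a? ≡ 1ℚ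
𝟙-yes (yes _) a = refl
𝟙-yes (no ¬a) a = ⊥-elim (¬a a)

𝟙-no : ∀ {A : Set} (a? : Dec A) → ¬ A → 𝟙 a? ≡ 0ℚ
𝟙-no (yes a) ¬a = ⊥-elim (¬a a)
𝟙-no (no _) ¬a = refl

𝟙-⇔ : ∀ {A B : Set} (a? : Dec A) (b? : Dec B) → (A → B) → (B → A) → 𝟙 a? ≡ 𝟙 b?
𝟙-⇔ (yes a) b? f g = sym (𝟙-yes b? (f a))
𝟙-⇔ (no ¬a) b? f g = sym (𝟙-no b? (¬a ∘ g))

0≤𝟙 : ∀ {A : Set} (a? : Dec A) → 0ℚ ≤ 𝟙 a?
0≤𝟙 (yes _) = 0≤1
0≤𝟙 (no _) = ≤-refl

𝟙≤1 : ∀ {A : Set} (a? : Dec A) → 𝟙 a? ≤ 1ℚ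
𝟙≤1 (yes _) = ≤-refl
𝟙≤1 (no _) = 0≤1

∑-single : ∀ y {f} {j} → 1 ℕ.≤ j → j ℕ.≤ y → (∀ i → 1 ℕ.≤ i → i ℕ.≤ y → i ≢ j → f i ≡ 0ℚ) → ∑ y f ≡ f j
∑-single y {f} {suc j} 1≤j j≤y h =
  trans (∑-extend j≤y (λ i j<i i≤y → h i (ℕₚ.≤-trans 1≤j (ℕₚ.<⇒≤ j<i)) i≤y (λ e → ℕₚ.<⇒≢ j<i (sym e))))
    (trans (cong (_+ f (suc j)) (∑-0 j (λ i 1≤i i≤j → h i 1≤i (ℕₚ.≤-trans i≤j (ℕₚ.≤-trans (ℕₚ.n≤1+n j) j≤y)) (ℕₚ.<⇒≢ (s≤s i≤j))))) (+-identityˡ _))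

∑-𝟙 : ∀ y (f : ℕ → ℚ) {j} → 1 ℕ.≤ j → j ℕ.≤ y → ∑ y (λ i → 𝟙 (i ℕₚ.≟ j) * f i) ≡ f j
∑-𝟙 y f {j} 1≤j j≤y = trans (∑-single y {λ i → 𝟙 (i ℕₚ.≟ j) * f i} 1≤j j≤y (λ i _ _ i≢j → trans (cong (λ t → t * f i) (𝟙-no (i ℕₚ.≟ j) i≢j)) (*-zeroˡ (f i))))
  (trans (cong (λ t → t * f j) (𝟙-yes (j ℕₚ.≟ j) refl)) (*-identityˡ (f j)))

-- Integer quotients and sums over multiples.

infixl 7 _÷_
_÷_ : ℕ → ℕ → ℕ
y ÷ zero = 0
y ÷ suc m = y ℕ./ suc m

-- Together with `÷-adj⁻` this is a Galois connection; identities between quotients then follow by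
-- comparing lower sets with `≤-ext`.
÷-adj : ∀ {y m k} → 1 ℕ.≤ m → k ℕ.≤ y ÷ m → m ℕ.* k ℕ.≤ y
÷-adj {y} {suc m} {k} _ h = ℕₚ.≤-trans (ℕₚ.*-monoʳ-≤ (suc m) h) (subst (ℕ._≤ y) (ℕₚ.*-comm (y ÷ suc m) (suc m)) (DM.m/n*n≤m y (suc m)))

÷-adj⁻ : ∀ {y m k} → 1 ℕ.≤ m → m ℕ.* k ℕ.≤ y → k ℕ.≤ y ÷ m
÷-adj⁻ {y} {suc m} {k} _ h = subst (ℕ._≤ y ÷ suc m) (trans (cong (ℕ._/ suc m) (ℕₚ.*-comm (suc m) k)) (DM.m*n/n≡m k (suc m))) (DM./-monoˡ-≤ (suc m) h)

≤-ext : ∀ {a b} → (∀ k → k ℕ.≤ a → k ℕ.≤ b) → (∀ k → k ℕ.≤ b → k ℕ.≤ a) → a ≡ b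
≤-ext f g = ℕₚ.≤-antisym (f _ ℕₚ.≤-refl) (g _ ℕₚ.≤-refl)

÷÷ : ∀ y {m n} → 1 ℕ.≤ m → 1 ℕ.≤ n → y ÷ m ÷ n ≡ y ÷ (m ℕ.* n)
÷÷ y {m} {n} hm hn = ≤-ext
  (λ k h → ÷-adj⁻ (ℕₚ.*-mono-≤ hm hn) (subst (ℕ._≤ y) (sym (ℕₚ.*-assoc m n k)) (÷-adj hm (÷-adj hn h))))
  (λ k h → ÷-adj⁻ hn (÷-adj⁻ hm (subst (ℕ._≤ y) (ℕₚ.*-assoc m n k) (÷-adj (ℕₚ.*-mono-≤ hm hn) h))))

÷≤ : ∀ y m → y ÷ m ℕ.≤ y
÷≤ y zero = z≤n
÷≤ y (suc m) = DM.m/n≤m y (suc m)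

÷-small : ∀ {y m} → y ℕ.< m → y ÷ m ≡ 0
÷-small {y} {suc m} h = DM.m<n⇒m/n≡0 h

∑-multiples : ∀ y {m} (h : ℕ → ℚ) → 1 ℕ.≤ m → ∑ y (λ n → 𝟙 (m ∣? n) * h n) ≡ ∑ (y ÷ m) (λ k → h (m ℕ.* k))
∑-multiples zero {suc m} h 1≤m = refl
∑-multiples (suc y) {m} h 1≤m with m ∣? suc y
... | yes (divides (suc q) e) = trans (cong₂ _+_ (∑-multiples y h 1≤m) (*-identityˡ (h (suc y))))
        (trans (cong₂ (λ a b → ∑ a (λ k → h (m ℕ.* k)) + h b) y÷m e') (cong (λ a → ∑ a (λ k → h (m ℕ.* k))) (sym sy÷m)))
  where
  e' : suc y ≡ m ℕ.* suc q
  e' = trans e (ℕₚ.*-comm (suc q) m)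
  sy÷m : suc y ÷ m ≡ suc q
  sy÷m = ≤-ext (λ k hk → ℕₚ.*-cancelˡ-≤ m {{ℕ.>-nonZero 1≤m}} (subst (m ℕ.* k ℕ.≤_) e' (÷-adj 1≤m hk)))
    (λ k hk → ÷-adj⁻ 1≤m (subst (m ℕ.* k ℕ.≤_) (sym e') (ℕₚ.*-monoʳ-≤ m hk)))
  y÷m : y ÷ m ≡ q
  y÷m = ≤-ext (λ k hk → ℕₚ.≤-pred (ℕₚ.*-cancelˡ-< m k (suc q) (subst (m ℕ.* k ℕ.<_) e' (s≤s (÷-adj 1≤m hk)))))
    (λ k hk → ÷-adj⁻ 1≤m (ℕₚ.≤-pred (subst (m ℕ.* k ℕ.<_) (sym e') (ℕₚ.*-monoʳ-< m {{ℕ.>-nonZero 1≤m}} (s≤s hk)))))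
... | no ¬d = trans (cong₂ _+_ (∑-multiples y h 1≤m) (*-zeroˡ (h (suc y)))) (trans (+-identityʳ _) (cong (λ a → ∑ a (λ k → h (m ℕ.* k))) eq))
  where
  eq : y ÷ m ≡ suc y ÷ m
  eq = ≤-ext (λ k hk → ÷-adj⁻ 1≤m (ℕₚ.m≤n⇒m≤1+n (÷-adj 1≤m hk)))
    (λ k hk → ÷-adj⁻ 1≤m (ℕₚ.≤-pred (ℕₚ.≤∧≢⇒< (÷-adj 1≤m hk) (λ e → ¬d (divides k (trans (sym e) (ℕₚ.*-comm m k)))))))

-- Harmonic sums and the discrete logarithm.

rec-diff : ∀ {n} → 1 ℕ.≤ n → rec n - rec (suc n) ≡ rec n * rec (suc n)
rec-diff {n} h = *-cancel-≡ {n} h (*-cancel-≡ {suc n} (s≤s z≤n) (trans (lem (rec n) (rec (suc n)) (ι n) (ι (suc n)))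
  (trans (cong₂ (λ a b → a * ι (suc n) - b * ι n) (rec-ι h) (rec-ι {suc n} (s≤s z≤n)))
   (trans (cong (λ a → 1ℚ * a - 1ℚ * ι n) (ι-suc n)) (trans (lem2 (ι n)) (trans (cong₂ _*_ (sym (rec-ι h)) (sym (rec-ι {suc n} (s≤s z≤n)))) (lem3 (rec n) (rec (suc n)) (ι n) (ι (suc n)))))))))
  where
  lem : ∀ a b x y → (a - b) * x * y ≡ a * x * y - b * y * x
  lem = RS.solve-∀ ℚring
  lem2 : ∀ x → 1ℚ * (1ℚ + x) - 1ℚ * x ≡ 1ℚ * 1ℚ
  lem2 = RS.solve-∀ ℚring
  lem3 : ∀ a b x y → a * x * (b * y) ≡ a * b * x * y
  lem3 = RS.solve-∀ ℚring

ι*rec* : ∀ m {n} → 1 ℕ.≤ n → ι n * rec (m ℕ.* n) ≡ rec m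
ι*rec* m {n} h = trans (cong (ι n *_) (rec-* m n)) (trans (lem (ι n) (rec m) (rec n)) (trans (cong (rec m *_) (rec-ι h)) (*-identityʳ (rec m))))
  where
  lem : ∀ a b c → a * (b * c) ≡ b * (c * a)
  lem = RS.solve-∀ ℚring

harm : ℕ → ℚ
harm n = ∑ n rec

-- Each dyadic block of reciprocals is worth at least 1/2.
harm-unbounded : ∀ k → ι k * rec 2 ≤ harm (2 ℕ.^ k)
harm-unbounded zero = *≤* (ℤ.+≤+ z≤n)
harm-unbounded (suc k) = ≤-trans (≤-reflexive (trans (cong (_* rec 2) (ι-suc k)) (lem (ι k) (rec 2))))
  (≤-trans (+-mono-≤ (harm-unbounded k) half) (≤-reflexive (sym split)))
  where
  p = 2 ℕ.^ k
  1≤p : 1 ℕ.≤ p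
  1≤p = ℕₚ.m^n>0 2 k
  lem : ∀ a b → (1ℚ + a) * b ≡ a * b + b
  lem = RS.solve-∀ ℚring
  split : harm (2 ℕ.^ suc k) ≡ harm p + ∑ p (λ i → rec (p ℕ.+ i))
  split = trans (cong harm (cong (p ℕ.+_) (ℕₚ.+-identityʳ p))) (∑-split p p rec)
  half : rec 2 ≤ ∑ p (λ i → rec (p ℕ.+ i))
  half = ≤-trans (≤-reflexive (trans (sym (ι*rec* 2 1≤p)) (sym (∑-const p (rec (2 ℕ.* p))))))
    (∑-mono p (λ i 1≤i i≤p → rec-anti (ℕₚ.≤-trans 1≤i (ℕₚ.m≤n+m i p)) (subst (p ℕ.+ i ℕ.≤_) (cong (p ℕ.+_) (sym (ℕₚ.+-identityʳ p))) (ℕₚ.+-monoʳ-≤ p i≤p))))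

-- Discrete logarithm: lg n = H(nM) - H(M), where H is the harmonic sum; it tends to ln n as M grows
-- and is additive up to an error 1/M. (lg 0 is junk.)
module Log (M : ℕ) (1≤M : 1 ℕ.≤ M) where

  lg : ℕ → ℚ
  lg n = harm (n ℕ.* M) - harm M

  lg-1 : lg 1 ≡ 0ℚ
  lg-1 = trans (cong (λ t → harm t - harm M) (ℕₚ.*-identityˡ M)) (ℚₚ.+-inverseʳ (harm M))

  private
    lg-step : ∀ n → lg (suc n) ≡ lg n + ∑ M (λ i → rec (n ℕ.* M ℕ.+ i))
    lg-step n = trans (cong (λ t → harm t - harm M) (ℕₚ.+-comm M (n ℕ.* M)))
      (trans (cong (_- harm M) (∑-split (n ℕ.* M) M rec)) (lem (harm (n ℕ.* M)) _ (harm M)))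
      where
      lem : ∀ a b c → a + b - c ≡ a - c + b
      lem = RS.solve-∀ ℚring

  lg-step≤ : ∀ {n} → 1 ℕ.≤ n → lg (suc n) ≤ lg n + rec n
  lg-step≤ {n} h = ≤-trans (≤-reflexive (lg-step n)) (+ˡ (lg n) (≤-trans
    (∑-≤-const M (λ i _ _ → rec-anti (ℕₚ.*-mono-≤ h 1≤M) (ℕₚ.m≤m+n (n ℕ.* M) i))) (≤-reflexive (ι*rec* n 1≤M))))

  lg-step≥ : ∀ n → lg n + rec (suc n) ≤ lg (suc n)
  lg-step≥ n = ≤-trans (+ˡ (lg n) (≤-trans (≤-reflexive (trans (sym (ι*rec* (suc n) 1≤M)) (sym (∑-const M (rec (suc n ℕ.* M))))))
    (∑-mono M (λ i 1≤i i≤M → rec-anti (ℕₚ.≤-trans 1≤i (ℕₚ.m≤n+m i _)) (subst (n ℕ.* M ℕ.+ i ℕ.≤_) (ℕₚ.+-comm (n ℕ.* M) M) (ℕₚ.+-monoʳ-≤ (n ℕ.* M) i≤M))))))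
    (≤-reflexive (sym (lg-step n)))

  lg-mono : ∀ {m n} → m ℕ.≤ n → lg m ≤ lg n
  lg-mono {m} {n} h with ℕₚ.m≤n⇒∃[o]m+o≡n h
  ... | o , refl = go o
    where
    go : ∀ o → lg m ≤ lg (m ℕ.+ o)
    go zero = ≤-reflexive (cong lg (sym (ℕₚ.+-identityʳ m)))
    go (suc o) = ≤-trans (go o) (≤-trans (≤-+ (lg (m ℕ.+ o)) (0≤rec (suc (m ℕ.+ o)))) (≤-trans (lg-step≥ (m ℕ.+ o)) (≤-reflexive (cong lg (sym (ℕₚ.+-suc m o))))))

  0≤lg : ∀ {n} → 1 ℕ.≤ n → 0ℚ ≤ lg n
  0≤lg h = ≤-trans (≤-reflexive (sym lg-1)) (lg-mono h)

  1+lg≤ι : ∀ {n} → 1 ℕ.≤ n → 1ℚ + lg n ≤ ι n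
  1+lg≤ι {suc zero} _ = ≤-reflexive (trans (cong (1ℚ +_) lg-1) refl)
  1+lg≤ι {suc (suc n)} _ = ≤-trans (+-mono-≤ (≤-refl {1ℚ}) (≤-trans (lg-step≤ {suc n} (s≤s z≤n)) (+ˡ (lg (suc n)) (rec≤1 (suc n)))))
    (≤-trans (≤-reflexive (lem (lg (suc n)))) (≤-trans (+-mono-≤ (≤-refl {1ℚ}) (1+lg≤ι {suc n} (s≤s z≤n))) (≤-reflexive (sym (ι-suc (suc n))))))
    where
    lem : ∀ a → 1ℚ + (a + 1ℚ) ≡ 1ℚ + (1ℚ + a)
    lem = RS.solve-∀ ℚring

  lg≤ι : ∀ {n} → 1 ℕ.≤ n → lg n ≤ ι n
  lg≤ι {n} h = ≤-trans (≤-by {lg n} 0≤1 (+-comm 1ℚ (lg n))) (1+lg≤ι h)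

  harm≤1+lg : ∀ {n} → 1 ℕ.≤ n → harm n ≤ 1ℚ + lg n
  harm≤1+lg {suc zero} _ = ≤-trans (≤-reflexive refl) (≤-reflexive (sym (trans (cong (1ℚ +_) lg-1) refl)))
  harm≤1+lg {suc (suc n)} _ = ≤-trans (+-mono-≤ (harm≤1+lg {suc n} (s≤s z≤n)) ≤-refl)
    (≤-trans (≤-reflexive (+-assoc 1ℚ (lg (suc n)) _)) (+-mono-≤ (≤-refl {1ℚ}) (lg-step≥ (suc n))))

  lg≤harm : ∀ n → lg (suc n) ≤ harm n
  lg≤harm zero = ≤-reflexive lg-1
  lg≤harm (suc n) = ≤-trans (lg-step≤ {suc n} (s≤s z≤n)) (+ʳ (rec (suc n)) (lg≤harm n))

  private
    -- `lg m` is `G m M` and `lg (m * n) - lg n` is `G m (n * M)`, so near-additivity of `lg`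
    -- amounts to `G m` being nearly constant: `G m K` increases with K, whereas `G m K + rec K`
    -- decreases.
    G : ℕ → ℕ → ℚ
    G m K = harm (m ℕ.* K) - harm K

    G-step : ∀ m K → G m (suc K) ≡ G m K + (∑ m (λ i → rec (m ℕ.* K ℕ.+ i)) - rec (suc K))
    G-step m K = trans (cong (λ t → harm t - harm (suc K)) (trans (ℕₚ.*-suc m K) (ℕₚ.+-comm m (m ℕ.* K))))
      (trans (cong (_- harm (suc K)) (∑-split (m ℕ.* K) m rec)) (lem (harm (m ℕ.* K)) _ (harm K) (rec (suc K))))
      where
      lem : ∀ a b c e → a + b - (c + e) ≡ a - c + (b - e)
      lem = RS.solve-∀ ℚring

    block≤ : ∀ {m K} → 1 ℕ.≤ m → 1 ℕ.≤ K → ∑ m (λ i → rec (m ℕ.* K ℕ.+ i)) ≤ rec K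
    block≤ {m} {K} hm hK = ≤-trans (∑-≤-const m (λ i _ _ → rec-anti (ℕₚ.*-mono-≤ hm hK) (ℕₚ.m≤m+n (m ℕ.* K) i)))
      (≤-reflexive (trans (cong (λ t → ι m * rec t) (ℕₚ.*-comm m K)) (ι*rec* K hm)))

    block≥ : ∀ {m} K → 1 ℕ.≤ m → rec (suc K) ≤ ∑ m (λ i → rec (m ℕ.* K ℕ.+ i))
    block≥ {m} K hm = ≤-trans (≤-reflexive (trans (sym (ι*rec* (suc K) hm)) (sym (∑-const m (rec (suc K ℕ.* m))))))
      (∑-mono m (λ i 1≤i i≤m → rec-anti (ℕₚ.≤-trans 1≤i (ℕₚ.m≤n+m i _))
        (subst (m ℕ.* K ℕ.+ i ℕ.≤_) (trans (ℕₚ.+-comm (m ℕ.* K) m) (cong (m ℕ.+_) (ℕₚ.*-comm m K))) (ℕₚ.+-monoʳ-≤ (m ℕ.* K) i≤m))))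

    G-mono : ∀ {m} K t → 1 ℕ.≤ m → G m K ≤ G m (K ℕ.+ t)
    G-mono {m} K zero hm = ≤-reflexive (cong (G m) (sym (ℕₚ.+-identityʳ K)))
    G-mono {m} K (suc t) hm = ≤-trans (G-mono K t hm) (≤-trans (≤-by (diff≥0 (block≥ (K ℕ.+ t) hm)) (G-step m (K ℕ.+ t)))
      (≤-reflexive (cong (G m) (sym (ℕₚ.+-suc K t)))))

    G-bound : ∀ {m K} t → 1 ℕ.≤ m → 1 ℕ.≤ K → G m (K ℕ.+ t) + rec (K ℕ.+ t) ≤ G m K + rec K
    G-bound {m} {K} zero hm hK = ≤-reflexive (cong (λ t → G m t + rec t) (ℕₚ.+-identityʳ K))
    G-bound {m} {K} (suc t) hm hK = ≤-trans (≤-trans (≤-reflexive (trans (cong (λ t → G m t + rec t) (ℕₚ.+-suc K t))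
        (trans (cong (_+ rec (suc (K ℕ.+ t))) (G-step m (K ℕ.+ t))) (lem (G m (K ℕ.+ t)) _ (rec (suc (K ℕ.+ t)))))))
        (+ˡ (G m (K ℕ.+ t)) (block≤ hm (ℕₚ.≤-trans hK (ℕₚ.m≤m+n K t))))) (G-bound t hm hK)
      where
      lem : ∀ a b c → a + (b - c) + c ≡ a + b
      lem = RS.solve-∀ ℚring

    lg-G : ∀ m {n} → 1 ℕ.≤ n → ∃ λ t → lg (m ℕ.* n) - lg n ≡ G m (M ℕ.+ t) × lg m ≡ G m M
    lg-G m {suc n} _ = n ℕ.* M , trans (cong (λ t → harm t - harm M - lg (suc n)) (ℕₚ.*-assoc m (suc n) M)) (lem (harm (m ℕ.* (M ℕ.+ n ℕ.* M))) (harm (M ℕ.+ n ℕ.* M)) (harm M)) , refl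
      where
      lem : ∀ a b c → a - c - (b - c) ≡ a - b
      lem = RS.solve-∀ ℚring

  lg-super : ∀ {m n} → 1 ℕ.≤ m → 1 ℕ.≤ n → lg m + lg n ≤ lg (m ℕ.* n)
  lg-super {m} {n} hm hn with lg-G m hn
  ... | t , e , e' = ≤-by (diff≥0 (G-mono M t hm)) (trans (lem (lg (m ℕ.* n)) (lg n)) (trans (cong (_+ lg n) e) (trans (lem2 (G m (M ℕ.+ t)) (G m M) (lg n)) (cong (λ x → x + lg n + (G m (M ℕ.+ t) - G m M)) (sym e')))))
    where
    lem : ∀ a b → a ≡ a - b + b
    lem = RS.solve-∀ ℚring
    lem2 : ∀ a b c → a + c ≡ b + c + (a - b)
    lem2 = RS.solve-∀ ℚring

  lg-sub : ∀ {m n} → 1 ℕ.≤ m → 1 ℕ.≤ n → lg (m ℕ.* n) ≤ lg m + lg n + rec M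
  lg-sub {m} {n} hm hn with lg-G m hn
  ... | t , e , e' = ≤-trans (≤-reflexive (trans (lem (lg (m ℕ.* n)) (lg n)) (cong (_+ lg n) e)))
      (≤-trans (+ʳ (lg n) (≤-trans (≤-+ (G m (M ℕ.+ t)) (0≤rec (M ℕ.+ t))) (G-bound t hm 1≤M))) (≤-reflexive (trans (lem2 (G m M) (rec M) (lg n)) (cong (λ x → x + lg n + rec M) (sym e')))))
    where
    lem : ∀ a b → a ≡ a - b + b
    lem = RS.solve-∀ ℚring
    lem2 : ∀ a b c → a + b + c ≡ a + c + b
    lem2 = RS.solve-∀ ℚring

  -- The analogue of log x! ≥ x log x - x. Passing from x = n to n + 1 raises each of the n old
  -- terms by at most 1/n, hence the sum by at most 1.
  ∑-lg-gap : ∀ {x} → 1 ℕ.≤ x → ∑ x (λ m → lg x - lg m) ≤ ι x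
  ∑-lg-gap {suc zero} _ = ≤-trans (≤-reflexive (trans (+-identityˡ _) (ℚₚ.+-inverseʳ (lg 1)))) 0≤1
  ∑-lg-gap {suc (suc n)} _ = ≤-trans (≤-reflexive (trans (cong₂ _+_ (trans (∑-cong (suc n) (λ m _ _ → lem (lg (suc (suc n))) (lg (suc n)) (lg m)))
      (∑-+ (suc n) (λ _ → lg (suc (suc n)) - lg (suc n)) (λ m → lg (suc n) - lg m))) (ℚₚ.+-inverseʳ (lg (suc (suc n))))) (+-identityʳ _)))
    (≤-trans (+-mono-≤ (≤-trans (≤-reflexive (∑-const (suc n) _)) (≤-trans (*-monoˡ (0≤ι (suc n)) gap) (≤-reflexive (trans (*-comm (ι (suc n)) (rec (suc n))) (rec-ι {suc n} (s≤s z≤n)))))) (∑-lg-gap {suc n} (s≤s z≤n)))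
      (≤-reflexive (sym (ι-suc (suc n)))))
    where
    lem : ∀ a b c → a - c ≡ (a - b) + (b - c)
    lem = RS.solve-∀ ℚring
    lem2 : ∀ a b → b + a - b ≡ a
    lem2 = RS.solve-∀ ℚring
    gap : lg (suc (suc n)) - lg (suc n) ≤ rec (suc n)
    gap = ≤-trans (+ʳ (- lg (suc n)) (lg-step≤ {suc n} (s≤s z≤n))) (≤-reflexive (lem2 (rec (suc n)) (lg (suc n))))

  -- (lg j)/j itself is not monotone, but it is the difference of this and of 1/j.
  lg/-anti : ∀ {j} → 1 ℕ.≤ j → (lg (suc j) + 1ℚ) * rec (suc j) ≤ (lg j + 1ℚ) * rec j
  lg/-anti {j} h = ≤-trans (*-monoʳ (0≤rec (suc j)) (+ʳ 1ℚ (lg-step≤ h)))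
    (≤-by (*-≥0 (0≤lg h) (*-≥0 (0≤rec j) (0≤rec (suc j)))) (lem (lg j) (rec j) (rec (suc j)) (rec-diff h)))
    where
    lem : ∀ l r s → r - s ≡ r * s → (l + 1ℚ) * r ≡ (l + r + 1ℚ) * s + l * (r * s)
    lem l r s e = trans (p l r s) (trans (cong (λ t → (l + 1ℚ) * s + (l + 1ℚ) * t) e) (q l r s))
      where
      p : ∀ l r s → (l + 1ℚ) * r ≡ (l + 1ℚ) * s + (l + 1ℚ) * (r - s)
      p = RS.solve-∀ ℚring
      q : ∀ l r s → (l + 1ℚ) * s + (l + 1ℚ) * (r * s) ≡ (l + r + 1ℚ) * s + l * (r * s)
      q = RS.solve-∀ ℚring

  -- The subtracted term imitates the antiderivative of (log t)/t², with 2 in place of 1 so that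
  -- each increment dominates the next summand. `rare` uses it to bound Σ log q / (q (q - 1)).
  lg-tail : ∀ y → ∑ y (λ m → lg (suc m) * (rec m * rec (suc m))) ≤ ι 2 - (lg (suc y) + ι 2) * rec (suc y)
  lg-tail zero = ≤-reflexive (sym (trans (cong (λ t → ι 2 - (t + ι 2) * 1ℚ) lg-1) refl))
  lg-tail (suc n) = ≤-trans (+ʳ _ (lg-tail n))
    (≤-by (+-≥0 (*-≥0 (0≤rec m) (diff≥0 (lg-step≤ {m} (s≤s z≤n)))) (*-≥0 (0≤rec m) (*-≥0 (0≤rec m') (diff≥0 (rec≤1 m)))))
      (lem (lg m) (lg m') (rec m) (rec m') (rec-diff {m} (s≤s z≤n))))
    where
    m = suc n
    m' = suc m
    lem : ∀ l l' r s → r - s ≡ r * s →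
      ι 2 - (l' + ι 2) * s ≡ ι 2 - (l + ι 2) * r + l' * (r * s) + (r * (l + r - l') + r * (s * (1ℚ - r)))
    lem l l' r s e = trans (p l' r s) (trans (cong (λ t → ι 2 - r - s - l' * s + t) e)
      (trans (q l l' r s) (trans (cong (λ t → ι 2 - (l + ι 2) * r + l' * t + (r * (l + r - l') + (t - r * t))) e) (w l l' r s))))
      where
      p : ∀ l' r s → ι 2 - (l' + ι 2) * s ≡ ι 2 - r - s - l' * s + (r - s)
      p = RS.solve-∀ ℚring
      q : ∀ l l' r s → ι 2 - r - s - l' * s + r * s ≡ ι 2 - (l + ι 2) * r + l' * (r - s) + (r * (l + r - l') + (r - s - r * (r - s)))
      q = RS.solve-∀ ℚring
      w : ∀ l l' r s → ι 2 - (l + ι 2) * r + l' * (r * s) + (r * (l + r - l') + (r * s - r * (r * s))) ≡ ι 2 - (l + ι 2) * r + l' * (r * s) + (r * (l + r - l') + r * (s * (1ℚ - r)))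
      w = RS.solve-∀ ℚring

-- Oscillating functions and Abel summation.

-- Functions all of whose dilations are periodic mod d with mean zero: the test functions that
-- separate residue classes.
record Osc (d : ℕ) (B : ℚ) (f : ℕ → ℚ) : Set where
  field
    periodic : ∀ n → f (d ℕ.+ n) ≡ f n
    mean-0 : ∀ u → ∑ d (λ i → f (u ℕ.* i)) ≡ 0ℚ
    bounded : ∀ n → ∣ f n ∣ ≤ B
open Osc public

periodic* : ∀ {d B f} → Osc d B f → ∀ k n → f (k ℕ.* d ℕ.+ n) ≡ f n
periodic* o zero n = refl
periodic* {d} {f = f} o (suc k) n = trans (cong f (ℕₚ.+-assoc d (k ℕ.* d) n)) (trans (periodic o (k ℕ.* d ℕ.+ n)) (periodic* o k n))

dilate : ∀ {d B f} → Osc d B f → ∀ u → Osc d B (λ n → f (u ℕ.* n))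
dilate {d} {f = f} o u .periodic n = trans (cong f (ℕₚ.*-distribˡ-+ u d n)) (periodic* o u (u ℕ.* n))
dilate {d} {f = f} o u .mean-0 v = trans (∑-cong d (λ i _ _ → cong f (sym (ℕₚ.*-assoc u v i)))) (mean-0 o (u ℕ.* v))
dilate o u .bounded n = bounded o (u ℕ.* n)

0≤B : ∀ {d B f} → Osc d B f → 0ℚ ≤ B
0≤B {f = f} o = ≤-trans (ℚₚ.0≤∣p∣ (f 0)) (bounded o 0)

∑-shift : ∀ {d} {f : ℕ → ℚ} → (∀ n → f (d ℕ.+ n) ≡ f n) → ∀ s → ∑ d (λ i → f (s ℕ.+ i)) ≡ ∑ d f
∑-shift per zero = refl
∑-shift {d} {f} per (suc s) = trans (lem (∑ d (λ i → f (suc s ℕ.+ i))) (f (suc s)) (∑ d (λ i → f (s ℕ.+ i))) e) (∑-shift per s)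
  where
  lem : ∀ a b c → b + a ≡ c + b → a ≡ c
  lem a b c e = trans (h a b) (trans (cong (λ t → t - b) e) (k c b))
    where
    h : ∀ a b → a ≡ b + a - b
    h = RS.solve-∀ ℚring
    k : ∀ c b → c + b - b ≡ c
    k = RS.solve-∀ ℚring
  shift : ∀ i → f (suc (s ℕ.+ i)) ≡ f (s ℕ.+ suc i)
  shift i = cong f (sym (ℕₚ.+-suc s i))
  front : ∀ t → f (s ℕ.+ 1) + ∑ t (λ i → f (s ℕ.+ suc i)) ≡ ∑ (suc t) (λ i → f (s ℕ.+ i))
  front zero = +-comm (f (s ℕ.+ 1)) 0ℚ
  front (suc t) = trans (sym (+-assoc (f (s ℕ.+ 1)) _ _)) (cong (_+ f (s ℕ.+ suc (suc t))) (front t))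
  e : f (suc s) + ∑ d (λ i → f (suc s ℕ.+ i)) ≡ ∑ d (λ i → f (s ℕ.+ i)) + f (suc s)
  e = trans (cong₂ _+_ (cong f (ℕₚ.+-comm 1 s)) (∑-cong d (λ i _ _ → shift i)))
        (trans (front d) (cong (∑ d (λ i → f (s ℕ.+ i)) +_) (trans (cong f (trans (ℕₚ.+-suc s d) (trans (cong suc (ℕₚ.+-comm s d)) (sym (ℕₚ.+-suc d s))))) (per (suc s)))))

∑-periods : ∀ {d} {f : ℕ → ℚ} → (∀ n → f (d ℕ.+ n) ≡ f n) → ∀ t → ∑ (t ℕ.* d) f ≡ ι t * ∑ d f
∑-periods {d} {f} per zero = sym (*-zeroˡ (∑ d f))
∑-periods {d} {f} per (suc t) = trans (∑-split d (t ℕ.* d) f) (trans (cong (∑ d f +_) (trans (∑-cong (t ℕ.* d) (λ i _ _ → per i)) (∑-periods per t))) (lem (∑ d f) (ι t)))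
  where
  lem : ∀ a t → a + t * a ≡ (1ℚ + t) * a
  lem = RS.solve-∀ ℚring

period-0 : ∀ {d B f} → Osc d B f → ∀ s → ∑ d (λ i → f (s ℕ.+ i)) ≡ 0ℚ
period-0 {d} {f = f} o s = trans (∑-shift (periodic o) s) (trans (∑-cong d (λ i _ _ → cong f (sym (ℕₚ.*-identityˡ i)))) (mean-0 o 1))

-- Complete periods cancel, and fewer than d terms remain.
interval≤ : ∀ {d B f} → Osc d B f → 1 ℕ.≤ d → ∀ s t → ∣ ∑ t (λ i → f (s ℕ.+ i)) ∣ ≤ ι d * B
interval≤ {d@(suc _)} {B} {f} o _ s t = subst (λ t → ∣ ∑ t (λ i → f (s ℕ.+ i)) ∣ ≤ ι d * B) (sym (trans (DM.m≡m%n+[m/n]*n t d) (ℕₚ.+-comm (t ℕ.% d) _))) (go (t ℕ./ d) s)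
  where
  go : ∀ q s → ∣ ∑ (q ℕ.* d ℕ.+ t ℕ.% d) (λ i → f (s ℕ.+ i)) ∣ ≤ ι d * B
  go zero s = ≤-trans (∣∑∣≤ (t ℕ.% d) (λ i _ _ → bounded o (s ℕ.+ i))) (≤-trans (≤-reflexive (∑-const (t ℕ.% d) B)) (*-monoʳ (0≤B o) (ι-mono (ℕₚ.<⇒≤ (DM.m%n<n t d)))))
  go (suc q) s = ≤-trans (≤-reflexive (cong ∣_∣ (trans (cong (λ t → ∑ t (λ i → f (s ℕ.+ i))) (ℕₚ.+-assoc d (q ℕ.* d) (t ℕ.% d)))
      (trans (∑-split d (q ℕ.* d ℕ.+ t ℕ.% d) (λ i → f (s ℕ.+ i))) (trans (cong₂ _+_ (period-0 o s) (∑-cong (q ℕ.* d ℕ.+ t ℕ.% d) (λ i _ _ → cong f (sym (ℕₚ.+-assoc s d i))))) (+-identityˡ _)))))) (go q (s ℕ.+ d))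

abel≡ : ∀ t (F g : ℕ → ℚ) → ∑ (suc t) (λ i → F i * g i) ≡ ∑ (suc t) F * g (suc t) + ∑ t (λ i → ∑ i F * (g i - g (suc i)))
abel≡ zero F g = lem (F 1 * g 1) (F 1) (g 1) refl
  where
  lem : ∀ a b c → a ≡ b * c → 0ℚ + a ≡ (0ℚ + b) * c + 0ℚ
  lem _ b c refl = h b c
    where
    h : ∀ b c → 0ℚ + b * c ≡ (0ℚ + b) * c + 0ℚ
    h = RS.solve-∀ ℚring
abel≡ (suc t) F g = trans (cong (_+ F (suc (suc t)) * g (suc (suc t))) (abel≡ t F g)) (lem (∑ (suc t) F) (g (suc t)) (g (suc (suc t))) (F (suc (suc t))) _)
  where
  lem : ∀ a b b' c e → a * b + e + c * b' ≡ (a + c) * b' + (e + a * (b - b'))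
  lem = RS.solve-∀ ℚring

telescope : ∀ t (g : ℕ → ℚ) → ∑ t (λ i → g i - g (suc i)) ≡ g 1 - g (suc t)
telescope zero g = sym (ℚₚ.+-inverseʳ (g 1))
telescope (suc t) g = trans (cong (_+ (g (suc t) - g (suc (suc t)))) (telescope t g)) (lem (g 1) (g (suc t)) (g (suc (suc t))))
  where
  lem : ∀ a b c → a - b + (b - c) ≡ a - c
  lem = RS.solve-∀ ℚring

abel : ∀ {C} t (F g : ℕ → ℚ) → (∀ s → ∣ ∑ s F ∣ ≤ C) → (∀ i → 1 ℕ.≤ i → 0ℚ ≤ g i) → (∀ i → 1 ℕ.≤ i → g (suc i) ≤ g i) →
       ∣ ∑ t (λ i → F i * g i) ∣ ≤ C * g 1
abel {C} zero F g hF hg _ = *-≥0 (≤-trans (ℚₚ.0≤∣p∣ 0ℚ) (hF 0)) (hg 1 (s≤s z≤n))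
abel {C} (suc t) F g hF hg hm = ≤-trans (≤-reflexive (cong ∣_∣ (abel≡ t F g)))
  (≤-trans (∣+∣≤ (∣*∣≤ (hF (suc t)) (≤-reflexive (ℚₚ.0≤p⇒∣p∣≡p (hg (suc t) (s≤s z≤n)))))
      (≤-trans (∣∑∣≤ t (λ i 1≤i _ → ∣*∣≤ (hF i) (≤-reflexive (ℚₚ.0≤p⇒∣p∣≡p (diff≥0 (hm i 1≤i)))))) (≤-reflexive (trans (∑-*ˡ t C _) (cong (C *_) (telescope t g))))))
    (≤-reflexive (lem C (g 1) (g (suc t)))))
  where
  lem : ∀ a b c → a * c + a * (b - c) ≡ a * b
  lem = RS.solve-∀ ℚring

osc-tail : ∀ {d B f} → Osc d B f → 1 ℕ.≤ d → ∀ s t → ∣ ∑ t (λ i → f (s ℕ.+ i) * rec (s ℕ.+ i)) ∣ ≤ ι d * B * rec (suc s)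
osc-tail {d} {B} {f} o hd s t = ≤-trans (abel t (λ i → f (s ℕ.+ i)) (λ i → rec (s ℕ.+ i)) (interval≤ o hd s) (λ i _ → 0≤rec (s ℕ.+ i))
    (λ i 1≤i → rec-anti (ℕₚ.≤-trans 1≤i (ℕₚ.m≤n+m i s)) (ℕₚ.+-monoʳ-≤ s (ℕₚ.n≤1+n i)))) (≤-reflexive (cong (λ t → ι d * B * rec t) (ℕₚ.+-comm s 1)))

-- The tail of Σ f(k)/k beyond y/m, where f oscillates.
osc-cut : ∀ {d B f} → Osc d B f → 1 ℕ.≤ d → ∀ {y N m} → 1 ℕ.≤ m → 1 ℕ.≤ y → y ℕ.≤ N →
  ∣ ∑ N (λ k → f k * rec k) - ∑ (y ÷ m) (λ k → f k * rec k) ∣ ≤ ι d * B * (ι m * rec y)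
osc-cut {d} {B} {f} o hd {y} {N} {m} hm hy y≤N with ℕₚ.m≤n⇒∃[o]m+o≡n (ℕₚ.≤-trans (÷≤ y m) y≤N)
... | t , refl = ≤-trans (≤-reflexive (cong ∣_∣ (trans (cong (_- ∑ (y ÷ m) (λ k → f k * rec k)) (∑-split (y ÷ m) t (λ k → f k * rec k))) (lem (∑ (y ÷ m) (λ k → f k * rec k)) _))))
    (≤-trans (osc-tail o hd (y ÷ m) t) (*-monoˡ (*-≥0 (0≤ι d) (0≤B o)) bound))
  where
  lem : ∀ a b → a + b - a ≡ b
  lem = RS.solve-∀ ℚring
  y≤ : y ℕ.≤ m ℕ.* suc (y ÷ m)
  y≤ with y ℕ.≤? m ℕ.* suc (y ÷ m)
  ... | yes h = h
  ... | no ¬h = ⊥-elim (ℕₚ.1+n≰n (÷-adj⁻ {y} {m} {suc (y ÷ m)} hm (ℕₚ.<⇒≤ (ℕₚ.≰⇒> ¬h))))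
  bound : rec (suc (y ÷ m)) ≤ ι m * rec y
  bound = ≤-trans (≤-reflexive (sym (trans (cong (ι m *_) (cong rec (ℕₚ.*-comm m (suc (y ÷ m))))) (ι*rec* (suc (y ÷ m)) hm)))) (*-monoˡ (0≤ι m) (rec-anti hy y≤))

-- Primes, the Möbius function and multiplicities.

prime≥2 : ∀ {p} → Prime p → 2 ℕ.≤ p
prime≥2 {p} pr = ℕ.nonTrivial⇒n>1 p {{prime⇒nonTrivial pr}}

prime≥1 : ∀ {p} → Prime p → 1 ℕ.≤ p
prime≥1 pr = ℕₚ.≤-trans (ℕₚ.n≤1+n 1) (prime≥2 pr)

prime∣prime : ∀ {p q} → Prime p → Prime q → p ∣ q → p ≡ q
prime∣prime pp pq d with prime⇒irreducible pq d
... | inj₁ refl = ⊥-elim (ℕₚ.<-irrefl refl (prime≥2 pp))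
... | inj₂ e = e

prime∣^ : ∀ {p} a k → Prime p → p ∣ a ℕ.^ k → p ∣ a
prime∣^ a zero pp d = ⊥-elim (ℕₚ.<-irrefl (sym (∣ₚ.∣1⇒≡1 d)) (prime≥2 pp))
prime∣^ a (suc k) pp d with euclidsLemma a (a ℕ.^ k) pp d
... | inj₁ h = h
... | inj₂ h = prime∣^ a k pp h

prime-coprime : ∀ {p a} → Prime p → ¬ (p ∣ a) → C.Coprime p a
prime-coprime pp ∤ {i} (i∣p , i∣a) with prime⇒irreducible pp i∣p
... | inj₁ e = e
... | inj₂ refl = ⊥-elim (∤ i∣a)

prime-induction : (P : ℕ → Set) → P 1 → (∀ q n → Prime q → 1 ℕ.≤ n → P n → P (q ℕ.* n)) → ∀ n → 1 ℕ.≤ n → P n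
prime-induction P base step n 1≤n = subst P (sym isFactorisation) (proj₂ (go factors factorsPrime))
  where
  open PrimeFactorisation (factorise n {{ℕ.>-nonZero 1≤n}})
  open import Data.Nat.ListAction using (product)
  go : ∀ ps → All Prime ps → 1 ℕ.≤ product ps × P (product ps)
  go [] [] = s≤s z≤n , base
  go (p ∷ ps) (pp ∷ h) = ℕₚ.*-mono-≤ (prime≥1 pp) (proj₁ (go ps h)) , step p (product ps) pp (proj₁ (go ps h)) (proj₂ (go ps h))

prime-divisor : ∀ n → 2 ℕ.≤ n → ∃ λ p → Prime p × p ∣ n
prime-divisor n 2≤n with prime-induction (λ n → n ≡ 1 ⊎ ∃ λ p → Prime p × p ∣ n) (inj₁ refl)
    (λ q n pq _ _ → inj₂ (q , pq , divides n (ℕₚ.*-comm q n))) n (ℕₚ.≤-trans (ℕₚ.n≤1+n 1) 2≤n)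
... | inj₁ refl = ⊥-elim (ℕₚ.<-irrefl refl 2≤n)
... | inj₂ h = h

prime-∣* : ∀ {r q n} → Prime r → Prime q → r ≢ q → r ∣ q ℕ.* n → r ∣ n
prime-∣* {r} {q} {n} pr pq r≢q d with euclidsLemma q n pr d
... | inj₁ h = ⊥-elim (r≢q (prime∣prime pr pq h))
... | inj₂ h = h

q*k÷q : ∀ {q} k → 1 ℕ.≤ q → (q ℕ.* k) ÷ q ≡ k
q*k÷q {q} k h = ≤-ext (λ j hj → ℕₚ.*-cancelˡ-≤ q {{ℕ.>-nonZero h}} (÷-adj h hj)) (λ j hj → ÷-adj⁻ h (ℕₚ.*-monoʳ-≤ q hj))

private
  -- Dirichlet convolution with δ₁ - δₚ, one Euler factor of 1/ζ. Adding the primes one at a time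
  -- makes the divisor sums of μ accessible to induction on z.
  μ-step : ∀ {p} → Dec (Prime p) → (ℕ → ℚ) → ℕ → ℚ
  μ-step {p} (yes _) f n = f n - 𝟙 (p ∣? n) * f (n ÷ p)
  μ-step (no _) f n = f n

-- The Möbius function restricted to integers with all prime factors ≤ z.
μ : ℕ → ℕ → ℚ
μ zero n = 𝟙 (n ℕₚ.≟ 1)
μ (suc z) n = μ-step (prime? (suc z)) (μ z) n

μ-support : ∀ z {n r} → Prime r → r ∣ n → z ℕ.< r → μ z n ≡ 0ℚ
μ-support zero {n} {r} pr d h = 𝟙-no (n ℕₚ.≟ 1) (λ { refl → ℕₚ.<-irrefl (sym (∣ₚ.∣1⇒≡1 d)) (prime≥2 pr) })
μ-support (suc z) {n} {r} pr d h with prime? (suc z)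
... | no _ = μ-support z pr d (ℕₚ.<-trans (ℕₚ.n<1+n z) h)
... | yes pq with suc z ∣? n
...   | no _ = trans (cong (λ t → t - 0ℚ * μ z (n ÷ suc z)) (μ-support z pr d (ℕₚ.<-trans (ℕₚ.n<1+n z) h))) (cong (λ t → 0ℚ - t) (*-zeroˡ (μ z (n ÷ suc z))))
...   | yes (divides k e) = trans (cong₂ (λ a b → a - 1ℚ * b) (μ-support z pr d (ℕₚ.<-trans (ℕₚ.n<1+n z) h)) (μ-support z pr r∣ (ℕₚ.<-trans (ℕₚ.n<1+n z) h))) refl
  where
  e' : n ≡ suc z ℕ.* k
  e' = trans e (ℕₚ.*-comm k (suc z))
  r∣ : r ∣ n ÷ suc z
  r∣ = subst (r ∣_) (sym (trans (cong (_÷ suc z) e') (q*k÷q k (s≤s z≤n)))) (prime-∣* pr pq (ℕₚ.<⇒≢ h ∘ sym) (subst (r ∣_) e' d))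

-- If the new prime divides n, the old value at n vanishes by `μ-support`; the two terms of `μ-step`
-- are never both nonzero.
∣μ∣≤1 : ∀ z n → ∣ μ z n ∣ ≤ 1ℚ
∣μ∣≤1 zero n = ≤-trans (≤-reflexive (ℚₚ.0≤p⇒∣p∣≡p (0≤𝟙 (n ℕₚ.≟ 1)))) (𝟙≤1 (n ℕₚ.≟ 1))
∣μ∣≤1 (suc z) n with prime? (suc z)
... | no _ = ∣μ∣≤1 z n
... | yes pq with suc z ∣? n
...   | no _ = ≤-trans (≤-reflexive (cong ∣_∣ (lem (μ z n) (μ z (n ÷ suc z))))) (∣μ∣≤1 z n)
  where
  lem : ∀ a b → a - 0ℚ * b ≡ a
  lem = RS.solve-∀ ℚring
...   | yes d = ≤-trans (≤-reflexive (trans (cong ∣_∣ (trans (cong (λ t → t - 1ℚ * μ z (n ÷ suc z)) (μ-support z pq d (ℕₚ.n<1+n z))) (lem (μ z (n ÷ suc z))))) (ℚₚ.∣-p∣≡∣p∣ (μ z (n ÷ suc z))))) (∣μ∣≤1 z (n ÷ suc z))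
  where
  lem : ∀ b → 0ℚ - 1ℚ * b ≡ - b
  lem = RS.solve-∀ ℚring

private
  free-step : ∀ {p} → Dec (Prime p) → (n : ℕ) → ℚ → ℚ
  free-step {p} (yes _) n c = 𝟙 (¬? (p ∣? n)) * c
  free-step (no _) n c = c

-- The indicator of the integers without prime factors ≤ z, i.e. 1 ∗ μ z.
free : ℕ → ℕ → ℚ
free zero n = 1ℚ
free (suc z) n = free-step (prime? (suc z)) n (free z n)

free-* : ∀ z {q n} → Prime q → z ℕ.< q → free z (q ℕ.* n) ≡ free z n
free-* zero pq h = refl
free-* (suc z) {q} {n} pq h with prime? (suc z)
... | no _ = free-* z pq (ℕₚ.<-trans (ℕₚ.n<1+n z) h)
... | yes pr = cong₂ _*_ (𝟙-⇔ (¬? (suc z ∣? q ℕ.* n)) (¬? (suc z ∣? n)) (λ a b → a (∣ₚ.∣n⇒∣m*n q b)) (λ a b → a (prime-∣* pr pq (ℕₚ.<⇒≢ h) b))) (free-* z pq (ℕₚ.<-trans (ℕₚ.n<1+n z) h))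

free-0 : ∀ z {p n} → Prime p → p ∣ n → p ℕ.≤ z → free z n ≡ 0ℚ
free-0 zero {suc p} _ _ ()
free-0 (suc z) {p} {n} pp d h with p ℕₚ.≟ suc z | prime? (suc z)
... | yes refl | yes _ = trans (cong (_* free z n) (𝟙-no (¬? (p ∣? n)) (λ a → a d))) (*-zeroˡ (free z n))
... | yes refl | no ¬p = ⊥-elim (¬p pp)
... | no p≢ | no _ = free-0 z pp d (ℕₚ.≤-pred (ℕₚ.≤∧≢⇒< h p≢))
... | no p≢ | yes _ = trans (cong (𝟙 (¬? (suc z ∣? n)) *_) (free-0 z pp d (ℕₚ.≤-pred (ℕₚ.≤∧≢⇒< h p≢)))) (*-zeroʳ (𝟙 (¬? (suc z ∣? n))))

free-1 : ∀ z → free z 1 ≡ 1ℚ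
free-1 zero = refl
free-1 (suc z) with prime? (suc z)
... | no _ = free-1 z
... | yes pq = trans (cong₂ _*_ (𝟙-yes (¬? (suc z ∣? 1)) (λ d → ℕₚ.<-irrefl (sym (∣ₚ.∣1⇒≡1 d)) (prime≥2 pq))) (free-1 z)) refl

∑-divisors : ∀ {Y n} → 1 ℕ.≤ n → n ℕ.≤ Y → (h : ℕ → ℚ) → ∑ Y (λ m → 𝟙 (m ∣? n) * h m) ≡ ∑ n (λ m → 𝟙 (m ∣? n) * h m)
∑-divisors {Y} {n} 1≤n n≤Y h = ∑-extend n≤Y (λ m n<m _ → trans (cong (_* h m) (𝟙-no (m ∣? n) (λ d → ℕₚ.<⇒≱ n<m (∣ₚ.∣⇒≤ {{ℕ.>-nonZero 1≤n}} d)))) (*-zeroˡ (h m)))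

∑-divisors-* : ∀ {Y q n} → 1 ℕ.≤ q → 1 ℕ.≤ n → q ℕ.* n ℕ.≤ Y → (h : ℕ → ℚ) →
  ∑ Y (λ m → 𝟙 (q ∣? m) * (𝟙 (m ∣? q ℕ.* n) * h m)) ≡ ∑ Y (λ m → 𝟙 (m ∣? n) * h (q ℕ.* m))
∑-divisors-* {Y} {q} {n} 1≤q 1≤n qn≤Y h = trans (∑-multiples Y (λ m → 𝟙 (m ∣? q ℕ.* n) * h m) 1≤q)
  (trans (∑-cong (Y ÷ q) (λ m _ _ → cong (_* h (q ℕ.* m)) (𝟙-⇔ (q ℕ.* m ∣? q ℕ.* n) (m ∣? n) (∣ₚ.*-cancelˡ-∣ q {{ℕ.>-nonZero 1≤q}}) (∣ₚ.*-monoʳ-∣ q))))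
    (trans (∑-divisors 1≤n (÷-adj⁻ 1≤q qn≤Y) (λ m → h (q ℕ.* m))) (sym (∑-divisors 1≤n (ℕₚ.≤-trans (ℕₚ.m≤n*m n q {{ℕ.>-nonZero 1≤q}}) qn≤Y) (λ m → h (q ℕ.* m))))))

-- A new prime p removes the multiples of p: for n = pk the subtracted sum is `free z k`, which
-- equals `free z n` because p > z has not been sieved before.
∑-μ-free : ∀ z {Y n} → 1 ℕ.≤ n → n ℕ.≤ Y → ∑ Y (λ m → 𝟙 (m ∣? n) * μ z m) ≡ free z n
∑-μ-free zero {Y} {n} 1≤n n≤Y = trans (∑-cong Y (λ m _ _ → *-comm (𝟙 (m ∣? n)) (𝟙 (m ℕₚ.≟ 1)))) (trans (∑-𝟙 Y (λ m → 𝟙 (m ∣? n)) (s≤s z≤n) (ℕₚ.≤-trans 1≤n n≤Y)) (𝟙-yes (1 ∣? n) (∣ₚ.1∣ n)))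
∑-μ-free (suc z) {Y} {n} 1≤n n≤Y with prime? (suc z)
... | no _ = ∑-μ-free z 1≤n n≤Y
... | yes pq = trans (∑-cong Y (λ m _ _ → lem (𝟙 (m ∣? n)) (μ z m) (𝟙 (suc z ∣? m)) (μ z (m ÷ suc z))))
    (trans (∑-- Y (λ m → 𝟙 (m ∣? n) * μ z m) (λ m → 𝟙 (suc z ∣? m) * (𝟙 (m ∣? n) * μ z (m ÷ suc z))))
      (trans (cong (_- ∑ Y (λ m → 𝟙 (suc z ∣? m) * (𝟙 (m ∣? n) * μ z (m ÷ suc z)))) (∑-μ-free z 1≤n n≤Y)) (second (suc z ∣? n))))
  where
  lem : ∀ a b c e → a * (b - c * e) ≡ a * b - c * (a * e)
  lem = RS.solve-∀ ℚring
  second : (d? : Dec (suc z ∣ n)) → free z n - ∑ Y (λ m → 𝟙 (suc z ∣? m) * (𝟙 (m ∣? n) * μ z (m ÷ suc z))) ≡ 𝟙 (¬? d?) * free z n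
  second (no ¬d) = trans (cong (λ t → free z n - t) (∑-0 Y (λ m _ _ → zeroes m))) (lem2 (free z n))
    where
    lem2 : ∀ a → a - 0ℚ ≡ 1ℚ * a
    lem2 = RS.solve-∀ ℚring
    zeroes : ∀ m → 𝟙 (suc z ∣? m) * (𝟙 (m ∣? n) * μ z (m ÷ suc z)) ≡ 0ℚ
    zeroes m with suc z ∣? m | m ∣? n
    ... | no _ | w = *-zeroˡ (𝟙 w * μ z (m ÷ suc z))
    ... | yes a | yes b = ⊥-elim (¬d (∣ₚ.∣-trans a b))
    ... | yes a | no _ = trans (cong (1ℚ *_) (*-zeroˡ (μ z (m ÷ suc z)))) refl
  second (yes (divides k e)) = trans (cong₂ _-_ (trans (cong (free z) e') (free-* z pq (ℕₚ.n<1+n z))) s) (trans (ℚₚ.+-inverseʳ (free z k)) (sym (*-zeroˡ (free z n))))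
    where
    e' : n ≡ suc z ℕ.* k
    e' = trans e (ℕₚ.*-comm k (suc z))
    1≤k : 1 ℕ.≤ k
    1≤k = ℕₚ.n≢0⇒n>0 (λ { refl → ℕₚ.<⇒≢ 1≤n (sym e) })
    s : ∑ Y (λ m → 𝟙 (suc z ∣? m) * (𝟙 (m ∣? n) * μ z (m ÷ suc z))) ≡ free z k
    s = trans (∑-cong Y (λ m _ _ → cong (λ n → 𝟙 (suc z ∣? m) * (𝟙 (m ∣? n) * μ z (m ÷ suc z))) e'))
        (trans (∑-divisors-* (s≤s z≤n) 1≤k (subst (ℕ._≤ Y) e' n≤Y) (λ m → μ z (m ÷ suc z)))
          (trans (∑-cong Y (λ m _ _ → cong (λ t → 𝟙 (m ∣? k) * μ z t) (q*k÷q m (s≤s z≤n)))) (∑-μ-free z 1≤k (ℕₚ.≤-trans (subst (k ℕ.≤_) (sym e') (ℕₚ.m≤n*m k (suc z))) n≤Y))))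

∑-μ : ∀ {Y n} → 1 ℕ.≤ n → n ℕ.≤ Y → ∑ Y (λ m → 𝟙 (m ∣? n) * μ Y m) ≡ 𝟙 (n ℕₚ.≟ 1)
∑-μ {Y} {suc zero} 1≤n n≤Y = trans (∑-μ-free Y 1≤n n≤Y) (free-1 Y)
∑-μ {Y} {n@(suc (suc _))} 1≤n n≤Y with prime-divisor n (s≤s (s≤s z≤n))
... | p , pp , d = trans (∑-μ-free Y 1≤n n≤Y) (free-0 Y pp d (ℕₚ.≤-trans (∣ₚ.∣⇒≤ d) n≤Y))

n<2^n : ∀ n → n ℕ.< 2 ℕ.^ n
n<2^n zero = s≤s z≤n
n<2^n (suc n) = ℕₚ.≤-trans (ℕₚ.+-mono-≤ (ℕₚ.m^n>0 2 n) (n<2^n n)) (ℕₚ.+-monoʳ-≤ (2 ℕ.^ n) (ℕₚ.≤-reflexive (sym (ℕₚ.+-identityʳ (2 ℕ.^ n)))))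

∑-front : ∀ t f → ∑ (suc t) f ≡ f 1 + ∑ t (λ i → f (suc i))
∑-front zero f = +-comm 0ℚ (f 1)
∑-front (suc t) f = trans (cong (_+ f (suc (suc t))) (∑-front t f)) (+-assoc (f 1) _ _)

-- This is the multiplicity of q in n only for 1 ≤ n ≤ Y.
val : ℕ → ℕ → ℕ → ℚ
val Y q n = ∑ Y (λ k → 𝟙 (q ℕ.^ k ∣? n))

^-too-big : ∀ {q Y n} → 2 ℕ.≤ q → 1 ℕ.≤ n → n ℕ.≤ Y → ¬ (q ℕ.^ Y ∣ n)
^-too-big {q} {Y} 2≤q 1≤n n≤Y d = ℕₚ.<⇒≱ (n<2^n Y) (ℕₚ.≤-trans (ℕₚ.^-monoˡ-≤ Y 2≤q) (ℕₚ.≤-trans (∣ₚ.∣⇒≤ {{ℕ.>-nonZero 1≤n}} d) n≤Y))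

val-* : ∀ {Y r q n} → Prime r → Prime q → 1 ℕ.≤ n → n ℕ.≤ Y → val Y r (q ℕ.* n) ≡ 𝟙 (r ℕₚ.≟ q) + val Y r n
val-* {Y} {r} {q} {n} pr pq 1≤n n≤Y with r ℕₚ.≟ q
... | no r≢q = trans (∑-cong Y (λ k _ _ → 𝟙-⇔ (r ℕ.^ k ∣? q ℕ.* n) (r ℕ.^ k ∣? n)
        (λ d → C.coprime-divisor (C.sym (prime-coprime pq (λ h → r≢q (sym (prime∣prime pq pr (prime∣^ r k pq h)))))) d) (∣ₚ.∣n⇒∣m*n q))) (sym (+-identityˡ (val Y r n)))
... | yes refl = go Y n≤Y
  where
  go : ∀ Y → n ℕ.≤ Y → ∑ Y (λ k → 𝟙 (q ℕ.^ k ∣? q ℕ.* n)) ≡ 1ℚ + ∑ Y (λ k → 𝟙 (q ℕ.^ k ∣? n))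
  go zero h = ⊥-elim (ℕₚ.<⇒≱ 1≤n h)
  go (suc Y) h = trans (∑-front Y (λ k → 𝟙 (q ℕ.^ k ∣? q ℕ.* n)))
    (cong₂ _+_ (𝟙-yes (q ℕ.^ 1 ∣? q ℕ.* n) (subst (_∣ q ℕ.* n) (sym (ℕₚ.*-identityʳ q)) (∣ₚ.m∣m*n n)))
      (trans (∑-cong Y (λ k _ _ → 𝟙-⇔ (q ℕ.^ suc k ∣? q ℕ.* n) (q ℕ.^ k ∣? n) (∣ₚ.*-cancelˡ-∣ q {{prime⇒nonZero pq}}) (∣ₚ.*-monoʳ-∣ q)))
        (sym (trans (cong (∑ Y (λ k → 𝟙 (q ℕ.^ k ∣? n)) +_) (𝟙-no (q ℕ.^ suc Y ∣? n) (^-too-big (prime≥2 pq) 1≤n h))) (+-identityʳ _)))))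

val-extend : ∀ {q Y Z n} → 2 ℕ.≤ q → 1 ℕ.≤ n → n ℕ.≤ Y → Y ℕ.≤ Z → val Z q n ≡ val Y q n
val-extend {q} {n = n} 2≤q 1≤n n≤Y Y≤Z = ∑-extend Y≤Z (λ k Y<k _ → 𝟙-no (q ℕ.^ k ∣? n) (^-too-big 2≤q 1≤n (ℕₚ.≤-trans n≤Y (ℕₚ.<⇒≤ Y<k))))

hyperbola : ∀ {y Y} → y ℕ.≤ Y → (F g : ℕ → ℚ) →
  ∑ y (λ n → F n * ∑ Y (λ m → 𝟙 (m ∣? n) * g m)) ≡ ∑ y (λ m → g m * ∑ (y ÷ m) (λ k → F (m ℕ.* k)))
hyperbola {y} {Y} y≤Y F g = trans (∑-cong y (λ n 1≤n n≤y → trans (cong (F n *_) (trans (∑-divisors 1≤n (ℕₚ.≤-trans n≤y y≤Y) g) (sym (∑-divisors 1≤n n≤y g))))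
    (trans (sym (∑-*ˡ y (F n) (λ m → 𝟙 (m ∣? n) * g m))) (∑-cong y (λ m _ _ → lem (F n) (𝟙 (m ∣? n)) (g m))))))
  (trans (∑-swap y y (λ n m → g m * (𝟙 (m ∣? n) * F n)))
    (∑-cong y (λ m 1≤m _ → trans (∑-*ˡ y (g m) (λ n → 𝟙 (m ∣? n) * F n)) (cong (g m *_) (∑-multiples y F 1≤m)))))
  where
  lem : ∀ a b c → a * (b * c) ≡ c * (b * a)
  lem = RS.solve-∀ ℚring

-- Von Mangoldt's function and the estimates of Chebyshev and Mertens.

halve : ∀ y → ∃ λ z → y ≡ z ℕ.+ z ⊎ y ≡ suc (z ℕ.+ z)
halve zero = 0 , inj₁ refl
halve (suc y) with halve y
... | z , inj₁ e = z , inj₂ (cong suc e)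
... | z , inj₂ e = suc z , inj₁ (trans (cong suc e) (cong suc (sym (ℕₚ.+-suc z z))))

-- All arguments stay below Y, so that every sum over primes, exponents or divisors can have the
-- fixed range Y. The condition Y ≤ M keeps the accumulated error n/M of the logarithm at most 1.
module Mangoldt (Y M : ℕ) (1≤M : 1 ℕ.≤ M) (Y≤M : Y ℕ.≤ M) where
  open Log M 1≤M

  pw : ℕ → ℕ → ℚ
  pw q n = ∑ Y (λ k → 𝟙 (q ℕ.^ k ℕₚ.≟ n))

  P : ℕ → ℚ
  P q = 𝟙 (prime? q)

  -- von Mangoldt's function and its divisor sum, with lg in place of the logarithm;
  -- L is completely additive, so that L differs slightly from lg.
  Λ L : ℕ → ℚ
  Λ n = ∑ Y (λ q → P q * (lg q * pw q n))
  L n = ∑ Y (λ m → 𝟙 (m ∣? n) * Λ m)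

  0≤pw : ∀ q n → 0ℚ ≤ pw q n
  0≤pw q n = ∑-≥0 Y (λ k _ _ → 0≤𝟙 (q ℕ.^ k ℕₚ.≟ n))

  0≤Λ : ∀ n → 0ℚ ≤ Λ n
  0≤Λ n = ∑-≥0 Y (λ q 1≤q _ → *-≥0 (0≤𝟙 (prime? q)) (*-≥0 (0≤lg 1≤q) (0≤pw q n)))

  private
    inner : ∀ {a n} → 1 ℕ.≤ a → 1 ℕ.≤ n → n ℕ.≤ Y → ∑ Y (λ m → 𝟙 (m ∣? n) * 𝟙 (a ℕₚ.≟ m)) ≡ 𝟙 (a ∣? n)
    inner {a} {n} 1≤a 1≤n n≤Y with a ℕ.≤? Y
    ... | yes a≤Y = trans (∑-cong Y (λ m _ _ → trans (*-comm (𝟙 (m ∣? n)) (𝟙 (a ℕₚ.≟ m))) (cong (_* 𝟙 (m ∣? n)) (𝟙-⇔ (a ℕₚ.≟ m) (m ℕₚ.≟ a) sym sym)))) (∑-𝟙 Y (λ m → 𝟙 (m ∣? n)) 1≤a a≤Y)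
    ... | no a≰Y = trans (∑-0 Y (λ m _ m≤Y → trans (cong (𝟙 (m ∣? n) *_) (𝟙-no (a ℕₚ.≟ m) (λ { refl → a≰Y m≤Y }))) (*-zeroʳ (𝟙 (m ∣? n)))))
        (sym (𝟙-no (a ∣? n) (λ d → a≰Y (ℕₚ.≤-trans (∣ₚ.∣⇒≤ {{ℕ.>-nonZero 1≤n}} d) n≤Y))))

    L-val : ∀ {n} → 1 ℕ.≤ n → n ℕ.≤ Y → L n ≡ ∑ Y (λ q → P q * (lg q * val Y q n))
    L-val {n} 1≤n n≤Y = trans (∑-cong Y (λ m _ _ → sym (∑-*ˡ Y (𝟙 (m ∣? n)) (λ q → P q * (lg q * pw q m)))))
      (trans (∑-swap Y Y (λ m q → 𝟙 (m ∣? n) * (P q * (lg q * pw q m))))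
        (∑-cong Y (λ q 1≤q _ → trans (∑-cong Y (λ m _ _ → lem (𝟙 (m ∣? n)) (P q) (lg q) (pw q m)))
          (trans (∑-*ˡ Y (P q * lg q) (λ m → 𝟙 (m ∣? n) * pw q m)) (trans (*-assoc (P q) (lg q) _) (cong (λ t → P q * (lg q * t)) (swap q 1≤q)))))))
      where
      lem : ∀ a b c e → a * (b * (c * e)) ≡ b * c * (a * e)
      lem = RS.solve-∀ ℚring
      swap : ∀ q → 1 ℕ.≤ q → ∑ Y (λ m → 𝟙 (m ∣? n) * pw q m) ≡ val Y q n
      swap q 1≤q = trans (∑-cong Y (λ m _ _ → sym (∑-*ˡ Y (𝟙 (m ∣? n)) (λ k → 𝟙 (q ℕ.^ k ℕₚ.≟ m)))))
        (trans (∑-swap Y Y (λ m k → 𝟙 (m ∣? n) * 𝟙 (q ℕ.^ k ℕₚ.≟ m))) (∑-cong Y (λ k _ _ → inner (ℕₚ.m^n>0 q {{ℕ.>-nonZero 1≤q}} k) 1≤n n≤Y)))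

  L-* : ∀ {q n} → Prime q → 1 ℕ.≤ n → q ℕ.* n ℕ.≤ Y → L (q ℕ.* n) ≡ lg q + L n
  L-* {q} {n} pq 1≤n qn≤Y = trans (L-val (ℕₚ.*-mono-≤ (prime≥1 pq) 1≤n) qn≤Y)
    (trans (∑-cong Y (λ r _ _ → split r (prime? r)))
      (trans (∑-+ Y (λ r → 𝟙 (r ℕₚ.≟ q) * (P r * lg r)) (λ r → P r * (lg r * val Y r n)))
        (cong₂ _+_ (trans (∑-𝟙 Y (λ r → P r * lg r) (prime≥1 pq) (ℕₚ.≤-trans (ℕₚ.m≤m*n q n {{ℕ.>-nonZero 1≤n}}) qn≤Y)) (trans (cong (_* lg q) (𝟙-yes (prime? q) pq)) (*-identityˡ (lg q))))
          (sym (L-val 1≤n n≤Y)))))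
    where
    n≤Y = ℕₚ.≤-trans (ℕₚ.m≤n*m n q {{prime⇒nonZero pq}}) qn≤Y
    lem : ∀ a b c e → a * (b * (c + e)) ≡ c * (a * b) + a * (b * e)
    lem = RS.solve-∀ ℚring
    lem0 : ∀ a b c e → 0ℚ * a ≡ b * (0ℚ * c) + 0ℚ * e
    lem0 = RS.solve-∀ ℚring
    split : ∀ r (p? : Dec (Prime r)) → 𝟙 p? * (lg r * val Y r (q ℕ.* n)) ≡ 𝟙 (r ℕₚ.≟ q) * (𝟙 p? * lg r) + 𝟙 p? * (lg r * val Y r n)
    split r (yes pr) = trans (cong (λ t → 1ℚ * (lg r * t)) (val-* pr pq 1≤n n≤Y)) (lem 1ℚ (lg r) (𝟙 (r ℕₚ.≟ q)) (val Y r n))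
    split r (no _) = lem0 (lg r * val Y r (q ℕ.* n)) (𝟙 (r ℕₚ.≟ q)) (lg r) (lg r * val Y r n)

  L-1 : 1 ℕ.≤ Y → L 1 ≡ 0ℚ
  L-1 1≤Y = trans (L-val (s≤s z≤n) 1≤Y) (∑-0 Y (λ q _ _ → zeroes q (prime? q)))
    where
    zeroes : ∀ q (p? : Dec (Prime q)) → 𝟙 p? * (lg q * val Y q 1) ≡ 0ℚ
    zeroes q (no _) = *-zeroˡ (lg q * val Y q 1)
    zeroes q (yes pq) = trans (cong (λ t → 1ℚ * (lg q * t)) (∑-0 Y (λ { (suc k) _ _ → 𝟙-no (q ℕ.^ suc k ∣? 1) (λ d → ℕₚ.<-irrefl (sym (∣ₚ.∣1⇒≡1 (∣ₚ.m*n∣⇒m∣ q (q ℕ.^ k) d))) (prime≥2 pq)) })))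
      (trans (cong (1ℚ *_) (*-zeroʳ (lg q))) refl)

  L-additive : ∀ {m n} → 1 ℕ.≤ m → 1 ℕ.≤ n → m ℕ.* n ℕ.≤ Y → L (m ℕ.* n) ≡ L m + L n
  L-additive {m} {n} 1≤m 1≤n = prime-induction (λ m → m ℕ.* n ℕ.≤ Y → L (m ℕ.* n) ≡ L m + L n)
    (λ h → trans (cong L (ℕₚ.*-identityˡ n)) (sym (trans (cong (_+ L n) (L-1 (ℕₚ.≤-trans 1≤n (subst (ℕ._≤ Y) (ℕₚ.*-identityˡ n) h)))) (+-identityˡ (L n)))))
    step m 1≤m
    where
    step : ∀ q m → Prime q → 1 ℕ.≤ m → (m ℕ.* n ℕ.≤ Y → L (m ℕ.* n) ≡ L m + L n) → q ℕ.* m ℕ.* n ℕ.≤ Y → L (q ℕ.* m ℕ.* n) ≡ L (q ℕ.* m) + L n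
    step q m pq 1≤m ih h = trans (cong L (ℕₚ.*-assoc q m n)) (trans (L-* pq (ℕₚ.*-mono-≤ 1≤m 1≤n) h')
      (trans (cong (lg q +_) (ih (ℕₚ.≤-trans (ℕₚ.m≤n*m (m ℕ.* n) q {{prime⇒nonZero pq}}) h')))
        (trans (sym (+-assoc (lg q) (L m) (L n))) (cong (_+ L n) (sym (L-* pq 1≤m (ℕₚ.≤-trans (ℕₚ.m≤m*n (q ℕ.* m) n {{ℕ.>-nonZero 1≤n}}) h)))))))
      where
      h' : q ℕ.* (m ℕ.* n) ℕ.≤ Y
      h' = subst (ℕ._≤ Y) (ℕₚ.*-assoc q m n) h

  private
    n≤qn : ∀ {q} n → Prime q → n ℕ.≤ q ℕ.* n
    n≤qn n pq = ℕₚ.m≤n*m n _ {{prime⇒nonZero pq}}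

  L≤lg : ∀ {n} → 1 ℕ.≤ n → n ℕ.≤ Y → L n ≤ lg n
  L≤lg {n} 1≤n = prime-induction (λ n → n ℕ.≤ Y → L n ≤ lg n) (λ h → ≤-reflexive (trans (L-1 h) (sym lg-1)))
    (λ q n pq 1≤n ih h → ≤-trans (≤-reflexive (L-* pq 1≤n h)) (≤-trans (+ˡ (lg q) (ih (ℕₚ.≤-trans (n≤qn n pq) h))) (lg-super (prime≥1 pq) 1≤n))) n 1≤n

  -- Each prime factor costs one error 1/M, and n has at most n of them: the induction closes
  -- because 1 + n ≤ q n for q ≥ 2.
  lg≤L : ∀ {n} → 1 ℕ.≤ n → n ℕ.≤ Y → lg n ≤ L n + ι n * rec M
  lg≤L {n} 1≤n = prime-induction (λ n → n ℕ.≤ Y → lg n ≤ L n + ι n * rec M)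
    (λ h → ≤-trans (≤-reflexive (trans lg-1 (sym (L-1 h)))) (≤-+ (L 1) (*-≥0 (0≤ι 1) (0≤rec M))))
    (λ q n pq 1≤n ih h → ≤-trans (lg-sub (prime≥1 pq) 1≤n) (≤-trans (+ʳ (rec M) (+ˡ (lg q) (ih (ℕₚ.≤-trans (n≤qn n pq) h))))
      (≤-trans (≤-reflexive (trans (lem (lg q) (L n) (ι n) (rec M)) (cong₂ (λ a b → a + b * rec M) (sym (L-* pq 1≤n h)) (sym (ι-suc n)))))
        (+ˡ (L (q ℕ.* n)) (*-monoʳ (0≤rec M) (ι-mono (ℕₚ.≤-trans (ℕₚ.+-mono-≤ 1≤n (ℕₚ.≤-reflexive (sym (ℕₚ.+-identityʳ n)))) (ℕₚ.*-monoˡ-≤ n (prime≥2 pq))))))))) n 1≤n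
    where
    lem : ∀ a b c e → a + (b + c * e) + e ≡ a + b + (1ℚ + c) * e
    lem = RS.solve-∀ ℚring

  lg≤L+1 : ∀ {n} → 1 ℕ.≤ n → n ℕ.≤ Y → lg n ≤ L n + 1ℚ
  lg≤L+1 {n} 1≤n n≤Y = ≤-trans (lg≤L 1≤n n≤Y) (+ˡ (L n) (≤-trans (*-monoʳ (0≤rec M) (ι-mono (ℕₚ.≤-trans n≤Y Y≤M))) (≤-reflexive (trans (*-comm (ι M) (rec M)) (rec-ι 1≤M)))))

  0≤L : ∀ n → 0ℚ ≤ L n
  0≤L n = ∑-≥0 Y (λ m _ _ → *-≥0 (0≤𝟙 (m ∣? n)) (0≤Λ m))

  Λ≤lg : ∀ {n} → 1 ℕ.≤ n → n ℕ.≤ Y → Λ n ≤ lg n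
  Λ≤lg {n} 1≤n n≤Y = ≤-trans (≤-reflexive (sym (trans (cong (_* Λ n) (𝟙-yes (n ∣? n) ∣ₚ.∣-refl)) (*-identityˡ (Λ n)))))
    (≤-trans (term≤∑ Y {λ m → 𝟙 (m ∣? n) * Λ m} (λ m _ _ → *-≥0 (0≤𝟙 (m ∣? n)) (0≤Λ m)) 1≤n n≤Y) (L≤lg 1≤n n≤Y))

  ψ T V : ℕ → ℚ
  ψ y = ∑ y Λ
  T y = ∑ y L
  V y = ∑ y (λ n → Λ n * rec n)

  T-Λ : ∀ {y} → y ℕ.≤ Y → T y ≡ ∑ y (λ m → Λ m * ι (y ÷ m))
  T-Λ {y} y≤Y = trans (∑-cong y (λ n _ _ → sym (*-identityˡ (L n)))) (trans (hyperbola y≤Y (λ _ → 1ℚ) Λ)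
    (∑-cong y (λ m _ _ → cong (Λ m *_) (trans (∑-const (y ÷ m) 1ℚ) (*-identityʳ (ι (y ÷ m)))))))

  private
    -- T(2z) - 2 T(z) plays the role of the logarithm of the central binomial coefficient. The
    -- quotient of 2z by m is at least twice that of z by m, and it is at least 1 for z < m ≤ 2z.
    T-double≥ : ∀ {z} → z ℕ.+ z ℕ.≤ Y → ι 2 * T z + ∑ z (λ i → Λ (z ℕ.+ i)) ≤ T (z ℕ.+ z)
    T-double≥ {z} h = ≤-trans (+-mono-≤ (≤-trans (≤-reflexive (trans (cong (ι 2 *_) (T-Λ (ℕₚ.≤-trans (ℕₚ.m≤m+n z z) h))) (sym (∑-*ˡ z (ι 2) (λ m → Λ m * ι (z ÷ m))))))
        (∑-mono z (λ m 1≤m _ → ≤-trans (≤-reflexive (trans (lem (Λ m) (ι (z ÷ m))) (cong (Λ m *_) (sym (ι-+ (z ÷ m) (z ÷ m)))))) (*-monoˡ (0≤Λ m) (ι-mono (twice 1≤m))))))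
        (∑-mono z (λ i 1≤i i≤z → ≤-trans (≤-reflexive (sym (*-identityʳ (Λ (z ℕ.+ i))))) (*-monoˡ (0≤Λ (z ℕ.+ i)) (1≤ι (÷-adj⁻ (ℕₚ.≤-trans 1≤i (ℕₚ.m≤n+m i z)) (subst (ℕ._≤ z ℕ.+ z) (sym (ℕₚ.*-identityʳ (z ℕ.+ i))) (ℕₚ.+-monoʳ-≤ z i≤z))))))))
      (≤-reflexive (sym (trans (T-Λ h) (∑-split z z (λ m → Λ m * ι ((z ℕ.+ z) ÷ m))))))
      where
      lem : ∀ a b → ι 2 * (a * b) ≡ a * (b + b)
      lem = RS.solve-∀ ℚring
      twice : ∀ {m} → 1 ℕ.≤ m → z ÷ m ℕ.+ z ÷ m ℕ.≤ (z ℕ.+ z) ÷ m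
      twice {m} 1≤m = ÷-adj⁻ 1≤m (subst (ℕ._≤ z ℕ.+ z) (sym (ℕₚ.*-distribˡ-+ m (z ÷ m) (z ÷ m))) (ℕₚ.+-mono-≤ (÷-adj {z} {m} 1≤m ℕₚ.≤-refl) (÷-adj {z} {m} 1≤m ℕₚ.≤-refl)))

    lg-2 : lg 2 ≤ 1ℚ
    lg-2 = ≤-trans (lg-step≤ {1} (s≤s z≤n)) (≤-reflexive (trans (cong (_+ 1ℚ) lg-1) refl))

    -- The arguments 2j - 1 and 2j are compared with two copies of j: the even one costs log 2 ≤ 1,
    -- the odd one costs 2 because it is first raised to 2j. This makes 3 for each j.
    T-double≤ : ∀ z → z ℕ.+ z ℕ.≤ Y → T (z ℕ.+ z) ≤ ι 2 * T z + ι 3 * ι z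
    T-double≤ zero _ = ≤-refl
    T-double≤ (suc z) h = subst (λ t → T (suc t) ≤ ι 2 * T (suc z) + ι 3 * ι (suc z)) (sym (ℕₚ.+-suc z z)) (≤-trans (+-mono-≤ (+-mono-≤ (T-double≤ z (ℕₚ.≤-trans (ℕₚ.≤-trans (ℕₚ.n≤1+n _) (ℕₚ.n≤1+n _)) h')) odd) even)
        (≤-reflexive (trans (lem (T z) (ι z) (L (suc z))) (cong (λ t → ι 2 * T (suc z) + ι 3 * t) (sym (ι-suc z))))))
      where
      h' : suc (suc (z ℕ.+ z)) ℕ.≤ Y
      h' = subst (λ t → suc t ℕ.≤ Y) (ℕₚ.+-suc z z) h
      e : suc (suc (z ℕ.+ z)) ≡ 2 ℕ.* suc z
      e = trans (cong suc (sym (ℕₚ.+-suc z z))) (cong (suc z ℕ.+_) (sym (ℕₚ.+-identityʳ (suc z))))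
      even : L (suc (suc (z ℕ.+ z))) ≤ 1ℚ + L (suc z)
      even = ≤-trans (≤-reflexive (trans (cong L e) (L-* prime[2] (s≤s z≤n) (subst (ℕ._≤ Y) e h')))) (+ʳ (L (suc z)) lg-2)
      odd : L (suc (z ℕ.+ z)) ≤ 1ℚ + L (suc z) + 1ℚ
      odd = ≤-trans (L≤lg (s≤s z≤n) (ℕₚ.≤-trans (ℕₚ.n≤1+n _) h')) (≤-trans (lg-mono (ℕₚ.n≤1+n (suc (z ℕ.+ z)))) (≤-trans (lg≤L+1 (s≤s z≤n) h') (+ʳ 1ℚ even)))
      lem : ∀ t z l → ι 2 * t + ι 3 * z + (1ℚ + l + 1ℚ) + (1ℚ + l) ≡ ι 2 * (t + l) + ι 3 * (1ℚ + z)
      lem = RS.solve-∀ ℚring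

    ψ-double : ∀ z → z ℕ.+ z ℕ.≤ Y → ψ (z ℕ.+ z) ≤ ψ z + ι 3 * ι z
    ψ-double z h = ≤-trans (≤-reflexive (∑-split z z Λ)) (+ˡ (ψ z) (cancel (ι 2 * T z) _ (ι 3 * ι z) (≤-trans (T-double≥ {z} h) (T-double≤ z h))))
      where
      cancel : ∀ a b c → a + b ≤ a + c → b ≤ c
      cancel a b c h = ≤-trans (≤-reflexive (lem a b)) (≤-trans (+ˡ (- a) h) (≤-reflexive (sym (lem a c))))
        where
        lem : ∀ a b → b ≡ - a + (a + b)
        lem = RS.solve-∀ ℚring

  -- Halving y adds 3z. At y = 2z + 1 the crude bound Λ(y) ≤ y adds 2z + 1 more, and 5z + 3z + 2z +
  -- 1 ≤ 5(2z + 1) is what fixes the constant 5.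
  chebyshev : ∀ y → y ℕ.≤ Y → ψ y ≤ ι 5 * ι y
  chebyshev y = go (suc y) y (ℕₚ.n<1+n y)
    where
    go : ∀ fuel y → y ℕ.< fuel → y ℕ.≤ Y → ψ y ≤ ι 5 * ι y
    go (suc fuel) zero _ _ = ≤-refl
    go (suc fuel) y@(suc _) (s≤s y≤f) y≤Y with halve y
    ... | suc z , inj₁ refl = ≤-trans (ψ-double (suc z) y≤Y) (≤-trans (+ʳ (ι 3 * ι (suc z)) (go fuel (suc z) (ℕₚ.≤-trans (s≤s (subst (suc z ℕ.≤_) (sym (ℕₚ.+-suc z z)) (s≤s (ℕₚ.m≤m+n z z)))) y≤f) (ℕₚ.≤-trans (ℕₚ.m≤m+n (suc z) (suc z)) y≤Y)))
        (≤-by (*-≥0 (0≤ι 2) (0≤ι (suc z))) (trans (cong (ι 5 *_) (ι-+ (suc z) (suc z))) (lem (ι (suc z))))))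
      where
      lem : ∀ a → ι 5 * (a + a) ≡ ι 5 * a + ι 3 * a + ι 2 * a
      lem = RS.solve-∀ ℚring
    ... | z , inj₂ refl = ≤-trans (+-mono-≤ (≤-trans (ψ-double z y≤Y') (+ʳ (ι 3 * ι z) (go fuel z (ℕₚ.≤-trans (s≤s (ℕₚ.m≤m+n z z)) y≤f) (ℕₚ.≤-trans (ℕₚ.m≤m+n z z) y≤Y'))))
          (≤-trans (Λ≤lg (s≤s z≤n) y≤Y) (lg≤ι {suc (z ℕ.+ z)} (s≤s z≤n))))
        (≤-by (0≤ι 4) (trans (cong (ι 5 *_) ιy) (trans (lem (ι z)) (cong (λ t → ι 5 * ι z + ι 3 * ι z + t + ι 4) (sym ιy)))))
      where
      y≤Y' : z ℕ.+ z ℕ.≤ Y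
      y≤Y' = ℕₚ.≤-trans (ℕₚ.n≤1+n _) y≤Y
      ιy : ι (suc (z ℕ.+ z)) ≡ 1ℚ + (ι z + ι z)
      ιy = trans (ι-suc (z ℕ.+ z)) (cong (1ℚ +_) (ι-+ z z))
      lem : ∀ a → ι 5 * (1ℚ + (a + a)) ≡ ι 5 * a + ι 3 * a + (1ℚ + (a + a)) + ι 4
      lem = RS.solve-∀ ℚring

  -- Replacing the quotients `y ÷ m` in `T-Λ` by y/m costs at most ψ(y), so Chebyshev's constant is
  -- the error.
  mertens≤ : ∀ {y} → 1 ℕ.≤ y → y ℕ.≤ Y → V y ≤ lg y + ι 5
  mertens≤ {y} 1≤y y≤Y = *-cancelˡ (0<ι 1≤y) (≤-trans (≤-reflexive (sym (∑-*ˡ y (ι y) (λ n → Λ n * rec n))))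
    (≤-trans (∑-mono y (λ m 1≤m _ → ≤-trans (≤-reflexive (lem (ι y) (Λ m) (rec m))) (≤-trans (*-monoˡ (0≤Λ m) (floor m 1≤m)) (≤-reflexive (lem2 (Λ m) (ι (y ÷ m)))))))
      (≤-trans (≤-reflexive (trans (∑-+ y (λ m → Λ m * ι (y ÷ m)) Λ) (cong (_+ ψ y) (sym (T-Λ y≤Y)))))
        (≤-trans (+-mono-≤ (∑-≤-const y (λ n 1≤n n≤y → ≤-trans (L≤lg 1≤n (ℕₚ.≤-trans n≤y y≤Y)) (lg-mono n≤y))) (chebyshev y y≤Y)) (≤-reflexive (lem3 (ι y) (lg y)))))))
    where
    lem : ∀ a b c → a * (b * c) ≡ b * (a * c)
    lem = RS.solve-∀ ℚring
    lem2 : ∀ a b → a * (b + 1ℚ) ≡ a * b + a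
    lem2 = RS.solve-∀ ℚring
    lem3 : ∀ a b → a * b + ι 5 * a ≡ a * (b + ι 5)
    lem3 = RS.solve-∀ ℚring
    floor : ∀ m → 1 ℕ.≤ m → ι y * rec m ≤ ι (y ÷ m) + 1ℚ
    floor m 1≤m = *-cancelˡ (0<ι 1≤m) (≤-trans (≤-reflexive (trans (lem4 (ι m) (ι y) (rec m)) (trans (cong (ι y *_) (rec-ι 1≤m)) (*-identityʳ (ι y)))))
      (≤-trans (ι-mono (ℕₚ.<⇒≤ (ℕₚ.≰⇒> (λ h → ℕₚ.1+n≰n (÷-adj⁻ {y} {m} {suc (y ÷ m)} 1≤m h))))) (≤-reflexive (trans (ι-* m (suc (y ÷ m))) (cong (ι m *_) (trans (ι-suc (y ÷ m)) (+-comm 1ℚ (ι (y ÷ m)))))))))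
      where
      lem4 : ∀ a b c → a * (b * c) ≡ b * (c * a)
      lem4 = RS.solve-∀ ℚring

  -- One unit of the error is `lg≤L+1`, the other is `∑-lg-gap`.
  mertens≥ : ∀ {y} → 1 ℕ.≤ y → y ℕ.≤ Y → lg y ≤ V y + ι 2
  mertens≥ {y} 1≤y y≤Y = *-cancelˡ (0<ι 1≤y) (≤-trans lower (≤-trans (+ʳ (ι 2 * ι y) upper) (≤-reflexive (lem (V y) (ι y)))))
    where
    lem : ∀ a b → b * a + ι 2 * b ≡ b * (a + ι 2)
    lem = RS.solve-∀ ℚring
    upper : T y ≤ ι y * V y
    upper = ≤-trans (≤-reflexive (T-Λ y≤Y)) (≤-trans (∑-mono y (λ m 1≤m _ → ≤-trans (*-monoˡ (0≤Λ m) (floor m 1≤m)) (≤-reflexive (lem2 (Λ m) (ι y) (rec m))))) (≤-reflexive (∑-*ˡ y (ι y) (λ n → Λ n * rec n))))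
      where
      lem2 : ∀ a b c → a * (b * c) ≡ b * (a * c)
      lem2 = RS.solve-∀ ℚring
      floor : ∀ m → 1 ℕ.≤ m → ι (y ÷ m) ≤ ι y * rec m
      floor m 1≤m = *-cancelˡ (0<ι 1≤m) (≤-trans (≤-trans (≤-reflexive (sym (ι-* m (y ÷ m)))) (ι-mono (÷-adj {y} {m} 1≤m ℕₚ.≤-refl)))
        (≤-reflexive (sym (trans (lem4 (ι m) (ι y) (rec m)) (trans (cong (ι y *_) (rec-ι 1≤m)) (*-identityʳ (ι y)))))))
        where
        lem4 : ∀ a b c → a * (b * c) ≡ b * (c * a)
        lem4 = RS.solve-∀ ℚring
    lower : ι y * lg y ≤ T y + ι 2 * ι y
    lower = ≤-trans (≤-reflexive (sym (∑-const y (lg y)))) (≤-trans (∑-mono y (λ n 1≤n n≤y → ≤-trans (≤-reflexive (lem3 (lg y) (lg n))) (+ʳ (lg y - lg n) (lg≤L+1 1≤n (ℕₚ.≤-trans n≤y y≤Y)))))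
      (≤-trans (≤-reflexive (trans (∑-+ y (λ n → L n + 1ℚ) (λ n → lg y - lg n)) (cong (_+ ∑ y (λ n → lg y - lg n)) (trans (∑-+ y L (λ _ → 1ℚ)) (cong (T y +_) (trans (∑-const y 1ℚ) (*-identityʳ (ι y))))))))
        (≤-trans (+ˡ (T y + ι y) (∑-lg-gap 1≤y)) (≤-reflexive (lem5 (T y) (ι y))))))
      where
      lem3 : ∀ a b → a ≡ b + (a - b)
      lem3 = RS.solve-∀ ℚring
      lem5 : ∀ t a → t + a + a ≡ t + ι 2 * a
      lem5 = RS.solve-∀ ℚring

-- The Selberg-type identity for oscillating functions.

module Bilinear (Y M : ℕ) (1≤M : 1 ℕ.≤ M) (Y≤M : Y ℕ.≤ M) (d : ℕ) (1≤d : 1 ℕ.≤ d) where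
  open Log M 1≤M
  open Mangoldt Y M 1≤M Y≤M

  -- (log j)/j is the difference of (log j + 1)/j and 1/j, both decreasing, and Abel summation gives
  -- d B for each. The last B pays for `L - lg`, which is at most j/M in absolute value.
  osc-L : ∀ {B f} → Osc d B f → ∀ {y} → y ℕ.≤ Y → ∣ ∑ y (λ j → f j * rec j * L j) ∣ ≤ ι d * B + ι d * B + B
  osc-L {B} {f} o {y} y≤Y = ≤-trans (≤-reflexive (cong ∣_∣ (trans (∑-cong y (λ j _ _ → lem (f j) (rec j) (L j) (lg j)))
      (trans (∑-+ y (λ j → f j * ((lg j + 1ℚ) * rec j) + - (f j * rec j)) (λ j → f j * rec j * (L j - lg j)))
        (cong (_+ ∑ y (λ j → f j * rec j * (L j - lg j))) (trans (∑-+ y (λ j → f j * ((lg j + 1ℚ) * rec j)) (λ j → - (f j * rec j))) (cong (∑ y (λ j → f j * ((lg j + 1ℚ) * rec j)) +_) (∑-neg y (λ j → f j * rec j)))))))))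
    (∣+∣≤ (∣+∣≤ (≤-trans (abel y f (λ j → (lg j + 1ℚ) * rec j) (interval≤ o 1≤d 0) (λ j 1≤j → *-≥0 (+-≥0 (0≤lg 1≤j) 0≤1) (0≤rec j)) (λ j 1≤j → lg/-anti 1≤j))
        (≤-reflexive (trans (cong (λ t → ι d * B * ((t + 1ℚ) * 1ℚ)) lg-1) (*-identityʳ (ι d * B)))))
        (≤-trans (≤-reflexive (ℚₚ.∣-p∣≡∣p∣ (∑ y (λ j → f j * rec j)))) (≤-trans (osc-tail o 1≤d 0 y) (≤-reflexive (*-identityʳ (ι d * B))))))
      (≤-trans (∣∑∣≤ y (λ j 1≤j j≤y → err j 1≤j (ℕₚ.≤-trans j≤y y≤Y))) (≤-trans (≤-reflexive (∑-const y (B * rec M)))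
        (≤-trans (*-monoʳ (*-≥0 (0≤B o) (0≤rec M)) (ι-mono (ℕₚ.≤-trans y≤Y Y≤M))) (≤-reflexive (trans (lem2 (ι M) B (rec M)) (trans (cong (B *_) (rec-ι 1≤M)) (*-identityʳ B))))))))
    where
    lem : ∀ a r l g → a * r * l ≡ a * ((g + 1ℚ) * r) + - (a * r) + a * r * (l - g)
    lem = RS.solve-∀ ℚring
    lem2 : ∀ m b r → m * (b * r) ≡ b * (r * m)
    lem2 = RS.solve-∀ ℚring
    err : ∀ j → 1 ℕ.≤ j → j ℕ.≤ Y → ∣ f j * rec j * (L j - lg j) ∣ ≤ B * rec M
    err j 1≤j j≤Y = ≤-trans (∣*∣≤ (∣*∣≤ (bounded o j) (≤-reflexive (ℚₚ.0≤p⇒∣p∣≡p (0≤rec j)))) (∣∣-intro {L j - lg j} {ι j * rec M}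
        (≤-by (diff≥0 (lg≤L 1≤j j≤Y)) (lem3 (L j) (lg j) (ι j * rec M))) (≤-by (+-≥0 (diff≥0 (L≤lg 1≤j j≤Y)) (*-≥0 (0≤ι j) (0≤rec M))) (lem4 (L j) (lg j) (ι j * rec M)))))
      (≤-reflexive (trans (lem5 B (rec j) (ι j) (rec M)) (trans (cong (λ t → B * rec M * t) (rec-ι 1≤j)) (*-identityʳ (B * rec M)))))
      where
      lem3 : ∀ a b c → a - b ≡ - c + (a + c - b)
      lem3 = RS.solve-∀ ℚring
      lem4 : ∀ a b c → c ≡ a - b + (b - a + c)
      lem4 = RS.solve-∀ ℚring
      lem5 : ∀ a b c e → a * b * (c * e) ≡ a * e * (b * c)
      lem5 = RS.solve-∀ ℚring

  -- The multiplicative convolution of f with the prime weight Λ(n)/n up to y. It oscillates again,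
  -- so Möbius inversion at scale x can be applied to it; that produces the product of two prime
  -- sums.
  smear : (ℕ → ℚ) → ℕ → ℕ → ℚ
  smear f y u = ∑ y (λ n → Λ n * rec n * f (u ℕ.* n))

  0≤Λr : ∀ n → 0ℚ ≤ Λ n * rec n
  0≤Λr n = *-≥0 (0≤Λ n) (0≤rec n)

  smear-osc : ∀ {B f} → Osc d B f → ∀ y → Osc d (V y * B) (smear f y)
  smear-osc {B} {f} o y .periodic u = ∑-cong y (λ n _ _ → cong (Λ n * rec n *_) (trans (cong f (trans (ℕₚ.*-distribʳ-+ n d u) (cong (ℕ._+ u ℕ.* n) (ℕₚ.*-comm d n)))) (periodic* o n (u ℕ.* n))))
  smear-osc {B} {f} o y .mean-0 u = trans (∑-swap d y (λ i n → Λ n * rec n * f (u ℕ.* i ℕ.* n))) (∑-0 y (λ n _ _ →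
    trans (∑-*ˡ d (Λ n * rec n) (λ i → f (u ℕ.* i ℕ.* n))) (trans (cong (Λ n * rec n *_) (trans (∑-cong d (λ i _ _ → cong f (trans (ℕₚ.*-comm (u ℕ.* i) n) (sym (ℕₚ.*-assoc n u i))))) (mean-0 o (n ℕ.* u)))) (*-zeroʳ (Λ n * rec n)))))
  smear-osc {B} {f} o y .bounded u = ≤-trans (∣∑∣≤ y (λ n _ _ → ∣*∣≤ (≤-reflexive (ℚₚ.0≤p⇒∣p∣≡p (0≤Λr n))) (bounded o (u ℕ.* n)))) (≤-reflexive (∑-*ʳ y B (λ n → Λ n * rec n)))

  -- 2d + 1 from `osc-L` and 5d from the tail in `smear-sum`, with Chebyshev's 5.
  Z : ℚ
  Z = ι 7 * ι d + 1ℚ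

  -- This is the sum of Λ(n) f(nk)/(nk) over the square n, k ≤ y. The part nk ≤ y collapses to Σ
  -- f(j) L(j)/j, bounded by `osc-L`. For fixed n the rest is an oscillating tail of size d B n/y,
  -- and the factors Λ(n)/n turn the total into d B ψ(y)/y. The bound is thus independent of y,
  -- although `smear` itself may grow like log y.
  smear-sum : ∀ {B f} → Osc d B f → ∀ {y} → 1 ℕ.≤ y → y ℕ.≤ Y → ∣ ∑ y (λ k → smear f y k * rec k) ∣ ≤ Z * B
  smear-sum {B} {f} o {y} 1≤y y≤Y = ≤-trans (≤-reflexive (cong ∣_∣ rearrange)) (≤-trans (∣+∣≤ (osc-L o y≤Y) cut) (≤-reflexive (lem (ι d) B)))
    where
    lem : ∀ a b → a * b + a * b + b + a * b * ι 5 ≡ (ι 7 * a + 1ℚ) * b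
    lem = RS.solve-∀ ℚring
    S : ℕ → ℕ → ℚ
    S n t = ∑ t (λ k → f (n ℕ.* k) * rec k)
    rearrange : ∑ y (λ k → smear f y k * rec k) ≡ ∑ y (λ j → f j * rec j * L j) + ∑ y (λ n → Λ n * rec n * (S n y - S n (y ÷ n)))
    rearrange = trans (∑-cong y (λ k _ _ → sym (∑-*ʳ y (rec k) (λ n → Λ n * rec n * f (k ℕ.* n)))))
      (trans (∑-swap y y (λ k n → Λ n * rec n * f (k ℕ.* n) * rec k))
        (trans (∑-cong y (λ n _ _ → trans (∑-cong y (λ k _ _ → trans (*-assoc (Λ n * rec n) (f (k ℕ.* n)) (rec k)) (cong (λ t → Λ n * rec n * (f t * rec k)) (ℕₚ.*-comm k n)))) (trans (∑-*ˡ y (Λ n * rec n) (λ k → f (n ℕ.* k) * rec k)) (lem2 (Λ n * rec n) (S n y) (S n (y ÷ n))))))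
          (trans (∑-+ y (λ n → Λ n * rec n * S n (y ÷ n)) (λ n → Λ n * rec n * (S n y - S n (y ÷ n)))) (cong (_+ ∑ y (λ n → Λ n * rec n * (S n y - S n (y ÷ n))))
            (trans (∑-cong y (λ n _ _ → trans (*-assoc (Λ n) (rec n) _) (cong (Λ n *_) (trans (sym (∑-*ˡ (y ÷ n) (rec n) (λ k → f (n ℕ.* k) * rec k))) (∑-cong (y ÷ n) (λ k _ _ → trans (lem3 (rec n) (f (n ℕ.* k)) (rec k)) (cong (f (n ℕ.* k) *_) (sym (rec-* n k)))))))))
              (sym (hyperbola y≤Y (λ j → f j * rec j) Λ)))))))
      where
      lem2 : ∀ a b c → a * b ≡ a * c + a * (b - c)
      lem2 = RS.solve-∀ ℚring
      lem3 : ∀ a b c → a * (b * c) ≡ b * (a * c)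
      lem3 = RS.solve-∀ ℚring
    cut : ∣ ∑ y (λ n → Λ n * rec n * (S n y - S n (y ÷ n))) ∣ ≤ ι d * B * ι 5
    cut = ≤-trans (∣∑∣≤ y {g = λ n → Λ n * (ι d * B * rec y)} (λ n 1≤n _ → ≤-trans (∣*∣≤ (≤-reflexive (ℚₚ.0≤p⇒∣p∣≡p (0≤Λr n))) (osc-cut (dilate o n) 1≤d 1≤n 1≤y ℕₚ.≤-refl))
        (≤-reflexive (trans (lem4 (Λ n) (rec n) (ι d * B) (ι n) (rec y)) (trans (cong (Λ n * (ι d * B * rec y) *_) (rec-ι 1≤n)) (*-identityʳ (Λ n * (ι d * B * rec y))))))))
      (≤-trans (≤-reflexive (∑-*ʳ y (ι d * B * rec y) Λ)) (≤-trans (*-monoʳ (*-≥0 (*-≥0 (0≤ι d) (0≤B o)) (0≤rec y)) (chebyshev y y≤Y))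
        (≤-reflexive (trans (lem5 (ι y) (ι d * B) (rec y)) (trans (cong (ι d * B * ι 5 *_) (rec-ι 1≤y)) (*-identityʳ (ι d * B * ι 5)))))))
      where
      lem4 : ∀ a b c e g → a * b * (c * (e * g)) ≡ a * (c * g) * (b * e)
      lem4 = RS.solve-∀ ℚring
      lem5 : ∀ a b c → ι 5 * a * (b * c) ≡ b * ι 5 * (c * a)
      lem5 = RS.solve-∀ ℚring

  private
    μY : ℕ → ℚ
    μY = μ Y

    at-1 : ∀ {x} → 1 ℕ.≤ x → x ℕ.≤ Y → (G : ℕ → ℚ) → G 1 ≡ ∑ x (λ m → μY m * ∑ (x ÷ m) (λ k → G (m ℕ.* k)))
    at-1 {x} 1≤x x≤Y G = trans (sym (trans (∑-cong x (λ n _ _ → *-comm (G n) (𝟙 (n ℕₚ.≟ 1)))) (∑-𝟙 x G (s≤s z≤n) 1≤x)))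
      (trans (∑-cong x (λ n 1≤n n≤x → cong (G n *_) (sym (∑-μ 1≤n (ℕₚ.≤-trans n≤x x≤Y))))) (hyperbola x≤Y G μY))

    -- The identity Λ = μ ∗ L in summed form. `G j` is expanded by `at-1` along the multiples of j,
    -- after which the sums over j and k recombine by L = 1 ∗ Λ.
    convolve : ∀ {x} → x ℕ.≤ Y → (G : ℕ → ℚ) → ∑ x (λ j → Λ j * G j) ≡ ∑ x (λ m → μY m * ∑ (x ÷ m) (λ k → G (m ℕ.* k) * L k))
    convolve {x} x≤Y G = trans (∑-cong x (λ j 1≤j j≤x → cong (Λ j *_) (expand j 1≤j j≤x)))
      (trans (∑-cong x (λ j _ _ → trans (sym (∑-*ˡ x (Λ j) _)) (∑-cong x (λ m _ _ → lem (Λ j) (μY m) _))))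
        (trans (∑-swap x x (λ j m → μY m * (Λ j * ∑ (x ÷ j ÷ m) (λ k → G (j ℕ.* (m ℕ.* k))))))
          (∑-cong x (λ m 1≤m m≤x → trans (∑-*ˡ x (μY m) (λ j → Λ j * ∑ (x ÷ j ÷ m) (λ k → G (j ℕ.* (m ℕ.* k))))) (cong (μY m *_) (collect m 1≤m))))))
      where
      lem : ∀ a b c → a * (b * c) ≡ b * (a * c)
      lem = RS.solve-∀ ℚring
      expand : ∀ j → 1 ℕ.≤ j → j ℕ.≤ x → G j ≡ ∑ x (λ m → μY m * ∑ (x ÷ j ÷ m) (λ k → G (j ℕ.* (m ℕ.* k))))
      expand j 1≤j j≤x = trans (cong G (sym (ℕₚ.*-identityʳ j))) (trans (at-1 (÷-adj⁻ 1≤j (subst (ℕ._≤ x) (sym (ℕₚ.*-identityʳ j)) j≤x)) (ℕₚ.≤-trans (÷≤ x j) x≤Y) (λ i → G (j ℕ.* i)))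
        (sym (∑-extend (÷≤ x j) (λ m h _ → trans (cong (λ t → μY m * ∑ t (λ k → G (j ℕ.* (m ℕ.* k)))) (÷-small h)) (*-zeroʳ (μY m))))))
      collect : ∀ m → 1 ℕ.≤ m → ∑ x (λ j → Λ j * ∑ (x ÷ j ÷ m) (λ k → G (j ℕ.* (m ℕ.* k)))) ≡ ∑ (x ÷ m) (λ k → G (m ℕ.* k) * L k)
      collect m 1≤m = trans (∑-cong x (λ j 1≤j _ → cong (Λ j *_) (trans (cong (λ t → ∑ t (λ k → G (j ℕ.* (m ℕ.* k)))) (trans (÷÷ x 1≤j 1≤m) (trans (cong (x ÷_) (ℕₚ.*-comm j m)) (sym (÷÷ x 1≤m 1≤j)))))
            (∑-cong (x ÷ m ÷ j) (λ k _ _ → cong G (trans (sym (ℕₚ.*-assoc j m k)) (trans (cong (ℕ._* k) (ℕₚ.*-comm j m)) (ℕₚ.*-assoc m j k))))))))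
        (trans (∑-extend (÷≤ x m) (λ j h _ → trans (cong (λ t → Λ j * ∑ t (λ k → G (m ℕ.* (j ℕ.* k)))) (÷-small h)) (*-zeroʳ (Λ j))))
          (sym (hyperbola (ℕₚ.≤-trans (÷≤ x m) x≤Y) (λ n → G (m ℕ.* n)) Λ)))

  -- Möbius inversion: the sum over n ≤ x of f(n)/n Σ_{m|n} μ(m)(lg x - L(m)).
  inversion : ∀ {x} → 1 ℕ.≤ x → x ℕ.≤ Y → (f : ℕ → ℚ) →
    lg x * f 1 + ∑ x (λ n → Λ n * rec n * f n) ≡ ∑ x (λ m → μY m * ((lg x - L m) * (rec m * ∑ (x ÷ m) (λ k → f (m ℕ.* k) * rec k))))
  inversion {x} 1≤x x≤Y f = trans (cong₂ _+_ e₁ e₂) (trans (sym (∑-+ x (λ m → μY m * A m) (λ m → μY m * C m))) (∑-cong x (λ m 1≤m m≤x → trans (sym (*-distribˡ-+ (μY m) (A m) (C m))) (cong (μY m *_) (inner m 1≤m m≤x)))))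
    where
    F : ℕ → ℚ
    F n = f n * rec n
    A C : ℕ → ℚ
    A m = ∑ (x ÷ m) (λ k → (lg x - L (m ℕ.* k)) * F (m ℕ.* k))
    C m = ∑ (x ÷ m) (λ k → F (m ℕ.* k) * L k)
    e₁ : lg x * f 1 ≡ ∑ x (λ m → μY m * A m)
    e₁ = trans (sym (trans (cong (λ t → (lg x - t) * F 1) (L-1 (ℕₚ.≤-trans 1≤x x≤Y))) (lem (lg x) (f 1)))) (at-1 1≤x x≤Y (λ n → (lg x - L n) * F n))
      where
      lem : ∀ a b → (a - 0ℚ) * (b * 1ℚ) ≡ a * b
      lem = RS.solve-∀ ℚring
    e₂ : ∑ x (λ n → Λ n * rec n * f n) ≡ ∑ x (λ m → μY m * C m)
    e₂ = trans (∑-cong x (λ n _ _ → lem (Λ n) (rec n) (f n))) (convolve x≤Y F)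
      where
      lem : ∀ a b c → a * b * c ≡ a * (c * b)
      lem = RS.solve-∀ ℚring
    inner : ∀ m → 1 ℕ.≤ m → m ℕ.≤ x → A m + C m ≡ (lg x - L m) * (rec m * ∑ (x ÷ m) (λ k → f (m ℕ.* k) * rec k))
    inner m 1≤m m≤x = trans (sym (∑-+ (x ÷ m) _ _)) (trans (∑-cong (x ÷ m) (λ k 1≤k k≤ → trans (cong₂ (λ a b → (lg x - a) * (f (m ℕ.* k) * b) + f (m ℕ.* k) * b * L k) (L-additive 1≤m 1≤k (ℕₚ.≤-trans (÷-adj 1≤m k≤) x≤Y)) (rec-* m k))
        (lem (lg x) (L m) (L k) (f (m ℕ.* k)) (rec m) (rec k))))
      (trans (∑-*ˡ (x ÷ m) ((lg x - L m) * rec m) (λ k → f (m ℕ.* k) * rec k)) (*-assoc (lg x - L m) (rec m) _)))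
      where
      lem : ∀ a b c e g h → (a - (b + c)) * (e * (g * h)) + e * (g * h) * c ≡ (a - b) * g * (e * h)
      lem = RS.solve-∀ ℚring

  -- Each inner sum is the sum up to N, at most C, minus an oscillating tail d B m/x. The tails have
  -- total weight Σ (lg x - lg m + 1)/x ≤ 2. The C-part is estimated trivially and is large in x,
  -- but for a smeared f it does not grow with y: this is why y has to be much larger than x.
  inversion-bound : ∀ {B C f} → Osc d B f → ∀ {x N} → 1 ℕ.≤ x → x ℕ.≤ Y → x ℕ.≤ N → (∀ m → ∣ ∑ N (λ k → f (m ℕ.* k) * rec k) ∣ ≤ C) →
    ∣ lg x * f 1 + ∑ x (λ n → Λ n * rec n * f n) ∣ ≤ ι x * (lg x * C) + ι 2 * (ι d * B)
  inversion-bound {B} {C} {f} o {x} {N} 1≤x x≤Y x≤N hC = ≤-trans (≤-reflexive (cong ∣_∣ (inversion 1≤x x≤Y f)))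
    (≤-trans (∣∑∣≤ x {g = λ m → lg x * C + (lg x - lg m + 1ℚ) * (ι d * B * rec x)} (λ m 1≤m m≤x → term m 1≤m m≤x))
      (≤-trans (≤-reflexive (trans (∑-+ x (λ _ → lg x * C) (λ m → (lg x - lg m + 1ℚ) * (ι d * B * rec x))) (cong₂ _+_ (∑-const x (lg x * C)) (∑-*ʳ x (ι d * B * rec x) (λ m → lg x - lg m + 1ℚ)))))
        (+ˡ (ι x * (lg x * C)) (≤-trans (*-monoʳ 0≤dBr (≤-trans (≤-reflexive (trans (∑-+ x (λ m → lg x - lg m) (λ _ → 1ℚ)) (cong (∑ x (λ m → lg x - lg m) +_) (trans (∑-const x 1ℚ) (*-identityʳ (ι x)))))) (+ʳ (ι x) (∑-lg-gap 1≤x))))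
          (≤-reflexive (trans (lem (ι x) (ι d * B) (rec x)) (trans (cong (ι 2 * (ι d * B) *_) (rec-ι 1≤x)) (*-identityʳ (ι 2 * (ι d * B))))))))))
    where
    0≤C : 0ℚ ≤ C
    0≤C = ≤-trans (ℚₚ.0≤∣p∣ (∑ N (λ k → f (0 ℕ.* k) * rec k))) (hC 0)
    0≤dBr : 0ℚ ≤ ι d * B * rec x
    0≤dBr = *-≥0 (*-≥0 (0≤ι d) (0≤B o)) (0≤rec x)
    lem : ∀ a b c → (a + a) * (b * c) ≡ ι 2 * b * (c * a)
    lem = RS.solve-∀ ℚring
    term : ∀ m → 1 ℕ.≤ m → m ℕ.≤ x → ∣ μY m * ((lg x - L m) * (rec m * ∑ (x ÷ m) (λ k → f (m ℕ.* k) * rec k))) ∣ ≤ lg x * C + (lg x - lg m + 1ℚ) * (ι d * B * rec x)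
    term m 1≤m m≤x = ≤-trans (∣*∣≤ (∣μ∣≤1 Y m) (∣*∣≤ (≤-reflexive (ℚₚ.0≤p⇒∣p∣≡p 0≤w)) (∣*∣≤ (≤-reflexive (ℚₚ.0≤p⇒∣p∣≡p (0≤rec m))) inner)))
      (≤-trans (≤-reflexive (trans (lem1 (lg x - L m) (rec m) C (ι d * B) (ι m) (rec x)) (cong (λ t → (lg x - L m) * (rec m * C) + (lg x - L m) * (ι d * B * rec x * t)) (rec-ι 1≤m))))
        (+-mono-≤ (*-mono 0≤w (*-≥0 (0≤rec m) 0≤C) (≤-by (0≤L m) (lem2 (lg x) (L m))) (≤-trans (*-monoʳ 0≤C (rec≤1 m)) (≤-reflexive (*-identityˡ C))))
          (≤-trans (≤-reflexive (cong ((lg x - L m) *_) (*-identityʳ (ι d * B * rec x)))) (*-monoʳ 0≤dBr (≤-by {lg x - L m} {lg x - lg m + 1ℚ} (diff≥0 (lg≤L+1 1≤m (ℕₚ.≤-trans m≤x x≤Y))) (lem3 (lg x) (L m) (lg m)))))))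
      where
      0≤w : 0ℚ ≤ lg x - L m
      0≤w = diff≥0 (≤-trans (L≤lg 1≤m (ℕₚ.≤-trans m≤x x≤Y)) (lg-mono m≤x))
      lem1 : ∀ w r c b i s → 1ℚ * (w * (r * (c + b * (i * s)))) ≡ w * (r * c) + w * (b * s * (r * i))
      lem1 = RS.solve-∀ ℚring
      lem2 : ∀ a b → a ≡ a - b + b
      lem2 = RS.solve-∀ ℚring
      lem3 : ∀ a b c → a - c + 1ℚ ≡ a - b + (b + 1ℚ - c)
      lem3 = RS.solve-∀ ℚring
      inner : ∣ ∑ (x ÷ m) (λ k → f (m ℕ.* k) * rec k) ∣ ≤ C + ι d * B * (ι m * rec x)
      inner = ≤-trans (≤-reflexive (cong ∣_∣ (lem4 (∑ (x ÷ m) (λ k → f (m ℕ.* k) * rec k)) (∑ N (λ k → f (m ℕ.* k) * rec k)))))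
        (∣+∣≤ (hC m) (≤-trans (≤-reflexive (ℚₚ.∣-p∣≡∣p∣ (∑ N (λ k → f (m ℕ.* k) * rec k) - ∑ (x ÷ m) (λ k → f (m ℕ.* k) * rec k)))) (osc-cut (dilate o m) 1≤d 1≤m 1≤x x≤N)))
        where
        lem4 : ∀ a b → a ≡ b + - (b - a)
        lem4 = RS.solve-∀ ℚring

  -- At two scales x ≤ y, the prime density V_f(y) satisfies lg(x) V_f(y) ≈ - (V(x) ∗ V(y))_f.
  bilinear : ∀ {f} → Osc d 1ℚ f → ∀ {x y} → 1 ℕ.≤ x → x ℕ.≤ y → y ℕ.≤ Y →
    ∣ lg x * smear f y 1 + ∑ x (λ n → Λ n * rec n * smear f y n) ∣ ≤ ι x * (lg x * Z) + ι 2 * (ι d * V y)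
  bilinear {f} o {x} {y} 1≤x x≤y y≤Y = ≤-trans (inversion-bound (smear-osc o y) 1≤x (ℕₚ.≤-trans x≤y y≤Y) x≤y hyp)
      (≤-reflexive (cong (λ t → ι x * (lg x * Z) + ι 2 * (ι d * t)) (*-identityʳ (V y))))
    where
    hyp : ∀ m → ∣ ∑ y (λ k → smear f y (m ℕ.* k) * rec k) ∣ ≤ Z
    hyp m = ≤-trans (≤-reflexive (cong ∣_∣ (∑-cong y (λ k _ _ → cong (_* rec k) (∑-cong y (λ n _ _ → cong (λ t → Λ n * rec n * f t) (ℕₚ.*-assoc m k n)))))))
      (≤-trans (smear-sum (dilate o m) (ℕₚ.≤-trans 1≤x x≤y) y≤Y) (≤-reflexive (*-identityʳ Z)))

-- Prime powers and small primes are negligible.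

geometric : ∀ r K → 1 ℕ.≤ r → ∑ K (λ k → rec (suc r ℕ.^ k)) ≤ rec r
geometric r K 1≤r = ≤-by (*-≥0 (0≤rec r) (0≤rec (suc r ℕ.^ K))) (sym (exact K))
  where
  step : rec (suc r) + rec r * rec (suc r) ≡ rec r
  step = trans (cong (rec (suc r) +_) (sym (rec-diff 1≤r))) (lem (rec (suc r)) (rec r))
    where
    lem : ∀ a b → a + (b - a) ≡ b
    lem = RS.solve-∀ ℚring
  exact : ∀ K → ∑ K (λ k → rec (suc r ℕ.^ k)) + rec r * rec (suc r ℕ.^ K) ≡ rec r
  exact zero = trans (+-identityˡ (rec r * 1ℚ)) (*-identityʳ (rec r))
  exact (suc K) = trans (cong (λ t → ∑ K (λ k → rec (suc r ℕ.^ k)) + t + rec r * t) (rec-* (suc r) (suc r ℕ.^ K)))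
    (trans (lem (∑ K (λ k → rec (suc r ℕ.^ k))) (rec (suc r)) (rec (suc r ℕ.^ K)) (rec r)) (trans (cong (λ t → ∑ K (λ k → rec (suc r ℕ.^ k)) + t * rec (suc r ℕ.^ K)) step) (exact K)))
    where
    lem : ∀ s a b c → s + a * b + c * (a * b) ≡ s + (a + c * a) * b
    lem = RS.solve-∀ ℚring

count≤ : ∀ Y N → ∑ Y (λ q → 𝟙 (q ℕ.≤? N)) ≤ ι N
count≤ Y N with Y ℕ.≤? N
... | yes h = ≤-trans (∑-≤-const Y (λ q _ _ → 𝟙≤1 (q ℕ.≤? N))) (≤-trans (≤-reflexive (*-identityʳ (ι Y))) (ι-mono h))
... | no h = ≤-trans (≤-reflexive (∑-extend (ℕₚ.<⇒≤ (ℕₚ.≰⇒> h)) (λ i N<i _ → 𝟙-no (i ℕ.≤? N) (ℕₚ.<⇒≱ N<i))))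
    (≤-trans (∑-≤-const N (λ q _ _ → 𝟙≤1 (q ℕ.≤? N))) (≤-reflexive (*-identityʳ (ι N))))

module Rare (Y M : ℕ) (1≤M : 1 ℕ.≤ M) (Y≤M : Y ℕ.≤ M) where
  open Log M 1≤M
  open Mangoldt Y M 1≤M Y≤M

  -- Proper prime powers and the primes up to N contribute boundedly to Σ Λ(n)/n.
  rare : ∀ (w : ℕ → ℚ) N {y} → y ℕ.≤ Y → (∀ n → 0ℚ ≤ w n) → (∀ n → w n ≤ 1ℚ) → (∀ q → Prime q → N ℕ.< q → w q ≡ 0ℚ) →
    ∑ y (λ n → w n * (Λ n * rec n)) ≤ ι N + ι 2
  rare w N {y} y≤Y 0≤w w≤1 w-0 = ≤-trans (≤-reflexive rearrange) (≤-trans (∑-mono Y (λ q 1≤q q≤Y → per-q q 1≤q (prime? q)))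
      (≤-trans (≤-reflexive (∑-+ Y (λ q → 𝟙 (q ℕ.≤? N)) (λ q → lg q * (rec (ℕ.pred q) * rec q)))) (+-mono-≤ (count≤ Y N) (tail Y))))
    where
    X : ℕ → ℕ → ℚ
    X q k = ∑ y (λ n → 𝟙 (q ℕ.^ k ℕₚ.≟ n) * (w n * rec n))
    rearrange : ∑ y (λ n → w n * (Λ n * rec n)) ≡ ∑ Y (λ q → P q * (lg q * ∑ Y (X q)))
    rearrange = trans (∑-cong y (λ n _ _ → trans (lem (w n) (Λ n) (rec n)) (sym (∑-*ˡ Y (w n * rec n) (λ q → P q * (lg q * pw q n))))))
      (trans (∑-swap y Y (λ n q → w n * rec n * (P q * (lg q * pw q n))))
        (∑-cong Y (λ q _ _ → trans (∑-cong y (λ n _ _ → lem2 (w n * rec n) (P q) (lg q) (pw q n)))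
          (trans (∑-*ˡ y (P q * lg q) (λ n → w n * rec n * pw q n)) (trans (*-assoc (P q) (lg q) _) (cong (λ t → P q * (lg q * t))
            (trans (∑-cong y (λ n _ _ → sym (∑-*ˡ Y (w n * rec n) (λ k → 𝟙 (q ℕ.^ k ℕₚ.≟ n)))))
              (trans (∑-swap y Y (λ n k → w n * rec n * 𝟙 (q ℕ.^ k ℕₚ.≟ n))) (∑-cong Y (λ k _ _ → ∑-cong y (λ n _ _ → *-comm (w n * rec n) (𝟙 (q ℕ.^ k ℕₚ.≟ n)))))))))))))
      where
      lem : ∀ a b c → a * (b * c) ≡ a * c * b
      lem = RS.solve-∀ ℚring
      lem2 : ∀ a b c e → a * (b * (c * e)) ≡ b * c * (a * e)
      lem2 = RS.solve-∀ ℚring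
    pick : ∀ a → 1 ℕ.≤ a → ∑ y (λ n → 𝟙 (a ℕₚ.≟ n) * (w n * rec n)) ≤ w a * rec a
    pick a 1≤a with a ℕ.≤? y
    ... | yes a≤y = ≤-reflexive (trans (∑-cong y (λ n _ _ → cong (_* (w n * rec n)) (𝟙-⇔ (a ℕₚ.≟ n) (n ℕₚ.≟ a) sym sym))) (∑-𝟙 y (λ n → w n * rec n) 1≤a a≤y))
    ... | no a≰y = ≤-trans (≤-reflexive (∑-0 y (λ n _ n≤y → trans (cong (_* (w n * rec n)) (𝟙-no (a ℕₚ.≟ n) (λ { refl → a≰y n≤y }))) (*-zeroˡ (w n * rec n))))) (*-≥0 (0≤w a) (0≤rec a))
    X≤ : ∀ q k → 1 ℕ.≤ q → X q k ≤ rec (q ℕ.^ k)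
    X≤ q k 1≤q = ≤-trans (pick (q ℕ.^ k) (ℕₚ.m^n>0 q {{ℕ.>-nonZero 1≤q}} k)) (≤-trans (*-monoʳ (0≤rec (q ℕ.^ k)) (w≤1 (q ℕ.^ k))) (≤-reflexive (*-identityˡ (rec (q ℕ.^ k)))))
    -- For q ≤ N all powers of q together give log q / (q - 1) ≤ 1, charged to the indicator. For q
    -- > N the weight kills the exponent 1, and the powers from q² on give log q / (q (q - 1)).
    per-q : ∀ q → 1 ℕ.≤ q → (p? : Dec (Prime q)) → 𝟙 p? * (lg q * ∑ Y (X q)) ≤ 𝟙 (q ℕ.≤? N) + lg q * (rec (ℕ.pred q) * rec q)
    per-q q 1≤q (no _) = ≤-trans (≤-reflexive (*-zeroˡ (lg q * ∑ Y (X q)))) (+-≥0 (0≤𝟙 (q ℕ.≤? N)) (*-≥0 (0≤lg 1≤q) (*-≥0 (0≤rec (ℕ.pred q)) (0≤rec q))))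
    per-q zero () (yes pq)
    per-q (suc r) 1≤q (yes pq) with suc r ℕ.≤? N
    ... | yes _ = ≤-trans (≤-reflexive (*-identityˡ (lg (suc r) * ∑ Y (X (suc r))))) (≤-trans (*-monoˡ (0≤lg 1≤q) (≤-trans (∑-mono Y (λ k _ _ → X≤ (suc r) k 1≤q)) (geometric r Y 1≤r)))
        (≤-trans (≤-trans (*-monoʳ (0≤rec r) lg≤r) (≤-reflexive (trans (*-comm (ι r) (rec r)) (rec-ι 1≤r)))) (≤-+ 1ℚ (*-≥0 (0≤lg 1≤q) (*-≥0 (0≤rec r) (0≤rec (suc r)))))))
      where
      1≤r : 1 ℕ.≤ r
      1≤r = ℕₚ.≤-pred (prime≥2 pq)
      lg≤r : lg (suc r) ≤ ι r
      lg≤r = ≤-trans (≤-reflexive (lem (lg (suc r)))) (≤-trans (+ˡ (- 1ℚ) (1+lg≤ι {suc r} (s≤s z≤n))) (≤-reflexive (trans (cong (- 1ℚ +_) (ι-suc r)) (lem' (ι r)))))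
        where
        lem : ∀ a → a ≡ - 1ℚ + (1ℚ + a)
        lem = RS.solve-∀ ℚring
        lem' : ∀ a → - 1ℚ + (1ℚ + a) ≡ a
        lem' = RS.solve-∀ ℚring
    ... | no q≰N = ≤-trans (≤-reflexive (*-identityˡ (lg (suc r) * ∑ Y (X (suc r))))) (≤-trans (*-monoˡ (0≤lg 1≤q) (tail-k Y)) (≤-reflexive (sym (+-identityˡ _))))
      where
      1≤r : 1 ℕ.≤ r
      1≤r = ℕₚ.≤-pred (prime≥2 pq)
      tail-k : ∀ Y → ∑ Y (X (suc r)) ≤ rec r * rec (suc r)
      tail-k zero = *-≥0 (0≤rec r) (0≤rec (suc r))
      tail-k (suc Y) = ≤-trans (≤-reflexive (∑-front Y (X (suc r)))) (≤-trans (+-mono-≤ first (∑-mono Y (λ k _ _ → ≤-trans (X≤ (suc r) (suc k) 1≤q) (≤-reflexive (rec-* (suc r) (suc r ℕ.^ k))))))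
          (≤-trans (≤-reflexive (trans (+-identityˡ _) (∑-*ˡ Y (rec (suc r)) (λ k → rec (suc r ℕ.^ k))))) (≤-trans (*-monoˡ (0≤rec (suc r)) (geometric r Y 1≤r)) (≤-reflexive (*-comm (rec (suc r)) (rec r))))))
        where
        first : X (suc r) 1 ≤ 0ℚ
        first = ≤-trans (pick (suc r ℕ.^ 1) (ℕₚ.m^n>0 (suc r) 1)) (≤-reflexive (trans (cong (_* rec (suc r ℕ.^ 1)) (trans (cong w (ℕₚ.*-identityʳ (suc r))) (w-0 (suc r) pq (ℕₚ.≰⇒> q≰N)))) (*-zeroˡ (rec (suc r ℕ.^ 1)))))
    tail : ∀ Y → ∑ Y (λ q → lg q * (rec (ℕ.pred q) * rec q)) ≤ ι 2
    tail zero = 0≤ι 2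
    tail (suc Y) = ≤-trans (≤-reflexive (trans (∑-front Y (λ q → lg q * (rec (ℕ.pred q) * rec q))) (cong (_+ ∑ Y (λ m → lg (suc m) * (rec m * rec (suc m)))) (trans (cong (_* (rec 0 * rec 1)) lg-1) (*-zeroˡ (rec 0 * rec 1))))))
      (≤-trans (≤-reflexive (+-identityˡ _)) (≤-trans (lg-tail Y) (≤-by (*-≥0 (+-≥0 (0≤lg {suc Y} (s≤s z≤n)) (0≤ι 2)) (0≤rec (suc Y))) (lem (ι 2) ((lg (suc Y) + ι 2) * rec (suc Y))))))
      where
      lem : ∀ a b → a ≡ a - b + b
      lem = RS.solve-∀ ℚring

<⇒≱ : ∀ {a b} → a < b → ¬ (b ≤ a)
<⇒≱ h k = ℚₚ.<-irrefl refl (ℚₚ.<-≤-trans h k)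

search : ∀ {P : ℕ → Set} → (∀ i → Dec (P i)) → ∀ y → (∃ λ i → 1 ℕ.≤ i × i ℕ.≤ y × P i) ⊎ (∀ i → 1 ℕ.≤ i → i ℕ.≤ y → ¬ P i)
search P? zero = inj₂ (λ { (suc i) _ () })
search P? (suc y) with P? (suc y) | search P? y
... | yes p | _ = inj₁ (suc y , s≤s z≤n , ℕₚ.≤-refl , p)
... | no _ | inj₁ (i , a , b , p) = inj₁ (i , a , ℕₚ.m≤n⇒m≤1+n b , p)
... | no ¬p | inj₂ h = inj₂ go
  where
  go : ∀ i → 1 ℕ.≤ i → i ℕ.≤ suc y → ¬ _
  go i a b with i ℕₚ.≟ suc y
  ... | yes refl = ¬p
  ... | no i≢ = h i a (ℕₚ.≤-pred (ℕₚ.≤∧≢⇒< b i≢))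

-- The group of units mod d.

-- Residue classes mod d, represented by 1, …, d.
module Classes (d : ℕ) {{d≢0 : ℕ.NonZero d}} where

  infix 4 _≋_
  _≋_ : ℕ → ℕ → Set
  m ≋ n = m ℕ.% d ≡ n ℕ.% d

  Unit : ℕ → Set
  Unit n = C.Coprime n d

  unit? : ∀ n → Dec (Unit n)
  unit? n = C.coprime? n d

  𝕖 : ℕ → ℕ → ℚ
  𝕖 b n = 𝟙 (n ℕ.% d ℕₚ.≟ b ℕ.% d)

  𝕦 : ℕ → ℚ
  𝕦 n = 𝟙 (unit? n)

  ≋-* : ∀ {m m' n n'} → m ≋ m' → n ≋ n' → m ℕ.* n ≋ m' ℕ.* n'
  ≋-* {m} {m'} {n} {n'} e f = trans (DM.%-distribˡ-* m n d) (trans (cong₂ (λ a b → (a ℕ.* b) ℕ.% d) e f) (sym (DM.%-distribˡ-* m' n' d)))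

  +d≋ : ∀ n → d ℕ.+ n ≋ n
  +d≋ n = trans (cong (ℕ._% d) (ℕₚ.+-comm d n)) (DM.[m+n]%n≡m%n n d)

  +kd≋ : ∀ n k → n ℕ.+ k ℕ.* d ≋ n
  +kd≋ n k = DM.[m+kn]%n≡m%n n k d

  unit-≋ : ∀ {m n} → m ≋ n → Unit m → Unit n
  unit-≋ {m} {n} e c {i} (i∣n , i∣d) = c (∣ₚ.∣n∣m%n⇒∣m {n = d} i∣d (subst (i ∣_) (sym e) (∣ₚ.%-presˡ-∣ i∣n i∣d)) , i∣d)

  unit-*ˡ : ∀ {m n} → Unit (m ℕ.* n) → Unit m
  unit-*ˡ {m} {n} c (i∣m , i∣d) = c (∣ₚ.∣m⇒∣m*n n i∣m , i∣d)

  unit-*ʳ : ∀ {m n} → Unit (m ℕ.* n) → Unit n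
  unit-*ʳ {m} {n} c (i∣n , i∣d) = c (∣ₚ.∣n⇒∣m*n m i∣n , i∣d)

  unit-* : ∀ {m n} → Unit m → Unit n → Unit (m ℕ.* n)
  unit-* {m} {n} c c' {i} (i∣mn , i∣d) = c' (C.coprime-divisor {i} {m} (λ { (x , y) → c (y , ∣ₚ.∣-trans x i∣d) }) i∣mn , i∣d)

  unit-1 : Unit 1
  unit-1 = C.1-coprimeTo d

  private
    1≤d : 1 ℕ.≤ d
    1≤d = ℕ.>-nonZero⁻¹ d

  rep : ∀ n → ∃ λ j → 1 ℕ.≤ j × j ℕ.≤ d × j ≋ n
  rep n with n ℕ.% d in e
  ... | zero = d , 1≤d , ℕₚ.≤-refl , trans (DM.n%n≡0 d) refl
  ... | suc r = suc r , s≤s z≤n , ℕₚ.<⇒≤ r<d , DM.m<n⇒m%n≡m r<d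
    where
    r<d : suc r ℕ.< d
    r<d = subst (ℕ._< d) e (DM.m%n<n n d)

  rep-unique : ∀ {i j} → 1 ℕ.≤ i → i ℕ.≤ d → 1 ℕ.≤ j → j ℕ.≤ d → i ≋ j → i ≡ j
  rep-unique {i} {j} 1≤i i≤d 1≤j j≤d e with i ℕₚ.≟ d | j ℕₚ.≟ d
  ... | yes refl | yes refl = refl
  ... | no i≢ | no j≢ = trans (sym (DM.m<n⇒m%n≡m (ℕₚ.≤∧≢⇒< i≤d i≢))) (trans e (DM.m<n⇒m%n≡m (ℕₚ.≤∧≢⇒< j≤d j≢)))
  ... | yes refl | no j≢ = ⊥-elim (ℕₚ.<⇒≢ 1≤j (trans (sym (DM.n%n≡0 d)) (trans e (DM.m<n⇒m%n≡m (ℕₚ.≤∧≢⇒< j≤d j≢)))))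
  ... | no i≢ | yes refl = ⊥-elim (ℕₚ.<⇒≢ 1≤i (trans (sym (DM.n%n≡0 d)) (trans (sym e) (DM.m<n⇒m%n≡m (ℕₚ.≤∧≢⇒< i≤d i≢)))))

  Periodic : (ℕ → ℚ) → Set
  Periodic h = ∀ {m n} → m ≋ n → h m ≡ h n

  ∑-class : ∀ (h : ℕ → ℚ) → Periodic h → ∀ n → ∑ d (λ b → 𝕖 b n * h b) ≡ h n
  ∑-class h per n with rep n
  ... | j , 1≤j , j≤d , j≋n = trans (∑-single d {λ b → 𝕖 b n * h b} 1≤j j≤d (λ i 1≤i i≤d i≢j → trans (cong (_* h i) (𝟙-no (n ℕ.% d ℕₚ.≟ i ℕ.% d) (λ e → i≢j (rep-unique 1≤i i≤d 1≤j j≤d (trans (sym e) (sym j≋n)))))) (*-zeroˡ (h i))))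
    (trans (cong (_* h j) (𝟙-yes (n ℕ.% d ℕₚ.≟ j ℕ.% d) (sym j≋n))) (trans (*-identityˡ (h j)) (per j≋n)))

  inverse : ∀ {t} → Unit t → ∃ λ t' → t ℕ.* t' ≋ 1
  inverse {t} c with C.coprime-Bézout c
  ... | Bézout.Identity.+- x y e = x , trans (cong (ℕ._% d) (trans (ℕₚ.*-comm t x) (sym e))) (+kd≋ 1 y)
  -- Here xt ≡ -1 mod d, which is not an inverse; (xt)² ≡ 1 gives one without subtraction.
  ... | Bézout.Identity.-+ x y e = x ℕ.* (t ℕ.* x) , trans (cong (ℕ._% d) (lem t x)) (square (x ℕ.* t) e)
    where
    lem : ∀ t x → t ℕ.* (x ℕ.* (t ℕ.* x)) ≡ x ℕ.* t ℕ.* (x ℕ.* t)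
    lem = ℕS.solve-∀
    square : ∀ w → 1 ℕ.+ w ≡ y ℕ.* d → w ℕ.* w ≋ 1
    square zero e = trans (sym (+kd≋ 0 y)) (cong (ℕ._% d) (sym e))
    square (suc w) e = trans (cong (ℕ._% d) (trans (lem2 w) (cong (1 ℕ.+_) (trans (cong (w ℕ.*_) e) (sym (ℕₚ.*-assoc w y d)))))) (+kd≋ 1 (w ℕ.* y))
      where
      lem2 : ∀ w → suc w ℕ.* suc w ≡ 1 ℕ.+ w ℕ.* suc (suc w)
      lem2 = ℕS.solve-∀

  quotient-class : ∀ {t} → Unit t → ∀ b → ∃ λ s → 1 ℕ.≤ s × s ℕ.≤ d × t ℕ.* s ≋ b
  quotient-class {t} ct b with inverse ct
  ... | t' , e with rep (t' ℕ.* b)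
  ...   | s , 1≤s , s≤d , s≋ = s , 1≤s , s≤d ,
      trans (≋-* {t} {t} {s} {t' ℕ.* b} refl s≋) (trans (cong (ℕ._% d) (sym (ℕₚ.*-assoc t t' b))) (trans (≋-* {n = b} e refl) (cong (ℕ._% d) (ℕₚ.*-identityˡ b))))

  divide : ∀ {t b} → Unit t → Unit b → ∃ λ s → 1 ℕ.≤ s × s ℕ.≤ d × t ℕ.* s ≋ b × Unit s
  divide {t} {b} ct cb = let s , 1≤s , s≤d , ts≋b = quotient-class ct b in s , 1≤s , s≤d , ts≋b , unit-*ʳ {t} {s} (unit-≋ (sym ts≋b) cb)

  Partner : ℕ → ℕ → Set
  Partner a s = ∃ λ t → ∃ λ s' → Unit t × 1 ℕ.≤ t × t ℕ.≤ d × 1 ℕ.≤ s' × s' ℕ.≤ d × s' ≋ s × t ℕ.* s' ≋ a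

  partner : ∀ {a s} → Unit a → Unit s → Partner a s
  partner {a} {s} ca cs =
    let s' , 1≤s' , s'≤d , e = rep s
        t , 1≤t , t≤d , e' , ct = divide {s'} {a} (unit-≋ (sym e) cs) ca
    in t , s' , ct , 1≤t , t≤d , 1≤s' , s'≤d , e , trans (cong (ℕ._% d) (ℕₚ.*-comm t s')) e'

  cancel : ∀ {t m n} → Unit t → t ℕ.* m ≋ t ℕ.* n → m ≋ n
  cancel {t} {m} {n} ct e with inverse ct
  ... | t' , e' = trans (sym (h m)) (trans (≋-* {t'} {t'} refl e) (h n))
    where
    h : ∀ m → t' ℕ.* (t ℕ.* m) ≋ m
    h m = trans (cong (ℕ._% d) (trans (sym (ℕₚ.*-assoc t' t m)) (cong (ℕ._* m) (ℕₚ.*-comm t' t)))) (trans (≋-* {n = m} e' refl) (cong (ℕ._% d) (ℕₚ.*-identityˡ m)))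

  ∑-𝕖* : ∀ {t b} → Unit t → (h : ℕ → ℚ) → ∀ {s} → 1 ℕ.≤ s → s ℕ.≤ d → t ℕ.* s ≋ b → ∑ d (λ s → 𝕖 b (t ℕ.* s) * h s) ≡ h s
  ∑-𝕖* {t} {b} ct h {s} 1≤s s≤d e = trans (∑-single d {λ s → 𝕖 b (t ℕ.* s) * h s} 1≤s s≤d (λ i 1≤i i≤d i≢s → trans (cong (_* h i) (𝟙-no ((t ℕ.* i) ℕ.% d ℕₚ.≟ b ℕ.% d) (λ e' → i≢s (rep-unique 1≤i i≤d 1≤s s≤d (cancel ct (trans e' (sym e))))))) (*-zeroˡ (h i))))
    (trans (cong (_* h s) (𝟙-yes ((t ℕ.* s) ℕ.% d ℕₚ.≟ b ℕ.% d) e)) (*-identityˡ (h s)))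

  𝕖-0 : ∀ {b n} → Unit b → ¬ Unit n → 𝕖 b n ≡ 0ℚ
  𝕖-0 {b} {n} cb ¬cn = 𝟙-no (n ℕ.% d ℕₚ.≟ b ℕ.% d) (λ e → ¬cn (unit-≋ (sym e) cb))

  ∑-𝕖-unit : ∀ {b} t → Unit b → ∑ d (λ s → 𝕖 b (t ℕ.* s)) ≡ 𝕦 t
  ∑-𝕖-unit {b} t cb with unit? t
  ... | no ¬ct = ∑-0 d (λ s _ _ → 𝕖-0 {b} {t ℕ.* s} cb (λ c → ¬ct (unit-*ˡ {t} {s} c)))
  ... | yes ct = let s , 1≤s , s≤d , e , _ = divide ct cb in
    trans (∑-cong d (λ s _ _ → sym (*-identityʳ (𝕖 b (t ℕ.* s))))) (∑-𝕖* ct (λ _ → 1ℚ) 1≤s s≤d e)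

  ∑-𝕦-𝕖 : ∀ n → ∑ d (λ b → 𝕦 b * 𝕖 b n) ≡ 𝕦 n
  ∑-𝕦-𝕖 n = trans (∑-cong d (λ b _ _ → *-comm (𝕦 b) (𝕖 b n))) (∑-class 𝕦 (λ {m} {n} e → 𝟙-⇔ (unit? m) (unit? n) (unit-≋ e) (unit-≋ (sym e))) n)

  𝕖-cong : ∀ {b m n} → m ≋ n → 𝕖 b m ≡ 𝕖 b n
  𝕖-cong {b} e = cong (λ t → 𝟙 (t ℕₚ.≟ b ℕ.% d)) e

  -- Along the dilation by u both indicators have the same mean, 1/d if u is a unit and 0 otherwise,
  -- so their difference averages to zero even for u not prime to d.
  osc-class : ∀ {b b'} → Unit b → Unit b' → Osc d 1ℚ (λ n → 𝕖 b n - 𝕖 b' n)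
  osc-class {b} {b'} cb cb' .periodic n = cong₂ _-_ (𝕖-cong {b} (+d≋ n)) (𝕖-cong {b'} (+d≋ n))
  osc-class {b} {b'} cb cb' .mean-0 u = trans (∑-- d (λ i → 𝕖 b (u ℕ.* i)) (λ i → 𝕖 b' (u ℕ.* i))) (trans (cong₂ _-_ (∑-𝕖-unit u cb) (∑-𝕖-unit u cb')) (ℚₚ.+-inverseʳ (𝕦 u)))
  osc-class {b} {b'} cb cb' .bounded n = ∣∣-intro (≤-by {s = 1ℚ - y + x} (+-≥0 (diff≥0 (𝟙≤1 (n ℕ.% d ℕₚ.≟ b' ℕ.% d))) (0≤𝟙 (n ℕ.% d ℕₚ.≟ b ℕ.% d))) (lem x y)) (≤-by {s = 1ℚ - x + y} (+-≥0 (diff≥0 (𝟙≤1 (n ℕ.% d ℕₚ.≟ b ℕ.% d))) (0≤𝟙 (n ℕ.% d ℕₚ.≟ b' ℕ.% d))) (lem' x y))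
    where
    x y : ℚ
    x = 𝕖 b n
    y = 𝕖 b' n
    lem : ∀ x y → x - y ≡ - 1ℚ + (1ℚ - y + x)
    lem = RS.solve-∀ ℚring
    lem' : ∀ x y → 1ℚ ≡ x - y + (1ℚ - x + y)
    lem' = RS.solve-∀ ℚring

  φ : ℚ
  φ = ∑ d 𝕦

  φ≤d : φ ≤ ι d
  φ≤d = ≤-trans (∑-≤-const d (λ b _ _ → 𝟙≤1 (unit? b))) (≤-reflexive (*-identityʳ (ι d)))

  1≤φ : 1ℚ ≤ φ
  1≤φ = ≤-trans (≤-reflexive (sym (𝟙-yes (unit? 1) unit-1))) (term≤∑ d (λ b _ _ → 0≤𝟙 (unit? b)) (s≤s z≤n) 1≤d)

  ∑-𝕖-dilate : ∀ {v} b → Unit v → ∑ d (λ j → 𝕖 b (v ℕ.* j)) ≡ 1ℚ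
  ∑-𝕖-dilate {v} b cv = let s , 1≤s , s≤d , e = quotient-class cv b in
    trans (∑-cong d (λ j _ _ → sym (*-identityʳ (𝕖 b (v ℕ.* j))))) (∑-𝕖* cv (λ _ → 1ℚ) 1≤s s≤d e)

  ∑-dilate : ∀ {v} (h : ℕ → ℚ) → Periodic h → Unit v → ∑ d (λ k → h (v ℕ.* k)) ≡ ∑ d h
  ∑-dilate {v} h per cv = trans (∑-cong d (λ k _ _ → sym (∑-class h per (v ℕ.* k)))) (trans (∑-swap d d (λ k b → 𝕖 b (v ℕ.* k) * h b))
    (∑-cong d (λ b _ _ → trans (∑-*ʳ d (h b) (λ k → 𝕖 b (v ℕ.* k))) (trans (cong (_* h b) (∑-𝕖-dilate b cv)) (*-identityˡ (h b))))))

  ∑-affine : ∀ {v} (h : ℕ → ℚ) → Periodic h → Unit v → ∀ s → ∑ d (λ k → h (s ℕ.+ v ℕ.* k)) ≡ ∑ d h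
  ∑-affine {v} h per cv s = trans (∑-dilate (λ k → h (s ℕ.+ k)) (λ {m} {n} e → per (+-≋ e)) cv) (∑-shift (λ n → per (+d≋ n)) s)
    where
    +-≋ : ∀ {m n} → m ≋ n → s ℕ.+ m ≋ s ℕ.+ n
    +-≋ {m} {n} e = trans (DM.%-distribˡ-+ s m d) (trans (cong (λ t → (s ℕ.% d ℕ.+ t) ℕ.% d) e) (sym (DM.%-distribˡ-+ s n d)))

  -- Every block of d consecutive integers contains exactly one member of the class; `pred i`
  -- appears because sums start at 1.
  ∑-members : ∀ {A} → 1 ℕ.≤ A → A ℕ.≤ d → (h : ℕ → ℚ) → ∀ n → ∑ (n ℕ.* d) (λ x → 𝕖 A x * h x) ≡ ∑ n (λ i → h (A ℕ.+ ℕ.pred i ℕ.* d))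
  ∑-members {A} 1≤A A≤d h zero = refl
  ∑-members {A} 1≤A A≤d h (suc n) = trans (cong (λ t → ∑ t (λ x → 𝕖 A x * h x)) (ℕₚ.+-comm d (n ℕ.* d))) (trans (∑-split (n ℕ.* d) d (λ x → 𝕖 A x * h x)) (cong₂ _+_ (∑-members 1≤A A≤d h n)
    (trans (∑-single d {λ i → 𝕖 A (n ℕ.* d ℕ.+ i) * h (n ℕ.* d ℕ.+ i)} 1≤A A≤d (λ i 1≤i i≤d i≢A → trans (cong (_* h (n ℕ.* d ℕ.+ i)) (𝟙-no ((n ℕ.* d ℕ.+ i) ℕ.% d ℕₚ.≟ A ℕ.% d) (λ e → i≢A (rep-unique 1≤i i≤d 1≤A A≤d (trans (sym (back i)) e))))) (*-zeroˡ (h (n ℕ.* d ℕ.+ i)))))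
      (trans (cong (_* h (n ℕ.* d ℕ.+ A)) (𝟙-yes ((n ℕ.* d ℕ.+ A) ℕ.% d ℕₚ.≟ A ℕ.% d) (back A))) (trans (*-identityˡ (h (n ℕ.* d ℕ.+ A))) (cong h (ℕₚ.+-comm (n ℕ.* d) A)))))))
    where
    back : ∀ i → n ℕ.* d ℕ.+ i ≋ i
    back i = trans (cong (ℕ._% d) (ℕₚ.+-comm (n ℕ.* d) i)) (+kd≋ i n)

  ∑-members-∣ : ∀ {A m} → 1 ℕ.≤ A → A ℕ.≤ d → 1 ℕ.≤ m → ∀ n → ∑ n (λ i → 𝟙 (m ∣? A ℕ.+ ℕ.pred i ℕ.* d)) ≡ ∑ ((n ℕ.* d) ÷ m) (λ j → 𝕖 A (m ℕ.* j))
  ∑-members-∣ {A} {m} 1≤A A≤d 1≤m n = trans (sym (∑-members 1≤A A≤d (λ x → 𝟙 (m ∣? x)) n)) (trans (∑-cong (n ℕ.* d) (λ x _ _ → *-comm (𝕖 A x) (𝟙 (m ∣? x)))) (∑-multiples (n ℕ.* d) (𝕖 A) 1≤m))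

-- A lower bound for L(1,χ), χ a real character.

strip : ∀ {q} → Prime q → ∀ fuel n → 1 ℕ.≤ n → n ℕ.≤ fuel → ∃ λ e → ∃ λ m → n ≡ q ℕ.^ e ℕ.* m × ¬ (q ∣ m) × 1 ℕ.≤ m
strip pq zero n 1≤n n≤f = ⊥-elim (ℕₚ.<⇒≱ 1≤n n≤f)
strip {q} pq (suc f) n 1≤n n≤f with q ∣? n
... | no ∤ = 0 , n , sym (ℕₚ.*-identityˡ n) , ∤ , 1≤n
... | yes (divides k e) with strip pq f k 1≤k (ℕₚ.≤-pred (ℕₚ.≤-trans k<n n≤f))
  where
  1≤k : 1 ℕ.≤ k
  1≤k = ℕₚ.n≢0⇒n>0 (λ { refl → ℕₚ.<⇒≢ 1≤n (sym e) })
  k<n : k ℕ.< n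
  k<n = subst (k ℕ.<_) (sym e) (subst (ℕ._< k ℕ.* q) (ℕₚ.*-identityʳ k) (ℕₚ.*-monoʳ-< k {{ℕ.>-nonZero 1≤k}} (prime≥2 pq)))
...   | e' , m , refl , ∤ , 1≤m = suc e' , m , trans e (trans (ℕₚ.*-comm (q ℕ.^ e' ℕ.* m) q) (sym (ℕₚ.*-assoc q (q ℕ.^ e') m))) , ∤ , 1≤m

-- The function r = 1 ∗ χ is multiplicative but not completely so, hence a prime is stripped with
-- its full power in one step.
prime-power-induction : (P : ℕ → Set) → P 1 → (∀ q e n → Prime q → ¬ (q ∣ n) → 1 ℕ.≤ n → P n → P (q ℕ.^ e ℕ.* n)) → ∀ n → 1 ℕ.≤ n → P n
prime-power-induction P base step n = go (suc n) n (ℕₚ.n<1+n n)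
  where
  go : ∀ fuel n → n ℕ.< fuel → 1 ℕ.≤ n → P n
  go (suc f) (suc zero) _ _ = base
  go (suc f) n@(suc (suc _)) (s≤s n≤f) 1≤n with prime-divisor n (s≤s (s≤s z≤n))
  ... | q , pq , q∣n with strip pq n n 1≤n ℕₚ.≤-refl
  ...   | zero , m , e , ∤ , 1≤m = ⊥-elim (∤ (subst (q ∣_) (trans e (ℕₚ.*-identityˡ m)) q∣n))
  ...   | suc k , m , e , ∤ , 1≤m = subst P (sym e) (step q (suc k) m pq ∤ 1≤m (go f m (ℕₚ.≤-trans m<n n≤f) 1≤m))
    where
    m<n : m ℕ.< n
    m<n = subst (m ℕ.<_) (sym e) (subst (ℕ._< q ℕ.^ suc k ℕ.* m) (ℕₚ.*-identityˡ m) (ℕₚ.*-monoˡ-< m {{ℕ.>-nonZero 1≤m}}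
      (ℕₚ.≤-trans (prime≥2 pq) (ℕₚ.m≤m*n q (q ℕ.^ k) {{ℕ.>-nonZero (ℕₚ.m^n>0 q {{prime⇒nonZero pq}} k)}}))))

data Sign (x : ℚ) : Set where
  one : x ≡ 1ℚ → Sign x
  minus-one : x ≡ - 1ℚ → Sign x
  zero : x ≡ 0ℚ → Sign x

sign≤1 : ∀ {x} → Sign x → ∣ x ∣ ≤ 1ℚ
sign≤1 (one refl) = ≤-refl
sign≤1 (minus-one refl) = ≤-refl
sign≤1 (zero refl) = 0≤1

∑-ι : ∀ t → ι 2 * ∑ t ι ≡ ι t * (ι t + 1ℚ)
∑-ι zero = refl
∑-ι (suc t) = trans (*-distribˡ-+ (ι 2) (∑ t ι) (ι (suc t))) (trans (cong₂ (λ a b → a + ι 2 * b) (∑-ι t) (ι-suc t)) (trans (lem (ι t)) (cong (λ a → a * (a + 1ℚ)) (sym (ι-suc t)))))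
  where
  lem : ∀ a → a * (a + 1ℚ) + ι 2 * (1ℚ + a) ≡ (1ℚ + a) * (1ℚ + a + 1ℚ)
  lem = RS.solve-∀ ℚring

-- A real character: L(1,χ) is bounded below because r = 1 ∗ χ is nonnegative, and at least 1 on squares.
module RealCharacter (d : ℕ) (1≤d : 1 ℕ.≤ d) (χ : ℕ → ℚ) (χ-osc : Osc d 1ℚ χ) (χ-sign : ∀ n → Sign (χ n))
  (χ-1 : χ 1 ≡ 1ℚ) (χ-* : ∀ m n → χ (m ℕ.* n) ≡ χ m * χ n) where

  r : ℕ → ℕ → ℚ
  r Y n = ∑ Y (λ k → 𝟙 (k ∣? n) * χ k)

  private
    -- The value 1 + x + ... + xᵉ of r at qᵉ, for x = χ(q), in Horner form. For x = -1 it alternates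
    -- between 1 and 0, which is why squares, having even exponents, give at least 1.
    s : ℚ → ℕ → ℚ
    s x zero = 1ℚ
    s x (suc e) = 1ℚ + x * s x e

    s-minus : ∀ e → s (- 1ℚ) (suc (suc e)) ≡ s (- 1ℚ) e
    s-minus e = lem (s (- 1ℚ) e)
      where
      lem : ∀ a → 1ℚ + - 1ℚ * (1ℚ + - 1ℚ * a) ≡ a
      lem = RS.solve-∀ ℚring

    1≤s-one : ∀ e → 1ℚ ≤ s 1ℚ e
    1≤s-one zero = ≤-refl
    1≤s-one (suc e) = ≤-+ 1ℚ (≤-trans (≤-trans 0≤1 (1≤s-one e)) (≤-reflexive (sym (*-identityˡ (s 1ℚ e)))))

    s-zero : ∀ e → s 0ℚ e ≡ 1ℚ
    s-zero zero = refl
    s-zero (suc e) = cong (1ℚ +_) (*-zeroˡ (s 0ℚ e))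

    0≤s : ∀ {x} → Sign x → ∀ e → 0ℚ ≤ s x e
    0≤s (one refl) e = ≤-trans 0≤1 (1≤s-one e)
    0≤s (zero refl) e = ≤-trans 0≤1 (≤-reflexive (sym (s-zero e)))
    0≤s (minus-one refl) zero = 0≤1
    0≤s (minus-one refl) (suc zero) = ≤-refl
    0≤s (minus-one refl) (suc (suc e)) = ≤-trans (0≤s (minus-one refl) e) (≤-reflexive (sym (s-minus e)))

    1≤s-even : ∀ {x} → Sign x → ∀ e → 1ℚ ≤ s x (e ℕ.+ e)
    1≤s-even (one refl) e = 1≤s-one (e ℕ.+ e)
    1≤s-even (zero refl) e = ≤-reflexive (sym (s-zero (e ℕ.+ e)))
    1≤s-even (minus-one refl) zero = ≤-refl
    1≤s-even (minus-one refl) (suc e) = subst (λ t → 1ℚ ≤ s (- 1ℚ) (suc t)) (sym (ℕₚ.+-suc e e)) (≤-trans (1≤s-even (minus-one refl) e) (≤-reflexive (sym (s-minus (e ℕ.+ e)))))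

    -- A divisor of qᵉ⁺¹ n is either prime to q, and then divides n, or is q times a divisor of qᵉ
    -- n. This is the Horner recursion of `s`.
    r-power : ∀ {Y q n} → Prime q → ¬ (q ∣ n) → 1 ℕ.≤ n → ∀ e → q ℕ.^ e ℕ.* n ℕ.≤ Y → r Y (q ℕ.^ e ℕ.* n) ≡ s (χ q) e * r Y n
    r-power {Y} {q} {n} pq ∤ 1≤n zero h = trans (cong (r Y) (ℕₚ.*-identityˡ n)) (sym (*-identityˡ (r Y n)))
    r-power {Y} {q} {n} pq ∤ 1≤n (suc e) h = trans (∑-cong Y (λ k _ _ → split k (q ∣? k) )) (trans (∑-+ Y (λ k → 𝟙 (k ∣? n) * χ k) (λ k → 𝟙 (q ∣? k) * (𝟙 (k ∣? q ℕ.* N) * χ k)))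
        (trans (cong (r Y n +_) (trans (∑-divisors-* (prime≥1 pq) 1≤N h' χ) (trans (∑-cong Y (λ k _ _ → trans (cong (𝟙 (k ∣? N) *_) (χ-* q k)) (lem2 (𝟙 (k ∣? N)) (χ q) (χ k)))) (trans (∑-*ˡ Y (χ q) (λ k → 𝟙 (k ∣? N) * χ k))
            (cong (χ q *_) (r-power pq ∤ 1≤n e (ℕₚ.≤-trans (ℕₚ.m≤n*m N q {{prime⇒nonZero pq}}) h')))))))
          (lem (r Y n) (χ q) (s (χ q) e))))
      where
      N = q ℕ.^ e ℕ.* n
      h' : q ℕ.* N ℕ.≤ Y
      h' = subst (ℕ._≤ Y) (ℕₚ.*-assoc q (q ℕ.^ e) n) h
      1≤N : 1 ℕ.≤ N
      1≤N = ℕₚ.*-mono-≤ (ℕₚ.m^n>0 q {{prime⇒nonZero pq}} e) 1≤n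
      lem : ∀ a x s → a + x * (s * a) ≡ (1ℚ + x * s) * a
      lem = RS.solve-∀ ℚring
      lem2 : ∀ a b c → a * (b * c) ≡ b * (a * c)
      lem2 = RS.solve-∀ ℚring
      lem3 : ∀ a b → a * b ≡ 0ℚ * b + 1ℚ * (a * b)
      lem3 = RS.solve-∀ ℚring
      lem4 : ∀ a b c → a * b ≡ a * b + 0ℚ * (c * b)
      lem4 = RS.solve-∀ ℚring
      split : ∀ k (q∣? : Dec (q ∣ k)) → 𝟙 (k ∣? q ℕ.* q ℕ.^ e ℕ.* n) * χ k ≡ 𝟙 (k ∣? n) * χ k + 𝟙 q∣? * (𝟙 (k ∣? q ℕ.* N) * χ k)
      split k (yes q∣k) = trans (cong (λ t → 𝟙 (k ∣? t) * χ k) (ℕₚ.*-assoc q (q ℕ.^ e) n)) (trans (lem3 (𝟙 (k ∣? q ℕ.* N)) (χ k)) (cong (λ t → t * χ k + 1ℚ * (𝟙 (k ∣? q ℕ.* N) * χ k)) (sym (𝟙-no (k ∣? n) (λ k∣n → ∤ (∣ₚ.∣-trans q∣k k∣n))))))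
      split k (no q∤k) = trans (cong (_* χ k) (𝟙-⇔ (k ∣? q ℕ.* q ℕ.^ e ℕ.* n) (k ∣? n)
          (λ d → C.coprime-divisor (C.sym (prime-coprime pq q∤k ⟨C⟩ suc e)) d) (∣ₚ.∣n⇒∣m*n (q ℕ.^ suc e)))) (lem4 (𝟙 (k ∣? n)) (χ k) (𝟙 (k ∣? q ℕ.* N)))
        where
        _⟨C⟩_ : C.Coprime q k → ∀ e → C.Coprime (q ℕ.^ e) k
        (c ⟨C⟩ zero) = C.1-coprimeTo k
        (c ⟨C⟩ suc e) {i} (i∣ , i∣k) = (c ⟨C⟩ e) (C.coprime-divisor {i} {q} (λ { (x , y) → c (y , ∣ₚ.∣-trans x i∣k) }) i∣ , i∣k)

  r-1 : ∀ {Y} → 1 ℕ.≤ Y → r Y 1 ≡ 1ℚ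
  r-1 {Y} 1≤Y = trans (∑-divisors (s≤s z≤n) 1≤Y χ) (trans (cong (λ t → 0ℚ + 1ℚ * t) χ-1) refl)

  0≤r : ∀ {Y n} → 1 ℕ.≤ n → n ℕ.≤ Y → 0ℚ ≤ r Y n
  0≤r {Y} {n} 1≤n = prime-power-induction (λ n → n ℕ.≤ Y → 0ℚ ≤ r Y n) (λ h → ≤-trans 0≤1 (≤-reflexive (sym (r-1 h))))
    (λ q e n pq ∤ 1≤n ih h → ≤-trans (*-≥0 (0≤s (χ-sign q) e) (ih (ℕₚ.≤-trans (ℕₚ.m≤n*m n (q ℕ.^ e) {{ℕ.>-nonZero (ℕₚ.m^n>0 q {{prime⇒nonZero pq}} e)}}) h))) (≤-reflexive (sym (r-power pq ∤ 1≤n e h)))) n 1≤n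

  1≤r-square : ∀ {Y m} → 1 ℕ.≤ m → m ℕ.* m ℕ.≤ Y → 1ℚ ≤ r Y (m ℕ.* m)
  1≤r-square {Y} {m} 1≤m = prime-power-induction (λ m → m ℕ.* m ℕ.≤ Y → 1ℚ ≤ r Y (m ℕ.* m)) (λ h → ≤-reflexive (sym (r-1 h))) step m 1≤m
    where
    step : ∀ q e n → Prime q → ¬ (q ∣ n) → 1 ℕ.≤ n → (n ℕ.* n ℕ.≤ Y → 1ℚ ≤ r Y (n ℕ.* n)) → (q ℕ.^ e ℕ.* n) ℕ.* (q ℕ.^ e ℕ.* n) ℕ.≤ Y → 1ℚ ≤ r Y ((q ℕ.^ e ℕ.* n) ℕ.* (q ℕ.^ e ℕ.* n))
    step q e n pq ∤ 1≤n ih h = ≤-trans (*-mono {1ℚ} {s (χ q) (e ℕ.+ e)} {1ℚ} {r Y (n ℕ.* n)} 0≤1 0≤1 (1≤s-even (χ-sign q) e) (ih (ℕₚ.≤-trans (ℕₚ.m≤n*m (n ℕ.* n) (q ℕ.^ (e ℕ.+ e)) {{ℕ.>-nonZero (ℕₚ.m^n>0 q {{prime⇒nonZero pq}} (e ℕ.+ e))}}) h')))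
        (≤-reflexive (sym (trans (cong (r Y) eq) (r-power pq ∤² (ℕₚ.*-mono-≤ 1≤n 1≤n) (e ℕ.+ e) h'))))
      where
      eq : (q ℕ.^ e ℕ.* n) ℕ.* (q ℕ.^ e ℕ.* n) ≡ q ℕ.^ (e ℕ.+ e) ℕ.* (n ℕ.* n)
      eq = trans (ℕₚ.[m*n]*[o*p]≡[m*o]*[n*p] (q ℕ.^ e) n (q ℕ.^ e) n) (cong (ℕ._* (n ℕ.* n)) (sym (ℕₚ.^-distribˡ-+-* q e e)))
      h' = subst (ℕ._≤ Y) eq h
      ∤² : ¬ (q ∣ n ℕ.* n)
      ∤² h with euclidsLemma n n pq h
      ... | inj₁ x = ∤ x
      ... | inj₂ x = ∤ x

  private
    -- The sum of X - n over the multiples n ≤ X of k; truncated subtraction cuts off the rest. With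
    -- weight 1 in place of X - n the rounding error would be of order √X, like the contribution of
    -- the squares; the smoothing makes it smaller.
    ramp : ℕ → ℕ → ℚ
    ramp X k = ∑ X (λ m → ι (X ℕ.∸ k ℕ.* m))

    ramp-anti : ∀ X k → ramp X (suc k) ≤ ramp X k
    ramp-anti X k = ∑-mono X (λ m _ _ → ι-mono (ℕₚ.∸-monoʳ-≤ X (ℕₚ.*-monoˡ-≤ m (ℕₚ.n≤1+n k))))

    ramp≡ : ∀ X {k} → 1 ℕ.≤ k → ramp X k ≡ ∑ (X ÷ k) (λ m → ι (X ℕ.∸ k ℕ.* m))
    ramp≡ X {k} 1≤k = ∑-extend (÷≤ X k) (λ m h _ → cong ι (ℕₚ.m≤n⇒m∸n≡0 (ℕₚ.<⇒≤ (ℕₚ.≰⇒> (λ km≤X → ℕₚ.<⇒≱ h (÷-adj⁻ 1≤k km≤X))))))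

    ι-∸ : ∀ {a b} → b ℕ.≤ a → ι (a ℕ.∸ b) ≡ ι a - ι b
    ι-∸ {a} {b} h = trans (lem (ι (a ℕ.∸ b)) (ι b)) (cong (_- ι b) (trans (sym (ι-+ (a ℕ.∸ b) b)) (cong ι (ℕₚ.m∸n+n≡m h))))
      where
      lem : ∀ a b → a ≡ a + b - b
      lem = RS.solve-∀ ℚring

    -- With ρ the remainder of X mod k, the arithmetic progression sums exactly to the stated main
    -- terms plus e = ½ρ(1 - ρ/k).
    ramp-error : ∀ X {k} → 1 ℕ.≤ k → ∃ λ e → ramp X k ≡ ½ * (ι X * ι X) * rec k - ½ * ι X + e × 0ℚ ≤ e × e ≤ ½ * ι k
    ramp-error X {k} 1≤k = ½ * (ρ * (1ℚ - ρ * rec k)) , eq , *-≥0 0≤½ (*-≥0 (0≤ι ρₙ) (diff≥0 ρr≤1)) ,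
        *-monoˡ 0≤½ (≤-trans (≤-by {ρ * (1ℚ - ρ * rec k)} {ρ} {ρ * (ρ * rec k)} (*-≥0 (0≤ι ρₙ) (*-≥0 (0≤ι ρₙ) (0≤rec k))) (lem0 ρ (rec k))) (ι-mono (ℕₚ.<⇒≤ ρ<k)))
      where
      0≤½ : 0ℚ ≤ ½
      0≤½ = *≤* (ℤ.+≤+ z≤n)
      t = X ÷ k
      ρₙ = X ℕ.∸ k ℕ.* t
      ρ = ι ρₙ
      kt≤X : k ℕ.* t ℕ.≤ X
      kt≤X = ÷-adj {X} {k} 1≤k ℕₚ.≤-refl
      ρ<k : ρₙ ℕ.< k
      ρ<k = ℕₚ.+-cancelʳ-< (k ℕ.* t) ρₙ k (subst (ℕ._< k ℕ.+ k ℕ.* t) (sym (ℕₚ.m∸n+n≡m kt≤X)) (subst (X ℕ.<_) (ℕₚ.*-suc k t) (ℕₚ.≰⇒> (λ h → ℕₚ.1+n≰n (÷-adj⁻ {X} {k} {suc t} 1≤k h)))))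
      ρr≤1 : ρ * rec k ≤ 1ℚ
      ρr≤1 = ≤-trans (*-monoʳ (0≤rec k) (ι-mono (ℕₚ.<⇒≤ ρ<k))) (≤-reflexive (trans (*-comm (ι k) (rec k)) (rec-ι 1≤k)))
      lem0 : ∀ a b → a ≡ a * (1ℚ - a * b) + a * (a * b)
      lem0 = RS.solve-∀ ℚring
      X≡ : ι X ≡ ι k * ι t + ρ
      X≡ = trans (trans (cong ι (sym (ℕₚ.m∸n+n≡m kt≤X))) (ι-+ ρₙ (k ℕ.* t))) (trans (+-comm ρ (ι (k ℕ.* t))) (cong (_+ ρ) (ι-* k t)))
      sum : ramp X k ≡ ι t * ι X - ι k * (½ * (ι t * (ι t + 1ℚ)))
      sum = trans (ramp≡ X 1≤k) (trans (∑-cong t (λ m 1≤m m≤t → trans (ι-∸ (÷-adj {X} {k} 1≤k m≤t)) (cong (λ z → ι X - z) (ι-* k m))))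
        (trans (∑-- t (λ _ → ι X) (λ m → ι k * ι m)) (cong₂ _-_ (∑-const t (ι X)) (trans (∑-*ˡ t (ι k) ι) (cong (ι k *_) (trans (lem (∑ t ι)) (cong (½ *_) (∑-ι t))))))))
        where
        lem : ∀ a → a ≡ ½ * (ι 2 * a)
        lem = RS.solve-∀ ℚring
      eq : ramp X k ≡ ½ * (ι X * ι X) * rec k - ½ * ι X + ½ * (ρ * (1ℚ - ρ * rec k))
      eq = trans sum (trans (cong (λ x → ι t * x - ι k * (½ * (ι t * (ι t + 1ℚ)))) X≡)
        (trans (lem1 (ι k) (ι t) ρ (rec k) )
          (trans (cong (λ z → ½ * (z * (ι k * ι t * ι t) + ι 2 * z * (ι t * ρ) + ρ * ρ * rec k) - ½ * (ι k * ι t + ρ) + ½ * (ρ * (1ℚ - ρ * rec k))) (sym (rec-ι 1≤k)))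
            (trans (lem2 (ι k) (ι t) ρ (rec k)) (cong (λ x → ½ * (x * x) * rec k - ½ * x + ½ * (ρ * (1ℚ - ρ * rec k))) (sym X≡))))))
        where
        lem1 : ∀ k t p r → t * (k * t + p) - k * (½ * (t * (t + 1ℚ))) ≡ ½ * (1ℚ * (k * t * t) + ι 2 * 1ℚ * (t * p) + p * p * r) - ½ * (k * t + p) + ½ * (p * (1ℚ - p * r))
        lem1 = RS.solve-∀ ℚring
        lem2 : ∀ k t p r → ½ * (r * k * (k * t * t) + ι 2 * (r * k) * (t * p) + p * p * r) - ½ * (k * t + p) + ½ * (p * (1ℚ - p * r)) ≡ ½ * ((k * t + p) * (k * t + p)) * r - ½ * (k * t + p) + ½ * (p * (1ℚ - p * r))
        lem2 = RS.solve-∀ ℚring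

    sum-squares : ∀ (F : ℕ → ℚ) Q {X} → (∀ n → 0ℚ ≤ F n) → Q ℕ.* Q ℕ.≤ X → ∑ Q (λ m → F (m ℕ.* m)) ≤ ∑ X (λ n → F n * r X n)
    sum-squares F Q {X} 0≤F Q²≤X = ≤-trans (go Q Q²≤X) (∑-mono-range Q²≤X (λ n h n≤X → *-≥0 (0≤F n) (0≤r (ℕₚ.≤-trans (s≤s z≤n) h) n≤X)))
      where
      go : ∀ Q → Q ℕ.* Q ℕ.≤ X → ∑ Q (λ m → F (m ℕ.* m)) ≤ ∑ (Q ℕ.* Q) (λ n → F n * r X n)
      go zero _ = ≤-refl
      go (suc Q) h = ≤-trans (+-mono-≤ (≤-trans (go Q (ℕₚ.≤-trans Q²≤ h')) (∑-mono-range Q²≤ (λ n a b → *-≥0 (0≤F n) (0≤r (ℕₚ.≤-trans (s≤s z≤n) a) (ℕₚ.≤-trans b h')))))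
          (≤-trans (≤-reflexive (sym (*-identityʳ (F (suc Q ℕ.* suc Q))))) (*-monoˡ (0≤F (suc Q ℕ.* suc Q)) (1≤r-square {m = suc Q} (s≤s z≤n) h)))) ≤-refl
        where
        Q²≤ : Q ℕ.* Q ℕ.≤ Q ℕ.+ Q ℕ.* suc Q
        Q²≤ = ℕₚ.≤-trans (ℕₚ.*-monoʳ-≤ Q (ℕₚ.n≤1+n Q)) (ℕₚ.m≤n+m (Q ℕ.* suc Q) Q)
        h' : Q ℕ.+ Q ℕ.* suc Q ℕ.≤ X
        h' = ℕₚ.≤-trans (ℕₚ.n≤1+n (Q ℕ.+ Q ℕ.* suc Q)) h

    -- For k ≤ K the expansion of `ramp-error` is used, for k > K Abel summation, as `ramp X`
    -- decreases. The term d X²/K arises in two halves: from that Abel tail, and from extending Σ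
    -- χ(k)/k from K to N.
    module Upper (X K N u v : ℕ) (X≡ : X ≡ K ℕ.+ u) (N≡ : N ≡ K ℕ.+ v) (1≤K : 1 ℕ.≤ K) (K≤X : K ℕ.≤ X) where
      x S₁ S₂ : ℚ
      x = ι X
      S₁ = ∑ K (λ k → χ k * rec k)
      S₂ = ∑ v (λ i → χ (K ℕ.+ i) * rec (K ℕ.+ i))
      start : ∑ X (λ n → ι (X ℕ.∸ n) * r X n) ≡ ∑ K (λ k → χ k * ramp X k) + ∑ u (λ i → χ (K ℕ.+ i) * ramp X (K ℕ.+ i))
      start = trans (hyperbola {X} ℕₚ.≤-refl (λ n → ι (X ℕ.∸ n)) χ) (trans (∑-cong X (λ k 1≤k _ → cong (χ k *_) (sym (ramp≡ X 1≤k))))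
        (trans (cong (λ t → ∑ t (λ k → χ k * ramp X k)) X≡) (∑-split K u (λ k → χ k * ramp X k))))
      0≤½ : 0ℚ ≤ ½
      0≤½ = *≤* (ℤ.+≤+ z≤n)
      0≤hx : 0ℚ ≤ ½ * (x * x)
      0≤hx = *-≥0 0≤½ (*-≥0 (0≤ι X) (0≤ι X))
      lem : ∀ h a b m e t → h * (a + b) + (h * t + (h * t + (m + e))) ≡ h * a + (m + e) + h * t + (h * t - h * - b)
      lem = RS.solve-∀ ℚring
      lem2 : ∀ x d r m e → ½ * (x * x) * (d * 1ℚ * r) + (½ * (x * x) * (d * 1ℚ * r) + (m + e)) ≡ d * (x * x) * r + m + e
      lem2 = RS.solve-∀ ℚring
      end : ½ * (x * x) * (S₁ + S₂) + (½ * (x * x) * (ι d * 1ℚ * rec K) + (½ * (x * x) * (ι d * 1ℚ * rec K) + (½ * x * ι d + ½ * (ι K * ι K)))) ≡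
        ½ * (x * x) * ∑ N (λ k → χ k * rec k) + (ι d * (x * x) * rec K + ½ * x * ι d + ½ * (ι K * ι K))
      end = cong₂ (λ a b → ½ * (x * x) * a + b) (sym (trans (cong (λ t → ∑ t (λ k → χ k * rec k)) N≡) (∑-split K v (λ k → χ k * rec k)))) (lem2 x (ι d) (rec K) (½ * x * ι d) (½ * (ι K * ι K)))
      eₖ : ℕ → ℚ
      eₖ k = ramp X k - (½ * (x * x) * rec k - ½ * x)
      ∣eₖ∣ : ∀ k → 1 ℕ.≤ k → ∣ eₖ k ∣ ≤ ½ * ι k
      ∣eₖ∣ k 1≤k = bound-by (ramp-error X {k} 1≤k)
        where
        lem3 : ∀ a b → a + b - a ≡ b
        lem3 = RS.solve-∀ ℚring
        bound-by : (∃ λ e → ramp X k ≡ ½ * (x * x) * rec k - ½ * x + e × 0ℚ ≤ e × e ≤ ½ * ι k) → ∣ eₖ k ∣ ≤ ½ * ι k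
        bound-by (e , eq , 0≤e , e≤) = ≤-trans (≤-reflexive (trans (cong ∣_∣ (trans (cong (λ z → z - (½ * (x * x) * rec k - ½ * x)) eq) (lem3 (½ * (x * x) * rec k - ½ * x) e))) (ℚₚ.0≤p⇒∣p∣≡p 0≤e))) e≤
      head : ∑ K (λ k → χ k * ramp X k) ≡ ½ * (x * x) * ∑ K (λ k → χ k * rec k) + (∑ K (λ k → χ k * (- (½ * x))) + ∑ K (λ k → χ k * eₖ k))
      head = trans (∑-cong K (λ k _ _ → lem4 (χ k) (ramp X k) (½ * (x * x)) (rec k) (½ * x))) (trans (∑-+ K (λ k → ½ * (x * x) * (χ k * rec k)) (λ k → χ k * (- (½ * x)) + χ k * eₖ k))
        (cong₂ _+_ (∑-*ˡ K (½ * (x * x)) (λ k → χ k * rec k)) (∑-+ K (λ k → χ k * (- (½ * x))) (λ k → χ k * eₖ k))))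
        where
        lem4 : ∀ c f h r q → c * f ≡ h * (c * r) + (c * (- q) + c * (f - (h * r - q)))
        lem4 = RS.solve-∀ ℚring
      mid : ∣ ∑ K (λ k → χ k * (- (½ * x))) ∣ ≤ ½ * x * ι d
      mid = ≤-trans (≤-reflexive (cong ∣_∣ (∑-*ʳ K (- (½ * x)) χ))) (≤-trans (∣*∣≤ (interval≤ χ-osc 1≤d 0 K) (≤-reflexive (trans (ℚₚ.∣-p∣≡∣p∣ (½ * x)) (ℚₚ.0≤p⇒∣p∣≡p (*-≥0 0≤½ (0≤ι X)))))) (≤-reflexive (lem5 (ι d) (½ * x))))
        where
        lem5 : ∀ a b → a * 1ℚ * b ≡ b * a
        lem5 = RS.solve-∀ ℚring
      err : ∣ ∑ K (λ k → χ k * eₖ k) ∣ ≤ ½ * (ι K * ι K)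
      err = ≤-trans (∣∑∣≤ K (λ k 1≤k k≤K → ≤-trans (∣*∣≤ (bounded χ-osc k) (∣eₖ∣ k 1≤k)) (≤-trans (≤-reflexive (*-identityˡ (½ * ι k))) (*-monoˡ 0≤½ (ι-mono k≤K))))) (≤-reflexive (trans (∑-const K (½ * ι K)) (lem6 (ι K))))
        where
        lem6 : ∀ a → a * (½ * a) ≡ ½ * (a * a)
        lem6 = RS.solve-∀ ℚring
      tail₁ : ∣ ∑ u (λ i → χ (K ℕ.+ i) * ramp X (K ℕ.+ i)) ∣ ≤ ½ * (x * x) * (ι d * 1ℚ * rec K)
      tail₁ = ≤-trans (abel u (λ i → χ (K ℕ.+ i)) (λ i → ramp X (K ℕ.+ i)) (interval≤ χ-osc 1≤d K) (λ i _ → ∑-≥0 X (λ m _ _ → 0≤ι (X ℕ.∸ (K ℕ.+ i) ℕ.* m)))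
          (λ i _ → subst (λ t → ramp X t ≤ ramp X (K ℕ.+ i)) (sym (ℕₚ.+-suc K i)) (ramp-anti X (K ℕ.+ i))))
        (≤-trans (*-monoˡ (*-≥0 (0≤ι d) 0≤1) (≤-trans (subst (λ t → ramp X t ≤ ramp X K) (ℕₚ.+-comm 1 K) (ramp-anti X K)) ramp≤)) (≤-reflexive (lem7 (ι d) (½ * (x * x)) (rec K))))
        where
        lem7 : ∀ a b c → a * 1ℚ * (b * c) ≡ b * (a * 1ℚ * c)
        lem7 = RS.solve-∀ ℚring
        ramp≤ : ramp X K ≤ ½ * (x * x) * rec K
        ramp≤ = bound-by (ramp-error X {K} 1≤K)
          where
          lem8 : ∀ a b → a - b + b ≡ a
          lem8 = RS.solve-∀ ℚring
          bound-by : (∃ λ e → ramp X K ≡ ½ * (x * x) * rec K - ½ * x + e × 0ℚ ≤ e × e ≤ ½ * ι K) → ramp X K ≤ ½ * (x * x) * rec K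
          bound-by (e , eq , _ , e≤) = ≤-trans (≤-reflexive eq) (≤-trans (+ˡ (½ * (x * x) * rec K - ½ * x) (≤-trans e≤ (*-monoˡ 0≤½ (ι-mono K≤X)))) (≤-reflexive (lem8 (½ * (x * x) * rec K) (½ * x))))
      tail₂ : ∣ ∑ v (λ i → χ (K ℕ.+ i) * rec (K ℕ.+ i)) ∣ ≤ ι d * 1ℚ * rec K
      tail₂ = ≤-trans (osc-tail χ-osc 1≤d K v) (*-monoˡ (*-≥0 (0≤ι d) 0≤1) (rec-anti 1≤K (ℕₚ.n≤1+n K)))
      bound : ∑ X (λ n → ι (X ℕ.∸ n) * r X n) ≤ ½ * (x * x) * ∑ N (λ k → χ k * rec k) + (ι d * (x * x) * rec K + ½ * x * ι d + ½ * (ι K * ι K))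
      bound = ≤-trans (≤-reflexive start) (≤-trans (+-mono-≤ (≤-reflexive head) (proj₁ (∣∣≤⇒ tail₁)))
          (≤-trans (+ʳ (½ * (x * x) * (ι d * 1ℚ * rec K)) (+ˡ (½ * (x * x) * S₁) (+-mono-≤ (proj₁ (∣∣≤⇒ mid)) (proj₁ (∣∣≤⇒ err)))))
            (≤-trans (≤-by (diff≥0 (*-monoˡ 0≤hx (proj₂ (∣∣≤⇒ tail₂)))) (lem (½ * (x * x)) S₁ S₂ (½ * x * ι d) (½ * (ι K * ι K)) (ι d * 1ℚ * rec K)))
              (≤-reflexive end))))

  -- In terms of n = 3d, take K = 16n⁴, X = 64n⁶ and Q = 4n³. Then X = 4Q², so the squares m² with m
  -- ≤ Q have weight at least 3Q² and contribute 3Q³ = 192n⁹ = 576dn⁸. The errors are 256dn⁸ + 128n⁸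
  -- + 32dn⁶ ≤ 512dn⁸. The remaining c = 64dn⁸ is compared with ½X² S = 2048n¹² S, and the quotient
  -- 32n⁴/d is the constant 32 · 81 d³.
  L1-lower : ∀ {N} → 16 ℕ.* ((3 ℕ.* d) ℕ.* (3 ℕ.* d) ℕ.* ((3 ℕ.* d) ℕ.* (3 ℕ.* d))) ℕ.≤ N → 1ℚ ≤ ι 32 * ι 81 * (ι d * ι d * ι d) * ∑ N (λ k → χ k * rec k)
  L1-lower {N} K≤N = *-cancelˡ 0<c (cancel E (≤-trans (+ˡ (c * 1ℚ) E≤) (≤-trans (≤-reflexive low≡) (≤-trans low (≤-trans up (≤-reflexive up≡))))))
    where
    n K Yₙ X Q : ℕ
    n = 3 ℕ.* d
    Yₙ = 4 ℕ.* (n ℕ.* n)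
    K = 16 ℕ.* (n ℕ.* n ℕ.* (n ℕ.* n))
    X = Yₙ ℕ.* K
    Q = 4 ℕ.* (n ℕ.* n ℕ.* n)
    δ σ S E c : ℚ
    δ = ι d
    σ = ι n
    S = ∑ N (λ k → χ k * rec k)
    E = δ * (ι X * ι X) * rec K + ½ * ι X * δ + ½ * (ι K * ι K)
    c = ι 64 * δ * (σ * σ * (σ * σ) * (σ * σ * (σ * σ)))
    1≤n : 1 ℕ.≤ n
    1≤n = ℕₚ.*-mono-≤ {1} {3} (s≤s z≤n) 1≤d
    1≤K : 1 ℕ.≤ K
    1≤K = ℕₚ.*-mono-≤ {1} {16} (s≤s z≤n) (ℕₚ.*-mono-≤ (ℕₚ.*-mono-≤ 1≤n 1≤n) (ℕₚ.*-mono-≤ 1≤n 1≤n))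
    K≤X : K ℕ.≤ X
    K≤X = ℕₚ.m≤n*m K Yₙ {{ℕ.>-nonZero (ℕₚ.*-mono-≤ {1} {4} (s≤s z≤n) (ℕₚ.*-mono-≤ 1≤n 1≤n))}}
    σ≡ : σ ≡ ι 3 * δ
    σ≡ = ι-* 3 d
    0<c : 0ℚ < c
    0<c = subst (0ℚ <_) (trans (ι-* (64 ℕ.* d) (n ℕ.* n ℕ.* (n ℕ.* n) ℕ.* (n ℕ.* n ℕ.* (n ℕ.* n)))) (cong₂ _*_ (ι-* 64 d) (trans (ι-* (n ℕ.* n ℕ.* (n ℕ.* n)) _) (cong₂ _*_ n⁴ n⁴))))
        (0<ι (ℕₚ.*-mono-≤ (ℕₚ.*-mono-≤ {1} {64} (s≤s z≤n) 1≤d) (ℕₚ.*-mono-≤ (ℕₚ.*-mono-≤ (ℕₚ.*-mono-≤ 1≤n 1≤n) (ℕₚ.*-mono-≤ 1≤n 1≤n)) (ℕₚ.*-mono-≤ (ℕₚ.*-mono-≤ 1≤n 1≤n) (ℕₚ.*-mono-≤ 1≤n 1≤n)))))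
      where
      n⁴ : ι (n ℕ.* n ℕ.* (n ℕ.* n)) ≡ σ * σ * (σ * σ)
      n⁴ = trans (ι-* (n ℕ.* n) (n ℕ.* n)) (cong₂ _*_ (ι-* n n) (ι-* n n))
    ιK : ι K ≡ ι 16 * (σ * σ * (σ * σ))
    ιK = trans (ι-* 16 (n ℕ.* n ℕ.* (n ℕ.* n))) (cong (ι 16 *_) (trans (ι-* (n ℕ.* n) (n ℕ.* n)) (cong₂ _*_ (ι-* n n) (ι-* n n))))
    ιX : ι X ≡ ι 4 * (σ * σ) * ι K
    ιX = trans (ι-* Yₙ K) (cong (_* ι K) (trans (ι-* 4 (n ℕ.* n)) (cong (ι 4 *_) (ι-* n n))))
    ιX' : ι X ≡ ι 4 * (σ * σ) * (ι 16 * (σ * σ * (σ * σ)))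
    ιX' = trans ιX (cong (ι 4 * (σ * σ) *_) ιK)
    ιQ : ι Q ≡ ι 4 * (σ * σ * σ)
    ιQ = trans (ι-* 4 (n ℕ.* n ℕ.* n)) (cong (ι 4 *_) (trans (ι-* (n ℕ.* n) n) (cong (_* σ) (ι-* n n))))
    X≡4QQ : X ≡ Q ℕ.* Q ℕ.+ 3 ℕ.* (Q ℕ.* Q)
    X≡4QQ = lem n
      where
      lem : ∀ n → 4 ℕ.* (n ℕ.* n) ℕ.* (16 ℕ.* (n ℕ.* n ℕ.* (n ℕ.* n))) ≡ 4 ℕ.* (n ℕ.* n ℕ.* n) ℕ.* (4 ℕ.* (n ℕ.* n ℕ.* n)) ℕ.+ 3 ℕ.* (4 ℕ.* (n ℕ.* n ℕ.* n) ℕ.* (4 ℕ.* (n ℕ.* n ℕ.* n)))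
      lem = ℕS.solve-∀
    Q²≤X : Q ℕ.* Q ℕ.≤ X
    Q²≤X = subst (Q ℕ.* Q ℕ.≤_) (sym X≡4QQ) (ℕₚ.m≤m+n (Q ℕ.* Q) (3 ℕ.* (Q ℕ.* Q)))
    low : ι Q * (ι 3 * (ι Q * ι Q)) ≤ ∑ X (λ n → ι (X ℕ.∸ n) * r X n)
    low = ≤-trans (≤-trans (≤-reflexive (trans (cong (ι Q *_) (sym (trans (ι-* 3 (Q ℕ.* Q)) (cong (ι 3 *_) (ι-* Q Q))))) (sym (∑-const Q (ι (3 ℕ.* (Q ℕ.* Q)))))))
        (∑-mono Q (λ m _ m≤Q → ι-mono (subst (ℕ._≤ X ℕ.∸ m ℕ.* m) (trans (cong (ℕ._∸ Q ℕ.* Q) X≡4QQ) (ℕₚ.m+n∸m≡n (Q ℕ.* Q) (3 ℕ.* (Q ℕ.* Q)))) (ℕₚ.∸-monoʳ-≤ X (ℕₚ.*-mono-≤ m≤Q m≤Q))))))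
      (sum-squares (λ n → ι (X ℕ.∸ n)) Q (λ n → 0≤ι (X ℕ.∸ n)) Q²≤X)
    up : ∑ X (λ n → ι (X ℕ.∸ n) * r X n) ≤ ½ * (ι X * ι X) * S + E
    up = Upper.bound X K N (X ℕ.∸ K) (N ℕ.∸ K) (sym (ℕₚ.m+[n∸m]≡n K≤X)) (sym (ℕₚ.m+[n∸m]≡n K≤N)) 1≤K K≤X
    up≡ : ½ * (ι X * ι X) * S + E ≡ c * (ι 32 * ι 81 * (δ * δ * δ) * S) + E
    up≡ = cong (_+ E) (trans (cong (λ x → ½ * (x * x) * S) ιX') (trans (cong (λ s → ½ * (ι 4 * (s * s) * (ι 16 * (s * s * (s * s))) * (ι 4 * (s * s) * (ι 16 * (s * s * (s * s))))) * S) σ≡)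
        (trans (lem δ S) (cong (λ s → ι 64 * δ * (s * s * (s * s) * (s * s * (s * s))) * (ι 32 * ι 81 * (δ * δ * δ) * S)) (sym σ≡)))))
      where
      lem : ∀ a S → ½ * (ι 4 * (ι 3 * a * (ι 3 * a)) * (ι 16 * (ι 3 * a * (ι 3 * a) * (ι 3 * a * (ι 3 * a)))) * (ι 4 * (ι 3 * a * (ι 3 * a)) * (ι 16 * (ι 3 * a * (ι 3 * a) * (ι 3 * a * (ι 3 * a)))))) * S ≡
        ι 64 * a * (ι 3 * a * (ι 3 * a) * (ι 3 * a * (ι 3 * a)) * (ι 3 * a * (ι 3 * a) * (ι 3 * a * (ι 3 * a)))) * (ι 32 * ι 81 * (a * a * a) * S)
      lem = RS.solve-∀ ℚring
    low≡ : c * 1ℚ + ι 512 * δ * (σ * σ * (σ * σ) * (σ * σ * (σ * σ))) ≡ ι Q * (ι 3 * (ι Q * ι Q))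
    low≡ = trans (cong (λ s → ι 64 * δ * (s * s * (s * s) * (s * s * (s * s))) * 1ℚ + ι 512 * δ * (s * s * (s * s) * (s * s * (s * s)))) σ≡)
        (trans (lem δ) (trans (cong (λ s → ι 4 * (s * s * s) * (ι 3 * (ι 4 * (s * s * s) * (ι 4 * (s * s * s))))) (sym σ≡)) (cong (λ q → q * (ι 3 * (q * q))) (sym ιQ))))
      where
      lem : ∀ a → ι 64 * a * (ι 3 * a * (ι 3 * a) * (ι 3 * a * (ι 3 * a)) * (ι 3 * a * (ι 3 * a) * (ι 3 * a * (ι 3 * a)))) * 1ℚ + ι 512 * a * (ι 3 * a * (ι 3 * a) * (ι 3 * a * (ι 3 * a)) * (ι 3 * a * (ι 3 * a) * (ι 3 * a * (ι 3 * a)))) ≡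
        ι 4 * (ι 3 * a * (ι 3 * a) * (ι 3 * a)) * (ι 3 * (ι 4 * (ι 3 * a * (ι 3 * a) * (ι 3 * a)) * (ι 4 * (ι 3 * a * (ι 3 * a) * (ι 3 * a)))))
      lem = RS.solve-∀ ℚring
    E≤ : E ≤ ι 512 * δ * (σ * σ * (σ * σ) * (σ * σ * (σ * σ)))
    E≤ = ≤-by {s = gap} 0≤gap (trans (lem δ (σ * σ)) (cong (_+ gap) (sym E≡)))
      where
      a gap : ℚ
      a = σ * σ
      gap = ι 128 * (a * a * (a * a)) * (δ - 1ℚ) + ι 32 * δ * (a * a * a) * (a - 1ℚ + ι 3 * a)
      0≤a : 0ℚ ≤ a
      0≤a = *-≥0 (0≤ι n) (0≤ι n)
      1≤a : 1ℚ ≤ a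
      1≤a = *-mono {1ℚ} {σ} {1ℚ} {σ} 0≤1 0≤1 (1≤ι 1≤n) (1≤ι 1≤n)
      0≤gap : 0ℚ ≤ gap
      0≤gap = +-≥0 (*-≥0 (*-≥0 (0≤ι 128) (*-≥0 (*-≥0 0≤a 0≤a) (*-≥0 0≤a 0≤a))) (diff≥0 (1≤ι 1≤d)))
        (*-≥0 (*-≥0 (*-≥0 (0≤ι 32) (0≤ι d)) (*-≥0 (*-≥0 0≤a 0≤a) 0≤a)) (+-≥0 (diff≥0 1≤a) (*-≥0 (0≤ι 3) 0≤a)))
      E≡ : E ≡ δ * (ι 4 * a * (ι 4 * a) * (ι 16 * (a * a))) + ½ * (ι 4 * a * (ι 16 * (a * a))) * δ + ½ * (ι 16 * (a * a) * (ι 16 * (a * a)))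
      E≡ = cong₂ _+_ (cong₂ _+_ (trans (cong (λ x → δ * (x * x) * rec K) ιX) (trans (lem1 δ (ι 4 * a) (ι K) (rec K)) (trans (cong (λ t → δ * (ι 4 * a * (ι 4 * a) * (ι K * t))) (rec-ι 1≤K)) (cong (λ t → δ * (ι 4 * a * (ι 4 * a) * t)) (trans (*-identityʳ (ι K)) ιK)))))
        (cong (λ x → ½ * x * δ) ιX')) (cong (λ k → ½ * (k * k)) ιK)
        where
        lem1 : ∀ d b k r → d * (b * k * (b * k)) * r ≡ d * (b * b * (k * (r * k)))
        lem1 = RS.solve-∀ ℚring
      lem : ∀ d a → ι 512 * d * (a * a * (a * a)) ≡ d * (ι 4 * a * (ι 4 * a) * (ι 16 * (a * a))) + ½ * (ι 4 * a * (ι 16 * (a * a))) * d + ½ * (ι 16 * (a * a) * (ι 16 * (a * a)))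
        + (ι 128 * (a * a * (a * a)) * (d - 1ℚ) + ι 32 * d * (a * a * a) * (a - 1ℚ + ι 3 * a))
      lem = RS.solve-∀ ℚring
    cancel : ∀ e {a b} → a + e ≤ b + e → a ≤ b
    cancel e {a} {b} h = ≤-trans (≤-reflexive (lem a e)) (≤-trans (+ʳ (- e) h) (≤-reflexive (sym (lem b e))))
      where
      lem : ∀ a e → a ≡ a + e + - e
      lem = RS.solve-∀ ℚring

-- Densities on the unit classes that miss the class a.

-- A record, to keep the numeral from being unfolded whenever a context is normalised.
record Tiny (d : ℕ) (η : ℚ) : Set where
  constructor tiny
  field
    0≤η : 0ℚ ≤ η
    η-small : ι 100 * (ι d * ι d * ι d * η) ≤ 1ℚ

module Endgame (d : ℕ) {{d≢0 : ℕ.NonZero d}} (η : ℚ) (η-tiny : Tiny d η) (a : ℕ) where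
  open Classes d
  open Tiny η-tiny

  private
    δ : ℚ
    δ = ι d
    1≤d : 1 ℕ.≤ d
    1≤d = ℕ.>-nonZero⁻¹ d
    1≤δ : 1ℚ ≤ δ
    1≤δ = 1≤ι 1≤d
    0≤δ : 0ℚ ≤ δ
    0≤δ = 0≤ι d
    0≤φ : 0ℚ ≤ φ
    0≤φ = ≤-trans 0≤1 1≤φ
    0≤𝕖 : ∀ b n → 0ℚ ≤ 𝕖 b n
    0≤𝕖 b n = 0≤𝟙 (n ℕ.% d ℕₚ.≟ b ℕ.% d)

  conv : (ℕ → ℚ) → (ℕ → ℚ) → ℕ → ℚ
  conv F G b = ∑ d (λ t → ∑ d (λ s → 𝕖 b (t ℕ.* s) * (F t * G s)))

  conv-comm : ∀ F G b → conv F G b ≡ conv G F b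
  conv-comm F G b = trans (∑-swap d d (λ t s → 𝕖 b (t ℕ.* s) * (F t * G s))) (∑-cong d (λ s _ _ → ∑-cong d (λ t _ _ → cong₂ (λ x y → 𝕖 b x * y) (ℕₚ.*-comm t s) (*-comm (F t) (G s)))))

  -- A mass distribution whose φ-fold is at most 2+η on every unit class and which misses the class a.
  record Density (p : ℕ → ℚ) : Set where
    field
      nonneg : ∀ t → 0ℚ ≤ p t
      le : ∀ t → Unit t → φ * p t ≤ ι 2 + η
      mass≤ : ∑ d (λ t → 𝕦 t * p t) ≤ 1ℚ + η
      mass≥ : 1ℚ - η ≤ ∑ d (λ t → 𝕦 t * p t)
      miss : p a ≤ η
      cong-≋ : Periodic p
  open Density public

  -- The Selberg-type identity after normalisation; p belongs to the smaller scale and q to the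
  -- larger.
  record Pair (p q : ℕ → ℚ) : Set where
    field
      lower : ∀ b → Unit b → ι 2 - η ≤ φ * (q b + conv p q b)
      upper : ∀ b → Unit b → φ * (q b + conv p q b) ≤ ι 2 + η
  open Pair public

  η≤1 : η ≤ 1ℚ
  η≤1 = ≤-trans (≤-by {η} {ι 100 * (δ * δ * δ * η)} (+-≥0 (*-≥0 (diff≥0 1≤δ³) 0≤η) (*-≥0 (0≤ι 99) (*-≥0 0≤δ³ 0≤η))) (lem (δ * δ * δ) η)) η-small
    where
    1≤δ² : 1ℚ ≤ δ * δ
    1≤δ² = *-mono {1ℚ} {δ} {1ℚ} {δ} 0≤1 0≤1 1≤δ 1≤δ
    1≤δ³ : 1ℚ ≤ δ * δ * δ
    1≤δ³ = *-mono {1ℚ} {δ * δ} {1ℚ} {δ} 0≤1 0≤1 1≤δ² 1≤δ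
    0≤δ³ : 0ℚ ≤ δ * δ * δ
    0≤δ³ = ≤-trans 0≤1 1≤δ³
    lem : ∀ x e → ι 100 * (x * e) ≡ e + ((x - 1ℚ) * e + ι 99 * (x * e))
    lem = RS.solve-∀ ℚring

  private
    -- Over all factorisations ts ≡ b, the nonnegative terms F(t)(2 + η - φ G(s)) add up to (2 + η)
    -- times the mass of F minus φ times the convolution at b. If that convolution nearly attains
    -- its maximum the total is small, and each single term with it.
    term : ∀ {F G} → (∀ t → 0ℚ ≤ F t) → (∀ s → Unit s → φ * G s ≤ ι 2 + η) → ∑ d (λ t → 𝕦 t * F t) ≤ 1ℚ + η →
      ∀ {t s b} ℓ → Unit b → 1 ℕ.≤ t → t ℕ.≤ d → 1 ℕ.≤ s → s ℕ.≤ d → t ℕ.* s ≋ b → ℓ ≤ φ * conv F G b →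
      F t * (ι 2 + η - φ * G s) ≤ (ι 2 + η) * (1ℚ + η) - ℓ
    term {F} {G} 0≤F G≤ mass {t} {s} {b} ℓ cb 1≤t t≤d 1≤s s≤d e h =
      ≤-trans (≤-reflexive (sym (trans (cong (_* (F t * (c - φ * G s))) (𝟙-yes ((t ℕ.* s) ℕ.% d ℕₚ.≟ b ℕ.% d) e)) (*-identityˡ (F t * (c - φ * G s))))))
      (≤-trans (term≤∑ d {λ s → K t s} (λ s _ _ → 0≤K t s) 1≤s s≤d)
      (≤-trans (term≤∑ d {λ t → ∑ d (λ s → K t s)} (λ t _ _ → ∑-≥0 d (λ s _ _ → 0≤K t s)) 1≤t t≤d)
      (≤-trans (≤-reflexive total) (+-mono-≤ (*-monoˡ 0≤c mass) (ℚₚ.neg-antimono-≤ h)))))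
      where
      c : ℚ
      c = ι 2 + η
      0≤c : 0ℚ ≤ c
      0≤c = +-≥0 (0≤ι 2) 0≤η
      K : ℕ → ℕ → ℚ
      K t s = 𝕖 b (t ℕ.* s) * (F t * (c - φ * G s))
      0≤K : ∀ t s → 0ℚ ≤ K t s
      0≤K t s with unit? (t ℕ.* s)
      ... | yes u = *-≥0 (0≤𝕖 b (t ℕ.* s)) (*-≥0 (0≤F t) (diff≥0 (G≤ s (unit-*ʳ {t} {s} u))))
      ... | no ¬u = ≤-reflexive (sym (trans (cong (_* (F t * (c - φ * G s))) (𝕖-0 cb ¬u)) (*-zeroˡ (F t * (c - φ * G s)))))
      lem : ∀ e f c p g → e * (f * (c - p * g)) ≡ c * f * e - p * (e * (f * g))
      lem = RS.solve-∀ ℚring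
      total : ∑ d (λ t → ∑ d (λ s → K t s)) ≡ c * ∑ d (λ t → 𝕦 t * F t) - φ * conv F G b
      total = trans (∑-cong d (λ t _ _ → trans (∑-cong d (λ s _ _ → lem (𝕖 b (t ℕ.* s)) (F t) c φ (G s)))
          (trans (∑-- d (λ s → c * F t * 𝕖 b (t ℕ.* s)) (λ s → φ * (𝕖 b (t ℕ.* s) * (F t * G s)))) (cong₂ _-_ (trans (∑-*ˡ d (c * F t) (λ s → 𝕖 b (t ℕ.* s))) (trans (cong (c * F t *_) (∑-𝕖-unit t cb)) (lem2 c (F t) (𝕦 t)))) (∑-*ˡ d φ (λ s → 𝕖 b (t ℕ.* s) * (F t * G s)))))))
        (trans (∑-- d (λ t → c * (𝕦 t * F t)) (λ t → φ * ∑ d (λ s → 𝕖 b (t ℕ.* s) * (F t * G s)))) (cong₂ _-_ (∑-*ˡ d c (λ t → 𝕦 t * F t)) (∑-*ˡ d φ (λ t → ∑ d (λ s → 𝕖 b (t ℕ.* s) * (F t * G s))))))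
        where
        lem2 : ∀ a b c → a * b * c ≡ a * (c * b)
        lem2 = RS.solve-∀ ℚring

    -- If the density q is small at b = ts, then p(t) is small or φ q(s) is close to 2.
    gap : ∀ {p q} → Density p → Density q → Pair p q → ∀ {t s b} τ → Unit b → 1 ℕ.≤ t → t ℕ.≤ d → 1 ℕ.≤ s → s ℕ.≤ d → t ℕ.* s ≋ b → φ * q b ≤ τ →
      (p t * (ι 2 + η - φ * q s) ≤ ι 5 * η + τ) × (q s * (ι 2 + η - φ * p t) ≤ ι 5 * η + τ)
    gap {p} {q} dp dq pr {t} {s} {b} τ cb 1≤t t≤d 1≤s s≤d e small =
        ≤-trans (term (nonneg dp) (le dq) (mass≤ dp) (ι 2 - η - τ) cb 1≤t t≤d 1≤s s≤d e low) fin ,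
        ≤-trans (term (nonneg dq) (le dp) (mass≤ dq) (ι 2 - η - τ) cb 1≤s s≤d 1≤t t≤d (trans (cong (ℕ._% d) (ℕₚ.*-comm s t)) e) (≤-trans low (≤-reflexive (cong (φ *_) (conv-comm p q b))))) fin
      where
      low : ι 2 - η - τ ≤ φ * conv p q b
      low = ≤-trans (+-mono-≤ (lower pr b cb) (ℚₚ.neg-antimono-≤ small)) (≤-reflexive (lem φ (q b) (conv p q b)))
        where
        lem : ∀ f x y → f * (x + y) - f * x ≡ f * y
        lem = RS.solve-∀ ℚring
      fin : (ι 2 + η) * (1ℚ + η) - (ι 2 - η - τ) ≤ ι 5 * η + τ
      fin = ≤-by (*-≥0 0≤η (diff≥0 η≤1)) (lem η τ)
        where
        lem : ∀ e t → ι 5 * e + t ≡ (ι 2 + e) * (1ℚ + e) - (ι 2 - e - t) + e * (1ℚ - e)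
        lem = RS.solve-∀ ℚring

    -- The bound of `gap` at the class a, where missing it gives τ = d η.
    R : ℚ
    R = ι 5 * η + δ * η

    0≤R : 0ℚ ≤ R
    0≤R = +-≥0 (*-≥0 (0≤ι 5) 0≤η) (*-≥0 0≤δ 0≤η)

    -- everything in sight is at most 11 δ³ η ≤ 11/100
    R-small : δ * (ι 5 * η + δ * R) ≤ rec 8
    R-small = *-cancelˡ {c = ι 100} (0<ι {100} (s≤s z≤n)) (≤-trans (≤-by {s = ι 5 * ι 100 * (δ * (δ - 1ℚ) * (δ + 1ℚ)) * η + ι 5 * ι 100 * (δ * δ * (δ - 1ℚ)) * η}
        (+-≥0 (*-≥0 (*-≥0 (*-≥0 (0≤ι 5) (0≤ι 100)) (*-≥0 (*-≥0 0≤δ (diff≥0 1≤δ)) (+-≥0 0≤δ 0≤1))) 0≤η) (*-≥0 (*-≥0 (*-≥0 (0≤ι 5) (0≤ι 100)) (*-≥0 (*-≥0 0≤δ 0≤δ) (diff≥0 1≤δ))) 0≤η)) (lem δ η))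
      (≤-trans (*-monoˡ {c = ι 11} (0≤ι 11) η-small) (*≤* (ℤ.+≤+ (ℕₚ.≤ᵇ⇒≤ _ _ _)))))
      where
      lem : ∀ d e → ι 11 * (ι 100 * (d * d * d * e)) ≡ ι 100 * (d * (ι 5 * e + d * (ι 5 * e + d * e))) + (ι 5 * ι 100 * (d * (d - 1ℚ) * (d + 1ℚ)) * e + ι 5 * ι 100 * (d * d * (d - 1ℚ)) * e)
      lem = RS.solve-∀ ℚring

  -- The threshold lies halfway between 0 and 2, the only values that φ q will turn out to approach.
  Dense : (ℕ → ℚ) → ℕ → Set
  Dense q s = 1ℚ < φ * q s

  private
    rec8≤1 : rec 8 ≤ 1ℚ
    rec8≤1 = rec≤1 8

    1<2-8 : 1ℚ < ι 2 - rec 8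
    1<2-8 = from-yes (1ℚ ℚₚ.<? (ι 2 - rec 8))

    0≤5η+δR : 0ℚ ≤ ι 5 * η + δ * R
    0≤5η+δR = +-≥0 (*-≥0 (0≤ι 5) 0≤η) (*-≥0 0≤δ 0≤R)

    ≤δ* : ∀ {x} → 0ℚ ≤ x → x ≤ δ * x
    ≤δ* {x} 0≤x = ≤-trans (≤-reflexive (sym (*-identityˡ x))) (*-monoʳ 0≤x 1≤δ)

    5η+δR≤ : ι 5 * η + δ * R ≤ rec 8
    5η+δR≤ = ≤-trans (≤δ* 0≤5η+δR) R-small

    δR≤ : δ * R ≤ rec 8
    δR≤ = ≤-trans (≤-trans (≤-+ (δ * R) (*-≥0 (0≤ι 5) 0≤η)) (≤-reflexive (+-comm (δ * R) (ι 5 * η)))) 5η+δR≤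

    η≤ : η ≤ rec 8
    η≤ = ≤-trans (≤-by {η} {ι 5 * η + δ * R} {ι 4 * η + δ * R} (+-≥0 (*-≥0 (0≤ι 4) 0≤η) (*-≥0 0≤δ 0≤R)) (lem η (δ * R))) 5η+δR≤
      where
      lem : ∀ e r → ι 5 * e + r ≡ e + (ι 4 * e + r)
      lem = RS.solve-∀ ℚring

    push : ∀ {x y S} → φ * x ≤ ι 2 + η → 1ℚ < φ * y → 0ℚ ≤ S → y * (ι 2 + η - φ * x) ≤ S → ι 2 - δ * S ≤ φ * x
    push {x} {y} {S} hx hy 0≤S h = ≤-trans (≤-by {s = η + (δ * S - (ι 2 + η - φ * x))} (+-≥0 0≤η (diff≥0 le₁)) (lem (φ * x) η (δ * S))) ≤-refl
      where
      lem : ∀ f e s → f ≡ ι 2 - s + (e + (s - (ι 2 + e - f)))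
      lem = RS.solve-∀ ℚring
      le₁ : ι 2 + η - φ * x ≤ δ * S
      le₁ = ≤-trans (≤-reflexive (sym (*-identityˡ (ι 2 + η - φ * x)))) (≤-trans (*-monoʳ (diff≥0 hx) (<⇒≤ hy))
        (≤-trans (≤-reflexive (*-assoc φ y _)) (≤-trans (*-monoˡ 0≤φ h) (*-monoʳ 0≤S φ≤d))))

    drop : ∀ {x w S} → 0ℚ ≤ x → 1ℚ ≤ w → x * w ≤ S → x ≤ S
    drop {x} hx hw h = ≤-trans (≤-reflexive (sym (*-identityʳ x))) (≤-trans (*-monoˡ hx hw) h)

    1≤2+η-x : ∀ {x} → x ≤ 1ℚ → 1ℚ ≤ ι 2 + η - x
    1≤2+η-x {x} h = ≤-by (+-≥0 (diff≥0 h) 0≤η) (lem x η)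
      where
      lem : ∀ x e → ι 2 + e - x ≡ 1ℚ + (1ℚ - x + e)
      lem = RS.solve-∀ ℚring

    big : ∀ {x S} → S ≤ rec 8 → ι 2 - S ≤ x → 1ℚ < x
    big h k = ℚₚ.<-≤-trans 1<2-8 (≤-trans (+ˡ (ι 2) (ℚₚ.neg-antimono-≤ h)) k)

  -- Since q nearly vanishes at a, `gap` at b = a links the classes s and t = a/s: p is large at t
  -- exactly when q is large at s.
  module Reflect {p q} (dp : Density p) (dq : Density q) (pr : Pair p q) (ca : Unit a) where

    private
      near-a : φ * q a ≤ δ * η
      near-a = *-mono {φ} {δ} {q a} {η} 0≤φ (nonneg dq a) φ≤d (miss dq)

      gap-a : ∀ {t s} → 1 ℕ.≤ t → t ℕ.≤ d → 1 ℕ.≤ s → s ℕ.≤ d → t ℕ.* s ≋ a → (p t * (ι 2 + η - φ * q s) ≤ R) × (q s * (ι 2 + η - φ * p t) ≤ R)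
      gap-a = λ 1≤t t≤d 1≤s s≤d e → gap dp dq pr (δ * η) ca 1≤t t≤d 1≤s s≤d e near-a

    dense→ : ∀ {t s} → Unit t → 1 ℕ.≤ t → t ℕ.≤ d → 1 ℕ.≤ s → s ℕ.≤ d → t ℕ.* s ≋ a → Dense q s → Dense p t
    dense→ {t} {s} ct 1≤t t≤d 1≤s s≤d e h = big δR≤ (push {p t} {q s} {R} (le dp t ct) h 0≤R (proj₂ (gap-a 1≤t t≤d 1≤s s≤d e)))

    dense← : ∀ {t s} → Unit s → 1 ℕ.≤ t → t ℕ.≤ d → 1 ℕ.≤ s → s ℕ.≤ d → t ℕ.* s ≋ a → Dense p t → ι 2 - δ * R ≤ φ * q s
    dense← {t} {s} cs 1≤t t≤d 1≤s s≤d e h = push {q s} {p t} {R} (le dq s cs) h 0≤R (proj₁ (gap-a 1≤t t≤d 1≤s s≤d e))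

    -- If q(s) is not dense, its factor in `gap` is at least 1 and makes p(a/s) tiny; the other
    -- factor is then at least 1 as well and makes q(s) tiny.
    sparse : ∀ s → Unit s → ¬ Dense q s → q s ≤ R
    sparse s cs ¬h = via (partner ca cs)
     where
     via : Partner a s → q s ≤ R
     via (t , s' , ct , 1≤t , t≤d , 1≤s' , s'≤d , e , e') = subst (_≤ R) (cong-≋ dq e) (drop (nonneg dq s') (1≤2+η-x φp≤1) (proj₂ (gap-a 1≤t t≤d 1≤s' s'≤d e')))
      where
      p≤R : p t ≤ R
      p≤R = drop (nonneg dp t) (1≤2+η-x (ℚₚ.≮⇒≥ (λ h → ¬h (subst (λ x → 1ℚ < φ * x) (cong-≋ dq e) h)))) (proj₁ (gap-a 1≤t t≤d 1≤s' s'≤d e'))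
      φp≤1 : φ * p t ≤ 1ℚ
      φp≤1 = ≤-trans (*-mono {φ} {δ} {p t} {R} 0≤φ (nonneg dp t) φ≤d p≤R) (≤-trans δR≤ rec8≤1)

    -- Reflecting twice, from q to p and back, improves φ q > 1 to nearly 2.
    saturated : ∀ s → Unit s → Dense q s → ι 2 - δ * R ≤ φ * q s
    saturated s cs h = via (partner ca cs)
     where
     via : Partner a s → ι 2 - δ * R ≤ φ * q s
     via (t , s' , ct , 1≤t , t≤d , 1≤s' , s'≤d , e , e') = subst (λ x → ι 2 - δ * R ≤ φ * x) (cong-≋ dq e)
      (dense← (unit-≋ (sym e) cs) 1≤t t≤d 1≤s' s'≤d e' (dense→ ct 1≤t t≤d 1≤s' s'≤d e' (subst (λ x → 1ℚ < φ * x) (sym (cong-≋ dq e)) h)))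

  -- Three scales force the dense classes to be the nontrivial coset of a subgroup of index 2.
  module Coset {px py pz} (dx : Density px) (dy : Density py) (dz : Density pz) (xy : Pair px py) (xz : Pair px pz) (yz : Pair py pz) (ca : Unit a) where

    private
      module XY = Reflect dx dy xy ca
      module XZ = Reflect dx dz xz ca

    -- The smallest scale serves as mirror: density of `pz` at t passes to `px` at a/t, and from
    -- there to `py` at t.
    dense-y : ∀ {t} → Unit t → 1 ℕ.≤ t → t ℕ.≤ d → Dense pz t → Dense py t
    dense-y {t} ct 1≤t t≤d h = via (divide ct ca)
     where
     via : (∃ λ s → 1 ℕ.≤ s × s ℕ.≤ d × t ℕ.* s ≋ a × Unit s) → Dense py t
     via (s , 1≤s , s≤d , e , cs) = big δR≤ (XY.dense← ct 1≤s s≤d 1≤t t≤d e' (XZ.dense→ cs 1≤s s≤d 1≤t t≤d e' h))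
      where
      e' : s ℕ.* t ≋ a
      e' = trans (cong (ℕ._% d) (ℕₚ.*-comm s t)) e

    private
      -- If ts were dense too, `pz` alone would nearly exhaust 2/φ there, leaving no room for the
      -- product `py t * pz s`, which exceeds 1/φ², in the convolution.
      flip→ : ∀ {t s} → Unit t → Unit s → 1 ℕ.≤ t → t ℕ.≤ d → 1 ℕ.≤ s → s ℕ.≤ d → Dense pz t → Dense pz s → ¬ Dense pz (t ℕ.* s)
      flip→ {t} {s} ct cs 1≤t t≤d 1≤s s≤d ht hs hb = <⇒≱ 1<φφ (≤-trans (*-mono {φ} {δ} {φ * (py t * pz s)} {η + δ * R} 0≤φ 0≤φc φ≤d conv≤) (≤-trans (*-monoˡ 0≤δ η+≤) (≤-trans R-small rec8≤1)))
        where
        b = t ℕ.* s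
        φc = φ * conv py pz b
        tm : py t * pz s ≤ conv py pz b
        tm = ≤-trans (≤-reflexive (sym (trans (cong (_* (py t * pz s)) (𝟙-yes ((t ℕ.* s) ℕ.% d ℕₚ.≟ b ℕ.% d) refl)) (*-identityˡ (py t * pz s)))))
          (≤-trans (term≤∑ d {λ s → 𝕖 b (t ℕ.* s) * (py t * pz s)} (λ s _ _ → nn t s) 1≤s s≤d) (term≤∑ d {λ t → ∑ d (λ s → 𝕖 b (t ℕ.* s) * (py t * pz s))} (λ t _ _ → ∑-≥0 d (λ s _ _ → nn t s)) 1≤t t≤d))
          where
          nn : ∀ t s → 0ℚ ≤ 𝕖 b (t ℕ.* s) * (py t * pz s)
          nn t s = *-≥0 (0≤𝕖 b (t ℕ.* s)) (*-≥0 (nonneg dy t) (nonneg dz s))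
        0≤φc : 0ℚ ≤ φ * (py t * pz s)
        0≤φc = *-≥0 0≤φ (*-≥0 (nonneg dy t) (nonneg dz s))
        conv≤ : φ * (py t * pz s) ≤ η + δ * R
        conv≤ = ≤-trans (*-monoˡ 0≤φ tm) (≤-trans (≤-reflexive (lem φ (pz b) (conv py pz b))) (≤-trans (+-mono-≤ (upper yz b (unit-* ct cs)) (ℚₚ.neg-antimono-≤ (XZ.saturated b (unit-* ct cs) hb))) (≤-reflexive (lem2 η (δ * R)))))
          where
          lem : ∀ f x y → f * y ≡ f * (x + y) - f * x
          lem = RS.solve-∀ ℚring
          lem2 : ∀ e r → ι 2 + e - (ι 2 - r) ≡ e + r
          lem2 = RS.solve-∀ ℚring
        η+≤ : η + δ * R ≤ ι 5 * η + δ * R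
        η+≤ = +ʳ (δ * R) (≤-by {η} {ι 5 * η} {ι 4 * η} (*-≥0 (0≤ι 4) 0≤η) (lem η))
          where
          lem : ∀ e → ι 5 * e ≡ e + ι 4 * e
          lem = RS.solve-∀ ℚring
        1<φφ : 1ℚ < φ * (φ * (py t * pz s))
        1<φφ = ℚₚ.<-≤-trans (dense-y ct 1≤t t≤d ht) (≤-trans (≤-reflexive (sym (*-identityʳ (φ * py t)))) (≤-trans (*-monoˡ (*-≥0 0≤φ (nonneg dy t)) (<⇒≤ hs)) (≤-reflexive (lem φ (py t) (pz s)))))
          where
          lem : ∀ f x y → f * x * (f * y) ≡ f * (f * (x * y))
          lem = RS.solve-∀ ℚring

      -- At a sparse class ts the convolution must supply nearly all of 2/φ; as `py t` is large,
      -- `gap` forces `pz s` close to its maximum.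
      flip← : ∀ {t s} → Unit t → Unit s → 1 ℕ.≤ t → t ℕ.≤ d → 1 ℕ.≤ s → s ℕ.≤ d → Dense pz t → ¬ Dense pz (t ℕ.* s) → Dense pz s
      flip← {t} {s} ct cs 1≤t t≤d 1≤s s≤d ht ¬hb = big R-small (push {pz s} {py t} {ι 5 * η + δ * R} (le dz s cs) (dense-y ct 1≤t t≤d ht) 0≤5η+δR (proj₁ (gap dy dz yz (δ * R) (unit-* ct cs) 1≤t t≤d 1≤s s≤d refl
        (*-mono {φ} {δ} {pz (t ℕ.* s)} {R} 0≤φ (nonneg dz (t ℕ.* s)) φ≤d (XZ.sparse (t ℕ.* s) (unit-* ct cs) ¬hb)))))

    T : ℕ → Set
    T = Dense pz

    T? : ∀ n → Dec (T n)
    T? n = 1ℚ ℚₚ.<? φ * pz n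

    T-≋ : ∀ {m n} → m ≋ n → T m → T n
    T-≋ e = subst (λ x → 1ℚ < φ * x) (cong-≋ dz e)

    T-flip : ∀ t s → Unit t → Unit s → T t → (T s → ¬ T (t ℕ.* s)) × (¬ T (t ℕ.* s) → T s)
    T-flip t s ct cs ht = via (rep t) (rep s)
     where
     via : (∃ λ t' → 1 ℕ.≤ t' × t' ℕ.≤ d × t' ≋ t) → (∃ λ s' → 1 ℕ.≤ s' × s' ℕ.≤ d × s' ≋ s) → (T s → ¬ T (t ℕ.* s)) × (¬ T (t ℕ.* s) → T s)
     via (t' , a₁ , a₂ , e) (s' , b₁ , b₂ , f) = (λ hs h → flip→ ct' cs' a₁ a₂ b₁ b₂ ht' (T-≋ (sym f) hs) (T-≋ (sym ef) h)) ,
        (λ ¬h → T-≋ f (flip← ct' cs' a₁ a₂ b₁ b₂ ht' (λ h → ¬h (T-≋ ef h))))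
      where
      ct' = unit-≋ (sym e) ct
      cs' = unit-≋ (sym f) cs
      ht' = T-≋ (sym e) ht
      ef : t' ℕ.* s' ≋ t ℕ.* s
      ef = ≋-* {t'} {t} {s'} {s} e f

    -- If all classes were sparse, the total mass would be at most d R ≤ 1/8, but it is nearly 1.
    ∃T : ∃ λ t → Unit t × T t
    ∃T = via (search (λ t → unit? t ×-dec T? t) d)
     where
     via : (∃ λ t → 1 ℕ.≤ t × t ℕ.≤ d × Unit t × T t) ⊎ (∀ t → 1 ℕ.≤ t → t ℕ.≤ d → ¬ (Unit t × T t)) → ∃ λ t → Unit t × T t
     via (inj₁ (t , _ , _ , h)) = t , h
     via (inj₂ none) = ⊥-elim (<⇒≱ strict (≤-trans (≤-trans (+ˡ 1ℚ (ℚₚ.neg-antimono-≤ η≤)) (mass≥ dz)) (≤-trans (∑-mono d each) (≤-trans (≤-reflexive (∑-const d R)) δR≤))))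
      where
      strict : rec 8 < 1ℚ - rec 8
      strict = from-yes (rec 8 ℚₚ.<? (1ℚ - rec 8))
      each : ∀ t → 1 ℕ.≤ t → t ℕ.≤ d → 𝕦 t * pz t ≤ R
      each t 1≤t t≤d = go (unit? t)
       where
       go : (u? : Dec (Unit t)) → 𝟙 u? * pz t ≤ R
       go (no _) = ≤-trans (≤-reflexive (*-zeroˡ (pz t))) 0≤R
       go (yes ct) = ≤-trans (≤-reflexive (*-identityˡ (pz t))) (XZ.sparse t ct (λ h → none t 1≤t t≤d (ct , h)))

    private
      -- A dense t reduces this to the flip rules: tm is dense. If mn were dense, tmn would not be,
      -- which forces n to be dense.
      T-even : ∀ m n → Unit m → Unit n → ¬ T m → ¬ T n → ¬ T (m ℕ.* n)
      T-even m n cm cn ¬m ¬n h = via ∃T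
       where
       via : (∃ λ t → Unit t × T t) → ⊥
       via (t , ct , ht) = ¬n (proj₂ (T-flip (t ℕ.* m) n (unit-* ct cm) cn tm) (λ h' → proj₁ (T-flip t (m ℕ.* n) ct (unit-* cm cn) ht) h (subst T (ℕₚ.*-assoc t m n) h')))
        where
        tm : T (t ℕ.* m)
        tm = decidable-stable (T? (t ℕ.* m)) (λ ¬h → ¬m (proj₂ (T-flip t m ct cm ht) ¬h))

    sgn : ∀ {A B : Set} → Dec A → Dec B → ℚ
    sgn (no _) _ = 0ℚ
    sgn (yes _) (yes _) = - 1ℚ
    sgn (yes _) (no _) = 1ℚ

    χ : ℕ → ℚ
    χ n = sgn (unit? n) (T? n)

    private
      χ-0 : ∀ {n} → ¬ Unit n → χ n ≡ 0ℚ
      χ-0 {n} ¬c = go (unit? n)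
        where
        go : (u? : Dec (Unit n)) → sgn u? (T? n) ≡ 0ℚ
        go (no _) = refl
        go (yes c) = ⊥-elim (¬c c)

      χ-T : ∀ {n} → Unit n → T n → χ n ≡ - 1ℚ
      χ-T {n} c h = go (unit? n) (T? n)
        where
        go : (u? : Dec (Unit n)) (t? : Dec (T n)) → sgn u? t? ≡ - 1ℚ
        go (no ¬c) _ = ⊥-elim (¬c c)
        go (yes _) (yes _) = refl
        go (yes _) (no ¬h) = ⊥-elim (¬h h)

      χ-¬T : ∀ {n} → Unit n → ¬ T n → χ n ≡ 1ℚ
      χ-¬T {n} c ¬h = go (unit? n) (T? n)
        where
        go : (u? : Dec (Unit n)) (t? : Dec (T n)) → sgn u? t? ≡ 1ℚ
        go (no ¬c) _ = ⊥-elim (¬c c)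
        go (yes _) (yes h) = ⊥-elim (¬h h)
        go (yes _) (no _) = refl

    χ-sign : ∀ n → Sign (χ n)
    χ-sign n = go (unit? n) (T? n)
      where
      go : (u? : Dec (Unit n)) (t? : Dec (T n)) → Sign (sgn u? t?)
      go (no _) _ = zero refl
      go (yes _) (yes _) = minus-one refl
      go (yes _) (no _) = one refl

    χ-≋ : Periodic χ
    χ-≋ {m} {n} e = go (unit? m) (T? m)
      where
      go : Dec (Unit m) → Dec (T m) → χ m ≡ χ n
      go (no ¬c) _ = trans (χ-0 ¬c) (sym (χ-0 (λ c → ¬c (unit-≋ (sym e) c))))
      go (yes c) (yes h) = trans (χ-T c h) (sym (χ-T (unit-≋ e c) (T-≋ e h)))
      go (yes c) (no ¬h) = trans (χ-¬T c ¬h) (sym (χ-¬T (unit-≋ e c) (λ h → ¬h (T-≋ (sym e) h))))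

    -- Density of 1 would refute itself through `T-flip`, since 1 · 1 computes to 1.
    χ-1 : χ 1 ≡ 1ℚ
    χ-1 = χ-¬T unit-1 (λ h → proj₁ (T-flip 1 1 unit-1 unit-1 h) h h)

    χ-* : ∀ m n → χ (m ℕ.* n) ≡ χ m * χ n
    χ-* m n = go (unit? m) (unit? n) (T? m) (T? n)
      where
      go : Dec (Unit m) → Dec (Unit n) → Dec (T m) → Dec (T n) → χ (m ℕ.* n) ≡ χ m * χ n
      go (no ¬c) _ _ _ = trans (χ-0 (λ c → ¬c (unit-*ˡ {m} {n} c))) (sym (trans (cong (_* χ n) (χ-0 ¬c)) (*-zeroˡ (χ n))))
      go (yes _) (no ¬c) _ _ = trans (χ-0 (λ c → ¬c (unit-*ʳ {m} {n} c))) (sym (trans (cong (χ m *_) (χ-0 ¬c)) (*-zeroʳ (χ m))))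
      go (yes cm) (yes cn) (yes hm) (yes hn) = trans (χ-¬T (unit-* cm cn) (proj₁ (T-flip m n cm cn hm) hn)) (sym (cong₂ _*_ (χ-T cm hm) (χ-T cn hn)))
      go (yes cm) (yes cn) (yes hm) (no ¬hn) = trans (χ-T (unit-* cm cn) (decidable-stable (T? (m ℕ.* n)) (λ ¬h → ¬hn (proj₂ (T-flip m n cm cn hm) ¬h)))) (sym (cong₂ _*_ (χ-T cm hm) (χ-¬T cn ¬hn)))
      go (yes cm) (yes cn) (no ¬hm) (yes hn) = trans (χ-T (unit-* cm cn) (decidable-stable (T? (m ℕ.* n)) (λ ¬h → ¬hm (proj₂ (T-flip n m cn cm hn) (λ h → ¬h (subst T (ℕₚ.*-comm n m) h)))))) (sym (cong₂ _*_ (χ-¬T cm ¬hm) (χ-T cn hn)))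
      go (yes cm) (yes cn) (no ¬hm) (no ¬hn) = trans (χ-¬T (unit-* cm cn) (T-even m n cm cn ¬hm ¬hn)) (sym (cong₂ _*_ (χ-¬T cm ¬hm) (χ-¬T cn ¬hn)))

    -- Multiplication by a dense unit permutes the classes and reverses the sign of χ.
    ∑χ : ∑ d χ ≡ 0ℚ
    ∑χ = vanish (∑ d χ) (trans (sym twist) minus)
      where
      t = proj₁ ∃T
      ct = proj₁ (proj₂ ∃T)
      ht = proj₂ (proj₂ ∃T)
      minus : ∑ d (λ i → χ (t ℕ.* i)) ≡ - 1ℚ * ∑ d χ
      minus = trans (∑-cong d (λ i _ _ → trans (χ-* t i) (cong (_* χ i) (χ-T ct ht)))) (∑-*ˡ d (- 1ℚ) χ)
      twist : ∑ d (λ i → χ (t ℕ.* i)) ≡ ∑ d χ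
      twist = trans (∑-cong d (λ i _ _ → sym (∑-class χ χ-≋ (t ℕ.* i)))) (trans (∑-swap d d (λ i b → 𝕖 b (t ℕ.* i) * χ b))
        (∑-cong d (λ b _ _ → trans (∑-*ʳ d (χ b) (λ i → 𝕖 b (t ℕ.* i))) (collapse b (unit? b)))))
        where
        collapse : ∀ b → Dec (Unit b) → ∑ d (λ i → 𝕖 b (t ℕ.* i)) * χ b ≡ χ b
        collapse b (no ¬c) = trans (cong (∑ d (λ i → 𝕖 b (t ℕ.* i)) *_) (χ-0 ¬c)) (trans (*-zeroʳ (∑ d (λ i → 𝕖 b (t ℕ.* i)))) (sym (χ-0 ¬c)))
        collapse b (yes c) = trans (cong (_* χ b) (trans (∑-𝕖-unit t c) (𝟙-yes (unit? t) ct))) (*-identityˡ (χ b))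
      vanish : ∀ x → x ≡ - 1ℚ * x → x ≡ 0ℚ
      vanish x e = *-cancel-≡ {2} (s≤s z≤n) (trans (lem x) (trans (cong (x +_) e) (lem2 x)))
        where
        lem : ∀ x → x * ι 2 ≡ x + x
        lem = RS.solve-∀ ℚring
        lem2 : ∀ x → x + - 1ℚ * x ≡ 0ℚ * ι 2
        lem2 = RS.solve-∀ ℚring

    χ-osc : Osc d 1ℚ χ
    χ-osc .periodic n = χ-≋ (+d≋ n)
    χ-osc .mean-0 u = trans (∑-cong d (λ i _ _ → χ-* u i)) (trans (∑-*ˡ d (χ u) χ) (trans (cong (χ u *_) ∑χ) (*-zeroʳ (χ u))))
    χ-osc .bounded n = sign≤1 (χ-sign n)

    -- Almost all the mass sits where χ = -1: the classes with χ = 1 hold at most R each, so the sum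
    -- is at most -7/8 + 2/8.
    ∑χp : ∑ d (λ b → χ b * pz b) ≤ - ½
    ∑χp = ≤-trans (∑-mono d {g = λ b → - (𝕦 b * pz b) + ι 2 * R} (λ b _ _ → each b (unit? b) (T? b))) (≤-trans (≤-reflexive (trans (∑-+ d (λ b → - (𝕦 b * pz b)) (λ _ → ι 2 * R)) (cong₂ _+_ (∑-neg d (λ b → 𝕦 b * pz b)) (∑-const d (ι 2 * R)))))
      (≤-trans (+-mono-≤ (ℚₚ.neg-antimono-≤ (≤-trans (+ˡ 1ℚ (ℚₚ.neg-antimono-≤ η≤)) (mass≥ dz))) (≤-trans (≤-reflexive (lem δ R)) (*-monoˡ {c = ι 2} (0≤ι 2) δR≤))) (from-yes ((- (1ℚ - rec 8) + ι 2 * rec 8) ℚₚ.≤? (- ½)))))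
      where
      lem : ∀ d r → d * (ι 2 * r) ≡ ι 2 * (d * r)
      lem = RS.solve-∀ ℚring
      lem0 : ∀ x r → - (0ℚ * x) + ι 2 * r ≡ 0ℚ * x + ι 2 * r
      lem0 = RS.solve-∀ ℚring
      lem1 : ∀ x r → - (1ℚ * x) + ι 2 * r ≡ - 1ℚ * x + ι 2 * r
      lem1 = RS.solve-∀ ℚring
      lem2 : ∀ x r → - (1ℚ * x) + ι 2 * r ≡ 1ℚ * x + ι 2 * (r - x)
      lem2 = RS.solve-∀ ℚring
      each : ∀ b (u? : Dec (Unit b)) (t? : Dec (T b)) → sgn u? t? * pz b ≤ - (𝟙 u? * pz b) + ι 2 * R
      each b (no _) _ = ≤-by (*-≥0 (0≤ι 2) 0≤R) (lem0 (pz b) R)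
      each b (yes _) (yes _) = ≤-by (*-≥0 (0≤ι 2) 0≤R) (lem1 (pz b) R)
      each b (yes cb) (no ¬h) = ≤-by (*-≥0 (0≤ι 2) (diff≥0 (XZ.sparse b cb ¬h))) (lem2 (pz b) R)

-- Weighted prime sums in residue classes.

module ClassSums (Y M : ℕ) (1≤M : 1 ℕ.≤ M) (Y≤M : Y ℕ.≤ M) (d : ℕ) {{d≢0 : ℕ.NonZero d}} where
  open Log M 1≤M
  open Mangoldt Y M 1≤M Y≤M
  open Bilinear Y M 1≤M Y≤M d (ℕ.>-nonZero⁻¹ d)
  open Rare Y M 1≤M Y≤M
  open Classes d

  Λr : ℕ → ℚ
  Λr n = Λ n * rec n

  W : ℕ → ℕ → ℚ
  W y b = ∑ y (λ n → 𝕖 b n * Λr n)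

  U : ℕ → ℚ
  U y = ∑ y (λ n → Λr n * 𝕦 n)

  0≤W : ∀ y b → 0ℚ ≤ W y b
  0≤W y b = ∑-≥0 y (λ n _ _ → *-≥0 (0≤𝟙 (n ℕ.% d ℕₚ.≟ b ℕ.% d)) (0≤Λr n))

  W-≋ : ∀ y → Periodic (W y)
  W-≋ y {m} {n} e = ∑-cong y (λ k _ _ → cong (λ t → 𝟙 (k ℕ.% d ℕₚ.≟ t) * Λr k) e)

  fold : ∀ y (g : ℕ → ℚ) → Periodic g → ∑ d (λ s → g s * W y s) ≡ ∑ y (λ m → Λr m * g m)
  fold y g per = trans (∑-cong d (λ s _ _ → sym (∑-*ˡ y (g s) (λ m → 𝕖 s m * Λr m)))) (trans (∑-swap d y (λ s m → g s * (𝕖 s m * Λr m)))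
    (∑-cong y (λ m _ _ → trans (∑-cong d (λ s _ _ → lem (g s) (𝕖 s m) (Λr m))) (trans (∑-*ˡ d (Λr m) (λ s → 𝕖 s m * g s)) (cong (Λr m *_) (∑-class g per m))))))
    where
    lem : ∀ a b c → a * (b * c) ≡ c * (b * a)
    lem = RS.solve-∀ ℚring

  Q : ℕ → ℕ → ℕ → ℚ
  Q x y b = ∑ x (λ n → Λr n * ∑ y (λ m → Λr m * 𝕖 b (n ℕ.* m)))

  Q-fold : ∀ x y b → ∑ d (λ t → ∑ d (λ s → 𝕖 b (t ℕ.* s) * (W x t * W y s))) ≡ Q x y b
  Q-fold x y b = trans (∑-cong d (λ t _ _ → trans (∑-cong d (λ s _ _ → lem (𝕖 b (t ℕ.* s)) (W x t) (W y s))) (trans (∑-*ʳ d (W x t) (λ s → 𝕖 b (t ℕ.* s) * W y s))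
      (cong (_* W x t) (fold y (λ s → 𝕖 b (t ℕ.* s)) (λ {m} {n} e → 𝕖-cong {b} (≋-* {t} {t} {m} {n} refl e)))))))
    (fold x (λ t → ∑ y (λ m → Λr m * 𝕖 b (t ℕ.* m))) (λ {m} {n} e → ∑-cong y (λ k _ _ → cong (Λr k *_) (𝕖-cong {b} (≋-* {m} {n} {k} {k} e refl)))))
    where
    lem : ∀ a b c → a * (b * c) ≡ a * c * b
    lem = RS.solve-∀ ℚring

  -- `bilinear` controls only the difference of A between two unit classes. Its size comes from the
  -- total over the unit classes, which `∑-A` evaluates with no congruence condition left but
  -- coprimality to d.
  A : ℕ → ℕ → ℕ → ℚ
  A x y b = lg x * W y b + Q x y b

  A-close : ∀ {x y b b'} → Unit b → Unit b' → 1 ℕ.≤ x → x ℕ.≤ y → y ℕ.≤ Y → ∣ A x y b - A x y b' ∣ ≤ ι x * (lg x * Z) + ι 2 * (ι d * V y)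
  A-close {x} {y} {b} {b'} cb cb' 1≤x x≤y y≤Y = ≤-trans (≤-reflexive (cong ∣_∣ eq)) (bilinear (osc-class cb cb') 1≤x x≤y y≤Y)
    where
    f : ℕ → ℚ
    f n = 𝕖 b n - 𝕖 b' n
    at : ∀ n → smear f y n ≡ ∑ y (λ m → Λr m * 𝕖 b (n ℕ.* m)) - ∑ y (λ m → Λr m * 𝕖 b' (n ℕ.* m))
    at n = trans (∑-cong y (λ m _ _ → lem (Λr m) (𝕖 b (n ℕ.* m)) (𝕖 b' (n ℕ.* m)))) (∑-- y (λ m → Λr m * 𝕖 b (n ℕ.* m)) (λ m → Λr m * 𝕖 b' (n ℕ.* m)))
      where
      lem : ∀ a b c → a * (b - c) ≡ a * b - a * c
      lem = RS.solve-∀ ℚring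
    at-1 : ∀ b → ∑ y (λ m → Λr m * 𝕖 b (1 ℕ.* m)) ≡ W y b
    at-1 b = ∑-cong y (λ m _ _ → trans (cong (λ t → Λr m * 𝕖 b t) (ℕₚ.*-identityˡ m)) (*-comm (Λr m) (𝕖 b m)))
    eq : A x y b - A x y b' ≡ lg x * smear f y 1 + ∑ x (λ n → Λr n * smear f y n)
    eq = trans (lem (lg x) (W y b) (W y b') (Q x y b) (Q x y b')) (sym (cong₂ _+_ (cong (lg x *_) (trans (at 1) (cong₂ _-_ (at-1 b) (at-1 b'))))
        (trans (∑-cong x (λ n _ _ → trans (cong (Λr n *_) (at n)) (lem2 (Λr n) _ _))) (∑-- x (λ n → Λr n * ∑ y (λ m → Λr m * 𝕖 b (n ℕ.* m))) (λ n → Λr n * ∑ y (λ m → Λr m * 𝕖 b' (n ℕ.* m)))))))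
      where
      lem : ∀ l w w' q q' → l * w + q - (l * w' + q') ≡ l * (w - w') + (q - q')
      lem = RS.solve-∀ ℚring
      lem2 : ∀ a b c → a * (b - c) ≡ a * b - a * c
      lem2 = RS.solve-∀ ℚring

  𝕦-* : ∀ m n → 𝕦 (m ℕ.* n) ≡ 𝕦 m * 𝕦 n
  𝕦-* m n = go (unit? m) (unit? n)
    where
    go : (m? : Dec (Unit m)) (n? : Dec (Unit n)) → 𝕦 (m ℕ.* n) ≡ 𝟙 m? * 𝟙 n?
    go (yes cm) (yes cn) = trans (𝟙-yes (unit? (m ℕ.* n)) (unit-* cm cn)) refl
    go (yes _) (no ¬c) = trans (𝟙-no (unit? (m ℕ.* n)) (λ c → ¬c (unit-*ʳ {m} {n} c))) refl
    go (no ¬c) n? = trans (𝟙-no (unit? (m ℕ.* n)) (λ c → ¬c (unit-*ˡ {m} {n} c))) (sym (*-zeroˡ (𝟙 n?)))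

  𝕦-≋ : Periodic 𝕦
  𝕦-≋ {m} {n} e = 𝟙-⇔ (unit? m) (unit? n) (unit-≋ e) (unit-≋ (sym e))

  ∑-A : ∀ x y → ∑ d (λ b → 𝕦 b * A x y b) ≡ lg x * U y + U x * U y
  ∑-A x y = trans (∑-cong d (λ b _ _ → lem (𝕦 b) (lg x) (W y b) (Q x y b))) (trans (∑-+ d (λ b → lg x * (𝕦 b * W y b)) (λ b → 𝕦 b * Q x y b))
    (cong₂ _+_ (trans (∑-*ˡ d (lg x) (λ b → 𝕦 b * W y b)) (cong (lg x *_) (fold y 𝕦 𝕦-≋)))
      (trans (∑-cong d (λ b _ _ → sym (∑-*ˡ x (𝕦 b) (λ n → Λr n * ∑ y (λ m → Λr m * 𝕖 b (n ℕ.* m)))))) (trans (∑-swap d x (λ b n → 𝕦 b * (Λr n * ∑ y (λ m → Λr m * 𝕖 b (n ℕ.* m)))))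
        (trans (∑-cong x (λ n _ _ → inner n)) (∑-*ʳ x (U y) (λ n → Λr n * 𝕦 n)))))))
    where
    lem : ∀ u l w q → u * (l * w + q) ≡ l * (u * w) + u * q
    lem = RS.solve-∀ ℚring
    lem2 : ∀ u l s → u * (l * s) ≡ l * (u * s)
    lem2 = RS.solve-∀ ℚring
    lem3 : ∀ a u v → a * (u * v) ≡ u * (a * v)
    lem3 = RS.solve-∀ ℚring
    inner : ∀ n → ∑ d (λ b → 𝕦 b * (Λr n * ∑ y (λ m → Λr m * 𝕖 b (n ℕ.* m)))) ≡ Λr n * 𝕦 n * U y
    inner n = trans (∑-cong d (λ b _ _ → trans (lem2 (𝕦 b) (Λr n) _) (cong (Λr n *_) (sym (∑-*ˡ y (𝕦 b) (λ m → Λr m * 𝕖 b (n ℕ.* m)))))))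
      (trans (∑-*ˡ d (Λr n) (λ b → ∑ y (λ m → 𝕦 b * (Λr m * 𝕖 b (n ℕ.* m))))) (trans (cong (Λr n *_) (trans (∑-swap d y (λ b m → 𝕦 b * (Λr m * 𝕖 b (n ℕ.* m))))
        (trans (∑-cong y (λ m _ _ → trans (∑-cong d (λ b _ _ → lem2 (𝕦 b) (Λr m) (𝕖 b (n ℕ.* m)))) (trans (∑-*ˡ d (Λr m) (λ b → 𝕦 b * 𝕖 b (n ℕ.* m))) (trans (cong (Λr m *_) (trans (∑-𝕦-𝕖 (n ℕ.* m)) (𝕦-* n m))) (lem3 (Λr m) (𝕦 n) (𝕦 m))))))
          (∑-*ˡ y (𝕦 n) (λ m → Λr m * 𝕦 m))))) (sym (*-assoc (Λr n) (𝕦 n) (U y)))))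

  φA-close : ∀ {x y b} → Unit b → 1 ℕ.≤ x → x ℕ.≤ y → y ℕ.≤ Y → ∣ φ * A x y b - (lg x * U y + U x * U y) ∣ ≤ φ * (ι x * (lg x * Z) + ι 2 * (ι d * V y))
  φA-close {x} {y} {b} cb 1≤x x≤y y≤Y = ≤-trans (≤-reflexive (cong ∣_∣ (trans (cong₂ _-_ (sym (∑-*ʳ d (A x y b) 𝕦)) (sym (∑-A x y)))
      (trans (sym (∑-- d (λ b' → 𝕦 b' * A x y b) (λ b' → 𝕦 b' * A x y b'))) (∑-cong d (λ b' _ _ → lem (𝕦 b') (A x y b) (A x y b')))))))
    (≤-trans (∣∑∣≤ d (λ b' _ _ → each b' (unit? b'))) (≤-reflexive (∑-*ʳ d Err 𝕦)))
    where
    Err : ℚ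
    Err = ι x * (lg x * Z) + ι 2 * (ι d * V y)
    lem : ∀ u a b → u * a - u * b ≡ u * (a - b)
    lem = RS.solve-∀ ℚring
    each : ∀ b' (u? : Dec (Unit b')) → ∣ 𝟙 u? * (A x y b - A x y b') ∣ ≤ 𝟙 u? * Err
    each b' (yes cb') = ∣*∣≤ {1ℚ} ≤-refl (A-close cb cb' 1≤x x≤y y≤Y)
    each b' (no _) = ≤-reflexive (trans (cong ∣_∣ (*-zeroˡ (A x y b - A x y b'))) (sym (*-zeroˡ Err)))

  -- With `V≤U` this transfers Mertens' estimates to integers prime to d: primes dividing d, and
  -- their powers, contribute boundedly.
  U≤V : ∀ y → U y ≤ V y
  U≤V y = ∑-mono y (λ n _ _ → ≤-trans (*-monoˡ (0≤Λr n) (𝟙≤1 (unit? n))) (≤-reflexive (*-identityʳ (Λr n))))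

  V≤U : ∀ {y} N → d ℕ.≤ N → y ℕ.≤ Y → V y ≤ U y + (ι N + ι 2)
  V≤U {y} N d≤N y≤Y = ≤-trans (≤-reflexive (trans (∑-cong y (λ n _ _ → lem (Λr n) (𝕦 n))) (∑-+ y (λ n → Λr n * 𝕦 n) (λ n → (1ℚ - 𝕦 n) * Λr n))))
    (+ˡ (U y) (rare (λ n → 1ℚ - 𝕦 n) N y≤Y (λ n → diff≥0 (𝟙≤1 (unit? n))) (λ n → ≤-by (0≤𝟙 (unit? n)) (lem2 (𝕦 n)))
      (λ q pq N<q → trans (cong (λ t → 1ℚ - t) (𝟙-yes (unit? q) (prime-coprime pq (λ q∣d → ℕₚ.<⇒≱ N<q (ℕₚ.≤-trans (∣ₚ.∣⇒≤ q∣d) d≤N))))) refl)))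
    where
    lem : ∀ a u → a ≡ a * u + (1ℚ - u) * a
    lem = RS.solve-∀ ℚring
    lem2 : ∀ u → 1ℚ ≡ 1ℚ - u + u
    lem2 = RS.solve-∀ ℚring

  W-rare : ∀ {y} N a → y ℕ.≤ Y → (∀ q → Prime q → N ℕ.< q → ¬ (q ≋ a)) → W y a ≤ ι N + ι 2
  W-rare {y} N a y≤Y H = rare (𝕖 a) N y≤Y (λ n → 0≤𝟙 (n ℕ.% d ℕₚ.≟ a ℕ.% d)) (λ n → 𝟙≤1 (n ℕ.% d ℕₚ.≟ a ℕ.% d)) (λ q pq N<q → 𝟙-no (q ℕ.% d ℕₚ.≟ a ℕ.% d) (H q pq N<q))

-- The exponent makes the harmonic sum at least L + 1, so that the logarithm is at least L for every
-- mesh M. The scales can thus be fixed before M.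
scale : ℕ → ℕ
scale L = 2 ℕ.^ (2 ℕ.* suc L)

L≤scale : ∀ L → L ℕ.≤ scale L
L≤scale L = ℕₚ.≤-trans (ℕₚ.≤-trans (ℕₚ.n≤1+n L) (ℕₚ.m≤m+n (suc L) (suc L ℕ.+ 0))) (ℕₚ.<⇒≤ (n<2^n (2 ℕ.* suc L)))

1≤scale : ∀ L → 1 ℕ.≤ scale L
1≤scale L = ℕₚ.m^n>0 2 (2 ℕ.* suc L)

lg-scale : ∀ M 1≤M L → ι L ≤ Log.lg M 1≤M (scale L)
lg-scale M 1≤M L = shift (≤-trans (≤-reflexive eq) (≤-trans (harm-unbounded (2 ℕ.* suc L)) (Log.harm≤1+lg M 1≤M (1≤scale L))))
  where
  eq : 1ℚ + ι L ≡ ι (2 ℕ.* suc L) * rec 2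
  eq = sym (trans (cong (_* rec 2) (ι-* 2 (suc L))) (lem (ι L)))
    where
    lem : ∀ a → ι 2 * (1ℚ + a) * rec 2 ≡ 1ℚ + a
    lem = RS.solve-∀ ℚring
  shift : ∀ {a b} → 1ℚ + a ≤ 1ℚ + b → a ≤ b
  shift {a} {b} h = ≤-trans (≤-reflexive (lem a)) (≤-trans (+ˡ (- 1ℚ) h) (≤-reflexive (sym (lem b))))
    where
    lem : ∀ a → a ≡ - 1ℚ + (1ℚ + a)
    lem = RS.solve-∀ ℚring

inv : ∀ {K q} → 1 ℕ.≤ K → ι K ≤ q → ∃ λ κ → κ * q ≡ 1ℚ × 0ℚ ≤ κ × κ ≤ rec K
inv {K} {q} 1≤K h = κ , e , 0≤κ , κ≤
  where
  0<q : 0ℚ < q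
  0<q = ℚₚ.<-≤-trans (0<ι 1≤K) h
  κ : ℚ
  κ = (Data.Rational.1/ q) {{ℚₚ.pos⇒nonZero q {{positive 0<q}}}}
  e : κ * q ≡ 1ℚ
  e = ℚₚ.*-inverseˡ q {{ℚₚ.pos⇒nonZero q {{positive 0<q}}}}
  0≤κ : 0ℚ ≤ κ
  0≤κ = <⇒≤ (ℚₚ.positive⁻¹ κ {{ℚₚ.1/pos⇒pos q {{positive 0<q}}}})
  κ≤ : κ ≤ rec K
  κ≤ = ≤-trans (≤-reflexive (sym (trans (cong (κ *_) (trans (*-comm (ι K) (rec K)) (rec-ι 1≤K))) (*-identityʳ κ))))
    (≤-trans (*-monoˡ 0≤κ (*-monoʳ (0≤rec K) h)) (≤-reflexive (trans (sym (*-assoc κ q (rec K))) (trans (cong (_* rec K) e) (*-identityˡ (rec K))))))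

-- The three conditions absorb, in this order, the Mertens errors, the error of the bilinear
-- identity, and the quotient of `Z` by the lower bound for L(1,χ). In `EpsFor`, the 12 in the
-- second coefficient is 2 · 6, with 6 bounding κ V.
record Eps (A B C η ε : ℚ) : Set where
  field
    0≤ε : 0ℚ ≤ ε
    ε≤1 : ε ≤ 1ℚ
    c₁ : A * ε ≤ rec 8 * η
    c₂ : B * ε ≤ rec 2 * η
    c₃ : C * ε ≤ rec 4

EpsFor : ℕ → ℕ → ℚ → ℚ → Set
EpsFor d N = Eps (ι N + ι 5) (ι d * (ι 7 * ι d + 1ℚ + ι 12 * ι d)) (ι 32 * ι 81 * (ι d * ι d * ι d) * (ι 7 * ι d + 1ℚ))

module Scaled (Y M : ℕ) (1≤M : 1 ℕ.≤ M) (Y≤M : Y ℕ.≤ M) (d : ℕ) {{d≢0 : ℕ.NonZero d}} (N : ℕ) (d≤N : d ℕ.≤ N) (a : ℕ)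
  (H : ∀ q → Prime q → N ℕ.< q → ¬ (Classes._≋_ d q a)) {η ε} (η-tiny : Tiny d η) (eps : EpsFor d N η ε) where
  open Log M 1≤M
  open Mangoldt Y M 1≤M Y≤M
  open Bilinear Y M 1≤M Y≤M d (ℕ.>-nonZero⁻¹ d)
  open Classes d
  open ClassSums Y M 1≤M Y≤M d
  open Endgame d η η-tiny a
  open Tiny η-tiny
  open Eps eps

  private
    δ η' : ℚ
    δ = ι d
    η' = rec 8 * η
    0≤η' : 0ℚ ≤ η'
    0≤η' = *-≥0 (0≤rec 8) 0≤η
    η'≤η : η' ≤ η
    η'≤η = ≤-trans (*-monoʳ 0≤η (rec≤1 8)) (≤-reflexive (*-identityˡ η))
    0≤φ : 0ℚ ≤ φ
    0≤φ = ≤-trans 0≤1 1≤φ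

  record Scale (x : ℕ) (κ : ℚ) : Set where
    field
      1≤x : 1 ℕ.≤ x
      x≤Y : x ℕ.≤ Y
      κ-inv : κ * lg x ≡ 1ℚ
      0≤κ : 0ℚ ≤ κ
      κ≤ε : κ ≤ ε
  open Scale

  p : ℕ → ℚ → ℕ → ℚ
  p x κ b = κ * W x b

  private
    module At {x κ} (sc : Scale x κ) where
      u : ℚ
      u = κ * U x

      5κ≤ : κ * ι 5 ≤ η'
      5κ≤ = ≤-trans (*-monoʳ (0≤ι 5) (κ≤ε sc)) (≤-trans (≤-by (*-≥0 (0≤ι N) 0≤ε) (lem (ι N) ε)) c₁)
        where
        lem : ∀ n e → (n + ι 5) * e ≡ e * ι 5 + n * e
        lem = RS.solve-∀ ℚring

      N+4κ≤ : κ * (ι N + ι 4) ≤ η'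
      N+4κ≤ = ≤-trans (*-monoʳ (+-≥0 (0≤ι N) (0≤ι 4)) (κ≤ε sc)) (≤-trans (≤-by 0≤ε (lem (ι N) ε)) c₁)
        where
        lem : ∀ n e → (n + ι 5) * e ≡ e * (n + ι 4) + e
        lem = RS.solve-∀ ℚring

      κV≤ : κ * V x ≤ 1ℚ + κ * ι 5
      κV≤ = ≤-trans (*-monoˡ (0≤κ sc) (mertens≤ (1≤x sc) (x≤Y sc))) (≤-reflexive (trans (*-distribˡ-+ κ (lg x) (ι 5)) (cong (_+ κ * ι 5) (κ-inv sc))))

      u≤ : u ≤ 1ℚ + η'
      u≤ = ≤-trans (*-monoˡ (0≤κ sc) (U≤V x)) (≤-trans κV≤ (+ˡ 1ℚ 5κ≤))

      u≥ : 1ℚ - η' ≤ u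
      u≥ = ≤-trans (+-mono-≤ (≤-reflexive (sym (κ-inv sc))) (ℚₚ.neg-antimono-≤ N+4κ≤))
        (≤-trans (+ʳ (- (κ * (ι N + ι 4))) (*-monoˡ (0≤κ sc) (≤-trans (mertens≥ (1≤x sc) (x≤Y sc)) (+ʳ (ι 2) (V≤U N d≤N (x≤Y sc)))))) (≤-reflexive (lem κ (U x) (ι N))))
        where
        lem : ∀ k u n → k * (u + (n + ι 2) + ι 2) - k * (n + ι 4) ≡ k * u
        lem = RS.solve-∀ ℚring

      0≤u : 0ℚ ≤ u
      0≤u = *-≥0 (0≤κ sc) (∑-≥0 x (λ n _ _ → *-≥0 (0≤Λr n) (0≤𝟙 (unit? n))))

      mass : ∑ d (λ t → 𝕦 t * p x κ t) ≡ u
      mass = trans (∑-cong d (λ t _ _ → lem (𝕦 t) κ (W x t))) (trans (∑-*ˡ d κ (λ t → 𝕦 t * W x t)) (cong (κ *_) (fold x 𝕦 𝕦-≋)))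
        where
        lem : ∀ a b c → a * (b * c) ≡ b * (a * c)
        lem = RS.solve-∀ ℚring

      0≤p : ∀ t → 0ℚ ≤ p x κ t
      0≤p t = *-≥0 (0≤κ sc) (0≤W x t)

  -- After division by lg x lg y, A becomes q + p ∗ q with average close to 1 + 1. The error x lg x
  -- Z turns into Z x/lg y, which the separation of the scales makes at most Z ε. Of the tolerance
  -- η, half goes to this error and half to replacing the masses, each 1 up to η/8, by 1.
  pair : ∀ {x κ y κ'} (sx : Scale x κ) (sy : Scale y κ') → x ℕ.≤ y → ι x * κ' ≤ ε → Pair (p x κ) (p y κ')
  pair {x} {κ} {y} {κ'} sx sy x≤y xκ'≤ε = record
    { lower = λ b cb → ≤-trans lo (≤-trans (proj₁ (bounds b cb)) (≤-reflexive (sym (rescale b))))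
    ; upper = λ b cb → ≤-trans (≤-reflexive (rescale b)) (≤-trans (proj₂ (bounds b cb)) hi) }
    where
    module X = At sx
    module Y' = At sy
    Err : ℚ
    Err = ι x * (lg x * Z) + ι 2 * (ι d * V y)
    main : ℚ
    main = Y'.u + X.u * Y'.u
    rescale : ∀ b → φ * (p y κ' b + conv (p x κ) (p y κ') b) ≡ κ * κ' * (φ * A x y b)
    rescale b = trans (cong (φ *_) (cong₂ _+_ (trans (sym (*-identityˡ (κ' * W y b))) (cong (_* (κ' * W y b)) (sym (κ-inv sx))))
        (trans (∑-cong d (λ t _ _ → trans (∑-cong d (λ s _ _ → lem (𝕖 b (t ℕ.* s)) κ (W x t) κ' (W y s))) (∑-*ˡ d (κ * κ') (λ s → 𝕖 b (t ℕ.* s) * (W x t * W y s)))))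
          (trans (∑-*ˡ d (κ * κ') (λ t → ∑ d (λ s → 𝕖 b (t ℕ.* s) * (W x t * W y s)))) (cong (κ * κ' *_) (Q-fold x y b))))))
      (lem2 φ κ κ' (lg x) (W y b) (Q x y b))
      where
      lem : ∀ e k w k' w' → e * (k * w * (k' * w')) ≡ k * k' * (e * (w * w'))
      lem = RS.solve-∀ ℚring
      lem2 : ∀ f k k' l w q → f * (k * l * (k' * w) + k * k' * q) ≡ k * k' * (f * (l * w + q))
      lem2 = RS.solve-∀ ℚring
    0≤κκ : 0ℚ ≤ κ * κ'
    0≤κκ = *-≥0 (0≤κ sx) (0≤κ sy)
    main≡ : κ * κ' * (lg x * U y + U x * U y) ≡ main
    main≡ = trans (lem κ κ' (lg x) (U x) (U y)) (trans (cong (λ t → t * Y'.u + X.u * Y'.u) (κ-inv sx)) (cong (_+ X.u * Y'.u) (*-identityˡ Y'.u)))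
      where
      lem : ∀ k k' l u v → k * k' * (l * v + u * v) ≡ k * l * (k' * v) + k * u * (k' * v)
      lem = RS.solve-∀ ℚring
    err≤ : κ * κ' * (φ * Err) ≤ rec 2 * η
    err≤ = ≤-trans (≤-reflexive (trans (lem φ κ κ' (ι x) (lg x) Z δ (V y)) (cong (λ t → φ * (t * (ι x * κ' * Z) + ι 2 * (δ * (κ * (κ' * V y))))) (κ-inv sx))))
      (≤-trans (*-mono {φ} {δ} 0≤φ 0≤inner φ≤d inner≤) (≤-trans (≤-reflexive (lem2 δ ε Z)) c₂))
      where
      lem : ∀ f k k' x l z d v → k * k' * (f * (x * (l * z) + ι 2 * (d * v))) ≡ f * (k * l * (x * k' * z) + ι 2 * (d * (k * (k' * v))))
      lem = RS.solve-∀ ℚring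
      lem2 : ∀ d e z → d * (1ℚ * (e * z) + ι 2 * (d * (e * ι 6))) ≡ d * (z + ι 12 * d) * e
      lem2 = RS.solve-∀ ℚring
      0≤Z : 0ℚ ≤ Z
      0≤Z = +-≥0 (*-≥0 (0≤ι 7) (0≤ι d)) 0≤1
      0≤V : 0ℚ ≤ V y
      0≤V = ∑-≥0 y (λ n _ _ → 0≤Λr n)
      0≤inner : 0ℚ ≤ 1ℚ * (ι x * κ' * Z) + ι 2 * (δ * (κ * (κ' * V y)))
      0≤inner = +-≥0 (*-≥0 0≤1 (*-≥0 (*-≥0 (0≤ι x) (0≤κ sy)) 0≤Z)) (*-≥0 (0≤ι 2) (*-≥0 (0≤ι d) (*-≥0 (0≤κ sx) (*-≥0 (0≤κ sy) 0≤V))))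
      six : κ' * V y ≤ ι 6
      six = ≤-trans Y'.κV≤ (≤-trans (+ˡ 1ℚ (*-monoʳ (0≤ι 5) (≤-trans (κ≤ε sy) ε≤1))) ≤-refl)
      inner≤ : 1ℚ * (ι x * κ' * Z) + ι 2 * (δ * (κ * (κ' * V y))) ≤ 1ℚ * (ε * Z) + ι 2 * (δ * (ε * ι 6))
      inner≤ = +-mono-≤ (*-monoˡ 0≤1 (*-monoʳ 0≤Z xκ'≤ε)) (*-monoˡ (0≤ι 2) (*-monoˡ (0≤ι d) (*-mono (0≤κ sx) (*-≥0 (0≤κ sy) 0≤V) (κ≤ε sx) six)))
    bounds : ∀ b → Unit b → (main - rec 2 * η ≤ κ * κ' * (φ * A x y b)) × (κ * κ' * (φ * A x y b) ≤ main + rec 2 * η)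
    bounds b cb = ≤-trans (≤-by {s = rec 2 * η - κ * κ' * (φ * Err) + κ * κ' * (φ * Err - - D)} (+-≥0 (diff≥0 err≤) (*-≥0 0≤κκ (diff≥0 (proj₂ close)))) (lem main (rec 2 * η) (κ * κ') (φ * Err) D)) (≤-reflexive back) ,
        ≤-trans (≤-reflexive (sym back)) (≤-trans (+ˡ main (*-monoˡ 0≤κκ (proj₁ close))) (+ˡ main err≤))
      where
      D : ℚ
      D = φ * A x y b - (lg x * U y + U x * U y)
      close = ∣∣≤⇒ {D} {φ * Err} (φA-close cb (1≤x sx) x≤y (x≤Y sy))
      lem : ∀ m h k e d → m + k * d ≡ m - h + (h - k * e + k * (e - - d))
      lem = RS.solve-∀ ℚring
      back : main + κ * κ' * D ≡ κ * κ' * (φ * A x y b)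
      back = trans (cong (_+ κ * κ' * D) (sym main≡)) (lem2 (κ * κ') (φ * A x y b) (lg x * U y + U x * U y))
        where
        lem2 : ∀ k a m → k * m + k * (a - m) ≡ k * a
        lem2 = RS.solve-∀ ℚring
    η'≤1 : η' ≤ 1ℚ
    η'≤1 = ≤-trans (*-monoˡ (0≤rec 8) η≤1) (≤-trans (≤-reflexive (*-identityʳ (rec 8))) (rec≤1 8))
    hi : main + rec 2 * η ≤ ι 2 + η
    hi = ≤-trans (+ʳ (rec 2 * η) (+-mono-≤ Y'.u≤ (*-mono X.0≤u Y'.0≤u X.u≤ Y'.u≤)))
      (≤-by (*-≥0 0≤η' (diff≥0 η'≤1)) (trans (lem η η') (trans (cong (λ t → 1ℚ + η' + (1ℚ + η') * (1ℚ + η') + rec 2 * η + η' * (1ℚ - η') + t) (vanish η)) (+-identityʳ _))))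
      where
      lem : ∀ e e' → ι 2 + e ≡ 1ℚ + e' + (1ℚ + e') * (1ℚ + e') + rec 2 * e + e' * (1ℚ - e') + (rec 2 * e - ι 4 * e')
      lem = RS.solve-∀ ℚring
      vanish : ∀ e → rec 2 * e - ι 4 * (rec 8 * e) ≡ 0ℚ
      vanish = RS.solve-∀ ℚring
    lo : ι 2 - η ≤ main - rec 2 * η
    lo = ≤-trans (≤-by (+-≥0 0≤η' (*-≥0 0≤η' 0≤η')) (trans (lem η η') (trans (cong (λ t → ι 2 - η + (η' + η' * η') + t) (vanish η)) (+-identityʳ _)))) (+ʳ (- (rec 2 * η)) (+-mono-≤ Y'.u≥ (*-mono 0≤1-η' 0≤1-η' X.u≥ Y'.u≥)))
      where
      0≤1-η' : 0ℚ ≤ 1ℚ - η'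
      0≤1-η' = diff≥0 η'≤1
      lem : ∀ e e' → 1ℚ - e' + (1ℚ - e') * (1ℚ - e') - rec 2 * e ≡ ι 2 - e + (e' + e' * e') + (rec 2 * e - ι 4 * e')
      lem = RS.solve-∀ ℚring
      vanish : ∀ e → rec 2 * e - ι 4 * (rec 8 * e) ≡ 0ℚ
      vanish = RS.solve-∀ ℚring

  -- The pointwise bound φ p ≤ 2 + η follows from the pair with a smaller scale by dropping the
  -- nonnegative convolution; hence the auxiliary scale x₀.
  density : ∀ {x₀ κ₀ x κ} (s₀ : Scale x₀ κ₀) (sx : Scale x κ) → Pair (p x₀ κ₀) (p x κ) → Density (p x κ)
  density {x₀} {κ₀} {x} {κ} s₀ sx pr = record
    { nonneg = X.0≤p
    ; le = λ t ct → ≤-trans (≤-trans (≤-+ (φ * p x κ t) (*-≥0 0≤φ (∑-≥0 d (λ s _ _ → ∑-≥0 d (λ s' _ _ → *-≥0 (0≤𝟙 ((s ℕ.* s') ℕ.% d ℕₚ.≟ t ℕ.% d)) (*-≥0 (X₀.0≤p s) (X.0≤p s')))))))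
        (≤-reflexive (sym (*-distribˡ-+ φ (p x κ t) (conv (p x₀ κ₀) (p x κ) t))))) (upper pr t ct)
    ; mass≤ = ≤-trans (≤-reflexive X.mass) (≤-trans X.u≤ (+ˡ 1ℚ η'≤η))
    ; mass≥ = ≤-trans (+ˡ 1ℚ (ℚₚ.neg-antimono-≤ η'≤η)) (≤-trans X.u≥ (≤-reflexive (sym X.mass)))
    ; miss = ≤-trans (*-monoˡ (0≤κ sx) (≤-trans (W-rare N a (x≤Y sx) H) (≤-by (0≤ι 2) (lem (ι N))))) (≤-trans X.N+4κ≤ η'≤η)
    ; cong-≋ = λ e → cong (κ *_) (W-≋ x e)
    }
    where
    module X = At sx
    module X₀ = At s₀
    lem : ∀ n → n + ι 4 ≡ n + ι 2 + ι 2
    lem = RS.solve-∀ ℚring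

  -- Complete multiplicativity makes the sum in `smear-sum` the product of Σ Λ(n)χ(n)/n and S = Σ
  -- χ(k)/k, so this product is at most Z in absolute value. As the first factor is at most -½ lg z,
  -- S is at most 2Zε, while `L1-lower` keeps C S ≥ 1; condition `c₃` yields 1 ≤ 2 · ¼.
  contradiction : Unit a → ∀ {x₀ κ₀ x κ₁ y κ₂ z κ₃} → Scale x₀ κ₀ → (sx : Scale x κ₁) (sy : Scale y κ₂) (sz : Scale z κ₃) →
    Pair (p x₀ κ₀) (p x κ₁) → Pair (p x κ₁) (p y κ₂) → Pair (p x κ₁) (p z κ₃) → Pair (p y κ₂) (p z κ₃) →
    16 ℕ.* ((3 ℕ.* d) ℕ.* (3 ℕ.* d) ℕ.* ((3 ℕ.* d) ℕ.* (3 ℕ.* d))) ℕ.≤ z → ⊥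
  contradiction ca {z = z} {κ₃} s₀ sx sy sz p₀x pxy pxz pyz big-z = <⇒≱ half (≤-trans L1 (≤-trans (≤-reflexive (lem0 C S)) (≤-trans (*-monoˡ {c = ι 2} (0≤ι 2) (≤-trans CS≤ c₃)) ≤-refl)))
    where
    open Coset (density s₀ sx p₀x) (density sx sy pxy) (density sx sz pxz) pxy pxz pyz ca
    module RC' = RealCharacter d (ℕ.>-nonZero⁻¹ d) χ χ-osc χ-sign χ-1 χ-*
    half : ι 2 * rec 4 < 1ℚ
    half = from-yes ((ι 2 * rec 4) ℚₚ.<? 1ℚ)
    S Vχ C : ℚ
    S = ∑ z (λ k → χ k * rec k)
    Vχ = ∑ z (λ n → Λr n * χ n)
    C = ι 32 * ι 81 * (ι d * ι d * ι d)
    L1 : 1ℚ ≤ C * S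
    L1 = RC'.L1-lower big-z
    0≤C : 0ℚ ≤ C
    0≤C = *-≥0 (*-≥0 (0≤ι 32) (0≤ι 81)) (*-≥0 (*-≥0 (0≤ι d) (0≤ι d)) (0≤ι d))
    lem0 : ∀ c s → c * s ≡ ι 2 * (c * (rec 2 * s))
    lem0 = RS.solve-∀ ℚring
    κV : κ₃ * Vχ ≤ - ½
    κV = ≤-trans (≤-reflexive (sym (trans (∑-cong d (λ b _ _ → lem (χ b) κ₃ (W z b))) (trans (∑-*ˡ d κ₃ (λ b → χ b * W z b)) (cong (κ₃ *_) (fold z χ χ-≋)))))) ∑χp
      where
      lem : ∀ a b c → a * (b * c) ≡ b * (a * c)
      lem = RS.solve-∀ ℚring
    SV : ∣ Vχ * S ∣ ≤ Z
    SV = ≤-trans (≤-reflexive (cong ∣_∣ (sym (trans (∑-cong z (λ k _ _ → trans (cong (_* rec k) (trans (∑-cong z (λ n _ _ → trans (cong (Λr n *_) (χ-* k n)) (lem (Λr n) (χ k) (χ n)))) (∑-*ˡ z (χ k) (λ n → Λr n * χ n)))) (lem2 (χ k) Vχ (rec k)))) (∑-*ˡ z Vχ (λ k → χ k * rec k))))))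
      (≤-trans (smear-sum χ-osc (1≤x sz) (x≤Y sz)) (≤-reflexive (*-identityʳ Z)))
      where
      lem : ∀ a b c → a * (b * c) ≡ b * (a * c)
      lem = RS.solve-∀ ℚring
      lem2 : ∀ a b c → a * b * c ≡ b * (a * c)
      lem2 = RS.solve-∀ ℚring
    0≤S : 0ℚ ≤ S
    0≤S with ℚₚ.≤-total 0ℚ S
    ... | inj₁ h = h
    ... | inj₂ h = ⊥-elim (<⇒≱ 0<1 (≤-trans L1 (≤-trans (*-monoˡ 0≤C h) (≤-reflexive (*-zeroʳ C)))))
    CS≤ : C * (rec 2 * S) ≤ C * Z * ε
    CS≤ = ≤-trans (*-monoˡ 0≤C (≤-trans (≤-by {s = (- ½ - κ₃ * Vχ) * S} (*-≥0 (diff≥0 κV) 0≤S) (lem κ₃ Vχ S)) (≤-trans (*-monoˡ (0≤κ sz) (≤-trans (-∣∣≤ (Vχ * S)) SV)) (*-monoʳ 0≤Z (κ≤ε sz))))) (≤-reflexive (lem2 C ε Z))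
      where
      0≤Z : 0ℚ ≤ Z
      0≤Z = +-≥0 (*-≥0 (0≤ι 7) (0≤ι d)) 0≤1
      lem : ∀ k v s → k * - (v * s) ≡ rec 2 * s + (- ½ - k * v) * s
      lem = RS.solve-∀ ℚring
      lem2 : ∀ c e z → c * (e * z) ≡ c * z * e
      lem2 = RS.solve-∀ ℚring

-- The choice of scales, and Dirichlet's theorem.

private
  product≤ : ∀ {m n K} → 1 ℕ.≤ n → 1 ℕ.≤ K → m ℕ.* n ℕ.≤ K → ι m * rec K ≤ rec n
  product≤ {m} {n} {K} 1≤n 1≤K h = *-cancelˡ (0<ι 1≤n) (≤-trans (≤-reflexive (trans (lem (ι n) (ι m) (rec K)) (cong (_* rec K) (sym (ι-* m n)))))
    (≤-trans (*-monoʳ (0≤rec K) (ι-mono h)) (≤-reflexive (trans (trans (*-comm (ι K) (rec K)) (rec-ι 1≤K)) (sym (trans (*-comm (ι n) (rec n)) (rec-ι 1≤n)))))))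
    where
    lem : ∀ a b c → a * (b * c) ≡ b * a * c
    lem = RS.solve-∀ ℚring

dirichlet : ∀ d {{_ : ℕ.NonZero d}} a N → C.Coprime a d → ¬ (∀ q → Prime q → N ℕ.< q → ¬ (q ℕ.% d ≡ a ℕ.% d))
dirichlet d a N₀ ca H₀ = contradiction ca s₀ sx sy sz (pair s₀ sx x₀≤x g₁) (pair sx sy x≤y g₂) (pair sx sz (ℕₚ.≤-trans x≤y y≤z) g₃) (pair sy sz y≤z g₄) big-z
  where
  N E B₁ B₂ C B₃ K x₀ x y z : ℕ
  -- With d ≤ N the primes dividing d count as small.
  N = N₀ ℕ.+ d
  E = 100 ℕ.* (d ℕ.* d ℕ.* d)
  C = 32 ℕ.* 81 ℕ.* (d ℕ.* d ℕ.* d)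
  B₁ = (N ℕ.+ 5) ℕ.* (8 ℕ.* E)
  B₂ = d ℕ.* (7 ℕ.* d ℕ.+ 1 ℕ.+ 12 ℕ.* d) ℕ.* (2 ℕ.* E)
  B₃ = C ℕ.* (7 ℕ.* d ℕ.+ 1) ℕ.* 4
  -- ε = 1/K meets the three conditions of `Eps` as soon as K exceeds each of the three bounds.
  K = suc (B₁ ℕ.+ B₂ ℕ.+ B₃)
  -- Every later scale has logarithm at least K times the previous scale, so x/lg y ≤ 1/K for
  -- consecutive scales and also for x and z.
  x₀ = scale K
  x = scale (K ℕ.* x₀)
  y = scale (K ℕ.* x)
  z = scale (K ℕ.* y)
  1≤d : 1 ℕ.≤ d
  1≤d = ℕ.>-nonZero⁻¹ d
  1≤E : 1 ℕ.≤ E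
  1≤E = ℕₚ.*-mono-≤ {1} {100} (s≤s z≤n) (ℕₚ.*-mono-≤ (ℕₚ.*-mono-≤ 1≤d 1≤d) 1≤d)
  grow : ∀ w → w ℕ.≤ scale (K ℕ.* w)
  grow w = ℕₚ.≤-trans (ℕₚ.m≤n*m w K) (L≤scale (K ℕ.* w))
  x₀≤x = grow x₀
  x≤y = grow x
  y≤z = grow y
  1≤K : 1 ℕ.≤ K
  1≤K = s≤s z≤n
  open Log z (1≤scale (K ℕ.* y))
  ε η : ℚ
  ε = rec K
  η = rec E
  η-tiny : Tiny d η
  η-tiny = tiny (0≤rec E) (≤-reflexive (trans (sym (*-assoc (ι 100) (ι d * ι d * ι d) η)) (trans (cong (_* η) (sym (trans (ι-* 100 (d ℕ.* d ℕ.* d)) (cong (ι 100 *_) ι³)))) (trans (*-comm (ι E) η) (rec-ι 1≤E)))))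
    where
    ι³ : ι (d ℕ.* d ℕ.* d) ≡ ι d * ι d * ι d
    ι³ = trans (ι-* (d ℕ.* d) d) (cong (_* ι d) (ι-* d d))
  B₁≤K : B₁ ℕ.≤ K
  B₁≤K = ℕₚ.m≤n⇒m≤1+n (ℕₚ.≤-trans (ℕₚ.m≤m+n B₁ B₂) (ℕₚ.m≤m+n (B₁ ℕ.+ B₂) B₃))
  B₂≤K : B₂ ℕ.≤ K
  B₂≤K = ℕₚ.m≤n⇒m≤1+n (ℕₚ.≤-trans (ℕₚ.m≤n+m B₂ B₁) (ℕₚ.m≤m+n (B₁ ℕ.+ B₂) B₃))
  B₃≤K : B₃ ℕ.≤ K
  B₃≤K = ℕₚ.m≤n⇒m≤1+n (ℕₚ.m≤n+m B₃ (B₁ ℕ.+ B₂))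
  ι-Z : ι (7 ℕ.* d ℕ.+ 1) ≡ ι 7 * ι d + 1ℚ
  ι-Z = trans (ι-+ (7 ℕ.* d) 1) (cong (_+ ι 1) (ι-* 7 d))
  eps : EpsFor d N η ε
  eps = record
    { 0≤ε = 0≤rec K
    ; ε≤1 = rec≤1 K
    ; c₁ = ≤-trans (≤-reflexive (cong (_* ε) (sym (ι-+ N 5)))) (≤-trans (product≤ {N ℕ.+ 5} {8 ℕ.* E} {K} (ℕₚ.*-mono-≤ {1} {8} (s≤s z≤n) 1≤E) 1≤K B₁≤K) (≤-reflexive (rec-* 8 E)))
    ; c₂ = ≤-trans (≤-reflexive (cong (_* ε) (sym (trans (ι-* d (7 ℕ.* d ℕ.+ 1 ℕ.+ 12 ℕ.* d)) (cong (ι d *_) (trans (ι-+ (7 ℕ.* d ℕ.+ 1) (12 ℕ.* d)) (cong₂ _+_ ι-Z (ι-* 12 d))))))))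
        (≤-trans (product≤ {d ℕ.* (7 ℕ.* d ℕ.+ 1 ℕ.+ 12 ℕ.* d)} {2 ℕ.* E} {K} (ℕₚ.*-mono-≤ {1} {2} (s≤s z≤n) 1≤E) 1≤K B₂≤K) (≤-reflexive (rec-* 2 E)))
    ; c₃ = ≤-trans (≤-reflexive (cong (_* ε) (sym (trans (ι-* C (7 ℕ.* d ℕ.+ 1)) (cong₂ _*_ ιC ι-Z))))) (product≤ {C ℕ.* (7 ℕ.* d ℕ.+ 1)} {4} {K} (s≤s z≤n) 1≤K B₃≤K)
    }
    where
    ιC : ι C ≡ ι 32 * ι 81 * (ι d * ι d * ι d)
    ιC = trans (ι-* (32 ℕ.* 81) (d ℕ.* d ℕ.* d)) (cong₂ _*_ (ι-* 32 81) (trans (ι-* (d ℕ.* d) d) (cong (_* ι d) (ι-* d d))))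
  open Scaled z z (1≤scale (K ℕ.* y)) ℕₚ.≤-refl d N (ℕₚ.m≤n+m d N₀) a (λ q pq N<q → H₀ q pq (ℕₚ.≤-trans (s≤s (ℕₚ.m≤m+n N₀ d)) N<q)) η-tiny eps
  i₀ = inv 1≤K (lg-scale z (1≤scale (K ℕ.* y)) K)
  mk : ∀ w → 1 ℕ.≤ w → ∃ λ κ → κ * lg (scale (K ℕ.* w)) ≡ 1ℚ × 0ℚ ≤ κ × κ ≤ rec (K ℕ.* w)
  mk w 1≤w = inv (ℕₚ.*-mono-≤ 1≤K 1≤w) (lg-scale z (1≤scale (K ℕ.* y)) (K ℕ.* w))
  i₁ = mk x₀ (1≤scale K)
  i₂ = mk x (1≤scale (K ℕ.* x₀))
  i₃ = mk y (1≤scale (K ℕ.* x))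
  κ≤ε' : ∀ {κ} w → 1 ℕ.≤ w → κ ≤ rec (K ℕ.* w) → κ ≤ ε
  κ≤ε' w 1≤w h = ≤-trans h (rec-anti 1≤K (ℕₚ.m≤m*n K w {{ℕ.>-nonZero 1≤w}}))
  s₀ : Scale x₀ (proj₁ i₀)
  s₀ = record { 1≤x = 1≤scale K ; x≤Y = ℕₚ.≤-trans x₀≤x (ℕₚ.≤-trans x≤y y≤z) ; κ-inv = proj₁ (proj₂ i₀) ; 0≤κ = proj₁ (proj₂ (proj₂ i₀)) ; κ≤ε = proj₂ (proj₂ (proj₂ i₀)) }
  sx : Scale x (proj₁ i₁)
  sx = record { 1≤x = 1≤scale (K ℕ.* x₀) ; x≤Y = ℕₚ.≤-trans x≤y y≤z ; κ-inv = proj₁ (proj₂ i₁) ; 0≤κ = proj₁ (proj₂ (proj₂ i₁)) ; κ≤ε = κ≤ε' x₀ (1≤scale K) (proj₂ (proj₂ (proj₂ i₁))) }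
  sy : Scale y (proj₁ i₂)
  sy = record { 1≤x = 1≤scale (K ℕ.* x) ; x≤Y = y≤z ; κ-inv = proj₁ (proj₂ i₂) ; 0≤κ = proj₁ (proj₂ (proj₂ i₂)) ; κ≤ε = κ≤ε' x (1≤scale (K ℕ.* x₀)) (proj₂ (proj₂ (proj₂ i₂))) }
  sz : Scale z (proj₁ i₃)
  sz = record { 1≤x = 1≤scale (K ℕ.* y) ; x≤Y = ℕₚ.≤-refl ; κ-inv = proj₁ (proj₂ i₃) ; 0≤κ = proj₁ (proj₂ (proj₂ i₃)) ; κ≤ε = κ≤ε' y (1≤scale (K ℕ.* x)) (proj₂ (proj₂ (proj₂ i₃))) }
  gap : ∀ {κ} v w → 1 ℕ.≤ w → v ℕ.≤ w → κ ≤ rec (K ℕ.* w) → 0ℚ ≤ κ → ι v * κ ≤ ε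
  gap {κ} v w 1≤w v≤w h 0≤κ = ≤-trans (*-mono {ι v} {ι w} {κ} {rec (K ℕ.* w)} (0≤ι v) 0≤κ (ι-mono v≤w) h) (≤-reflexive (ι*rec* K 1≤w))
  g₁ = gap x₀ x₀ (1≤scale K) ℕₚ.≤-refl (proj₂ (proj₂ (proj₂ i₁))) (proj₁ (proj₂ (proj₂ i₁)))
  g₂ = gap x x (1≤scale (K ℕ.* x₀)) ℕₚ.≤-refl (proj₂ (proj₂ (proj₂ i₂))) (proj₁ (proj₂ (proj₂ i₂)))
  g₃ = gap x y (1≤scale (K ℕ.* x)) x≤y (proj₂ (proj₂ (proj₂ i₃))) (proj₁ (proj₂ (proj₂ i₃)))
  g₄ = gap y y (1≤scale (K ℕ.* x)) ℕₚ.≤-refl (proj₂ (proj₂ (proj₂ i₃))) (proj₁ (proj₂ (proj₂ i₃)))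
  big-z : 16 ℕ.* ((3 ℕ.* d) ℕ.* (3 ℕ.* d) ℕ.* ((3 ℕ.* d) ℕ.* (3 ℕ.* d))) ℕ.≤ z
  -- B₃ already dominates the range required by `L1-lower`, and z ≥ K > B₃.
  big-z = ℕₚ.≤-trans (ℕₚ.≤-trans (subst (16 ℕ.* ((3 ℕ.* d) ℕ.* (3 ℕ.* d) ℕ.* ((3 ℕ.* d) ℕ.* (3 ℕ.* d))) ℕ.≤_) (sym (lem d)) (ℕₚ.m≤m+n _ _)) B₃≤K)
    (ℕₚ.≤-trans (L≤scale K) (ℕₚ.≤-trans x₀≤x (ℕₚ.≤-trans x≤y y≤z)))
    where
    lem : ∀ d → 32 ℕ.* 81 ℕ.* (d ℕ.* d ℕ.* d) ℕ.* (7 ℕ.* d ℕ.+ 1) ℕ.* 4 ≡ 16 ℕ.* ((3 ℕ.* d) ℕ.* (3 ℕ.* d) ℕ.* ((3 ℕ.* d) ℕ.* (3 ℕ.* d))) ℕ.+ (71280 ℕ.* (d ℕ.* d ℕ.* d ℕ.* d) ℕ.+ 10368 ℕ.* (d ℕ.* d ℕ.* d))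
    lem = ℕS.solve-∀

-- Valuations of rationals and of the hypergeometric coefficients.

-- The cutoff n suffices for n ≥ 1, as pᵏ > n for k > n.
V : ℕ → ℕ → ℚ
V p n = val n p n

V-val : ∀ {p n Y} → Prime p → 1 ℕ.≤ n → n ℕ.≤ Y → val Y p n ≡ V p n
V-val pp 1≤n n≤Y = val-extend (prime≥2 pp) 1≤n ℕₚ.≤-refl n≤Y

V-1 : ∀ {p} → Prime p → V p 1 ≡ 0ℚ
V-1 {p} pp = trans (+-identityˡ _) (𝟙-no (p ℕ.^ 1 ∣? 1) (λ d → ℕₚ.<-irrefl (sym (∣ₚ.∣1⇒≡1 (subst (_∣ 1) (ℕₚ.*-identityʳ p) d))) (prime≥2 pp)))

V-prime* : ∀ {p q n} → Prime p → Prime q → 1 ℕ.≤ n → V p (q ℕ.* n) ≡ 𝟙 (p ℕₚ.≟ q) + V p n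
V-prime* {p} {q} {n} pp pq 1≤n = trans (val-* pp pq 1≤n n≤) (cong (𝟙 (p ℕₚ.≟ q) +_) (V-val pp 1≤n n≤))
  where
  n≤ : n ℕ.≤ q ℕ.* n
  n≤ = ℕₚ.m≤n*m n q {{prime⇒nonZero pq}}

V-* : ∀ {p} → Prime p → ∀ m n → 1 ℕ.≤ m → 1 ℕ.≤ n → V p (m ℕ.* n) ≡ V p m + V p n
V-* {p} pp m n 1≤m 1≤n = prime-induction (λ m → V p (m ℕ.* n) ≡ V p m + V p n)
  (trans (cong (V p) (ℕₚ.*-identityˡ n)) (sym (trans (cong (_+ V p n) (V-1 pp)) (+-identityˡ (V p n)))))
  (λ q m pq 1≤m ih → trans (cong (V p) (ℕₚ.*-assoc q m n)) (trans (V-prime* pp pq (ℕₚ.*-mono-≤ 1≤m 1≤n)) (trans (cong (𝟙 (p ℕₚ.≟ q) +_) ih)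
    (trans (sym (+-assoc (𝟙 (p ℕₚ.≟ q)) (V p m) (V p n))) (cong (_+ V p n) (sym (V-prime* pp pq 1≤m))))))) m 1≤m

0≤V : ∀ p n → 0ℚ ≤ V p n
0≤V p n = ∑-≥0 n (λ k _ _ → 0≤𝟙 (p ℕ.^ k ∣? n))

p∣p^ : ∀ {p k} → 1 ℕ.≤ k → p ∣ p ℕ.^ k
p∣p^ {p} {suc k} _ = ∣ₚ.m∣m*n (p ℕ.^ k)

V-∤ : ∀ {p n} → ¬ (p ∣ n) → V p n ≡ 0ℚ
V-∤ {p} {n} ∤ = ∑-0 n (λ k 1≤k _ → 𝟙-no (p ℕ.^ k ∣? n) (λ d → ∤ (∣ₚ.∣-trans (p∣p^ 1≤k) d)))

V-∣ : ∀ {p n} → 1 ℕ.≤ n → p ∣ n → 1ℚ ≤ V p n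
V-∣ {p} {n} 1≤n d = ≤-trans (≤-reflexive (sym (𝟙-yes (p ℕ.^ 1 ∣? n) (subst (_∣ n) (sym (ℕₚ.*-identityʳ p)) d)))) (term≤∑ n {λ k → 𝟙 (p ℕ.^ k ∣? n)} (λ k _ _ → 0≤𝟙 (p ℕ.^ k ∣? n)) (s≤s z≤n) 1≤n)

data Natural (x : ℚ) : Set where
  nat : ∀ n → x ≡ ι n → Natural x

V-natural : ∀ p n → Natural (V p n)
V-natural p n = go n
  where
  go : ∀ y → Natural (∑ y (λ k → 𝟙 (p ℕ.^ k ∣? n)))
  go zero = nat 0 refl
  go (suc y) with go y | p ℕ.^ suc y ∣? n
  ... | nat m e | yes _ = nat (suc m) (trans (cong (_+ 1ℚ) e) (+-comm (ι m) 1ℚ))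
  ... | nat m e | no _ = nat m (trans (cong (_+ 0ℚ) e) (+-identityʳ (ι m)))

ℤtoℚ≡mkℚ : ∀ z → ℤtoℚ z ≡ mkℚ z 0 (C.sym (C.1-coprimeTo ℤ.∣ z ∣))
ℤtoℚ≡mkℚ z = ℚₚ.↥p/↧p≡p (mkℚ z 0 (C.sym (C.1-coprimeTo ℤ.∣ z ∣)))

ℤtoℚ-+ : ∀ x y → ℤtoℚ (x ℤ.+ y) ≡ ℤtoℚ x + ℤtoℚ y
ℤtoℚ-+ x y rewrite ℤtoℚ≡mkℚ x | ℤtoℚ≡mkℚ y = cong (_/ 1) (sym (cong₂ ℤ._+_ (ℤₚ.*-identityʳ x) (ℤₚ.*-identityʳ y)))

ℤtoℚ-* : ∀ x y → ℤtoℚ (x ℤ.* y) ≡ ℤtoℚ x * ℤtoℚ y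
ℤtoℚ-* x y rewrite ℤtoℚ≡mkℚ x | ℤtoℚ≡mkℚ y = refl

-- The p-adic valuation, rational-valued; ν p 0 is junk.
ν : ℕ → ℚ → ℚ
ν p x = V p ℤ.∣ ↥ x ∣ - V p (↧ₙ x)

private
  ∣∣≥1 : ∀ {z} → z ≢ ℤ.+ 0 → 1 ℕ.≤ ℤ.∣ z ∣
  ∣∣≥1 {ℤ.+ zero} h = ⊥-elim (h refl)
  ∣∣≥1 {ℤ.+ suc n} h = s≤s z≤n
  ∣∣≥1 {ℤ.-[1+ n ]} h = s≤s z≤n

  ↥≢0 : ∀ {x} → x ≢ 0ℚ → ↥ x ≢ ℤ.+ 0
  ↥≢0 {x} h e = h (ℚₚ.↥p≡0⇒p≡0 x e)

↥≥1 : ∀ {x} → x ≢ 0ℚ → 1 ℕ.≤ ℤ.∣ ↥ x ∣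
↥≥1 h = ∣∣≥1 (↥≢0 h)

↧≥1 : ∀ x → 1 ℕ.≤ ↧ₙ x
↧≥1 (mkℚ _ _ _) = s≤s z≤n

*-≢0 : ∀ {x y} → x ≢ 0ℚ → y ≢ 0ℚ → x * y ≢ 0ℚ
*-≢0 {x} {y} hx hy e = hx (trans (sym (*-identityʳ x)) (trans (cong (x *_) (sym (ℚₚ.*-inverseʳ y {{nz}}))) (trans (sym (*-assoc x y _)) (trans (cong (_* Data.Rational.1/_ y {{nz}}) e) (*-zeroˡ (Data.Rational.1/_ y {{nz}}))))))
  where
  nz = Data.Rational.≢-nonZero hy

-- Reducing the product to lowest terms cancels a factor g, which counts equally in numerator and
-- denominator.
ν-* : ∀ {p x y} → Prime p → x ≢ 0ℚ → y ≢ 0ℚ → ν p (x * y) ≡ ν p x + ν p y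
ν-* {p} {x} {y} pp hx hy = combine (V p ℤ.∣ ↥ (x * y) ∣) (V p (↧ₙ (x * y))) (V p g) (V p ℤ.∣ ↥ x ∣) (V p ℤ.∣ ↥ y ∣) (V p (↧ₙ x)) (V p (↧ₙ y)) num den
  where
  nf : ℤ.ℤ
  nf = ℤgcd.gcd (↥ x ℤ.* ↥ y) (↧ x ℤ.* ↧ y)
  g : ℕ
  g = ℤ.∣ nf ∣
  den-eq : ↧ₙ (x * y) ℕ.* g ≡ ↧ₙ x ℕ.* ↧ₙ y
  den-eq = trans (sym (ℤₚ.abs-* (↧ (x * y)) (nf))) (trans (cong ℤ.∣_∣ (ℚₚ.↧-* x y)) (ℤₚ.abs-* (↧ x) (↧ y)))
  num-eq : ℤ.∣ ↥ (x * y) ∣ ℕ.* g ≡ ℤ.∣ ↥ x ∣ ℕ.* ℤ.∣ ↥ y ∣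
  num-eq = trans (sym (ℤₚ.abs-* (↥ (x * y)) (nf))) (trans (cong ℤ.∣_∣ (ℚₚ.↥-* x y)) (ℤₚ.abs-* (↥ x) (↥ y)))
  1≤g : 1 ℕ.≤ g
  1≤g = ℕₚ.n≢0⇒n>0 (λ g≡0 → ℕₚ.<⇒≢ (ℕₚ.*-mono-≤ (↧≥1 x) (↧≥1 y)) (trans (sym (ℕₚ.*-zeroʳ (↧ₙ (x * y)))) (trans (cong (↧ₙ (x * y) ℕ.*_) (sym g≡0)) den-eq)))
  num : V p ℤ.∣ ↥ (x * y) ∣ + V p g ≡ V p ℤ.∣ ↥ x ∣ + V p ℤ.∣ ↥ y ∣
  num = trans (sym (V-* pp _ _ (↥≥1 (*-≢0 hx hy)) 1≤g)) (trans (cong (V p) num-eq) (V-* pp _ _ (↥≥1 hx) (↥≥1 hy)))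
  den : V p (↧ₙ (x * y)) + V p g ≡ V p (↧ₙ x) + V p (↧ₙ y)
  den = trans (sym (V-* pp _ _ (↧≥1 (x * y)) 1≤g)) (trans (cong (V p) den-eq) (V-* pp _ _ (↧≥1 x) (↧≥1 y)))
  combine : ∀ a b g x y x' y' → a + g ≡ x + y → b + g ≡ x' + y' → a - b ≡ x - x' + (y - y')
  combine a b g x y x' y' e e' = trans (lem a b g) (trans (cong₂ _-_ e e') (lem2 x y x' y'))
    where
    lem : ∀ a b g → a - b ≡ a + g - (b + g)
    lem = RS.solve-∀ ℚring
    lem2 : ∀ x y x' y' → x + y - (x' + y') ≡ x - x' + (y - y')
    lem2 = RS.solve-∀ ℚring

ν-ℤ : ∀ {p} → Prime p → ∀ z → ν p (ℤtoℚ z) ≡ V p ℤ.∣ z ∣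
ν-ℤ {p} pp z = trans (cong (ν p) (ℤtoℚ≡mkℚ z)) (trans (cong (λ t → V p ℤ.∣ z ∣ - t) (V-1 pp)) (lem (V p ℤ.∣ z ∣)))
  where
  lem : ∀ a → a - 0ℚ ≡ a
  lem = RS.solve-∀ ℚring

ν-ι : ∀ {p} → Prime p → ∀ n → ν p (ι n) ≡ V p n
ν-ι {p} pp n = trans (cong (ν p) (ι≡ℕtoℚ n)) (ν-ℤ pp (ℤ.+ n))

ν-1 : ∀ {p} → Prime p → ν p 1ℚ ≡ 0ℚ
ν-1 {p} pp = trans (ν-ι pp 1) (V-1 pp)

ι≢0 : ∀ {n} → 1 ℕ.≤ n → ι n ≢ 0ℚ
ι≢0 h e = ℚₚ.<-irrefl (sym e) (0<ι h)

divQ-* : ∀ {x y} → y ≢ 0ℚ → divQ x y * y ≡ x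
divQ-* {x} {y} hy with y ℚₚ.≟ 0ℚ
... | yes e = ⊥-elim (hy e)
... | no h = trans (*-assoc x _ y) (trans (cong (x *_) (ℚₚ.*-inverseˡ y {{Data.Rational.≢-nonZero h}})) (*-identityʳ x))

divQ-≢0 : ∀ {x y} → x ≢ 0ℚ → y ≢ 0ℚ → divQ x y ≢ 0ℚ
divQ-≢0 {x} {y} hx hy e = hx (trans (sym (divQ-* hy)) (trans (cong (_* y) e) (*-zeroˡ y)))

ν-divQ : ∀ {p x y} → Prime p → x ≢ 0ℚ → y ≢ 0ℚ → ν p (divQ x y) ≡ ν p x - ν p y
ν-divQ {p} {x} {y} pp hx hy = trans (lem (ν p (divQ x y)) (ν p y)) (cong (_- ν p y) (trans (sym (ν-* pp (divQ-≢0 hx hy) hy)) (cong (ν p) (divQ-* hy))))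
  where
  lem : ∀ a b → a ≡ a + b - b
  lem = RS.solve-∀ ℚring

^ℚ-≢0 : ∀ {x} → x ≢ 0ℚ → ∀ n → x ^ℚ n ≢ 0ℚ
^ℚ-≢0 hx zero = λ ()
^ℚ-≢0 hx (suc n) = *-≢0 hx (^ℚ-≢0 hx n)

ν-^ : ∀ {p x} → Prime p → x ≢ 0ℚ → ∀ n → ν p (x ^ℚ n) ≡ ι n * ν p x
ν-^ {p} {x} pp hx zero = trans (ν-1 pp) (sym (*-zeroˡ (ν p x)))
ν-^ {p} {x} pp hx (suc n) = trans (ν-* pp hx (^ℚ-≢0 hx n)) (trans (cong (ν p x +_) (ν-^ pp hx n)) (lem (ν p x) (ι n)))
  where
  lem : ∀ a b → a + b * a ≡ (1ℚ + b) * a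
  lem = RS.solve-∀ ℚring

coprime-parts : ∀ x → C.Coprime ℤ.∣ ↥ x ∣ (↧ₙ x)
coprime-parts (mkℚ n d-1 c) = C.recompute c

ν-integer : ∀ {p k} → Prime p → IsInteger k → 0ℚ ≤ ν p k
ν-integer {p} pp (z , refl) = ≤-trans (0≤V p ℤ.∣ z ∣) (≤-reflexive (sym (ν-ℤ pp z)))

-- A prime factor of the reduced denominator does not divide the numerator, so the valuation there
-- would be negative.
integer-ν : ∀ x → (∀ p → Prime p → 0ℚ ≤ ν p x) → IsInteger x
integer-ν x h with ↧ₙ x ℕₚ.≟ 1
... | yes e = ↥ x , trans (sym (ℚₚ.↥p/↧p≡p x)) (ℚₚ./-cong {↥ x} {↧ₙ x} {↥ x} {1} refl e)
... | no ne = ⊥-elim (bad (prime-divisor (↧ₙ x) (ℕₚ.≤∧≢⇒< (↧≥1 x) (λ e → ne (sym e)))))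
  where
  bad : (∃ λ p → Prime p × p ∣ ↧ₙ x) → ⊥
  bad (p , pp , d) = ℚₚ.<-irrefl refl (ℚₚ.<-≤-trans 0<1 (≤-trans (V-∣ (↧≥1 x) d) (≤-trans (≤-by (h p pp) (lem (V p ℤ.∣ ↥ x ∣) (V p (↧ₙ x)))) (≤-reflexive (V-∤ (λ d' → ℕₚ.<-irrefl (sym (coprime-parts x (d' , d))) (prime≥2 pp)))))))
    where
    lem : ∀ a b → a ≡ b + (a - b)
    lem = RS.solve-∀ ℚring

*-den : ∀ a → a * ι (↧ₙ a) ≡ ℤtoℚ (↥ a)
*-den a@(mkℚ n d-1 c) = trans (cong (a *_) (ι≡ (suc d-1))) (trans (ℚₚ.toℚᵘ-injective (ℚᵘₚ.≃-trans (ℚₚ.toℚᵘ-homo-* a (mkℚ (ℤ.+ suc d-1) 0 (C.sym (C.1-coprimeTo (suc d-1))))) (ℚᵘ.*≡* eq))) (sym (ℤtoℚ≡mkℚ n)))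
  where
  eq : n ℤ.* ℤ.+ suc d-1 ℤ.* ℤ.+ 1 ≡ n ℤ.* ℤ.+ (suc (d-1 ℕ.* 1))
  eq = trans (ℤₚ.*-identityʳ (n ℤ.* ℤ.+ suc d-1)) (cong (λ t → n ℤ.* ℤ.+ suc t) (sym (ℕₚ.*-identityʳ d-1)))

ν-den : ∀ a i → a * ι (↧ₙ a) + ι i * ι (↧ₙ a) ≡ ℤtoℚ (↥ a ℤ.+ ℤ.+ i ℤ.* ↧ a)
ν-den a i = trans (cong₂ _+_ (*-den a) (trans (cong₂ _*_ (ι≡ℕtoℚ i) (ι≡ℕtoℚ (↧ₙ a))) (sym (ℤtoℚ-* (ℤ.+ i) (↧ a))))) (sym (ℤtoℚ-+ (↥ a) (ℤ.+ i ℤ.* ↧ a)))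

Sν : ℕ → ℚ → ℕ → ℚ
Sν p a n = ∑ n (λ i → V p ℤ.∣ ↥ a ℤ.+ ℤ.+ ℕ.pred i ℤ.* ↧ a ∣)

suc-pred : ∀ {i} → 1 ℕ.≤ i → suc (ℕ.pred i) ≡ i
suc-pred {suc i} _ = refl

+ι≢0 : ∀ {a} → NotNonPosInt a → ∀ i → a + ι i ≢ 0ℚ
+ι≢0 {a} h i e = h i (trans (lem a (ι i)) (trans (cong (_- ι i) e) (trans (+-identityˡ (- ι i)) (cong -_ (ι≡ℕtoℚ i)))))
  where
  lem : ∀ a b → a ≡ a + b - b
  lem = RS.solve-∀ ℚring

poch-step : ∀ a n → poch a (suc n) ≡ poch a n * (a + ι n)
poch-step a n = cong (λ t → poch a n * (a + t)) (sym (ι≡ℕtoℚ n))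

poch≢0 : ∀ {a} → NotNonPosInt a → ∀ n → poch a n ≢ 0ℚ
poch≢0 h zero = λ ()
poch≢0 {a} h (suc n) e = *-≢0 (poch≢0 h n) (+ι≢0 h n) (trans (sym (poch-step a n)) e)

shift : ℚ → ℕ → ℤ.ℤ
shift a i = ↥ a ℤ.+ ℤ.+ i ℤ.* ↧ a

shift-eq : ∀ a i → (a + ι i) * ι (↧ₙ a) ≡ ℤtoℚ (shift a i)
shift-eq a i = trans (*-distribʳ-+ (ι (↧ₙ a)) a (ι i)) (ν-den a i)

shift≢0 : ∀ {a} → NotNonPosInt a → ∀ i → shift a i ≢ ℤ.+ 0
shift≢0 {a} h i e = *-≢0 (+ι≢0 h i) (ι≢0 (↧≥1 a)) (trans (shift-eq a i) (cong ℤtoℚ e))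

ν-shift : ∀ {p a} → Prime p → NotNonPosInt a → ∀ i → ν p (a + ι i) ≡ V p ℤ.∣ shift a i ∣ - V p (↧ₙ a)
ν-shift {p} {a} pp h i = trans (lem (ν p (a + ι i)) (V p (↧ₙ a))) (cong (_- V p (↧ₙ a)) (trans (cong (ν p (a + ι i) +_) (sym (ν-ι pp (↧ₙ a)))) (trans (sym (ν-* pp (+ι≢0 h i) (ι≢0 (↧≥1 a)))) (trans (cong (ν p) (shift-eq a i)) (ν-ℤ pp (shift a i))))))
  where
  lem : ∀ a b → a ≡ a + b - b
  lem = RS.solve-∀ ℚring

ν-poch : ∀ {p a} → Prime p → NotNonPosInt a → ∀ n → ν p (poch a n) ≡ Sν p a n - ι n * V p (↧ₙ a)
ν-poch {p} {a} pp h zero = trans (ν-1 pp) (lem (V p (↧ₙ a)))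
  where
  lem : ∀ v → 0ℚ ≡ 0ℚ - 0ℚ * v
  lem = RS.solve-∀ ℚring
ν-poch {p} {a} pp h (suc n) = trans (cong (ν p) (poch-step a n)) (trans (ν-* pp (poch≢0 h n) (+ι≢0 h n)) (trans (cong₂ _+_ (ν-poch pp h n) (ν-shift pp h n)) (lem (Sν p a n) (ι n) (V p (↧ₙ a)) (V p ℤ.∣ shift a n ∣))))
  where
  lem : ∀ s n v x → s - n * v + (x - v) ≡ s + x - (1ℚ + n) * v
  lem = RS.solve-∀ ℚring

-- If p divides the denominator of a, then it divides no numerator of a + i.
Sν-0 : ∀ {p a} → Prime p → p ∣ ↧ₙ a → ∀ n → Sν p a n ≡ 0ℚ
Sν-0 {p} {a} pp d n = ∑-0 n (λ i _ _ → V-∤ (λ h → ℕₚ.<-irrefl (sym (coprime-parts a (back (ℕ.pred i) h , d))) (prime≥2 pp)))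
  where
  back : ∀ i → p ∣ ℤ.∣ shift a i ∣ → p ∣ ℤ.∣ ↥ a ∣
  back i h = ℤ∣.∣⇒∣ᵤ (ℤ∣.∣m+n∣n⇒∣m {ℤ.+ p} {↥ a} {ℤ.+ i ℤ.* ↧ a} (ℤ∣.∣ᵤ⇒∣ h) (ℤ∣.∣ᵤ⇒∣ (subst (p ∣_) (sym (ℤₚ.abs-* (ℤ.+ i) (↧ a))) (∣ₚ.∣n⇒∣m*n i d))))

prodℚ-≢0 : ∀ {xs} → All (_≢ 0ℚ) xs → prodℚ xs ≢ 0ℚ
prodℚ-≢0 [] = λ ()
prodℚ-≢0 (h ∷ hs) = *-≢0 h (prodℚ-≢0 hs)

∑ˡ : List ℚ → (ℚ → ℚ) → ℚ
∑ˡ [] f = 0ℚ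
∑ˡ (x ∷ xs) f = f x + ∑ˡ xs f

∑ˡ-cong : ∀ {P : ℚ → Set} {xs f g} → All P xs → (∀ x → P x → f x ≡ g x) → ∑ˡ xs f ≡ ∑ˡ xs g
∑ˡ-cong [] h = refl
∑ˡ-cong (p ∷ ps) h = cong₂ _+_ (h _ p) (∑ˡ-cong ps h)

∑ˡ-≤ : ∀ {P : ℚ → Set} {xs f g} → All P xs → (∀ x → P x → f x ≤ g x) → ∑ˡ xs f ≤ ∑ˡ xs g
∑ˡ-≤ [] h = ≤-refl
∑ˡ-≤ (p ∷ ps) h = +-mono-≤ (h _ p) (∑ˡ-≤ ps h)

∑ˡ-+ : ∀ xs f g → ∑ˡ xs (λ x → f x + g x) ≡ ∑ˡ xs f + ∑ˡ xs g
∑ˡ-+ [] f g = refl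
∑ˡ-+ (x ∷ xs) f g = trans (cong (f x + g x +_) (∑ˡ-+ xs f g)) (lem (f x) (g x) (∑ˡ xs f) (∑ˡ xs g))
  where
  lem : ∀ a b c e → a + b + (c + e) ≡ a + c + (b + e)
  lem = RS.solve-∀ ℚring

∑ˡ-*ˡ : ∀ xs c f → ∑ˡ xs (λ x → c * f x) ≡ c * ∑ˡ xs f
∑ˡ-*ˡ [] c f = sym (*-zeroʳ c)
∑ˡ-*ˡ (x ∷ xs) c f = trans (cong (c * f x +_) (∑ˡ-*ˡ xs c f)) (sym (*-distribˡ-+ c (f x) (∑ˡ xs f)))

∑ˡ-swap : ∀ xs y (f : ℚ → ℕ → ℚ) → ∑ˡ xs (λ x → ∑ y (f x)) ≡ ∑ y (λ i → ∑ˡ xs (λ x → f x i))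
∑ˡ-swap [] y f = sym (∑-0 y (λ _ _ _ → refl))
∑ˡ-swap (x ∷ xs) y f = trans (cong (∑ y (f x) +_) (∑ˡ-swap xs y f)) (sym (∑-+ y (f x) (λ i → ∑ˡ xs (λ x → f x i))))

ν-prod-poch : ∀ {p xs} → Prime p → All NotNonPosInt xs → ∀ n → (prodℚ (map (λ a → poch a n) xs) ≢ 0ℚ) × (ν p (prodℚ (map (λ a → poch a n) xs)) ≡ ∑ˡ xs (λ a → Sν p a n) - ι n * ∑ˡ xs (λ a → V p (d a)))
ν-prod-poch {p} pp [] n = (λ ()) , trans (ν-1 pp) (lem (ι n))
  where
  lem : ∀ n → 0ℚ ≡ 0ℚ - n * 0ℚ
  lem = RS.solve-∀ ℚring
ν-prod-poch {p} {x ∷ xs} pp (h ∷ hs) n = *-≢0 (poch≢0 h n) (proj₁ rest) , trans (ν-* pp (poch≢0 h n) (proj₁ rest)) (trans (cong₂ _+_ (ν-poch pp h n) (proj₂ rest))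
    (lem (Sν p x n) (V p (d x)) (∑ˡ xs (λ a → Sν p a n)) (∑ˡ xs (λ a → V p (d a))) (ι n)))
  where
  rest = ν-prod-poch {p} pp hs n
  lem : ∀ s v s' v' n → s - n * v + (s' - n * v') ≡ s + s' - n * (v + v')
  lem = RS.solve-∀ ℚring

-- W p n is the valuation of the n-th coefficient after the denominators d(α), d(β) are cleared.
W : List ℚ → List ℚ → ℕ → ℕ → ℚ
W α β p n = ∑ˡ α (λ a → Sν p a n) - ∑ˡ β (λ a → Sν p a n)

Vd : List ℚ → List ℚ → ℕ → ℚ
Vd α β p = ∑ˡ α (λ a → V p (d a)) - ∑ˡ β (λ a → V p (d a))

coeff≢0 : ∀ {α β} → All NotNonPosInt α → All NotNonPosInt β → ∀ n → hypCoeff α β n ≢ 0ℚ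
coeff≢0 hα hβ n = divQ-≢0 (proj₁ (ν-prod-poch prime[2] hα n)) (proj₁ (ν-prod-poch prime[2] hβ n))

ν-coeff : ∀ {p α β} → Prime p → All NotNonPosInt α → All NotNonPosInt β → ∀ {c} → c ≢ 0ℚ → ∀ n →
  ν p ((c ^ℚ n) * hypCoeff α β n) ≡ ι n * (ν p c - Vd α β p) + W α β p n
ν-coeff {p} {α} {β} pp hα hβ {c} hc n = trans (ν-* pp (^ℚ-≢0 hc n) (coeff≢0 hα hβ n)) (trans (cong₂ _+_ (ν-^ pp hc n) (trans (ν-divQ pp (proj₁ A) (proj₁ B)) (cong₂ _-_ (proj₂ A) (proj₂ B))))
    (lem (ι n) (ν p c) (∑ˡ α (λ a → Sν p a n)) (∑ˡ α (λ a → V p (d a))) (∑ˡ β (λ a → Sν p a n)) (∑ˡ β (λ a → V p (d a)))))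
  where
  A = ν-prod-poch {p} pp hα n
  B = ν-prod-poch {p} pp hβ n
  lem : ∀ n c s v s' v' → n * c + (s - n * v - (s' - n * v')) ≡ n * (c - (v - v')) + (s - s')
  lem = RS.solve-∀ ℚring

-- Growth of the valuations along n = pᵏ.

module ClassDiv (m : ℕ) {{m≢0 : ℕ.NonZero m}} where
  open Classes m

  ≋⇒∣ : ∀ {x y} → x ≋ y → ℤ.+ m ℤ∣.∣ ℤ.+ x ℤ.- ℤ.+ y
  ≋⇒∣ {x} {y} e = ℤ∣.divides (ℤ.+ (x ℕ./ m) ℤ.- ℤ.+ (y ℕ./ m)) (trans (cong₂ ℤ._-_ (split x) (split y)) (trans (cong (λ t → ℤ.+ t ℤ.+ ℤ.+ (x ℕ./ m) ℤ.* ℤ.+ m ℤ.- (ℤ.+ (y ℕ.% m) ℤ.+ ℤ.+ (y ℕ./ m) ℤ.* ℤ.+ m)) e) (lem (ℤ.+ (y ℕ.% m)) (ℤ.+ (x ℕ./ m)) (ℤ.+ (y ℕ./ m)) (ℤ.+ m))))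
    where
    split : ∀ x → ℤ.+ x ≡ ℤ.+ (x ℕ.% m) ℤ.+ ℤ.+ (x ℕ./ m) ℤ.* ℤ.+ m
    split x = trans (cong ℤ.+_ (DM.m≡m%n+[m/n]*n x m)) (trans (ℤₚ.pos-+ (x ℕ.% m) (x ℕ./ m ℕ.* m)) (cong (λ t → ℤ.+ (x ℕ.% m) ℤ.+ t) (ℤₚ.pos-* (x ℕ./ m) m)))
    lem : ∀ r a b m → r ℤ.+ a ℤ.* m ℤ.- (r ℤ.+ b ℤ.* m) ≡ (a ℤ.- b) ℤ.* m
    lem = ℤS.solve-∀

  ∣⇒≋ : ∀ {x y} → ℤ.+ m ℤ∣.∣ ℤ.+ x ℤ.- ℤ.+ y → x ≋ y
  ∣⇒≋ {x} {y} (ℤ∣.divides (ℤ.+ q) e) = trans (cong (ℕ._% m) (ℤₚ.+-injective (trans (lem (ℤ.+ x) (ℤ.+ y)) (trans (cong (λ t → ℤ.+ y ℤ.+ t) (trans e (sym (ℤₚ.pos-* q m)))) (sym (ℤₚ.pos-+ y (q ℕ.* m))))))) (+kd≋ y q)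
    where
    lem : ∀ x y → x ≡ y ℤ.+ (x ℤ.- y)
    lem = ℤS.solve-∀
  ∣⇒≋ {x} {y} (ℤ∣.divides ℤ.-[1+ q ] e) = sym (trans (cong (ℕ._% m) (ℤₚ.+-injective (trans (lem (ℤ.+ x) (ℤ.+ y)) (trans (cong (λ t → ℤ.+ x ℤ.+ t) (trans (cong ℤ.-_ e) (trans (ℤₚ.neg-distribˡ-* ℤ.-[1+ q ] (ℤ.+ m)) (sym (ℤₚ.pos-* (suc q) m))))) (sym (ℤₚ.pos-+ x (suc q ℕ.* m))))))) (+kd≋ x (suc q)))
    where
    lem : ∀ x y → y ≡ x ℤ.+ (ℤ.- (x ℤ.- y))
    lem = ℤS.solve-∀

  -- One full period of an arithmetic progression with difference prime to m meets 0 mod m exactly once.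
  progression : ∀ {w} → Unit w → ∀ u → ∑ m (λ i → 𝟙 (m ∣? ℤ.∣ u ℤ.+ ℤ.+ i ℤ.* ℤ.+ w ∣)) ≡ 1ℚ
  progression {w} cw u = via (quotient-class cw b)
    where
    b : ℕ
    -- The congruence to solve is w i ≡ -u; b is -u reduced to a natural number.
    b = ℤ.- u ℤ.%ℕ m
    q : ℤ.ℤ
    q = ℤ.- u ℤ./ℕ m
    -u≡ : ℤ.- u ≡ ℤ.+ b ℤ.+ q ℤ.* ℤ.+ m
    -u≡ = ℤDM.a≡a%ℕn+[a/ℕn]*n (ℤ.- u) m
    eq : ∀ i → u ℤ.+ ℤ.+ i ℤ.* ℤ.+ w ≡ ℤ.+ (w ℕ.* i) ℤ.- ℤ.+ b ℤ.- q ℤ.* ℤ.+ m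
    eq i = trans (lem u (ℤ.+ i) (ℤ.+ w)) (trans (cong (λ t → ℤ.+ w ℤ.* ℤ.+ i ℤ.- t) -u≡) (trans (cong (λ t → t ℤ.- (ℤ.+ b ℤ.+ q ℤ.* ℤ.+ m)) (sym (ℤₚ.pos-* w i))) (lem2 (ℤ.+ (w ℕ.* i)) (ℤ.+ b) (q ℤ.* ℤ.+ m))))
      where
      lem : ∀ u i w → u ℤ.+ i ℤ.* w ≡ w ℤ.* i ℤ.- (ℤ.- u)
      lem = ℤS.solve-∀
      lem2 : ∀ x b q → x ℤ.- (b ℤ.+ q) ≡ x ℤ.- b ℤ.- q
      lem2 = ℤS.solve-∀
    to : ∀ i → m ∣ ℤ.∣ u ℤ.+ ℤ.+ i ℤ.* ℤ.+ w ∣ → w ℕ.* i ≋ b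
    to i h = ∣⇒≋ {w ℕ.* i} {b} (ℤ∣.∣m+n∣n⇒∣m {ℤ.+ m} {ℤ.+ (w ℕ.* i) ℤ.- ℤ.+ b} {ℤ.- (q ℤ.* ℤ.+ m)} (subst (ℤ.+ m ℤ∣.∣_) (eq i) (ℤ∣.∣ᵤ⇒∣ h)) (ℤ∣.∣m⇒∣-m (ℤ∣.∣n⇒∣m*n q ℤ∣.∣-refl)))
    from : ∀ i → w ℕ.* i ≋ b → m ∣ ℤ.∣ u ℤ.+ ℤ.+ i ℤ.* ℤ.+ w ∣
    from i e = ℤ∣.∣⇒∣ᵤ (subst (ℤ.+ m ℤ∣.∣_) (sym (eq i)) (ℤ∣.∣m∣n⇒∣m-n (≋⇒∣ {w ℕ.* i} {b} e) (ℤ∣.∣n⇒∣m*n q ℤ∣.∣-refl)))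
    via : (∃ λ s → 1 ℕ.≤ s × s ℕ.≤ m × w ℕ.* s ≋ b) → ∑ m (λ i → 𝟙 (m ∣? ℤ.∣ u ℤ.+ ℤ.+ i ℤ.* ℤ.+ w ∣)) ≡ 1ℚ
    via (s , 1≤s , s≤m , e) = trans (∑-cong m (λ i _ _ → trans (𝟙-⇔ (m ∣? ℤ.∣ u ℤ.+ ℤ.+ i ℤ.* ℤ.+ w ∣) ((w ℕ.* i) ℕ.% m ℕₚ.≟ b ℕ.% m) (to i) (from i)) (sym (*-identityʳ (𝕖 b (w ℕ.* i)))))) (∑-𝕖* cw (λ _ → 1ℚ) 1≤s s≤m e)

prime-power-coprime : ∀ {p n} → Prime p → ¬ (p ∣ n) → ∀ k → C.Coprime n (p ℕ.^ k)
prime-power-coprime {p} {n} pp ∤ zero = C.sym (C.1-coprimeTo n)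
prime-power-coprime {p} {n} pp ∤ (suc k) {i} (i∣n , i∣) = prime-power-coprime pp ∤ k (i∣n , C.coprime-divisor {i} {p} (λ { (x , y) → prime-coprime pp ∤ (y , ∣ₚ.∣-trans x i∣n) }) i∣)

geometric-sum : ∀ p k → 1 ℕ.≤ p → ι (ℕ.pred p) * ∑ k (λ l → ι (p ℕ.^ (k ℕ.∸ l))) ≡ ι (p ℕ.^ k) - 1ℚ
geometric-sum (suc p) zero _ = trans (*-zeroʳ (ι p)) refl
geometric-sum (suc p) (suc k) h = trans (cong (ι p *_) (∑-front k (λ l → ι (suc p ℕ.^ (suc k ℕ.∸ l))))) (trans (*-distribˡ-+ (ι p) (ι (suc p ℕ.^ k)) _)
  (trans (cong (ι p * ι (suc p ℕ.^ k) +_) (geometric-sum (suc p) k h)) (trans (lem (ι p) (ι (suc p ℕ.^ k))) (cong (_- 1ℚ) (sym (ι-* (suc p) (suc p ℕ.^ k)))))))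
  where
  lem : ∀ p x → p * x + (x - 1ℚ) ≡ (1ℚ + p) * x - 1ℚ
  lem = RS.solve-∀ ℚring

-- Let `c l` count the multiples of pˡ among the first pᵏ numerators. For l ≤ k these numerators
-- form full periods, giving exactly pᵏ⁻ˡ; for l > k at most one multiple occurs, and none for l > k
-- + B by size. Hence S(a, pᵏ) differs from (pᵏ - 1)/(p - 1) by at most B, which does not depend on
-- k.
module Growth {p : ℕ} (pp : Prime p) {a : ℚ} (ha : NotNonPosInt a) (∤ : ¬ (p ∣ ↧ₙ a)) (k : ℕ) where

  private
    w n B L : ℕ
    w = ↧ₙ a
    n = p ℕ.^ k
    B = ℤ.∣ ↥ a ∣ ℕ.+ w
    L = ℤ.∣ ↥ a ∣ ℕ.+ n ℕ.* w

    1≤n : 1 ℕ.≤ n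
    1≤n = ℕₚ.m^n>0 p {{prime⇒nonZero pp}} k

    x : ℕ → ℕ
    x i = ℤ.∣ shift a (ℕ.pred i) ∣

    1≤x : ∀ i → 1 ℕ.≤ x i
    1≤x i = ℕₚ.n≢0⇒n>0 (λ e → shift≢0 ha (ℕ.pred i) (ℤₚ.∣i∣≡0⇒i≡0 e))

    x≤L : ∀ i → i ℕ.≤ n → x i ℕ.≤ L
    x≤L i i≤n = ℕₚ.≤-trans (ℤₚ.∣i+j∣≤∣i∣+∣j∣ (↥ a) (ℤ.+ ℕ.pred i ℤ.* ↧ a)) (ℕₚ.+-monoʳ-≤ ℤ.∣ ↥ a ∣ (ℕₚ.≤-trans (ℕₚ.≤-reflexive (ℤₚ.abs-* (ℤ.+ ℕ.pred i) (↧ a))) (ℕₚ.*-monoˡ-≤ w (ℕₚ.≤-trans ℕₚ.pred[n]≤n i≤n))))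

    c : ℕ → ℚ
    c l = ∑ n (λ i → 𝟙 (p ℕ.^ l ∣? x i))

    S≡ : Sν p a n ≡ ∑ L c
    S≡ = trans (∑-cong n (λ i _ i≤n → sym (V-val pp (1≤x i) (x≤L i i≤n)))) (∑-swap n L (λ i l → 𝟙 (p ℕ.^ l ∣? x i)))

    block : ∀ l s → ∑ (p ℕ.^ l) (λ i → 𝟙 (p ℕ.^ l ∣? x (s ℕ.+ i))) ≡ 1ℚ
    block l s = trans (∑-cong (p ℕ.^ l) (λ i 1≤i _ → cong (λ t → 𝟙 (p ℕ.^ l ∣? ℤ.∣ t ∣)) (reindex i 1≤i))) (ClassDiv.progression (p ℕ.^ l) {{ℕₚ.m^n≢0 p l {{prime⇒nonZero pp}}}} {w} (prime-power-coprime pp ∤ l) (↥ a ℤ.+ (ℤ.+ s ℤ.- ℤ.+ 1) ℤ.* ↧ a))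
      where
      pred-ℤ : ∀ j → 1 ℕ.≤ j → ℤ.+ ℕ.pred j ≡ ℤ.+ j ℤ.- ℤ.+ 1
      pred-ℤ (suc j) _ = trans (lem (ℤ.+ j)) (cong (ℤ._- ℤ.+ 1) (sym (ℤₚ.pos-+ 1 j)))
        where
        lem : ∀ j → j ≡ (ℤ.+ 1 ℤ.+ j) ℤ.- ℤ.+ 1
        lem = ℤS.solve-∀
      reindex : ∀ i → 1 ℕ.≤ i → shift a (ℕ.pred (s ℕ.+ i)) ≡ ↥ a ℤ.+ (ℤ.+ s ℤ.- ℤ.+ 1) ℤ.* ↧ a ℤ.+ ℤ.+ i ℤ.* ℤ.+ w
      reindex i 1≤i = trans (cong (λ t → ↥ a ℤ.+ t ℤ.* ↧ a) (trans (pred-ℤ (s ℕ.+ i) (ℕₚ.≤-trans 1≤i (ℕₚ.m≤n+m i s))) (cong (ℤ._- ℤ.+ 1) (ℤₚ.pos-+ s i)))) (trans (lem (↥ a) (ℤ.+ s) (ℤ.+ i) (↧ a)) (cong (λ t → ↥ a ℤ.+ (ℤ.+ s ℤ.- ℤ.+ 1) ℤ.* ↧ a ℤ.+ ℤ.+ i ℤ.* t) (↧≡ a)))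
        where
        ↧≡ : ∀ a → ↧ a ≡ ℤ.+ ↧ₙ a
        ↧≡ (mkℚ _ _ _) = refl
        lem : ∀ u s i w → u ℤ.+ (s ℤ.+ i ℤ.- ℤ.+ 1) ℤ.* w ≡ u ℤ.+ (s ℤ.- ℤ.+ 1) ℤ.* w ℤ.+ i ℤ.* w
        lem = ℤS.solve-∀

    blocks : ∀ l t s → ∑ (t ℕ.* p ℕ.^ l) (λ i → 𝟙 (p ℕ.^ l ∣? x (s ℕ.+ i))) ≡ ι t
    blocks l zero s = refl
    blocks l (suc t) s = trans (∑-split (p ℕ.^ l) (t ℕ.* p ℕ.^ l) (λ i → 𝟙 (p ℕ.^ l ∣? x (s ℕ.+ i)))) (cong₂ _+_ (block l s)
      (trans (∑-cong (t ℕ.* p ℕ.^ l) (λ i _ _ → cong (λ j → 𝟙 (p ℕ.^ l ∣? x j)) (sym (ℕₚ.+-assoc s (p ℕ.^ l) i)))) (blocks l t (s ℕ.+ p ℕ.^ l))))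

    c-low : ∀ l → l ℕ.≤ k → c l ≡ ι (p ℕ.^ (k ℕ.∸ l))
    c-low l l≤k = trans (cong (λ t → ∑ t (λ i → 𝟙 (p ℕ.^ l ∣? x i))) (trans (cong (p ℕ.^_) (sym (ℕₚ.m∸n+n≡m l≤k))) (ℕₚ.^-distribˡ-+-* p (k ℕ.∸ l) l))) (blocks l (p ℕ.^ (k ℕ.∸ l)) 0)

    c-high : ∀ l → k ℕ.≤ l → c l ≤ 1ℚ
    c-high l k≤l = ≤-trans (∑-mono-range {n} {p ℕ.^ l} (ℕₚ.^-monoʳ-≤ p {{prime⇒nonZero pp}} k≤l) (λ i _ _ → 0≤𝟙 (p ℕ.^ l ∣? x i))) (≤-reflexive (block l 0))

    c-0 : ∀ i → B ℕ.< i → c (k ℕ.+ i) ≡ 0ℚ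
    c-0 i B<i = ∑-0 n (λ j _ j≤n → 𝟙-no (p ℕ.^ (k ℕ.+ i) ∣? x j) (λ h → ℕₚ.<⇒≱ big (ℕₚ.≤-trans (∣ₚ.∣⇒≤ {{ℕ.>-nonZero (1≤x j)}} h) (x≤L j j≤n))))
      where
      big : L ℕ.< p ℕ.^ (k ℕ.+ i)
      big = ℕₚ.≤-trans (s≤s (ℕₚ.≤-trans (ℕₚ.+-monoˡ-≤ (n ℕ.* w) (ℕₚ.m≤n*m ℤ.∣ ↥ a ∣ n {{ℕ.>-nonZero 1≤n}})) (ℕₚ.≤-reflexive (sym (ℕₚ.*-distribˡ-+ n ℤ.∣ ↥ a ∣ w)))))
        (ℕₚ.≤-trans (ℕₚ.*-monoʳ-< n {{ℕ.>-nonZero 1≤n}} (ℕₚ.≤-trans B<i (ℕₚ.≤-trans (ℕₚ.<⇒≤ (n<2^n i)) (ℕₚ.^-monoˡ-≤ i (prime≥2 pp))))) (ℕₚ.≤-reflexive (sym (ℕₚ.^-distribˡ-+-* p k i))))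

    k≤L : k ℕ.≤ L
    k≤L = ℕₚ.≤-trans (ℕₚ.<⇒≤ (ℕₚ.≤-trans (n<2^n k) (ℕₚ.^-monoˡ-≤ k (prime≥2 pp)))) (ℕₚ.≤-trans (ℕₚ.m≤m*n n w {{ℕ.>-nonZero (↧≥1 a)}}) (ℕₚ.m≤n+m (n ℕ.* w) ℤ.∣ ↥ a ∣))

    low-sum : ∑ k c ≡ ∑ k (λ l → ι (p ℕ.^ (k ℕ.∸ l)))
    low-sum = ∑-cong k (λ l _ l≤k → c-low l l≤k)

    1≤p = prime≥1 pp

  growth≥ : ι (p ℕ.^ k) - 1ℚ ≤ ι (ℕ.pred p) * Sν p a (p ℕ.^ k)
  growth≥ = ≤-trans (≤-reflexive (sym (geometric-sum p k 1≤p))) (*-monoˡ (0≤ι (ℕ.pred p)) (≤-trans (≤-reflexive (sym low-sum)) (≤-trans (∑-mono-range k≤L (λ l _ _ → ∑-≥0 n (λ i _ _ → 0≤𝟙 (p ℕ.^ l ∣? x i)))) (≤-reflexive (sym S≡)))))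

  growth≤ : ι (ℕ.pred p) * Sν p a (p ℕ.^ k) ≤ ι (p ℕ.^ k) - 1ℚ + ι (ℕ.pred p) * ι (ℤ.∣ ↥ a ∣ ℕ.+ ↧ₙ a)
  growth≤ = ≤-trans (*-monoˡ (0≤ι (ℕ.pred p)) (≤-trans (≤-reflexive (trans S≡ (trans (cong (λ t → ∑ t c) (sym (ℕₚ.m+[n∸m]≡n k≤L))) (∑-split k (L ℕ.∸ k) c)))) (+-mono-≤ (≤-reflexive low-sum) tail)))
    (≤-reflexive (trans (*-distribˡ-+ (ι (ℕ.pred p)) (∑ k (λ l → ι (p ℕ.^ (k ℕ.∸ l)))) (ι B)) (cong (_+ ι (ℕ.pred p) * ι B) (geometric-sum p k 1≤p))))
    where
    tail : ∑ (L ℕ.∸ k) (λ i → c (k ℕ.+ i)) ≤ ι B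
    tail = ≤-trans (∑-mono (L ℕ.∸ k) (λ i _ _ → each i (i ℕ.≤? B))) (count≤ (L ℕ.∸ k) B)
      where
      each : ∀ i (i? : Dec (i ℕ.≤ B)) → c (k ℕ.+ i) ≤ 𝟙 i?
      each i (yes _) = c-high (k ℕ.+ i) (ℕₚ.m≤m+n k i)
      each i (no h) = ≤-reflexive (c-0 i (ℕₚ.≰⇒> h))

-- The valuation of the formula.

ι-product : ∀ ns → ι (product ns) ≡ foldr _*_ 1ℚ (map ι ns)
ι-product [] = refl
ι-product (n ∷ ns) = trans (ι-* n (product ns)) (cong (ι n *_) (ι-product ns))

product-d≥1 : ∀ xs → 1 ℕ.≤ product (map d xs)
product-d≥1 [] = s≤s z≤n
product-d≥1 (x ∷ xs) = ℕₚ.*-mono-≤ (↧≥1 x) (product-d≥1 xs)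

V-product : ∀ {p} → Prime p → ∀ xs → V p (product (map d xs)) ≡ ∑ˡ xs (λ a → V p (d a))
V-product pp [] = V-1 pp
V-product {p} pp (x ∷ xs) = trans (V-* pp (d x) (product (map d xs)) (↧≥1 x) (product-d≥1 xs)) (cong (V p (d x) +_) (V-product pp xs))

V-power : ∀ {q p} → Prime q → Prime p → ∀ n → V q (p ℕ.^ n) ≡ 𝟙 (q ℕₚ.≟ p) * ι n
V-power {q} {p} pq pp zero = trans (V-1 pq) (sym (*-zeroʳ (𝟙 (q ℕₚ.≟ p))))
V-power {q} {p} pq pp (suc n) = trans (V-prime* pq pp (ℕₚ.m^n>0 p {{prime⇒nonZero pp}} n)) (trans (cong (𝟙 (q ℕₚ.≟ p) +_) (V-power pq pp n)) (lem (𝟙 (q ℕₚ.≟ p)) (ι n)))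
  where
  lem : ∀ a n → a + a * n ≡ a * (1ℚ + n)
  lem = RS.solve-∀ ℚring

ℤtoℚ-neg : ∀ z → ℤtoℚ (ℤ.- z) ≡ - ℤtoℚ z
ℤtoℚ-neg z = lem (ℤtoℚ (ℤ.- z)) (ℤtoℚ z) (trans (sym (ℤtoℚ-+ (ℤ.- z) z)) (cong ℤtoℚ (ℤₚ.+-inverseˡ z)))
  where
  lem : ∀ a b → a + b ≡ 0ℚ → a ≡ - b
  lem a b e = trans (h a b) (trans (cong (_- b) e) (+-identityˡ (- b)))
    where
    h : ∀ a b → a ≡ a + b - b
    h = RS.solve-∀ ℚring

ℕtoℚ≢0 : ∀ {n} → 1 ℕ.≤ n → ℕtoℚ n ≢ 0ℚ
ℕtoℚ≢0 {n} h e = ι≢0 h (trans (ι≡ℕtoℚ n) e)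

powℤ≢0 : ∀ {p} → Prime p → ∀ e → powℤ p e ≢ 0ℚ
powℤ≢0 {p} pp (ℤ.+ n) = ℕtoℚ≢0 (ℕₚ.m^n>0 p {{prime⇒nonZero pp}} n)
powℤ≢0 {p} pp ℤ.-[1+ n ] = divQ-≢0 {1ℚ} (λ ()) (ℕtoℚ≢0 (ℕₚ.m^n>0 p {{prime⇒nonZero pp}} (suc n)))

ν-ℕ : ∀ {p} → Prime p → ∀ n → ν p (ℕtoℚ n) ≡ V p n
ν-ℕ {p} pp n = trans (cong (ν p) (sym (ι≡ℕtoℚ n))) (ν-ι pp n)

ν-powℤ : ∀ {q p} → Prime q → Prime p → ∀ e → ν q (powℤ p e) ≡ 𝟙 (q ℕₚ.≟ p) * ℤtoℚ e
ν-powℤ {q} {p} pq pp (ℤ.+ n) = trans (ν-ℕ pq (p ℕ.^ n)) (trans (V-power pq pp n) (cong (𝟙 (q ℕₚ.≟ p) *_) (ι≡ℕtoℚ n)))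
ν-powℤ {q} {p} pq pp ℤ.-[1+ n ] = trans (ν-divQ {q} {1ℚ} {ℕtoℚ (p ℕ.^ suc n)} pq (λ ()) (ℕtoℚ≢0 (ℕₚ.m^n>0 p {{prime⇒nonZero pp}} (suc n)))) (trans (cong₂ _-_ (ν-1 pq) (trans (ν-ℕ pq (p ℕ.^ suc n)) (V-power pq pp (suc n))))
  (trans (lem (𝟙 (q ℕₚ.≟ p)) (ι (suc n))) (cong (𝟙 (q ℕₚ.≟ p) *_) (trans (cong -_ (ι≡ℕtoℚ (suc n))) (sym (ℤtoℚ-neg (ℤ.+ suc n)))))))
  where
  lem : ∀ a n → 0ℚ - a * n ≡ a * - n
  lem = RS.solve-∀ ℚring

powers≢0 : ∀ (e : ℕ → ℤ.ℤ) {ps} → All Prime ps → prodℚ (map (λ p → powℤ p (e p)) ps) ≢ 0ℚ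
powers≢0 e [] = λ ()
powers≢0 e (pp ∷ h) = *-≢0 (powℤ≢0 pp (e _)) (powers≢0 e h)

ν-powers-∉ : ∀ {q} (e : ℕ → ℤ.ℤ) → Prime q → ∀ {ps} → All Prime ps → ¬ (q ∈ ps) → ν q (prodℚ (map (λ p → powℤ p (e p)) ps)) ≡ 0ℚ
ν-powers-∉ e pq [] _ = ν-1 pq
ν-powers-∉ {q} e pq {p ∷ ps} (pp ∷ h) ∉ = trans (ν-* pq (powℤ≢0 pp (e p)) (powers≢0 e h)) (cong₂ _+_ (trans (ν-powℤ pq pp (e p)) (trans (cong (_* ℤtoℚ (e p)) (𝟙-no (q ℕₚ.≟ p) (λ { refl → ∉ (here refl) }))) (*-zeroˡ (ℤtoℚ (e p))))) (ν-powers-∉ e pq h (λ x → ∉ (there x))))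

ν-powers-∈ : ∀ {q} (e : ℕ → ℤ.ℤ) → Prime q → ∀ {ps} → All Prime ps → Unique ps → q ∈ ps → ν q (prodℚ (map (λ p → powℤ p (e p)) ps)) ≡ ℤtoℚ (e q)
ν-powers-∈ {q} e pq {p ∷ ps} (pp ∷ h) (p∉ ∷ u) (here refl) = trans (ν-* pq (powℤ≢0 pp (e p)) (powers≢0 e h)) (trans (cong₂ _+_ (trans (ν-powℤ pq pp (e p)) (trans (cong (_* ℤtoℚ (e p)) (𝟙-yes (q ℕₚ.≟ p) refl)) (*-identityˡ (ℤtoℚ (e p))))) (ν-powers-∉ e pq h (λ q∈ → All.lookup p∉ q∈ refl))) (+-identityʳ (ℤtoℚ (e p))))
ν-powers-∈ {q} e pq {p ∷ ps} (pp ∷ h) (p∉ ∷ u) (there q∈) = trans (ν-* pq (powℤ≢0 pp (e p)) (powers≢0 e h)) (trans (cong₂ _+_ (trans (ν-powℤ pq pp (e p)) (trans (cong (_* ℤtoℚ (e p)) (𝟙-no (q ℕₚ.≟ p) (λ { refl → All.lookup p∉ q∈ refl }))) (*-zeroˡ (ℤtoℚ (e p))))) (ν-powers-∈ e pq h u q∈)) (+-identityˡ (ℤtoℚ (e q))))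

module Parameters (α β : List ℚ) where

  InSet : ℕ → Set
  InSet p = Prime p × (p ∣ dAB α β ⊎ p ℕ.+ length β ℕ.≤ suc (length α))

  inSet? : ∀ p → Dec (InSet p)
  inSet? p = prime? p ×-dec ((p ∣? dAB α β) ⊎-dec (p ℕ.+ length β ℕ.≤? suc (length α)))

  dAB≥1 : 1 ℕ.≤ dAB α β
  dAB≥1 = go (α ++ β)
    where
    go : ∀ xs → 1 ℕ.≤ foldr lcm 1 (map d xs)
    go [] = s≤s z≤n
    go (x ∷ xs) = ℕₚ.n≢0⇒n>0 (λ e → ℕₚ.<⇒≢ (ℕₚ.*-mono-≤ (↧≥1 x) (go xs)) (sym (trans (sym (gcd*lcm (d x) (foldr lcm 1 (map d xs)))) (trans (cong (gcd (d x) (foldr lcm 1 (map d xs)) ℕ.*_) e) (ℕₚ.*-zeroʳ (gcd (d x) (foldr lcm 1 (map d xs))))))))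

  d∣dAB : ∀ {a} → a ∈ α ++ β → d a ∣ dAB α β
  d∣dAB = go (α ++ β)
    where
    go : ∀ xs {a} → a ∈ xs → d a ∣ foldr lcm 1 (map d xs)
    go (x ∷ xs) (here refl) = m∣lcm[m,n] (d x) (foldr lcm 1 (map d xs))
    go (x ∷ xs) (there h) = ∣ₚ.∣-trans (go xs h) (n∣lcm[m,n] (d x) (foldr lcm 1 (map d xs)))

  floor : ℕ → ℤ.ℤ
  floor p = floorDiv (lambdaP p α β) (p ℕ.∸ 1)

  primes : All Prime (primeSet α β)
  primes = All.map proj₁ (AllP.all-filter inSet? (upTo (dAB α β ℕ.+ length α ℕ.+ 2)))

  private
    unique : Unique (primeSet α β)
    unique = UniqueP.filter⁺ inSet? (UniqueP.upTo⁺ (dAB α β ℕ.+ length α ℕ.+ 2))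

    inSet-< : ∀ {p} → InSet p → p ℕ.< dAB α β ℕ.+ length α ℕ.+ 2
    inSet-< {p} (pp , inj₁ h) = ℕₚ.≤-trans (s≤s (∣ₚ.∣⇒≤ {{ℕ.>-nonZero dAB≥1}} h)) (ℕₚ.≤-trans (s≤s (ℕₚ.m≤m+n (dAB α β) (length α))) (ℕₚ.≤-trans (ℕₚ.n≤1+n _) (ℕₚ.≤-reflexive (ℕₚ.+-comm 2 (dAB α β ℕ.+ length α)))))
    inSet-< {p} (pp , inj₂ h) = ℕₚ.≤-trans (s≤s (ℕₚ.≤-trans (ℕₚ.m≤m+n p (length β)) h)) (ℕₚ.≤-trans (s≤s (s≤s (ℕₚ.m≤n+m (length α) (dAB α β)))) (ℕₚ.≤-reflexive (ℕₚ.+-comm 2 (dAB α β ℕ.+ length α))))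

  ν-primeFactor-∈ : ∀ {p} → InSet p → ν p (primeFactor α β) ≡ - ℤtoℚ (floor p)
  ν-primeFactor-∈ {p} h = trans (ν-powers-∈ (λ p → ℤ.- floor p) (proj₁ h) primes unique (∈-filter⁺ inSet? (∈-upTo⁺ (inSet-< h)) h)) (ℤtoℚ-neg (floor p))

  ν-primeFactor-∉ : ∀ {p} → Prime p → ¬ InSet p → ν p (primeFactor α β) ≡ 0ℚ
  ν-primeFactor-∉ {p} pp h = ν-powers-∉ (λ p → ℤ.- floor p) pp primes (λ p∈ → h (proj₂ (∈-filter⁻ inSet? {xs = upTo (dAB α β ℕ.+ length α ℕ.+ 2)} p∈)))

  private
    num den : ℚ
    num = ℕtoℚ (product (map d α))
    den = ℕtoℚ (product (map d β))
    num≢0 : num ≢ 0ℚ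
    num≢0 = ℕtoℚ≢0 (product-d≥1 α)
    den≢0 : den ≢ 0ℚ
    den≢0 = ℕtoℚ≢0 (product-d≥1 β)
    pf≢0 : primeFactor α β ≢ 0ℚ
    pf≢0 = powers≢0 (λ p → ℤ.- floor p) primes

  formulaFactor≢0 : formulaFactor α β ≢ 0ℚ
  formulaFactor≢0 = *-≢0 (divQ-≢0 num≢0 den≢0) pf≢0

  ν-formulaFactor : ∀ {p} → Prime p → ν p (formulaFactor α β) ≡ Vd α β p + ν p (primeFactor α β)
  ν-formulaFactor {p} pp = trans (ν-* pp (divQ-≢0 num≢0 den≢0) pf≢0) (cong (_+ ν p (primeFactor α β)) (trans (ν-divQ pp num≢0 den≢0)
    (cong₂ _-_ (trans (ν-ℕ pp (product (map d α))) (V-product pp α)) (trans (ν-ℕ pp (product (map d β))) (V-product pp β)))))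

  integral : ℕ → List ℚ → ℚ
  integral p xs = ∑ˡ xs (λ a → 𝟙 (¬? (p ∣? d a)))

  private
    count≡ : ∀ p xs → ι (countInZp p xs) ≡ integral p xs
    count≡ p [] = refl
    count≡ p (x ∷ xs) with p ∣? d x
    ... | yes _ = trans (count≡ p xs) (sym (+-identityˡ (integral p xs)))
    ... | no _ = cong (1ℚ +_) (count≡ p xs)

  Λλ : ℕ → ℚ
  Λλ p = integral p α - integral p β

  ℤtoℚ-lambdaP : ∀ p → ℤtoℚ (lambdaP p α β) ≡ Λλ p
  ℤtoℚ-lambdaP p = trans (ℤtoℚ-+ (ℤ.+ countInZp p α) (ℤ.- (ℤ.+ countInZp p β))) (cong₂ _+_ (trans (sym (ι≡ℕtoℚ (countInZp p α))) (count≡ p α))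
    (trans (ℤtoℚ-neg (ℤ.+ countInZp p β)) (cong -_ (trans (sym (ι≡ℕtoℚ (countInZp p β))) (count≡ p β)))))

  private
    division : ∀ {p} → Prime p → ∃ λ r → Λλ p ≡ ι r + ℤtoℚ (floor p) * ι (ℕ.pred p) × r ℕ.< ℕ.pred p
    division {p} pp = go p (prime≥2 pp)
      where
      go : ∀ p → 2 ℕ.≤ p → ∃ λ r → Λλ p ≡ ι r + ℤtoℚ (floor p) * ι (ℕ.pred p) × r ℕ.< ℕ.pred p
      go (suc (suc m)) _ = x ℤDM.%ℕ suc m , trans (sym (ℤtoℚ-lambdaP (suc (suc m)))) (trans (cong ℤtoℚ (ℤDM.a≡a%ℕn+[a/ℕn]*n x (suc m))) (trans (ℤtoℚ-+ (ℤ.+ (x ℤDM.%ℕ suc m)) ((x ℤDM./ℕ suc m) ℤ.* ℤ.+ suc m))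
          (cong₂ _+_ (sym (ι≡ℕtoℚ (x ℤDM.%ℕ suc m))) (trans (ℤtoℚ-* (x ℤDM./ℕ suc m) (ℤ.+ suc m)) (cong (ℤtoℚ (x ℤDM./ℕ suc m) *_) (sym (ι≡ℕtoℚ (suc m)))))))) , ℤDM.n%ℕd<d x (suc m)
        where
        x = lambdaP (suc (suc m)) α β
      go (suc zero) (s≤s ())

  floor-lower : ∀ {p} → Prime p → ι (ℕ.pred p) * ℤtoℚ (floor p) ≤ Λλ p
  floor-lower {p} pp = bound (division pp)
    where
    bound : (∃ λ r → Λλ p ≡ ι r + ℤtoℚ (floor p) * ι (ℕ.pred p) × r ℕ.< ℕ.pred p) → ι (ℕ.pred p) * ℤtoℚ (floor p) ≤ Λλ p
    bound (r , e , _) = ≤-by (0≤ι r) (trans e (lem (ι r) (ℤtoℚ (floor p)) (ι (ℕ.pred p))))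
      where
      lem : ∀ r f m → r + f * m ≡ m * f + r
      lem = RS.solve-∀ ℚring

  floor-upper : ∀ {p} → Prime p → Λλ p < ι (ℕ.pred p) * (ℤtoℚ (floor p) + 1ℚ)
  floor-upper {p} pp = bound (division pp)
    where
    bound : (∃ λ r → Λλ p ≡ ι r + ℤtoℚ (floor p) * ι (ℕ.pred p) × r ℕ.< ℕ.pred p) → Λλ p < ι (ℕ.pred p) * (ℤtoℚ (floor p) + 1ℚ)
    bound (r , e , r<) = ℚₚ.<-≤-trans (subst (Λλ p <_) refl (ℚₚ.≤-<-trans (≤-reflexive e) (ℚₚ.<-≤-trans (lt (ι r) (ℤtoℚ (floor p) * ι (ℕ.pred p))) ≤-refl))) (≤-trans (≤-reflexive (lem (ι r) (ℤtoℚ (floor p)) (ι (ℕ.pred p)))) (≤-trans (+ʳ (ι (ℕ.pred p) * ℤtoℚ (floor p)) (ι-mono r<)) (≤-reflexive (lem2 (ι (ℕ.pred p)) (ℤtoℚ (floor p))))))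
      where
      lt : ∀ a b → a + b < a + b + 1ℚ
      lt a b = subst (_< a + b + 1ℚ) (+-identityʳ (a + b)) (ℚₚ.+-monoʳ-< (a + b) 0<1)
      lem : ∀ r f m → r + f * m + 1ℚ ≡ 1ℚ + r + m * f
      lem = RS.solve-∀ ℚring
      lem2 : ∀ m f → m + m * f ≡ m * (f + 1ℚ)
      lem2 = RS.solve-∀ ℚring

-- Integers among the rationals, and positivity.

int-+ : ∀ {x y} → IsInteger x → IsInteger y → IsInteger (x + y)
int-+ (a , refl) (b , refl) = a ℤ.+ b , sym (ℤtoℚ-+ a b)

int-neg : ∀ {x} → IsInteger x → IsInteger (- x)
int-neg (a , refl) = ℤ.- a , sym (ℤtoℚ-neg a)

int-- : ∀ {x y} → IsInteger x → IsInteger y → IsInteger (x - y)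
int-- hx hy = int-+ hx (int-neg hy)

int-* : ∀ {x y} → IsInteger x → IsInteger y → IsInteger (x * y)
int-* (a , refl) (b , refl) = a ℤ.* b , sym (ℤtoℚ-* a b)

int-ι : ∀ n → IsInteger (ι n)
int-ι n = ℤ.+ n , ι≡ℕtoℚ n

int-V : ∀ p n → IsInteger (V p n)
int-V p n with V-natural p n
... | nat m e = subst IsInteger (sym e) (int-ι m)

int-ν : ∀ p x → IsInteger (ν p x)
int-ν p x = int-- (int-V p ℤ.∣ ↥ x ∣) (int-V p (↧ₙ x))

int-∑ˡ : ∀ xs {f} → (∀ x → IsInteger (f x)) → IsInteger (∑ˡ xs f)
int-∑ˡ [] h = int-ι 0
int-∑ˡ (x ∷ xs) h = int-+ (h x) (int-∑ˡ xs h)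

int-𝟙 : ∀ {A : Set} (a? : Dec A) → IsInteger (𝟙 a?)
int-𝟙 (yes _) = int-ι 1
int-𝟙 (no _) = int-ι 0

ℤtoℚ-mono : ∀ {a b} → a ℤ.≤ b → ℤtoℚ a ≤ ℤtoℚ b
ℤtoℚ-mono {a} {b} h rewrite ℤtoℚ≡mkℚ a | ℤtoℚ≡mkℚ b = *≤* (ℤₚ.*-monoʳ-≤-nonNeg (ℤ.+ 1) h)

int-gap : ∀ {x y} → IsInteger x → IsInteger y → x < y + 1ℚ → x ≤ y
int-gap {x} {y} (a , refl) (b , refl) h with a ℤ.≤? b
... | yes a≤b = ℤtoℚ-mono a≤b
... | no a≰b = ⊥-elim (<⇒≱ h (≤-trans (≤-reflexive (trans (cong (ℤtoℚ b +_) refl) (trans (sym (ℤtoℚ-+ b (ℤ.+ 1))) (cong ℤtoℚ (ℤₚ.+-comm b (ℤ.+ 1)))))) (ℤtoℚ-mono (ℤₚ.i<j⇒suc[i]≤j (ℤₚ.≰⇒> a≰b)))))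

archimedean : ∀ x → ∃ λ K → x ≤ ι K
archimedean x with ℚₚ.≤-total x 0ℚ
... | inj₁ h = 0 , h
... | inj₂ h = ℤ.∣ ↥ x ∣ , ≤-trans (≤-trans (≤-reflexive (sym (*-identityʳ x))) (*-monoˡ h (1≤ι (↧≥1 x)))) (≤-trans (≤-reflexive (*-den x)) (abs (↥ x)))
  where
  abs : ∀ z → ℤtoℚ z ≤ ι ℤ.∣ z ∣
  abs z = ≤-trans (ℤtoℚ-mono (le z)) (≤-reflexive (sym (ι≡ℕtoℚ ℤ.∣ z ∣)))
    where
    le : ∀ z → z ℤ.≤ ℤ.+ ℤ.∣ z ∣
    le (ℤ.+ n) = ℤₚ.≤-refl
    le ℤ.-[1+ n ] = ℤ.-≤+

*-pos : ∀ {x y} → 0ℚ < x → 0ℚ < y → 0ℚ < x * y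
*-pos {x} {y} hx hy = ℚₚ.positive⁻¹ (x * y) {{ℚₚ.pos*pos⇒pos x {{positive hx}} y {{positive hy}}}}

pos⇒≢0 : ∀ {x} → 0ℚ < x → x ≢ 0ℚ
pos⇒≢0 h e = ℚₚ.<-irrefl (sym e) h

0<ℕtoℚ : ∀ {n} → 1 ℕ.≤ n → 0ℚ < ℕtoℚ n
0<ℕtoℚ {n} h = subst (0ℚ <_) (ι≡ℕtoℚ n) (0<ι h)

factor-pos : ∀ {x y z} → x * y ≡ z → 0ℚ < z → 0ℚ < y → 0ℚ < x
factor-pos {x} {y} e hz hy = ℚₚ.≰⇒> (λ h → <⇒≱ hz (≤-trans (≤-reflexive (sym e)) (≤-trans (*-monoʳ (<⇒≤ hy) h) (≤-reflexive (*-zeroˡ y)))))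

divQ-pos : ∀ {x y} → 0ℚ < x → 0ℚ < y → 0ℚ < divQ x y
divQ-pos hx hy = factor-pos (divQ-* (pos⇒≢0 hy)) hx hy

powℤ-pos : ∀ {p} → Prime p → ∀ e → 0ℚ < powℤ p e
powℤ-pos {p} pp (ℤ.+ n) = 0<ℕtoℚ (ℕₚ.m^n>0 p {{prime⇒nonZero pp}} n)
powℤ-pos {p} pp ℤ.-[1+ n ] = divQ-pos 0<1 (0<ℕtoℚ (ℕₚ.m^n>0 p {{prime⇒nonZero pp}} (suc n)))

prodℚ-pos : ∀ {f : ℕ → ℚ} {ps} → All Prime ps → (∀ p → Prime p → 0ℚ < f p) → 0ℚ < prodℚ (map f ps)
prodℚ-pos [] h = 0<1
prodℚ-pos (pp ∷ ps) h = *-pos (h _ pp) (prodℚ-pos ps h)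

formulaFactor-pos : ∀ α β → 0ℚ < formulaFactor α β
formulaFactor-pos α β = *-pos (divQ-pos (0<ℕtoℚ (product-d≥1 α)) (0<ℕtoℚ (product-d≥1 β))) (prodℚ-pos (Parameters.primes α β) (λ p pp → powℤ-pos pp (ℤ.- Parameters.floor α β p)))

-- The quotient of C_{α,β} by the formula is a positive integer.

module LowerBound {α β : List ℚ} (hα : All NotNonPosInt α) (hβ : All NotNonPosInt β) {c : ℚ} (c≢0 : c ≢ 0ℚ) (int : IntegralAt α β c) where
  open Parameters α β

  -- The exponent of p left in c after the denominators d(α), d(β) are cleared; it is to be compared
  -- with that of the product over primes.
  y : ℕ → ℚ
  y p = ν p c - Vd α β p

  private
    int-y : ∀ p → IsInteger (y p)
    int-y p = int-- (int-ν p c) (int-- (int-∑ˡ α (λ a → int-V p (d a))) (int-∑ˡ β (λ a → int-V p (d a))))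

    int-Λλ : ∀ p → IsInteger (Λλ p)
    int-Λλ p = int-- (int-∑ˡ α (λ a → int-𝟙 (¬? (p ∣? d a)))) (int-∑ˡ β (λ a → int-𝟙 (¬? (p ∣? d a))))

    M : ℚ → ℚ
    M a = ι (ℤ.∣ ↥ a ∣ ℕ.+ ↧ₙ a)

    m : ℕ → ℚ
    m p = ι (ℕ.pred p)

    upper : ∀ {p} → Prime p → ∀ k a → NotNonPosInt a → m p * Sν p a (p ℕ.^ k) ≤ (ι (p ℕ.^ k) - 1ℚ) * 𝟙 (¬? (p ∣? d a)) + m p * M a
    upper {p} pp k a ha = go (p ∣? d a)
      where
      go : (p? : Dec (p ∣ d a)) → m p * Sν p a (p ℕ.^ k) ≤ (ι (p ℕ.^ k) - 1ℚ) * 𝟙 (¬? p?) + m p * M a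
      go (yes h) = ≤-trans (≤-reflexive (trans (cong (m p *_) (Sν-0 {p} {a} pp h (p ℕ.^ k))) (*-zeroʳ (m p)))) (+-≥0 (≤-reflexive (sym (*-zeroʳ (ι (p ℕ.^ k) - 1ℚ)))) (*-≥0 (0≤ι (ℕ.pred p)) (0≤ι (ℤ.∣ ↥ a ∣ ℕ.+ ↧ₙ a))))
      go (no h) = ≤-trans (Growth.growth≤ pp ha h k) (≤-reflexive (cong (_+ m p * M a) (sym (*-identityʳ (ι (p ℕ.^ k) - 1ℚ)))))

    lower : ∀ {p} → Prime p → ∀ k a → NotNonPosInt a → (ι (p ℕ.^ k) - 1ℚ) * 𝟙 (¬? (p ∣? d a)) ≤ m p * Sν p a (p ℕ.^ k)
    lower {p} pp k a ha = go (p ∣? d a)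
      where
      go : (p? : Dec (p ∣ d a)) → (ι (p ℕ.^ k) - 1ℚ) * 𝟙 (¬? p?) ≤ m p * Sν p a (p ℕ.^ k)
      go (yes h) = ≤-trans (≤-reflexive (*-zeroʳ (ι (p ℕ.^ k) - 1ℚ))) (*-≥0 (0≤ι (ℕ.pred p)) (≤-reflexive (sym (Sν-0 {p} {a} pp h (p ℕ.^ k)))))
      go (no h) = ≤-trans (≤-reflexive (*-identityʳ (ι (p ℕ.^ k) - 1ℚ))) (Growth.growth≥ pp ha h k)

    W≤ : ∀ {p} → Prime p → ∀ k → m p * W α β p (p ℕ.^ k) ≤ (ι (p ℕ.^ k) - 1ℚ) * Λλ p + m p * ∑ˡ α M
    W≤ {p} pp k = ≤-trans (≤-reflexive (lem (m p) (∑ˡ α (λ a → Sν p a n)) (∑ˡ β (λ a → Sν p a n)))) (≤-trans (+-mono-≤ A (ℚₚ.neg-antimono-≤ B)) (≤-reflexive (lem2 (ι n - 1ℚ) (integral p α) (integral p β) (m p * ∑ˡ α M))))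
      where
      n : ℕ
      n = p ℕ.^ k
      lem : ∀ m s t → m * (s - t) ≡ m * s - m * t
      lem = RS.solve-∀ ℚring
      lem2 : ∀ n a b c → n * a + c - n * b ≡ n * (a - b) + c
      lem2 = RS.solve-∀ ℚring
      A : m p * ∑ˡ α (λ a → Sν p a n) ≤ (ι n - 1ℚ) * integral p α + m p * ∑ˡ α M
      A = ≤-trans (≤-reflexive (sym (∑ˡ-*ˡ α (m p) (λ a → Sν p a n)))) (≤-trans (∑ˡ-≤ hα (λ a ha → upper pp k a ha)) (≤-reflexive (trans (∑ˡ-+ α (λ a → (ι n - 1ℚ) * 𝟙 (¬? (p ∣? d a))) (λ a → m p * M a))
        (cong₂ _+_ (∑ˡ-*ˡ α (ι n - 1ℚ) (λ a → 𝟙 (¬? (p ∣? d a)))) (∑ˡ-*ˡ α (m p) M)))))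
      B : (ι n - 1ℚ) * integral p β ≤ m p * ∑ˡ β (λ a → Sν p a n)
      B = ≤-trans (≤-reflexive (sym (∑ˡ-*ˡ β (ι n - 1ℚ) (λ a → 𝟙 (¬? (p ∣? d a)))))) (≤-trans (∑ˡ-≤ hβ (λ a ha → lower pp k a ha)) (≤-reflexive (∑ˡ-*ˡ β (m p) (λ a → Sν p a n))))

    -- Integrality at n = pᵏ gives n y + W(n) ≥ 0, where (p - 1) W(n) is at most λ n up to a
    -- constant. A negative slope would be at most -1, being an integer, and would bound pᵏ for all
    -- k.
    slope : ∀ {p} → Prime p → 0ℚ ≤ m p * y p + Λλ p
    slope {p} pp = ℚₚ.≮⇒≥ (λ h → contra h (archimedean (m p * ∑ˡ α M - Λλ p)))
      where
      neg : m p * y p + Λλ p < 0ℚ → m p * y p + Λλ p ≤ - 1ℚ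
      neg h = int-gap (int-+ (int-* (int-ι (ℕ.pred p)) (int-y p)) (int-Λλ p)) (ℤ.-[1+ 0 ] , refl) h
      contra : m p * y p + Λλ p < 0ℚ → (∃ λ K → m p * ∑ˡ α M - Λλ p ≤ ι K) → ⊥
      contra h (K , hK) = <⇒≱ (lt (ι K)) (≤-trans (ι-mono (ℕₚ.≤-trans (n<2^n K) (ℕₚ.^-monoˡ-≤ K (prime≥2 pp)))) (≤-trans bound hK))
        where
        n : ℕ
        n = p ℕ.^ K
        lt : ∀ x → x < 1ℚ + x
        lt x = subst (_< 1ℚ + x) (+-identityˡ x) (ℚₚ.+-monoˡ-< x 0<1)
        nonneg : 0ℚ ≤ ι n * y p + W α β p n
        nonneg = ≤-trans (ν-integer pp (int n)) (≤-reflexive (ν-coeff pp hα hβ c≢0 n))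
        bound : ι n ≤ m p * ∑ˡ α M - Λλ p
        bound = ≤-by {s = m p * (ι n * y p + W α β p n) + ((ι n - 1ℚ) * Λλ p + m p * ∑ˡ α M - m p * W α β p n) + ι n * (- 1ℚ - (m p * y p + Λλ p))}
          (+-≥0 (+-≥0 (*-≥0 (0≤ι (ℕ.pred p)) nonneg) (diff≥0 (W≤ pp K))) (*-≥0 (0≤ι n) (diff≥0 (neg h)))) (lem (ι n) (m p) (y p) (W α β p n) (Λλ p) (∑ˡ α M))
          where
          lem : ∀ n m y w l M → m * M - l ≡ n + (m * (n * y + w) + ((n - 1ℚ) * l + m * M - m * w) + n * (- 1ℚ - (m * y + l)))
          lem = RS.solve-∀ ℚring

    m-cancel : ∀ {p x} → Prime p → 0ℚ < m p * x → 0ℚ < x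
    m-cancel {p} {x} pp h = ℚₚ.≰⇒> (λ x≤0 → <⇒≱ h (≤-trans (*-monoˡ (0≤ι (ℕ.pred p)) x≤0) (≤-reflexive (*-zeroʳ (m p)))))

    all-integral : ∀ p xs → (∀ {a} → a ∈ xs → ¬ (p ∣ d a)) → integral p xs ≡ ι (length xs)
    all-integral p [] h = refl
    all-integral p (x ∷ xs) h = cong₂ _+_ (𝟙-yes (¬? (p ∣? d x)) (h (here refl))) (all-integral p xs (λ x∈ → h (there x∈)))

  -- -⌊λ/(p - 1)⌋ is the least integer not below -λ/(p - 1), so the slope inequality rounds up to
  -- it. Outside the prime set all parameters are p-integral and λ = r - s ≤ p - 2; then y > -1,
  -- hence y ≥ 0.
  primeFactor≤ : ∀ {p} → Prime p → ν p (primeFactor α β) ≤ y p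
  primeFactor≤ {p} pp = go (inSet? p)
    where
    go : Dec (InSet p) → ν p (primeFactor α β) ≤ y p
    go (yes h) = ≤-trans (≤-reflexive (ν-primeFactor-∈ h)) (int-gap (int-neg (floor p , refl)) (int-y p) (lt (m-cancel pp pos)))
      where
      f = ℤtoℚ (floor p)
      pos : 0ℚ < m p * (y p + f + 1ℚ)
      pos = ℚₚ.≤-<-trans (slope pp) (ℚₚ.<-≤-trans (ℚₚ.+-monoʳ-< (m p * y p) (floor-upper pp)) (≤-reflexive (lem (m p) (y p) f)))
        where
        lem : ∀ m y f → m * y + m * (f + 1ℚ) ≡ m * (y + f + 1ℚ)
        lem = RS.solve-∀ ℚring
      lt : 0ℚ < y p + f + 1ℚ → - f < y p + 1ℚ
      lt h = subst₂ _<_ (+-identityʳ (- f)) (lem f (y p)) (ℚₚ.+-monoʳ-< (- f) h)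
        where
        lem : ∀ f y → - f + (y + f + 1ℚ) ≡ y + 1ℚ
        lem = RS.solve-∀ ℚring
    go (no ¬h) = ≤-trans (≤-reflexive (ν-primeFactor-∉ pp ¬h)) (int-gap (int-ι 0) (int-y p) (m-cancel pp (ℚₚ.<-≤-trans 0<1 pos)))
      where
      ∤ : ∀ {a} → a ∈ α ++ β → ¬ (p ∣ d a)
      ∤ a∈ h = ¬h (pp , inj₁ (∣ₚ.∣-trans h (d∣dAB a∈)))
      Λ≤ : Λλ p + ι 1 ≤ m p
      Λ≤ = ≤-by {s = ι (ℕ.pred p ℕ.+ length β) - ι (suc (length α))} (diff≥0 (ι-mono le)) (trans (lem (m p) (ι (length α)) (ι (length β))) (cong₂ (λ u v → u + ι 1 + (v - ι (suc (length α)))) (sym (cong₂ _-_ (all-integral p α (λ x → ∤ (∈-++⁺ˡ x))) (all-integral p β (λ x → ∤ (∈-++⁺ʳ α x))))) (sym (ι-+ (ℕ.pred p) (length β)))))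
        where
        lem : ∀ m r s → m ≡ r - s + ι 1 + (m + s - (1ℚ + r))
        lem = RS.solve-∀ ℚring
        le : suc (length α) ℕ.≤ ℕ.pred p ℕ.+ length β
        le = ℕₚ.≤-pred (subst (suc (suc (length α)) ℕ.≤_) (cong (ℕ._+ length β) (sym (suc-pred (prime≥1 pp)))) (ℕₚ.≰⇒> (λ h → ¬h (pp , inj₂ h))))
      pos : 1ℚ ≤ m p * (y p + 1ℚ)
      pos = ≤-by {s = m p * y p + Λλ p + (m p - (Λλ p + ι 1))} (+-≥0 (slope pp) (diff≥0 Λ≤)) (lem (m p) (y p) (Λλ p))
        where
        lem : ∀ m y l → m * (y + 1ℚ) ≡ 1ℚ + (m * y + l + (m - (l + ι 1)))
        lem = RS.solve-∀ ℚring

  quotient-integer : IsInteger (divQ c (formulaFactor α β))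
  quotient-integer = integer-ν (divQ c (formulaFactor α β)) (λ p pp → ≤-trans (diff≥0 (primeFactor≤ pp)) (≤-reflexive (trans (lem (ν p c) (Vd α β p) (ν p (primeFactor α β))) (trans (cong (λ t → ν p c - t) (sym (ν-formulaFactor pp))) (sym (ν-divQ pp c≢0 formulaFactor≢0))))))
    where
    lem : ∀ c v f → c - v - f ≡ c - (v + f)
    lem = RS.solve-∀ ℚring

  multiple : 0ℚ < c → ∃ λ C → c ≡ ℕtoℚ C * formulaFactor α β
  multiple 0<c = go quotient-integer
    where
    F = formulaFactor α β
    q = divQ c F
    0<q : 0ℚ < q
    0<q = divQ-pos 0<c (formulaFactor-pos α β)
    go : IsInteger q → ∃ λ C → c ≡ ℕtoℚ C * F
    go (ℤ.+ n , e) = n , trans (sym (divQ-* formulaFactor≢0)) (cong (_* F) e)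
    go (ℤ.-[1+ n ] , e) = ⊥-elim (<⇒≱ 0<q (≤-trans (≤-reflexive e) (ℤtoℚ-mono {ℤ.-[1+ n ]} {ℤ.+ 0} ℤ.-≤+)))

-- Parameters in (0,1] and Christol's criterion.

num : ℚ → ℕ
num a = ℤ.∣ ↥ a ∣

module UnitInterval {a : ℚ} (ha : InUnitInterval a) where

  private
    positive-num : ∀ a → 0ℚ < a → ↥ a ≡ ℤ.+ num a × 1 ℕ.≤ num a
    positive-num (mkℚ (ℤ.+ zero) e c) h = ⊥-elim (pos⇒≢0 h (ℚₚ.↥p≡0⇒p≡0 (mkℚ (ℤ.+ zero) e c) refl))
    positive-num (mkℚ (ℤ.+ suc n) e c) h = refl , s≤s z≤n
    positive-num a@(mkℚ ℤ.-[1+ n ] e c) h = ⊥-elim (<⇒≱ h (ℚₚ.nonPositive⁻¹ a))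

    num≤' : ∀ a → ↥ a ≡ ℤ.+ num a → a Data.Rational.≤ 1ℚ → num a ℕ.≤ d a
    num≤' (mkℚ (ℤ.+ n) e c) _ (*≤* h) = ℤ.drop‿+≤+ (subst₂ ℤ._≤_ (ℤₚ.*-identityʳ (ℤ.+ n)) (ℤₚ.*-identityˡ (ℤ.+ suc e)) h)

  ↥≡ : ↥ a ≡ ℤ.+ num a
  ↥≡ = proj₁ (positive-num a (proj₁ ha))

  1≤num : 1 ℕ.≤ num a
  1≤num = proj₂ (positive-num a (proj₁ ha))

  num≤d : num a ℕ.≤ d a
  num≤d = num≤' a ↥≡ (proj₂ ha)

  shift≡ : ∀ i → ℤ.∣ shift a i ∣ ≡ num a ℕ.+ i ℕ.* d a
  shift≡ i = cong ℤ.∣_∣ (trans (cong₂ ℤ._+_ ↥≡ (trans (cong (ℤ.+ i ℤ.*_) (↧≡ a)) (sym (ℤₚ.pos-* i (d a))))) (sym (ℤₚ.pos-+ (num a) (i ℕ.* d a))))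
    where
    ↧≡ : ∀ a → ↧ a ≡ ℤ.+ ↧ₙ a
    ↧≡ (mkℚ _ _ _) = refl

  notNonPos : NotNonPosInt a
  notNonPos n e = <⇒≱ (proj₁ ha) (≤-trans (≤-reflexive e) (ℚₚ.neg-antimono-≤ (≤-trans (0≤ι n) (≤-reflexive (ι≡ℕtoℚ n)))))

  x≤nd : ∀ {i n} → 1 ℕ.≤ i → i ℕ.≤ n → num a ℕ.+ ℕ.pred i ℕ.* d a ℕ.≤ n ℕ.* d a
  x≤nd {suc i} _ i≤n = ℕₚ.≤-trans (ℕₚ.+-monoˡ-≤ (i ℕ.* d a) num≤d) (ℕₚ.*-monoˡ-≤ (d a) i≤n)

  -- The parameter is written as A/Δ, so that the counts for all parameters refer to one modulus.
  module Rescaled (Δ : ℕ) {{Δ≢0 : ℕ.NonZero Δ}} (d∣Δ : d a ∣ Δ) where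
    open Classes Δ

    e A : ℕ
    e = Δ ÷ d a
    A = num a ℕ.* e

    d*e : d a ℕ.* e ≡ Δ
    d*e = split d∣Δ
      where
      split : d a ∣ Δ → d a ℕ.* (Δ ÷ d a) ≡ Δ
      split (divides q eq) = trans (cong (λ t → d a ℕ.* (t ÷ d a)) (trans eq (ℕₚ.*-comm q (d a)))) (trans (cong (d a ℕ.*_) (q*k÷q q (↧≥1 a))) (trans (ℕₚ.*-comm (d a) q) (sym eq)))

    1≤e : 1 ℕ.≤ e
    1≤e = ℕₚ.n≢0⇒n>0 (λ z → ℕₚ.<⇒≢ (ℕ.>-nonZero⁻¹ Δ) (trans (sym (ℕₚ.*-zeroʳ (d a))) (trans (cong (d a ℕ.*_) (sym z)) d*e)))

    1≤A : 1 ℕ.≤ A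
    1≤A = ℕₚ.*-mono-≤ 1≤num 1≤e

    A≤Δ : A ℕ.≤ Δ
    A≤Δ = subst (A ℕ.≤_) d*e (ℕₚ.*-monoˡ-≤ e num≤d)

    -- Multiplying by e, which is prime to m, preserves divisibility by m and turns the numerators
    -- into A + (i - 1)Δ. Because 0 < A ≤ Δ, these are all the positive integers up to nΔ in the
    -- class A; the multiples mj among them are counted on the right.
    level : ∀ {m} → 1 ℕ.≤ m → C.Coprime m e → ∀ n → ∑ n (λ i → 𝟙 (m ∣? ℤ.∣ shift a (ℕ.pred i) ∣)) ≡ ∑ ((n ℕ.* Δ) ÷ m) (λ j → 𝕖 A (m ℕ.* j))
    level {m} 1≤m cm n = trans (∑-cong n (λ i _ _ → 𝟙-⇔ (m ∣? ℤ.∣ shift a (ℕ.pred i) ∣) (m ∣? A ℕ.+ ℕ.pred i ℕ.* Δ)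
        (λ h → subst (m ∣_) (scale-eq i) (∣ₚ.∣m⇒∣m*n e h)) (λ h → C.coprime-divisor {n = e} cm (subst (m ∣_) (trans (sym (scale-eq i)) (ℕₚ.*-comm ℤ.∣ shift a (ℕ.pred i) ∣ e)) h)))) (∑-members-∣ 1≤A A≤Δ 1≤m n)
      where
      scale-eq : ∀ i → ℤ.∣ shift a (ℕ.pred i) ∣ ℕ.* e ≡ A ℕ.+ ℕ.pred i ℕ.* Δ
      scale-eq i = trans (cong (ℕ._* e) (shift≡ (ℕ.pred i))) (trans (ℕₚ.*-distribʳ-+ e (num a) (ℕ.pred i ℕ.* d a)) (cong (A ℕ.+_) (trans (ℕₚ.*-assoc (ℕ.pred i) (d a) e) (cong (ℕ.pred i ℕ.*_) d*e))))

    Sν-levels : ∀ {p} → Prime p → C.Coprime p e → ∀ {n L} → n ℕ.* d a ℕ.≤ L → Sν p a n ≡ ∑ L (λ l → ∑ ((n ℕ.* Δ) ÷ (p ℕ.^ l)) (λ j → 𝕖 A (p ℕ.^ l ℕ.* j)))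
    Sν-levels {p} pp cp {n} {L} nd≤L = trans (∑-cong n (λ i 1≤i i≤n → sym (V-val pp (x≥1 i) (ℕₚ.≤-trans (subst (ℕ._≤ n ℕ.* d a) (sym (shift≡ (ℕ.pred i))) (x≤nd 1≤i i≤n)) nd≤L))))
      (trans (∑-swap n L (λ i l → 𝟙 (p ℕ.^ l ∣? ℤ.∣ shift a (ℕ.pred i) ∣))) (∑-cong L (λ l _ _ → level (ℕₚ.m^n>0 p {{prime⇒nonZero pp}} l) (C.sym (prime-power-coprime pp (λ h → ℕₚ.<-irrefl (sym (cp (∣ₚ.∣-refl , h))) (prime≥2 pp)) l)) n)))
      where
      x≥1 : ∀ i → 1 ℕ.≤ ℤ.∣ shift a (ℕ.pred i) ∣
      x≥1 i = subst (1 ℕ.≤_) (sym (shift≡ (ℕ.pred i))) (ℕₚ.≤-trans 1≤num (ℕₚ.m≤m+n (num a) (ℕ.pred i ℕ.* d a)))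

V-small : ∀ {q x} → Prime q → 1 ℕ.≤ x → x ℕ.< q ℕ.* q → V q x ≡ 𝟙 (q ∣? x)
V-small {q} {x} pq 1≤x x<q² = trans (∑-single x {λ k → 𝟙 (q ℕ.^ k ∣? x)} (s≤s z≤n) 1≤x high) (𝟙-⇔ (q ℕ.^ 1 ∣? x) (q ∣? x) (subst (_∣ x) (ℕₚ.*-identityʳ q)) (subst (_∣ x) (sym (ℕₚ.*-identityʳ q))))
  where
  high : ∀ k → 1 ℕ.≤ k → k ℕ.≤ x → k ≢ 1 → 𝟙 (q ℕ.^ k ∣? x) ≡ 0ℚ
  high (suc zero) _ _ h = ⊥-elim (h refl)
  high (suc (suc k)) _ _ _ = 𝟙-no (q ℕ.^ suc (suc k) ∣? x) (λ h → ℕₚ.<⇒≱ x<q² (∣ₚ.∣⇒≤ {{ℕ.>-nonZero 1≤x}} (∣ₚ.m*n∣⇒m∣ (q ℕ.* q) (q ℕ.^ k) (subst (_∣ x) (sym (ℕₚ.*-assoc q q (q ℕ.^ k))) h))))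

module Dominated {α β : List ℚ} {c : ℚ} (c≢0 : c ≢ 0ℚ) (int : IntegralAt α β c) (Δ : ℕ) {{Δ≢0 : ℕ.NonZero Δ}}
  (hα : All (λ a → InUnitInterval a × d a ∣ Δ) α) (hβ : All (λ a → InUnitInterval a × d a ∣ Δ) β) where
  open Classes Δ

  cnt : ℚ → ℕ → ℕ → ℚ
  cnt a m X = ∑ X (λ j → 𝕖 (num a ℕ.* (Δ ÷ d a)) (m ℕ.* j))

  private
    nnp : ∀ {xs} → All (λ a → InUnitInterval a × d a ∣ Δ) xs → All NotNonPosInt xs
    nnp = All.map (λ h → UnitInterval.notNonPos (proj₁ h))

    e∣Δ : ∀ {a} → d a ∣ Δ → Δ ÷ d a ∣ Δ
    e∣Δ {a} (divides q eq) = subst (_∣ Δ) (sym (trans (cong (_÷ d a) (trans eq (ℕₚ.*-comm q (d a)))) (q*k÷q q (↧≥1 a)))) (divides (d a) (trans eq (ℕₚ.*-comm q (d a))))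

  -- For large q only the first power of q can divide a numerator, and neither c nor the
  -- denominators contain q. Integrality at a single n is then precisely the comparison of the
  -- counts at X.
  module FromPrime (m X q : ℕ) (pq : Prime q) (Δ<q : Δ ℕ.< q) (X<q : X ℕ.< q) (q∤c : ν q c ≡ 0ℚ) (q≡m : q ≋ m) where

    n : ℕ
    -- The least n with nΔ > Xq. As Δ < q, also nΔ < (X + 1)q, so the quotient of nΔ by q is exactly
    -- X; and X < q keeps all numerators below q².
    n = suc ((X ℕ.* q) ÷ Δ)

    private
      1≤Δ = ℕ.>-nonZero⁻¹ Δ

      q∤Δ : ¬ (q ∣ Δ)
      q∤Δ h = ℕₚ.<⇒≱ Δ<q (∣ₚ.∣⇒≤ h)

      Xq<nΔ : X ℕ.* q ℕ.< n ℕ.* Δ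
      Xq<nΔ = ℕₚ.≰⇒> (λ h → ℕₚ.1+n≰n (÷-adj⁻ {X ℕ.* q} {Δ} {n} 1≤Δ (subst (ℕ._≤ X ℕ.* q) (ℕₚ.*-comm n Δ) h)))

      nΔ<Xq+q : n ℕ.* Δ ℕ.< suc X ℕ.* q
      nΔ<Xq+q = ℕₚ.+-mono-<-≤ Δ<q (subst (ℕ._≤ X ℕ.* q) (ℕₚ.*-comm Δ ((X ℕ.* q) ÷ Δ)) (÷-adj {X ℕ.* q} {Δ} 1≤Δ ℕₚ.≤-refl))

      nΔ÷q : (n ℕ.* Δ) ÷ q ≡ X
      nΔ÷q = ≤-ext (λ k h → ℕₚ.≤-pred (ℕₚ.*-cancelˡ-< q k (suc X) (ℕₚ.≤-<-trans (÷-adj (prime≥1 pq) h) (subst (n ℕ.* Δ ℕ.<_) (ℕₚ.*-comm (suc X) q) nΔ<Xq+q))))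
        (λ k h → ÷-adj⁻ (prime≥1 pq) (ℕₚ.≤-trans (ℕₚ.*-monoʳ-≤ q h) (subst (ℕ._≤ n ℕ.* Δ) (ℕₚ.*-comm X q) (ℕₚ.<⇒≤ Xq<nΔ))))

      count : ∀ a → InUnitInterval a × d a ∣ Δ → Sν q a n ≡ cnt a m X
      count a (ha , da) = trans (∑-cong n (λ i 1≤i i≤n → V-small pq (x≥1 i) (ℕₚ.≤-<-trans (subst (ℕ._≤ n ℕ.* d a) (sym (shift≡ (ℕ.pred i))) (x≤nd 1≤i i≤n))
            (ℕₚ.≤-<-trans (ℕₚ.*-monoʳ-≤ n (∣ₚ.∣⇒≤ da)) (ℕₚ.<-≤-trans nΔ<Xq+q (ℕₚ.*-monoˡ-≤ q X<q))))))
          (trans (level (prime≥1 pq) (prime-coprime pq (λ h → q∤Δ (∣ₚ.∣-trans h (e∣Δ {a} da)))) n)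
            (trans (cong (λ t → ∑ t (λ j → 𝕖 A (q ℕ.* j))) nΔ÷q) (∑-cong X (λ j _ _ → 𝕖-cong {A} (≋-* {q} {m} {j} {j} q≡m refl)))))
        where
        open UnitInterval ha
        open Rescaled Δ da
        x≥1 : ∀ i → 1 ℕ.≤ ℤ.∣ shift a (ℕ.pred i) ∣
        x≥1 i = subst (1 ℕ.≤_) (sym (shift≡ (ℕ.pred i))) (ℕₚ.≤-trans 1≤num (ℕₚ.m≤m+n (num a) (ℕ.pred i ℕ.* d a)))

      Vd-0 : Vd α β q ≡ 0ℚ
      Vd-0 = cong₂ _-_ (zeroes hα) (zeroes hβ)
        where
        zeroes : ∀ {xs} → All (λ a → InUnitInterval a × d a ∣ Δ) xs → ∑ˡ xs (λ a → V q (d a)) ≡ 0ℚ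
        zeroes [] = refl
        zeroes (h ∷ hs) = cong₂ _+_ (V-∤ (λ x → q∤Δ (∣ₚ.∣-trans x (proj₂ h)))) (zeroes hs)

      W≥0 : 0ℚ ≤ W α β q n
      W≥0 = ≤-trans (ν-integer pq (int n)) (≤-reflexive (trans (ν-coeff pq (nnp hα) (nnp hβ) c≢0 n) (trans (cong₂ (λ u v → ι n * (u - v) + W α β q n) q∤c Vd-0) (lem (ι n) (W α β q n)))))
        where
        lem : ∀ n w → n * (0ℚ - 0ℚ) + w ≡ w
        lem = RS.solve-∀ ℚring

    result : ∑ˡ β (λ b → cnt b m X) ≤ ∑ˡ α (λ a → cnt a m X)
    result = ≤-by W≥0 (trans (lem (∑ˡ α (λ a → cnt a m X)) (∑ˡ β (λ b → cnt b m X))) (cong (∑ˡ β (λ b → cnt b m X) +_) (sym (cong₂ _-_ (∑ˡ-cong hα count) (∑ˡ-cong hβ count)))))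
      where
      lem : ∀ a b → a ≡ b + (a - b)
      lem = RS.solve-∀ ℚring

  -- Christol's criterion, necessity: the values of q mod Δ that matter are supplied by Dirichlet's theorem.
  dominated : ∀ m → C.Coprime m Δ → ∀ X → ∑ˡ β (λ b → cnt b m X) ≤ ∑ˡ α (λ a → cnt a m X)
  -- Order on ℚ is decidable, so refuting the opposite strict inequality suffices, and the negative
  -- form of `dirichlet` does that. N exceeds Δ, X and every prime factor of c.
  dominated m cm X = ℚₚ.≮⇒≥ (λ lt → dirichlet Δ m N cm (λ q pq N<q q≡m → <⇒≱ lt (FromPrime.result m X q pq (<N Δ≤N N<q) (<N X≤N N<q) (ν-0 q pq N<q) q≡m)))
    where
    N : ℕ
    N = Δ ℕ.+ X ℕ.+ ℤ.∣ ↥ c ∣ ℕ.+ ↧ₙ c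
    Δ≤N : Δ ℕ.≤ N
    Δ≤N = ℕₚ.≤-trans (ℕₚ.m≤m+n Δ X) (ℕₚ.≤-trans (ℕₚ.m≤m+n (Δ ℕ.+ X) ℤ.∣ ↥ c ∣) (ℕₚ.m≤m+n (Δ ℕ.+ X ℕ.+ ℤ.∣ ↥ c ∣) (↧ₙ c)))
    X≤N : X ℕ.≤ N
    X≤N = ℕₚ.≤-trans (ℕₚ.m≤n+m X Δ) (ℕₚ.≤-trans (ℕₚ.m≤m+n (Δ ℕ.+ X) ℤ.∣ ↥ c ∣) (ℕₚ.m≤m+n (Δ ℕ.+ X ℕ.+ ℤ.∣ ↥ c ∣) (↧ₙ c)))
    <N : ∀ {x q} → x ℕ.≤ N → N ℕ.< q → x ℕ.< q
    <N h k = ℕₚ.≤-<-trans h k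
    ν-0 : ∀ q → Prime q → N ℕ.< q → ν q c ≡ 0ℚ
    ν-0 q pq N<q = cong₂ _-_ (V-∤ (λ h → ℕₚ.<⇒≱ (<N (ℕₚ.≤-trans (ℕₚ.m≤n+m ℤ.∣ ↥ c ∣ (Δ ℕ.+ X)) (ℕₚ.m≤m+n (Δ ℕ.+ X ℕ.+ ℤ.∣ ↥ c ∣) (↧ₙ c))) N<q) (∣ₚ.∣⇒≤ {{ℕ.>-nonZero (↥≥1 c≢0)}} h)))
      (V-∤ (λ h → ℕₚ.<⇒≱ (<N (ℕₚ.m≤n+m (↧ₙ c) (Δ ℕ.+ X ℕ.+ ℤ.∣ ↥ c ∣)) N<q) (∣ₚ.∣⇒≤ {{ℕ.>-nonZero (↧≥1 c)}} h)))

  W-unramified : ∀ {p} → Prime p → ¬ (p ∣ Δ) → ∀ n → 0ℚ ≤ W α β p n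
  W-unramified {p} pp p∤Δ n = ≤-trans (diff≥0 (∑-mono L (λ l _ _ → dominated (p ℕ.^ l) (C.sym (prime-power-coprime pp p∤Δ l)) ((n ℕ.* Δ) ÷ (p ℕ.^ l)))))
      (≤-reflexive (cong₂ _-_ (sym (levels hα)) (sym (levels hβ))))
    where
    L : ℕ
    L = n ℕ.* Δ
    levels : ∀ {xs} → All (λ a → InUnitInterval a × d a ∣ Δ) xs → ∑ˡ xs (λ a → Sν p a n) ≡ ∑ L (λ l → ∑ˡ xs (λ a → cnt a (p ℕ.^ l) ((n ℕ.* Δ) ÷ (p ℕ.^ l))))
    levels {xs} h = trans (∑ˡ-cong h (λ a (ha , da) → UnitInterval.Rescaled.Sν-levels ha Δ da pp (prime-coprime pp (λ x → p∤Δ (∣ₚ.∣-trans x (e∣Δ {a} da)))) {n} {L} (ℕₚ.*-monoʳ-≤ n (∣ₚ.∣⇒≤ da))))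
      (∑ˡ-swap xs L (λ a l → cnt a (p ℕ.^ l) ((n ℕ.* Δ) ÷ (p ℕ.^ l))))

-- Primes dividing d_{α,β}: summation over lifts.

private
  dist : ℕ → ℕ → ℕ
  dist x y = ℤ.∣ ℤ.+ x ℤ.- ℤ.+ y ∣

  dist-* : ∀ k x y → dist (k ℕ.* x) (k ℕ.* y) ≡ k ℕ.* dist x y
  dist-* k x y = trans (cong ℤ.∣_∣ (trans (cong₂ ℤ._-_ (ℤₚ.pos-* k x) (ℤₚ.pos-* k y)) (lem (ℤ.+ k) (ℤ.+ x) (ℤ.+ y)))) (ℤₚ.abs-* (ℤ.+ k) (ℤ.+ x ℤ.- ℤ.+ y))
    where
    lem : ∀ k x y → k ℤ.* x ℤ.- k ℤ.* y ≡ k ℤ.* (x ℤ.- y)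
    lem = ℤS.solve-∀

  dist-∣ˡ : ∀ {k x y} → k ∣ dist x y → k ∣ y → k ∣ x
  dist-∣ˡ {k} {x} {y} h h' = ℤ∣.∣⇒∣ᵤ (subst (ℤ.+ k ℤ∣.∣_) (lem (ℤ.+ x) (ℤ.+ y)) (ℤ∣.∣m∣n⇒∣m+n (ℤ∣.∣ᵤ⇒∣ {ℤ.+ k} {ℤ.+ x ℤ.- ℤ.+ y} h) (ℤ∣.∣ᵤ⇒∣ {ℤ.+ k} {ℤ.+ y} h')))
    where
    lem : ∀ x y → x ℤ.- y ℤ.+ y ≡ x
    lem = ℤS.solve-∀

  dist-∣ʳ : ∀ {k x y} → k ∣ dist x y → k ∣ x → k ∣ y
  dist-∣ʳ {k} {x} {y} h = dist-∣ˡ {k} {y} {x} (subst (k ∣_) (trans (sym (ℤₚ.∣-i∣≡∣i∣ (ℤ.+ x ℤ.- ℤ.+ y))) (cong ℤ.∣_∣ (lem (ℤ.+ x) (ℤ.+ y)))) h)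
    where
    lem : ∀ x y → ℤ.- (x ℤ.- y) ≡ y ℤ.- x
    lem = ℤS.solve-∀

  module Mod (m : ℕ) {{m≢0 : ℕ.NonZero m}} where
    open Classes m

    to : ∀ {x y} → x ≋ y → m ∣ dist x y
    to {x} {y} e = ℤ∣.∣⇒∣ᵤ (ClassDiv.≋⇒∣ m {x} {y} e)

    from : ∀ {x y} → m ∣ dist x y → x ≋ y
    from {x} {y} h = ClassDiv.∣⇒≋ m {x} {y} (ℤ∣.∣ᵤ⇒∣ h)

coprime-∣ : ∀ {m n z} → C.Coprime m n → m ∣ z → n ∣ z → m ℕ.* n ∣ z
coprime-∣ {m} {n} c (divides k refl) h = subst (m ℕ.* n ∣_) (ℕₚ.*-comm m k) (∣ₚ.*-monoʳ-∣ m (C.coprime-divisor {n} {m} (C.sym c) (subst (n ∣_) (ℕₚ.*-comm k m) h)))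

coprime-* : ∀ {x m n} → C.Coprime x m → C.Coprime x n → C.Coprime x (m ℕ.* n)
coprime-* {x} {m} {n} c c' {i} (i∣x , i∣mn) = c' (i∣x , C.coprime-divisor {i} {m} (λ { (u , v) → c (∣ₚ.∣-trans u i∣x , v) }) i∣mn)

module Lifts {p : ℕ} (pp : Prime p) (f₁ : ℕ) (D : ℕ) {{D≢0 : ℕ.NonZero D}} (p∤D : ¬ (p ∣ D)) where

  P Δ : ℕ
  P = p ℕ.^ suc f₁
  Δ = P ℕ.* D

  instance
    P≢0 : ℕ.NonZero P
    P≢0 = ℕₚ.m^n≢0 p (suc f₁) {{prime⇒nonZero pp}}
    Δ≢0 : ℕ.NonZero Δ
    Δ≢0 = ℕₚ.m*n≢0 P D

  module CΔ = Classes Δ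
  module CP = Classes P
  module CD = Classes D

  1≤P : 1 ℕ.≤ P
  1≤P = ℕ.>-nonZero⁻¹ P

  P-D : C.Coprime P D
  P-D = C.sym (prime-power-coprime pp p∤D (suc f₁))

  p^-D : ∀ l → C.Coprime (p ℕ.^ l) D
  p^-D l = C.sym (prime-power-coprime pp p∤D l)

  1≤p^ : ∀ l → 1 ℕ.≤ p ℕ.^ l
  1≤p^ l = ℕₚ.m^n>0 p {{prime⇒nonZero pp}} l

  p∣P : p ∣ P
  p∣P = ∣ₚ.m∣m*n (p ℕ.^ f₁)

  crt : ∀ A x → CΔ.𝕖 A x ≡ CD.𝕖 A x * CP.𝕖 A x
  crt A x = go (x ℕ.% D ℕₚ.≟ A ℕ.% D) (x ℕ.% P ℕₚ.≟ A ℕ.% P)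
    where
    Δ? = x ℕ.% Δ ℕₚ.≟ A ℕ.% Δ
    go : (D? : Dec (x ℕ.% D ≡ A ℕ.% D)) (P? : Dec (x ℕ.% P ≡ A ℕ.% P)) → 𝟙 Δ? ≡ 𝟙 D? * 𝟙 P?
    go (yes e) (yes e') = 𝟙-yes Δ? (Mod.from Δ {x} {A} (coprime-∣ P-D (Mod.to P {x} {A} e') (Mod.to D {x} {A} e)))
    go (yes e) (no ne) = trans (𝟙-no Δ? (λ h → ne (Mod.from P {x} {A} (∣ₚ.m*n∣⇒m∣ P D (Mod.to Δ {x} {A} h))))) refl
    go (no ne) P? = trans (𝟙-no Δ? (λ h → ne (Mod.from D {x} {A} (∣ₚ.m*n∣⇒n∣ P D (Mod.to Δ {x} {A} h))))) (sym (*-zeroˡ (𝟙 P?)))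

  weight : ℕ → ℚ
  weight k = 𝟙 (¬? (p ∣? k))

  Φ : ℚ
  Φ = ∑ P weight

  Φ≡ : Φ ≡ ι (ℕ.pred p) * ι (p ℕ.^ f₁)
  Φ≡ = trans (∑-cong P (λ k _ _ → flip k (p ∣? k))) (trans (∑-- P (λ _ → 1ℚ) (λ k → 𝟙 (p ∣? k) * 1ℚ)) (trans (cong₂ _-_ (trans (∑-const P 1ℚ) (*-identityʳ (ι P)))
      (trans (∑-multiples P (λ _ → 1ℚ) (prime≥1 pp)) (trans (∑-const (P ÷ p) 1ℚ) (trans (*-identityʳ (ι (P ÷ p))) (cong ι (q*k÷q (p ℕ.^ f₁) (prime≥1 pp)))))))
    (trans (cong (_- ι (p ℕ.^ f₁)) (trans (ι-* p (p ℕ.^ f₁)) (cong (λ t → ι t * ι (p ℕ.^ f₁)) (sym (suc-pred (prime≥1 pp)))))) (lem (ι (ℕ.pred p)) (ι (p ℕ.^ f₁))))))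
    where
    flip : ∀ k (k? : Dec (p ∣ k)) → 𝟙 (¬? k?) ≡ 1ℚ - 𝟙 k? * 1ℚ
    flip k (yes _) = refl
    flip k (no _) = refl
    lem : ∀ a b → (1ℚ + a) * b - b ≡ a * b
    lem = RS.solve-∀ ℚring

  -- The number of units m mod P with mj ≡ A.
  ρ : ℕ → ℕ → ℚ
  ρ A j = ∑ P (λ m → weight m * CP.𝕖 A (m ℕ.* j))

  private
    p∤lift : ∀ {l k} → 1 ℕ.≤ l → ¬ (p ∣ k) → ¬ (p ∣ p ℕ.^ l ℕ.+ D ℕ.* k)
    p∤lift {l} {k} 1≤l p∤k h with euclidsLemma D k pp (∣ₚ.∣m+n∣m⇒∣n h (p∣p^ 1≤l))
    ... | inj₁ x = p∤D x
    ... | inj₂ x = p∤k x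

    weight-lift : ∀ {l} k → 1 ℕ.≤ l → weight (p ℕ.^ l ℕ.+ D ℕ.* k) ≡ weight k
    weight-lift {l} k 1≤l = 𝟙-⇔ (¬? (p ∣? p ℕ.^ l ℕ.+ D ℕ.* k)) (¬? (p ∣? k)) (λ h x → h (∣ₚ.∣m∣n⇒∣m+n (p∣p^ 1≤l) (∣ₚ.∣n⇒∣m*n D x))) (p∤lift 1≤l)

    weight-periodic : CP.Periodic weight
    weight-periodic {m} {n} e = 𝟙-⇔ (¬? (p ∣? m)) (¬? (p ∣? n)) (λ h x → h (dist-∣ˡ {p} {m} {n} (∣ₚ.∣-trans p∣P (Mod.to P {m} {n} e)) x)) (λ h x → h (dist-∣ʳ {p} {m} {n} (∣ₚ.∣-trans p∣P (Mod.to P {m} {n} e)) x))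

  lift-unit : ∀ {l k} → 1 ℕ.≤ l → ¬ (p ∣ k) → C.Coprime (p ℕ.^ l ℕ.+ D ℕ.* k) Δ
  lift-unit {l} {k} 1≤l p∤k = coprime-* (prime-power-coprime pp (p∤lift 1≤l p∤k) (suc f₁)) (λ { {i} (i∣ , i∣D) → p^-D l (∣ₚ.∣m+n∣m⇒∣n (subst (i ∣_) (ℕₚ.+-comm (p ℕ.^ l) (D ℕ.* k)) i∣) (∣ₚ.∣m⇒∣m*n k i∣D) , i∣D) })

  -- The numbers pˡ + Dk, k mod P, run through all classes mod P while staying fixed mod D.
  ∑-lifts : ∀ {l} A j → 1 ℕ.≤ l → ∑ P (λ k → weight k * CΔ.𝕖 A ((p ℕ.^ l ℕ.+ D ℕ.* k) ℕ.* j)) ≡ CD.𝕖 A (p ℕ.^ l ℕ.* j) * ρ A j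
  ∑-lifts {l} A j 1≤l = trans (∑-cong P (λ k _ _ → trans (cong₂ _*_ (sym (weight-lift k 1≤l)) (trans (crt A ((p ℕ.^ l ℕ.+ D ℕ.* k) ℕ.* j)) (cong (_* CP.𝕖 A ((p ℕ.^ l ℕ.+ D ℕ.* k) ℕ.* j)) (mod-D k)))) (lem (weight (p ℕ.^ l ℕ.+ D ℕ.* k)) (CD.𝕖 A (p ℕ.^ l ℕ.* j)) (CP.𝕖 A ((p ℕ.^ l ℕ.+ D ℕ.* k) ℕ.* j)))))
    (trans (∑-*ˡ P (CD.𝕖 A (p ℕ.^ l ℕ.* j)) (λ k → h (p ℕ.^ l ℕ.+ D ℕ.* k))) (cong (CD.𝕖 A (p ℕ.^ l ℕ.* j) *_) (CP.∑-affine h h-periodic (C.sym P-D) (p ℕ.^ l))))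
    where
    h : ℕ → ℚ
    h m = weight m * CP.𝕖 A (m ℕ.* j)
    h-periodic : CP.Periodic h
    h-periodic {m} {n} e = cong₂ _*_ (weight-periodic e) (CP.𝕖-cong {A} (CP.≋-* {m} {n} {j} {j} e refl))
    mod-D : ∀ k → CD.𝕖 A ((p ℕ.^ l ℕ.+ D ℕ.* k) ℕ.* j) ≡ CD.𝕖 A (p ℕ.^ l ℕ.* j)
    mod-D k = CD.𝕖-cong {A} (trans (cong (ℕ._% D) (lem2 (p ℕ.^ l) D k j)) (CD.+kd≋ (p ℕ.^ l ℕ.* j) (k ℕ.* j)))
      where
      lem2 : ∀ a D k j → (a ℕ.+ D ℕ.* k) ℕ.* j ≡ a ℕ.* j ℕ.+ k ℕ.* j ℕ.* D
      lem2 = ℕS.solve-∀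
    lem : ∀ w a b → w * (a * b) ≡ a * (w * b)
    lem = RS.solve-∀ ℚring

  -- The congruence mj ≡ 0 mod P does not depend on the unit m.
  ρ-0 : ∀ {A} j → P ∣ A → ρ A j ≡ 𝟙 (P ∣? j) * Φ
  ρ-0 {A} j P∣A = trans (∑-cong P (λ m _ _ → each m (p ∣? m))) (∑-*ˡ P (𝟙 (P ∣? j)) weight)
    where
    each : ∀ m (m? : Dec (p ∣ m)) → 𝟙 (¬? m?) * CP.𝕖 A (m ℕ.* j) ≡ 𝟙 (P ∣? j) * 𝟙 (¬? m?)
    each m (yes _) = trans (*-zeroˡ (CP.𝕖 A (m ℕ.* j))) (sym (*-zeroʳ (𝟙 (P ∣? j))))
    each m (no p∤m) = trans (*-comm 1ℚ (CP.𝕖 A (m ℕ.* j))) (cong (_* 1ℚ) (𝟙-⇔ ((m ℕ.* j) ℕ.% P ℕₚ.≟ A ℕ.% P) (P ∣? j)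
      (λ e → C.coprime-divisor (C.sym (prime-power-coprime pp p∤m (suc f₁))) (dist-∣ˡ {P} {m ℕ.* j} {A} (Mod.to P {m ℕ.* j} {A} e) P∣A))
      (λ h → Mod.from P {m ℕ.* j} {A} (ℤ∣.∣⇒∣ᵤ (ℤ∣.∣m∣n⇒∣m-n (ℤ∣.∣ᵤ⇒∣ {ℤ.+ P} {ℤ.+ (m ℕ.* j)} (∣ₚ.∣n⇒∣m*n m h)) (ℤ∣.∣ᵤ⇒∣ {ℤ.+ P} {ℤ.+ A} P∣A))))))

  -- A unit preserves the exact power of p, so solutions exist only if pᵍ exactly divides j.
  -- Dividing by pᵍ then leaves a congruence with one solution mod P/pᵍ, which has pᵍ lifts mod P.
  ρ-g : ∀ {A A₁} g j → g ℕ.≤ f₁ → A ≡ p ℕ.^ g ℕ.* A₁ → ¬ (p ∣ A₁) → ρ A j ≡ ι (p ℕ.^ g) * (𝟙 (p ℕ.^ g ∣? j) - 𝟙 (p ℕ.^ suc g ∣? j))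
  ρ-g {A} {A₁} g j g≤f₁ A≡ p∤A₁ = go (p ℕ.^ g ∣? j) (p ℕ.^ suc g ∣? j)
    where
    P' : ℕ
    P' = p ℕ.^ suc (f₁ ℕ.∸ g)
    P'≢0 : ℕ.NonZero P'
    P'≢0 = ℕₚ.m^n≢0 p (suc (f₁ ℕ.∸ g)) {{prime⇒nonZero pp}}
    module CP' = Classes P' {{P'≢0}}
    P≡ : P ≡ p ℕ.^ g ℕ.* P'
    P≡ = trans (cong (p ℕ.^_) (trans (cong suc (sym (ℕₚ.m+[n∸m]≡n g≤f₁))) (sym (ℕₚ.+-suc g (f₁ ℕ.∸ g))))) (ℕₚ.^-distribˡ-+-* p g (suc (f₁ ℕ.∸ g)))
    p^∣p^ : ∀ {i k} → i ℕ.≤ k → p ℕ.^ i ∣ p ℕ.^ k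
    p^∣p^ {i} {k} h = subst (p ℕ.^ i ∣_) (trans (sym (ℕₚ.^-distribˡ-+-* p i (k ℕ.∸ i))) (cong (p ℕ.^_) (ℕₚ.m+[n∸m]≡n h))) (∣ₚ.m∣m*n (p ℕ.^ (k ℕ.∸ i)))
    p^g∣A : p ℕ.^ g ∣ A
    p^g∣A = subst (p ℕ.^ g ∣_) (sym A≡) (∣ₚ.m∣m*n A₁)
    p∤A₁' : ¬ (p ℕ.^ suc g ∣ A)
    p∤A₁' h = p∤A₁ (∣ₚ.*-cancelˡ-∣ (p ℕ.^ g) {{ℕₚ.m^n≢0 p g {{prime⇒nonZero pp}}}} (subst₂ _∣_ (ℕₚ.*-comm p (p ℕ.^ g)) A≡ h))
    vanish : (∀ m → ¬ (p ∣ m) → ¬ ((m ℕ.* j) CP.≋ A)) → ρ A j ≡ 0ℚ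
    vanish no-sol = ∑-0 P (λ m _ _ → each m (p ∣? m))
      where
      each : ∀ m (m? : Dec (p ∣ m)) → 𝟙 (¬? m?) * CP.𝕖 A (m ℕ.* j) ≡ 0ℚ
      each m (yes _) = *-zeroˡ (CP.𝕖 A (m ℕ.* j))
      each m (no p∤m) = trans (*-identityˡ (CP.𝕖 A (m ℕ.* j))) (𝟙-no ((m ℕ.* j) ℕ.% P ℕₚ.≟ A ℕ.% P) (no-sol m p∤m))
    go : (g? : Dec (p ℕ.^ g ∣ j)) (g⁺? : Dec (p ℕ.^ suc g ∣ j)) → ρ A j ≡ ι (p ℕ.^ g) * (𝟙 g? - 𝟙 g⁺?)
    go (no ¬h) (yes h) = ⊥-elim (¬h (∣ₚ.∣-trans (p^∣p^ (ℕₚ.n≤1+n g)) h))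
    go (no ¬h) (no _) = trans (vanish (λ m p∤m e → ¬h (C.coprime-divisor (C.sym (prime-power-coprime pp p∤m g)) (dist-∣ˡ {p ℕ.^ g} {m ℕ.* j} {A} (∣ₚ.∣-trans (p^∣p^ (ℕₚ.m≤n⇒m≤1+n g≤f₁)) (Mod.to P {m ℕ.* j} {A} e)) p^g∣A)))) (sym (*-zeroʳ (ι (p ℕ.^ g))))
    go (yes _) (yes h) = trans (vanish (λ m p∤m e → p∤A₁' (dist-∣ʳ {p ℕ.^ suc g} {m ℕ.* j} {A} (∣ₚ.∣-trans (p^∣p^ (s≤s g≤f₁)) (Mod.to P {m ℕ.* j} {A} e)) (∣ₚ.∣n⇒∣m*n m h)))) (sym (*-zeroʳ (ι (p ℕ.^ g))))
    go (yes (divides j₁ eq)) (no ¬h) = trans (∑-cong P (λ m _ _ → each m (p ∣? m))) (trans (cong (λ t → ∑ t (λ m → CP'.𝕖 A₁ (j₁ ℕ.* m))) P≡)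
        (trans (∑-periods {P'} (λ m → CP'.𝕖-cong {A₁} (CP'.≋-* {j₁} {j₁} {P' ℕ.+ m} {m} refl (CP'.+d≋ m))) (p ℕ.^ g)) (cong (ι (p ℕ.^ g) *_) (CP'.∑-𝕖-dilate A₁ (prime-power-coprime pp p∤j₁ (suc (f₁ ℕ.∸ g)))))))
      where
      p∤j₁ : ¬ (p ∣ j₁)
      p∤j₁ h = ¬h (subst (p ℕ.* p ℕ.^ g ∣_) (sym eq) (∣ₚ.*-monoˡ-∣ (p ℕ.^ g) h))
      scaled : ∀ m → dist (m ℕ.* j) A ≡ p ℕ.^ g ℕ.* dist (j₁ ℕ.* m) A₁
      scaled m = trans (cong₂ dist (trans (cong (m ℕ.*_) eq) (lem m j₁ (p ℕ.^ g))) A≡) (dist-* (p ℕ.^ g) (j₁ ℕ.* m) A₁)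
        where
        lem : ∀ m j q → m ℕ.* (j ℕ.* q) ≡ q ℕ.* (j ℕ.* m)
        lem = ℕS.solve-∀
      to' : ∀ m → (m ℕ.* j) CP.≋ A → (j₁ ℕ.* m) CP'.≋ A₁
      to' m e = Mod.from P' {{P'≢0}} {j₁ ℕ.* m} {A₁} (∣ₚ.*-cancelˡ-∣ (p ℕ.^ g) {{ℕₚ.m^n≢0 p g {{prime⇒nonZero pp}}}} (subst₂ _∣_ P≡ (scaled m) (Mod.to P {m ℕ.* j} {A} e)))
      from' : ∀ m → (j₁ ℕ.* m) CP'.≋ A₁ → (m ℕ.* j) CP.≋ A
      from' m e = Mod.from P {m ℕ.* j} {A} (subst₂ _∣_ (sym P≡) (sym (scaled m)) (∣ₚ.*-monoʳ-∣ (p ℕ.^ g) (Mod.to P' {{P'≢0}} {j₁ ℕ.* m} {A₁} e)))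
      each : ∀ m (m? : Dec (p ∣ m)) → 𝟙 (¬? m?) * CP.𝕖 A (m ℕ.* j) ≡ CP'.𝕖 A₁ (j₁ ℕ.* m)
      each m (yes p∣m) = trans (*-zeroˡ (CP.𝕖 A (m ℕ.* j))) (sym (𝟙-no (ℕ._%_ (j₁ ℕ.* m) P' {{P'≢0}} ℕₚ.≟ ℕ._%_ A₁ P' {{P'≢0}}) (λ e → p∤A₁ (dist-∣ʳ {p} {j₁ ℕ.* m} {A₁} (∣ₚ.∣-trans (∣ₚ.m∣m*n (p ℕ.^ (f₁ ℕ.∸ g))) (Mod.to P' {{P'≢0}} {j₁ ℕ.* m} {A₁} e)) (∣ₚ.∣n⇒∣m*n j₁ p∣m)))))
      each m (no _) = trans (*-identityˡ (CP.𝕖 A (m ℕ.* j))) (𝟙-⇔ ((m ℕ.* j) ℕ.% P ℕₚ.≟ A ℕ.% P) (ℕ._%_ (j₁ ℕ.* m) P' {{P'≢0}} ℕₚ.≟ ℕ._%_ A₁ P' {{P'≢0}}) (to' m) (from' m))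

  -- The counts that domination compares, summed over all levels l and all lifts pˡ + Dk with p not
  -- dividing k. `G-0` and `G-g` evaluate it for the two kinds of parameter.
  G : ℕ → ℕ → ℕ → ℚ
  G n L A = ∑ L (λ l → ∑ P (λ k → weight k * ∑ ((n ℕ.* Δ) ÷ (p ℕ.^ l)) (λ j → CΔ.𝕖 A ((p ℕ.^ l ℕ.+ D ℕ.* k) ℕ.* j))))

  G≡ : ∀ n L A → G n L A ≡ ∑ L (λ l → ∑ ((n ℕ.* Δ) ÷ (p ℕ.^ l)) (λ j → CD.𝕖 A (p ℕ.^ l ℕ.* j) * ρ A j))
  G≡ n L A = ∑-cong L (λ l 1≤l _ → trans (∑-cong P (λ k _ _ → sym (∑-*ˡ ((n ℕ.* Δ) ÷ (p ℕ.^ l)) (weight k) (λ j → CΔ.𝕖 A ((p ℕ.^ l ℕ.+ D ℕ.* k) ℕ.* j)))))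
    (trans (∑-swap P ((n ℕ.* Δ) ÷ (p ℕ.^ l)) (λ k j → weight k * CΔ.𝕖 A ((p ℕ.^ l ℕ.+ D ℕ.* k) ℕ.* j))) (∑-cong ((n ℕ.* Δ) ÷ (p ℕ.^ l)) (λ j _ _ → ∑-lifts A j 1≤l))))

  -- Only multiples j of P occur. Removing P from j, from A and from the range leaves the count mod
  -- D at level l, weighted by the number Φ of units.
  G-0 : ∀ n L A' → G n L (P ℕ.* A') ≡ Φ * ∑ L (λ l → ∑ ((n ℕ.* D) ÷ (p ℕ.^ l)) (λ j → CD.𝕖 A' (p ℕ.^ l ℕ.* j)))
  G-0 n L A' = trans (G≡ n L (P ℕ.* A')) (trans (∑-cong L (λ l _ _ → each l)) (∑-*ˡ L Φ (λ l → ∑ ((n ℕ.* D) ÷ (p ℕ.^ l)) (λ j → CD.𝕖 A' (p ℕ.^ l ℕ.* j)))))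
    where
    lem : ∀ a b c → a * (b * c) ≡ c * (b * a)
    lem = RS.solve-∀ ℚring
    range : ∀ l → (n ℕ.* Δ) ÷ (p ℕ.^ l) ÷ P ≡ (n ℕ.* D) ÷ (p ℕ.^ l)
    range l = trans (÷÷ (n ℕ.* Δ) (1≤p^ l) 1≤P) (trans (cong ((n ℕ.* Δ) ÷_) (ℕₚ.*-comm (p ℕ.^ l) P)) (trans (sym (÷÷ (n ℕ.* Δ) 1≤P (1≤p^ l))) (cong (_÷ (p ℕ.^ l)) (trans (cong (_÷ P) (lem2 n P D)) (q*k÷q (n ℕ.* D) 1≤P)))))
      where
      lem2 : ∀ n P D → n ℕ.* (P ℕ.* D) ≡ P ℕ.* (n ℕ.* D)
      lem2 = ℕS.solve-∀
    each : ∀ l → ∑ ((n ℕ.* Δ) ÷ (p ℕ.^ l)) (λ j → CD.𝕖 (P ℕ.* A') (p ℕ.^ l ℕ.* j) * ρ (P ℕ.* A') j) ≡ Φ * ∑ ((n ℕ.* D) ÷ (p ℕ.^ l)) (λ j → CD.𝕖 A' (p ℕ.^ l ℕ.* j))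
    each l = trans (∑-cong ((n ℕ.* Δ) ÷ (p ℕ.^ l)) (λ j _ _ → trans (cong (CD.𝕖 (P ℕ.* A') (p ℕ.^ l ℕ.* j) *_) (ρ-0 j (∣ₚ.m∣m*n A'))) (lem (CD.𝕖 (P ℕ.* A') (p ℕ.^ l ℕ.* j)) (𝟙 (P ∣? j)) Φ)))
      (trans (∑-*ˡ ((n ℕ.* Δ) ÷ (p ℕ.^ l)) Φ (λ j → 𝟙 (P ∣? j) * CD.𝕖 (P ℕ.* A') (p ℕ.^ l ℕ.* j))) (cong (Φ *_) (trans (∑-multiples ((n ℕ.* Δ) ÷ (p ℕ.^ l)) (λ j → CD.𝕖 (P ℕ.* A') (p ℕ.^ l ℕ.* j)) 1≤P)
        (trans (cong (λ t → ∑ t (λ j → CD.𝕖 (P ℕ.* A') (p ℕ.^ l ℕ.* (P ℕ.* j)))) (range l)) (∑-cong ((n ℕ.* D) ÷ (p ℕ.^ l)) (λ j _ _ → 𝟙-⇔ ((p ℕ.^ l ℕ.* (P ℕ.* j)) ℕ.% D ℕₚ.≟ (P ℕ.* A') ℕ.% D) ((p ℕ.^ l ℕ.* j) ℕ.% D ℕₚ.≟ A' ℕ.% D)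
          (λ e → CD.cancel {P} {p ℕ.^ l ℕ.* j} {A'} P-D (trans (cong (ℕ._% D) (sym (lem3 (p ℕ.^ l) P j))) e)) (λ e → trans (cong (ℕ._% D) (lem3 (p ℕ.^ l) P j)) (CD.≋-* {P} {P} {p ℕ.^ l ℕ.* j} {A'} refl e))))))))
      where
      lem3 : ∀ a P j → a ℕ.* (P ℕ.* j) ≡ P ℕ.* (a ℕ.* j)
      lem3 = ℕS.solve-∀

  -- By `ρ-g` level l is pᵍ (F(l) - F(l + 1)), so the sum telescopes to pᵍ F(1). F(1) runs over n
  -- pᶠ¹⁻ᵍ full periods mod D (the exponent being `f₁ - g`), each with one solution, and the factor
  -- pᵍ removes the dependence on g.
  G-g : ∀ n {A A₁} g → g ℕ.≤ f₁ → A ≡ p ℕ.^ g ℕ.* A₁ → ¬ (p ∣ A₁) → G n (n ℕ.* Δ) A ≡ ι n * ι (p ℕ.^ f₁)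
  G-g n {A} {A₁} g g≤f₁ A≡ p∤A₁ = trans (G≡ n L A) (trans (∑-cong L (λ l _ _ → each l)) (trans (∑-*ˡ L (ι (p ℕ.^ g)) (λ l → F l - F (suc l))) (trans (cong (ι (p ℕ.^ g) *_) (trans (telescope L F) (cong₂ _-_ first last))) final)))
    where
    L : ℕ
    L = n ℕ.* Δ
    F : ℕ → ℚ
    F h = ∑ (L ÷ (p ℕ.^ (h ℕ.+ g))) (λ j → CD.𝕖 A (p ℕ.^ (h ℕ.+ g) ℕ.* j))
    lem : ∀ a b c e → a * (b * (c - e)) ≡ b * (c * a - e * a)
    lem = RS.solve-∀ ℚring
    sub : ∀ l h → ∑ (L ÷ (p ℕ.^ l)) (λ j → 𝟙 (p ℕ.^ h ∣? j) * CD.𝕖 A (p ℕ.^ l ℕ.* j)) ≡ ∑ (L ÷ (p ℕ.^ (l ℕ.+ h))) (λ j → CD.𝕖 A (p ℕ.^ (l ℕ.+ h) ℕ.* j))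
    sub l h = trans (∑-multiples (L ÷ (p ℕ.^ l)) (λ j → CD.𝕖 A (p ℕ.^ l ℕ.* j)) (1≤p^ h)) (trans (cong (λ t → ∑ t (λ j → CD.𝕖 A (p ℕ.^ l ℕ.* (p ℕ.^ h ℕ.* j)))) (trans (÷÷ L (1≤p^ l) (1≤p^ h)) (cong (L ÷_) (sym (ℕₚ.^-distribˡ-+-* p l h)))))
      (∑-cong (L ÷ (p ℕ.^ (l ℕ.+ h))) (λ j _ _ → cong (CD.𝕖 A) (trans (sym (ℕₚ.*-assoc (p ℕ.^ l) (p ℕ.^ h) j)) (cong (ℕ._* j) (sym (ℕₚ.^-distribˡ-+-* p l h)))))))
    each : ∀ l → ∑ (L ÷ (p ℕ.^ l)) (λ j → CD.𝕖 A (p ℕ.^ l ℕ.* j) * ρ A j) ≡ ι (p ℕ.^ g) * (F l - F (suc l))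
    each l = trans (∑-cong (L ÷ (p ℕ.^ l)) (λ j _ _ → trans (cong (CD.𝕖 A (p ℕ.^ l ℕ.* j) *_) (ρ-g g j g≤f₁ A≡ p∤A₁)) (lem (CD.𝕖 A (p ℕ.^ l ℕ.* j)) (ι (p ℕ.^ g)) (𝟙 (p ℕ.^ g ∣? j)) (𝟙 (p ℕ.^ suc g ∣? j)))))
      (trans (∑-*ˡ (L ÷ (p ℕ.^ l)) (ι (p ℕ.^ g)) (λ j → 𝟙 (p ℕ.^ g ∣? j) * CD.𝕖 A (p ℕ.^ l ℕ.* j) - 𝟙 (p ℕ.^ suc g ∣? j) * CD.𝕖 A (p ℕ.^ l ℕ.* j))) (cong (ι (p ℕ.^ g) *_)
        (trans (∑-- (L ÷ (p ℕ.^ l)) (λ j → 𝟙 (p ℕ.^ g ∣? j) * CD.𝕖 A (p ℕ.^ l ℕ.* j)) (λ j → 𝟙 (p ℕ.^ suc g ∣? j) * CD.𝕖 A (p ℕ.^ l ℕ.* j))) (cong₂ _-_ (sub l g) (trans (sub l (suc g)) (cong (λ t → ∑ (L ÷ (p ℕ.^ t)) (λ j → CD.𝕖 A (p ℕ.^ t ℕ.* j))) (ℕₚ.+-suc l g)))))))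
    last : F (suc L) ≡ 0ℚ
    -- The range is empty, since L < 2ᴸ ≤ pᴸ.
    last = cong (λ t → ∑ t (λ j → CD.𝕖 A (p ℕ.^ (suc L ℕ.+ g) ℕ.* j))) (÷-small {L} {p ℕ.^ (suc L ℕ.+ g)} (ℕₚ.≤-trans (n<2^n L) (ℕₚ.≤-trans (ℕₚ.^-monoˡ-≤ L (prime≥2 pp)) (ℕₚ.^-monoʳ-≤ p {{prime⇒nonZero pp}} (ℕₚ.≤-trans (ℕₚ.n≤1+n L) (ℕₚ.m≤m+n (suc L) g))))))
    r : ℕ
    r = p ℕ.^ (f₁ ℕ.∸ g)
    f₁≡ : p ℕ.^ suc f₁ ≡ p ℕ.^ (1 ℕ.+ g) ℕ.* r
    f₁≡ = trans (cong (p ℕ.^_) (sym (ℕₚ.m+[n∸m]≡n (s≤s g≤f₁)))) (ℕₚ.^-distribˡ-+-* p (suc g) (f₁ ℕ.∸ g))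
    range : L ÷ (p ℕ.^ (1 ℕ.+ g)) ≡ n ℕ.* r ℕ.* D
    range = trans (cong (λ t → (n ℕ.* (t ℕ.* D)) ÷ (p ℕ.^ (1 ℕ.+ g))) f₁≡) (trans (cong (_÷ (p ℕ.^ (1 ℕ.+ g))) (lem2 n (p ℕ.^ (1 ℕ.+ g)) r D)) (q*k÷q (n ℕ.* r ℕ.* D) (1≤p^ (1 ℕ.+ g))))
      where
      lem2 : ∀ n q r D → n ℕ.* (q ℕ.* r ℕ.* D) ≡ q ℕ.* (n ℕ.* r ℕ.* D)
      lem2 = ℕS.solve-∀
    first : F 1 ≡ ι (n ℕ.* r)
    first = trans (cong (λ t → ∑ t (λ j → CD.𝕖 A (p ℕ.^ (1 ℕ.+ g) ℕ.* j))) range) (trans (∑-periods {D} (λ m → CD.𝕖-cong {A} (CD.≋-* {p ℕ.^ (1 ℕ.+ g)} {p ℕ.^ (1 ℕ.+ g)} {D ℕ.+ m} {m} refl (CD.+d≋ m))) (n ℕ.* r))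
      (trans (cong (ι (n ℕ.* r) *_) (CD.∑-𝕖-dilate A (p^-D (1 ℕ.+ g)))) (*-identityʳ (ι (n ℕ.* r)))))
    final : ι (p ℕ.^ g) * (ι (n ℕ.* r) - 0ℚ) ≡ ι n * ι (p ℕ.^ f₁)
    final = trans (cong (λ t → ι (p ℕ.^ g) * (t - 0ℚ)) (ι-* n r)) (trans (lem3 (ι (p ℕ.^ g)) (ι n) (ι r)) (cong (ι n *_) (trans (sym (ι-* (p ℕ.^ g) r)) (cong ι (trans (sym (ℕₚ.^-distribˡ-+-* p g (f₁ ℕ.∸ g))) (cong (p ℕ.^_) (ℕₚ.m+[n∸m]≡n g≤f₁)))))))
      where
      lem3 : ∀ a b c → a * (b * c - 0ℚ) ≡ b * (a * c)
      lem3 = RS.solve-∀ ℚring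

module Ramified {α β : List ℚ} {c : ℚ} (c≢0 : c ≢ 0ℚ) (int : IntegralAt α β c) {p : ℕ} (pp : Prime p) (f₁ : ℕ) (D : ℕ) {{D≢0 : ℕ.NonZero D}} (p∤D : ¬ (p ∣ D))
  (hα : All (λ a → InUnitInterval a × d a ∣ p ℕ.^ suc f₁ ℕ.* D) α) (hβ : All (λ a → InUnitInterval a × d a ∣ p ℕ.^ suc f₁ ℕ.* D) β) (r≡s : length α ≡ length β) where
  open Lifts pp f₁ D p∤D
  open Dominated c≢0 int Δ hα hβ

  private
    q : ℚ
    q = ι (p ℕ.^ f₁)

  module _ (n : ℕ) where

    L : ℕ
    L = n ℕ.* Δ

    A : ℚ → ℕ
    A a = num a ℕ.* (Δ ÷ d a)

    G-value : ∀ a → InUnitInterval a × d a ∣ Δ → G n L (A a) ≡ Φ * Sν p a n + ι n * q * (1ℚ - 𝟙 (¬? (p ∣? d a)))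
    G-value a (ha , da) = go (p ∣? d a)
      where
      open UnitInterval ha
      p∤num : p ∣ d a → ¬ (p ∣ num a)
      p∤num h h' = ℕₚ.<-irrefl (sym (coprime-parts a (h' , h))) (prime≥2 pp)
      go : (p? : Dec (p ∣ d a)) → G n L (A a) ≡ Φ * Sν p a n + ι n * q * (1ℚ - 𝟙 (¬? p?))
      go (no p∤d) = trans (cong (G n L) A≡) (trans (G-0 n L A') (trans (cong (Φ *_) (sym (RD.Sν-levels pp (prime-coprime pp p∤e) {n} {L} (ℕₚ.*-monoʳ-≤ n (∣ₚ.∣⇒≤ da))))) (lem (Φ * Sν p a n) (ι n * q))))
        where
        d∣D : d a ∣ D
        d∣D = C.coprime-divisor (prime-power-coprime pp p∤d (suc f₁)) da
        module RD = Rescaled D d∣D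
        A' : ℕ
        A' = num a ℕ.* (D ÷ d a)
        p∤e : ¬ (p ∣ D ÷ d a)
        p∤e h = p∤D (subst (p ∣_) RD.d*e (∣ₚ.∣n⇒∣m*n (d a) h))
        A≡ : A a ≡ P ℕ.* A'
        A≡ = trans (cong (num a ℕ.*_) (trans (cong (_÷ d a) (trans (cong (P ℕ.*_) (sym RD.d*e)) (lem1 P (d a) RD.e))) (q*k÷q (P ℕ.* RD.e) (↧≥1 a)))) (lem1 (num a) P RD.e)
          where
          lem1 : ∀ x y z → x ℕ.* (y ℕ.* z) ≡ y ℕ.* (x ℕ.* z)
          lem1 = ℕS.solve-∀
        lem : ∀ x y → x ≡ x + y * (1ℚ - 1ℚ)
        lem = RS.solve-∀ ℚring
      go (yes p∣d) = trans (via (strip pp (A a) (A a) RΔ.1≤A ℕₚ.≤-refl)) (trans (lem Φ (ι n * q)) (cong (λ t → Φ * t + ι n * q * (1ℚ - 0ℚ)) (sym (Sν-0 {p} {a} pp p∣d n))))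
        where
        module RΔ = Rescaled Δ da
        lem : ∀ x y → y ≡ x * 0ℚ + y * (1ℚ - 0ℚ)
        lem = RS.solve-∀ ℚring
        P∤A : ¬ (P ∣ A a)
        -- If P divided A = num a · e, it would divide e, as p does not divide `num a`. With p
        -- dividing d(a), pP would divide d(a) e = PD, hence p would divide D. So the exponent of p
        -- in A is at most `f₁`, as `G-g` requires.
        P∤A h = p∤D (∣ₚ.*-cancelˡ-∣ P (subst₂ _∣_ (ℕₚ.*-comm p P) RΔ.d*e (∣ₚ.*-pres-∣ p∣d (C.coprime-divisor (C.sym (prime-power-coprime pp (p∤num p∣d) (suc f₁))) h))))
        via : (∃ λ g → ∃ λ A₁ → A a ≡ p ℕ.^ g ℕ.* A₁ × ¬ (p ∣ A₁) × 1 ℕ.≤ A₁) → G n L (A a) ≡ ι n * q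
        via (g , A₁ , eq , ∤ , _) = G-g n g (ℕₚ.≮⇒≥ (λ h → P∤A (subst (P ∣_) (sym eq) (∣ₚ.∣m⇒∣m*n A₁ (subst (P ∣_) (trans (sym (ℕₚ.^-distribˡ-+-* p (suc f₁) (g ℕ.∸ suc f₁))) (cong (p ℕ.^_) (ℕₚ.m+[n∸m]≡n h))) (∣ₚ.m∣m*n (p ℕ.^ (g ℕ.∸ suc f₁)))))))) eq ∤

    G-sum : ∀ xs → ∑ˡ xs (λ a → G n L (A a)) ≡ ∑ L (λ l → ∑ P (λ k → weight k * ∑ˡ xs (λ a → cnt a (p ℕ.^ l ℕ.+ D ℕ.* k) (L ÷ (p ℕ.^ l)))))
    G-sum xs = trans (∑ˡ-swap xs L (λ a l → ∑ P (λ k → weight k * cnt a (p ℕ.^ l ℕ.+ D ℕ.* k) (L ÷ (p ℕ.^ l))))) (∑-cong L (λ l _ _ → trans (∑ˡ-swap xs P (λ a k → weight k * cnt a (p ℕ.^ l ℕ.+ D ℕ.* k) (L ÷ (p ℕ.^ l))))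
      (∑-cong P (λ k _ _ → ∑ˡ-*ˡ xs (weight k) (λ a → cnt a (p ℕ.^ l ℕ.+ D ℕ.* k) (L ÷ (p ℕ.^ l)))))))

    G-dominated : ∑ˡ β (λ a → G n L (A a)) ≤ ∑ˡ α (λ a → G n L (A a))
    G-dominated = ≤-trans (≤-reflexive (G-sum β)) (≤-trans (∑-mono L (λ l 1≤l _ → ∑-mono P (λ k _ _ → each l k 1≤l (p ∣? k)))) (≤-reflexive (sym (G-sum α))))
      where
      each : ∀ l k → 1 ℕ.≤ l → (k? : Dec (p ∣ k)) → 𝟙 (¬? k?) * ∑ˡ β (λ a → cnt a (p ℕ.^ l ℕ.+ D ℕ.* k) (L ÷ (p ℕ.^ l))) ≤ 𝟙 (¬? k?) * ∑ˡ α (λ a → cnt a (p ℕ.^ l ℕ.+ D ℕ.* k) (L ÷ (p ℕ.^ l)))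
      each l k 1≤l (yes _) = ≤-reflexive (trans (*-zeroˡ (∑ˡ β (λ a → cnt a (p ℕ.^ l ℕ.+ D ℕ.* k) (L ÷ (p ℕ.^ l))))) (sym (*-zeroˡ (∑ˡ α (λ a → cnt a (p ℕ.^ l ℕ.+ D ℕ.* k) (L ÷ (p ℕ.^ l)))))))
      each l k 1≤l (no p∤k) = *-monoˡ 0≤1 (dominated (p ℕ.^ l ℕ.+ D ℕ.* k) (lift-unit 1≤l p∤k) (L ÷ (p ℕ.^ l)))

    private
      totals : ∀ {xs} → All (λ a → InUnitInterval a × d a ∣ Δ) xs → ∑ˡ xs (λ a → G n L (A a)) ≡ Φ * ∑ˡ xs (λ a → Sν p a n) + ι n * q * (ι (length xs) - ∑ˡ xs (λ a → 𝟙 (¬? (p ∣? d a))))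
      totals [] = lem Φ (ι n * q)
        where
        lem : ∀ f m → 0ℚ ≡ f * 0ℚ + m * (0ℚ - 0ℚ)
        lem = RS.solve-∀ ℚring
      totals {x ∷ xs} (h ∷ hs) = trans (cong₂ _+_ (G-value x h) (totals hs)) (lem Φ (Sν p x n) (ι n * q) (𝟙 (¬? (p ∣? d x))) (∑ˡ xs (λ a → Sν p a n)) (ι (length xs)) (∑ˡ xs (λ a → 𝟙 (¬? (p ∣? d a)))))
        where
        lem : ∀ f s m i S l I → f * s + m * (1ℚ - i) + (f * S + m * (l - I)) ≡ f * (s + S) + m * (1ℚ + l - (i + I))
        lem = RS.solve-∀ ℚring

    -- By `G-value` the constants n q occur once for every parameter that is not p-integral. With r
    -- = s, the numbers of these for α and β differ by -λ; dividing by q = p^f₁, where Φ = (p - 1)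
    -- q, leaves the claim.
    W-ramified : ι n * Parameters.Λλ α β p ≤ ι (ℕ.pred p) * W α β p n
    W-ramified = *-cancelˡ {c = q} (0<ι (ℕₚ.m^n>0 p {{prime⇒nonZero pp}} f₁)) (≤-by (diff≥0 G-dominated) (trans (lem q (ι (ℕ.pred p)) (ι n) Sα Sβ Iα Iβ (ι (length β)))
        (cong (q * (ι n * (Iα - Iβ)) +_) (sym (cong₂ _-_ (trans (totals hα) (cong₂ (λ u v → u * Sα + ι n * q * (v - Iα)) Φ≡ (cong ι r≡s))) (trans (totals hβ) (cong (λ u → u * Sβ + ι n * q * (ι (length β) - Iβ)) Φ≡)))))))
      where
      Sα Sβ Iα Iβ : ℚ
      Sα = ∑ˡ α (λ a → Sν p a n)
      Sβ = ∑ˡ β (λ a → Sν p a n)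
      Iα = ∑ˡ α (λ a → 𝟙 (¬? (p ∣? d a)))
      Iβ = ∑ˡ β (λ a → 𝟙 (¬? (p ∣? d a)))
      lem : ∀ q m n S S' I I' l → q * (m * (S - S')) ≡ q * (n * (I - I')) + (m * q * S + n * q * (l - I) - (m * q * S' + n * q * (l - I')))
      lem = RS.solve-∀ ℚring

-- Integrality at the formula itself, and the conclusion.

module UpperBound {α β : List ℚ} {c : ℚ} (c≢0 : c ≢ 0ℚ) (int : IntegralAt α β c) (r≡s : length α ≡ length β) (hα : All InUnitInterval α) (hβ : All InUnitInterval β) where
  open Parameters α β

  private
    Δ : ℕ
    Δ = dAB α β

    Δ≢0 : ℕ.NonZero Δ
    Δ≢0 = ℕ.>-nonZero dAB≥1

    nnα : All NotNonPosInt α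
    nnα = All.map UnitInterval.notNonPos hα

    nnβ : All NotNonPosInt β
    nnβ = All.map UnitInterval.notNonPos hβ

    with-d : ∀ {xs} → All InUnitInterval xs → (∀ {a} → a ∈ xs → d a ∣ Δ) → All (λ a → InUnitInterval a × d a ∣ Δ) xs
    with-d hs h = All.zip (hs , All.tabulate h)

    hα' : All (λ a → InUnitInterval a × d a ∣ Δ) α
    hα' = with-d hα (λ a∈ → d∣dAB (∈-++⁺ˡ a∈))

    hβ' : All (λ a → InUnitInterval a × d a ∣ Δ) β
    hβ' = with-d hβ (λ a∈ → d∣dAB (∈-++⁺ʳ α a∈))

    unramified-Λλ : ∀ {p} → ¬ (p ∣ Δ) → Λλ p ≡ 0ℚ
    unramified-Λλ {p} p∤Δ = trans (cong₂ _-_ (all hα') (all hβ')) (trans (cong (λ t → ι t - ι (length β)) r≡s) (ℚₚ.+-inverseʳ (ι (length β))))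
      where
      all : ∀ {xs} → All (λ a → InUnitInterval a × d a ∣ Δ) xs → integral p xs ≡ ι (length xs)
      all [] = refl
      all {x ∷ xs} (h ∷ hs) = cong₂ _+_ (𝟙-yes (¬? (p ∣? d x)) (λ p∣d → p∤Δ (∣ₚ.∣-trans p∣d (proj₂ h)))) (all hs)

    unramified-W : ∀ {p} → Prime p → ¬ (p ∣ Δ) → ∀ n → 0ℚ ≤ W α β p n
    unramified-W pp p∤Δ n = Dominated.W-unramified c≢0 int Δ {{Δ≢0}} hα' hβ' pp p∤Δ n

    W-bound : ∀ {p} → Prime p → ∀ n → ι n * Λλ p ≤ ι (ℕ.pred p) * W α β p n
    W-bound {p} pp n = go (p ∣? Δ)
      where
      go : Dec (p ∣ Δ) → ι n * Λλ p ≤ ι (ℕ.pred p) * W α β p n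
      go (no p∤Δ) = ≤-trans (≤-reflexive (trans (cong (ι n *_) (unramified-Λλ p∤Δ)) (*-zeroʳ (ι n)))) (*-≥0 (0≤ι (ℕ.pred p)) (unramified-W pp p∤Δ n))
      go (yes p∣Δ) = via (strip pp Δ Δ dAB≥1 ℕₚ.≤-refl)
        where
        via : (∃ λ f → ∃ λ D → Δ ≡ p ℕ.^ f ℕ.* D × ¬ (p ∣ D) × 1 ℕ.≤ D) → ι n * Λλ p ≤ ι (ℕ.pred p) * W α β p n
        via (zero , D , eq , p∤D , _) = ⊥-elim (p∤D (subst (p ∣_) (trans eq (ℕₚ.*-identityˡ D)) p∣Δ))
        via (suc f₁ , D , eq , p∤D , 1≤D) = Ramified.W-ramified c≢0 int pp f₁ D {{ℕ.>-nonZero 1≤D}} p∤D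
          (All.map (λ { (h , h') → h , subst (_ ∣_) eq h' }) hα') (All.map (λ { (h , h') → h , subst (_ ∣_) eq h' }) hβ') r≡s n

  -- The denominators cancel, leaving -n⌊λ/(p - 1)⌋ + W(n). Since (p - 1)⌊λ/(p - 1)⌋ ≤ λ, the lower
  -- bound n λ for (p - 1) W(n) makes this nonnegative.
  ν-coefficient : ∀ {p} → Prime p → ∀ n → 0ℚ ≤ ν p ((formulaFactor α β ^ℚ n) * hypCoeff α β n)
  ν-coefficient {p} pp n = ≤-trans (go (inSet? p)) (≤-reflexive (sym (trans (ν-coeff pp nnα nnβ formulaFactor≢0 n) (trans (cong (λ t → ι n * (t - Vd α β p) + W α β p n) (ν-formulaFactor pp)) (lem (ι n) (Vd α β p) (ν p (primeFactor α β)) (W α β p n))))))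
    where
    lem : ∀ n v f w → n * (v + f - v) + w ≡ n * f + w
    lem = RS.solve-∀ ℚring
    go : Dec (InSet p) → 0ℚ ≤ ι n * ν p (primeFactor α β) + W α β p n
    go (no ¬h) = ≤-trans (unramified-W pp (λ p∣Δ → ¬h (pp , inj₁ p∣Δ)) n) (≤-reflexive (trans (sym (+-identityˡ (W α β p n))) (cong (_+ W α β p n) (sym (trans (cong (ι n *_) (ν-primeFactor-∉ pp ¬h)) (*-zeroʳ (ι n)))))))
    go (yes h) = *-cancelˡ {c = ι (ℕ.pred p)} (0<ι (ℕₚ.pred-mono-≤ (prime≥2 pp))) (≤-by {s = ι n * (Λλ p - ι (ℕ.pred p) * ℤtoℚ (floor p)) + (ι (ℕ.pred p) * W α β p n - ι n * Λλ p)}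
        (+-≥0 (*-≥0 (0≤ι n) (diff≥0 (floor-lower pp))) (diff≥0 (W-bound pp n))) (trans (cong (λ t → ι (ℕ.pred p) * (ι n * t + W α β p n)) (ν-primeFactor-∈ h)) (lem2 (ι (ℕ.pred p)) (ι n) (ℤtoℚ (floor p)) (W α β p n) (Λλ p))))
      where
      lem2 : ∀ m n f w l → m * (n * - f + w) ≡ m * 0ℚ + (n * (l - m * f) + (m * w - n * l))
      lem2 = RS.solve-∀ ℚring

  formula-integral : IntegralAt α β (formulaFactor α β)
  formula-integral n = integer-ν ((formulaFactor α β ^ℚ n) * hypCoeff α β n) (λ p pp → ν-coefficient pp n)

theorem1 : (α β : List ℚ) →
    All NotNonPosInt α → All NotNonPosInt β →
    NIntegral α β →
    (Cαβ : ℚ) → 0ℚ < Cαβ →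
    ((c : ℚ) → IntegralAt α β c ⇔ (∃ λ (k : ℤ) → c ≡ ℤtoℚ k * Cαβ)) →
    ∃ λ (C : ℕ) →
    (Cαβ ≡ ℕtoℚ C * formulaFactor α β)
    × (length α ≡ length β → All InUnitInterval (α ++ β) → C ≡ 1)
theorem1 α β hα hβ _ c 0<c generates = proj₁ result , proj₂ result , λ r≡s h → is-one r≡s h (proj₁ result) (proj₂ result)
  where
  F : ℚ
  F = formulaFactor α β

  c-integral : IntegralAt α β c
  c-integral = Equivalence.from (generates c) (ℤ.+ 1 , sym (*-identityˡ c))

  result : ∃ λ C → c ≡ ℕtoℚ C * F
  result = LowerBound.multiple hα hβ (pos⇒≢0 0<c) c-integral 0<c

  is-one : length α ≡ length β → All InUnitInterval (α ++ β) → ∀ C → c ≡ ℕtoℚ C * F → C ≡ 1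
  is-one r≡s h C c≡ = unit (Equivalence.to (generates F) (UpperBound.formula-integral (pos⇒≢0 0<c) c-integral r≡s (AllP.++⁻ˡ α h) (AllP.++⁻ʳ α h)))
    where
    -- c = C F and F = k c with F nonzero give k C = 1 in ℤ, and C is a natural number.
    unit : (∃ λ (k : ℤ) → F ≡ ℤtoℚ k * c) → C ≡ 1
    unit (k , F≡) = ℕₚ.m*n≡1⇒n≡1 ℤ.∣ k ∣ C (trans (sym (ℤₚ.abs-* k (ℤ.+ C))) (cong ℤ.∣_∣ kC≡1))
      where
      kC : ℤtoℚ k * ℕtoℚ C ≡ 1ℚ
      kC = cancelF (trans (*-assoc (ℤtoℚ k) (ℕtoℚ C) F) (trans (cong (ℤtoℚ k *_) (sym c≡)) (trans (sym F≡) (sym (*-identityˡ F)))))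
        where
        cancelF : ∀ {x y} → x * F ≡ y * F → x ≡ y
        cancelF {x} {y} e = trans (expand x) (trans (cong (_* inverse) e) (sym (expand y)))
          where
          nz = Data.Rational.≢-nonZero (Parameters.formulaFactor≢0 α β)
          inverse = Data.Rational.1/_ F {{nz}}
          expand : ∀ x → x ≡ x * F * inverse
          expand x = sym (trans (*-assoc x F inverse) (trans (cong (x *_) (ℚₚ.*-inverseʳ F {{nz}})) (*-identityʳ x)))
      kC≡1 : k ℤ.* ℤ.+ C ≡ ℤ.+ 1
      kC≡1 = trans (cong ↥_ (sym (ℤtoℚ≡mkℚ (k ℤ.* ℤ.+ C)))) (cong ↥_ (trans (ℤtoℚ-* k (ℤ.+ C)) kC))
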